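{- Let $g\geq 1$ be an integer. Then: (i) For every oriented maximal Wicks form $w$, the group $\mathrm{Aut}(w)$ is cyclic of order $1$, $2$, $3$ or $6$. (ii) $\displaystyle m_1^g=\frac{2}{1}\Big(\frac{1^2}{12}\Big)^g\frac{(6g-5)!}{g!\,(3g-3)!}$. (iii) For a nonnegative integer $r$, one has $m_2^g(r)>0$ if and only if $f=\frac{2g+1-r}{4}\in\{0,1,2,\dots\}$, and in that case $$m_2^g(r)=\frac{2}{2}\Big(\frac{2^2}{12}\Big)^f\frac{1}{r!}\,\frac{(6f+2r-5)!}{f!\,(3f+r-3)!}.$$ (iv) For nonnegative integers $s,t$, one has $m_3^g(s,t)>0$ if and only if $f=\frac{g+1-s-t}{3}\in\{0,1,2,\dots\}$, $s\equiv 2g+1\pmod 3$ and $t\equiv 2g\pmod 3$. In that case, if $g>1$, $$m_3^g(s,t)=\frac{2}{3}\Big(\frac{3^2}{12}\Big)^f\frac{1}{s!\,t!}\,\frac{(6f+2s+2t-5)!}{f!\,(3f+s+t-3)!},$$ and for $g=1$ one has $m_3^1(0,2)=\frac16$. (v) For nonnegative integers $r,s,t$, one has $m_6^g(3r;2s,2t)>0$ if and only if $f=\frac{2g+5-3r-4s-4t}{12}\in\{0,1,2,\dots\}$, $2s\equiv 2g+1\pmod 3$ and $2t\equiv 2g\pmod 3$. In that case, if $g>1$, $$m_6^g(3r;2s,2t)=\frac{2}{6}\Big(\frac{6^2}{12}\Big)^f\frac{1}{r!\,s!\,t!}\,\frac{(6f+2r+2s+2t-5)!}{f!\,(3f+r+s+t-3)!},$$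 and for $g=1$ one has $m_6^1(3;0,2)=\frac16$.
   Context: An oriented Wicks form is a cyclic word $w=w_1w_2\cdots w_{2l}$ (an orbit of a linear word under cyclic permutations) over an alphabet $a_1^{\pm1},a_2^{\pm1},\dots$ such that: (1) if $a_i^{\epsilon}$ ($\epsilon\in\{\pm1\}$) appears in $w$, then $a_i^{ -\epsilon}$ appears exactly once in $w$; (2) no cyclic factor (subword of cyclically consecutive letters) of $w$ has the form $a_ia_i^{ -1}$ or $a_i^{ -1}a_i$; (3) if $a_i^{\epsilon}a_j^{\delta}$ is a cyclic factor of $w$, then $a_j^{ -\delta}a_i^{ -\epsilon}$ is not a cyclic factor of $w$. Two such forms $w$ (over alphabet $A$) and $w'$ (over alphabet $A'$) are isomorphic, or equivalent, if there is a bijection $\varphi:A\to A'$ with $\varphi(a^{ -1})=\varphi(a)^{ -1}$ such that $\varphi(w_1)\varphi(w_2)\cdots$ and $w'$ define the same cyclic word. Gluing the sides of a $2l$-gon in the oriented plane, labelled and oriented according to $w$, pairwise along equal labels gives a closed oriented surface $S$. The genus of $S$ is the genus of $w$. The images of the sides and corners of the polygon form a graph $\Gamma\subset S$ (the edges and vertices of $w$). Edges correspond to the letter pairs $\{a_i,a_i^{ -1}\}$, and each vertex is the class of the corners between cyclically consecutive letters $w_kw_{k+1}$ that get identified. An oriented Wicks form of genus $g$ has length at most $6(2g-1)$. It is maximal if its length is exactly $6(2g-1)$; then $\Gamma$ has $2(2g-1)$ vertices, all of degree $3$, and $3(2g-1)$ edges. Sign of a vertex: let $V$ be a vertex of a maximal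 form and let $a,b,c$ be the three edges at $V$, oriented toward $V$. Then $V$ is positive if $w=ab^{ -1}\cdots bc^{ -1}\cdots ca^{ -1}\cdots$ or $w=ac^{ -1}\cdots cb^{ -1}\cdots ba^{ -1}\cdots$ (as cyclic words). It is negative if $w=ab^{ -1}\cdots ca^{ -1}\cdots bc^{ -1}\cdots$ or $w=ac^{ -1}\cdots ba^{ -1}\cdots cb^{ -1}\cdots$. The automorphism group $\mathrm{Aut}(w)$ of $w=w_1\cdots w_{2e}$ is the group of cyclic shifts $\mu$ of the linear word $w_1\cdots w_{2e}$ (a subgroup of $\mathbb{Z}/2e\mathbb{Z}$) such that $\mu(w)$ is obtained from $w$ by a bijection $\varphi_\mu$ of the alphabet compatible with inverses. Such a $\mu$ permutes the corners, and hence the edges and vertices of $\Gamma$. An edge $\{a,a^{ -1}\}$ is invariant with reversed orientation if $\varphi_\mu(a)=a^{ -1}$. The sets of equivalence classes of oriented maximal Wicks forms of genus $g$ are: - $W_1^g$: all such forms; - $W_2^g(r)$: those having an automorphism of order $2$ that leaves exactly $r$ edges invariant with their orientation reversed; - $W_3^g(s,t)$: those having an automorphism of order $3$ that fixes exactly $s$ positive and $t$ negative vertices; - $W_6^g(3r;2s,2t)=W_2^g(3r)\cap W_3^g(2s,2t)$. The mass of a finite set $W$ is $m(W)=\sum_{w\in W}1/|\mathrm{Aut}(w)|$. We write $m_1^g=m(W_1^g)$, $m_2^g(r)=m(W_2^g(r))$, $m_3^g(s,t)=m(W_3^g(s,t))$ and $m_6^g(3r;2s,2t)=m(W_6^g(3r;2s,2t))$.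 -}

module Defs where

open import Data.Nat as ℕ using (ℕ; zero; suc; _+_; _*_; _∸_; _^_; _!; _%_)
open import Data.Nat.DivMod using (_mod_)
open import Data.Fin as Fin using (Fin; toℕ)
open import Data.Fin.Properties using (any?; all?)
open import Data.Bool as Bool using (Bool; true; false; not)
open import Data.Product using (Σ; ∃; ∃-syntax; _×_; _,_; proj₁; proj₂)
open import Data.Product.Properties using (≡-dec)
open import Data.List as List using (List; []; _∷_; length; filter; allFin; foldr; map)
open import Data.List.Relation.Unary.All using (All)
open import Data.List.Relation.Unary.Any using (Any)
open import Data.List.Relation.Unary.AllPairs using (AllPairs)
open import Data.Integer using (+_)
open import Data.Rational as ℚ using (ℚ; 0ℚ; 1ℚ)
open import Function using (_∘_)
open import Function.Definitions using (Bijective)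
open import Relation.Nullary using (¬_; Dec; yes; no)
open import Relation.Nullary.Decidable using (_×-dec_; _→-dec_; map′)
open import Relation.Unary using (Pred; Decidable)
open import Relation.Binary.PropositionalEquality using (_≡_; _≢_; refl; sym; trans; cong)

-- Letters.  The alphabet with e letters a_1..a_e and their inverses is
-- Fin e × Bool:  (i , true) = a_{i+1},  (i , false) = a_{i+1}^{-1}.

Letter : ℕ → Set
Letter e = Fin e × Bool

inv : ∀ {e} → Letter e → Letter e
inv (i , b) = i , not b

_≟L_ : ∀ {e} (x y : Letter e) → Dec (x ≡ y)
_≟L_ = ≡-dec Fin._≟_ Bool._≟_

allL? : ∀ {e p} {P : Pred (Letter e) p} → Decidable P → Dec (∀ x → P x)
allL? {P = P} P? =
  map′ (λ h → λ { (i , true) → proj₁ (h i) ; (i , false) → proj₂ (h i) })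
       (λ h i → h (i , true) , h (i , false))
       (all? (λ i → P? (i , true) ×-dec P? (i , false)))

-- Linear words of length 2e over the alphabet with e = suc k letters in
-- which every letter occurs exactly once (condition (1), with the
-- alphabet being exactly the set of letters occurring in w).  Such a word
-- is a bijection between positions and letters; `pos` is its inverse.

Len : ℕ → ℕ
Len k = suc k + suc k

record Word (k : ℕ) : Set where
  field
    letter     : Fin (Len k) → Letter (suc k)
    pos        : Letter (suc k) → Fin (Len k)
    pos-letter : ∀ i → pos (letter i) ≡ i
    letter-pos : ∀ x → letter (pos x) ≡ x
open Word public

_⊕_ : ∀ {k} → Fin (Len k) → ℕ → Fin (Len k)
_⊕_ {k} i d = (toℕ i + d) mod Len k

rel : ∀ {k} → Fin (Len k) → Fin (Len k) → ℕ
rel {k} i j = (toℕ j + (Len k ∸ toℕ i)) % Len k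

NoCancel : ∀ {k} → Word k → Set
NoCancel w = ∀ i → letter w (i ⊕ 1) ≢ inv (letter w i)

NoInversePair : ∀ {k} → Word k → Set
NoInversePair w = ∀ i j →
  ¬ (letter w j ≡ inv (letter w (i ⊕ 1)) × letter w (j ⊕ 1) ≡ inv (letter w i))

IsWicks : ∀ {k} → Word k → Set
IsWicks w = NoCancel w × NoInversePair w

count : ∀ {n p} {P : Pred (Fin n) p} → Decidable P → ℕ
count {n} P? = length (filter P? (allFin n))

-- Corners and vertices.  Corner i is the corner between w_i and w_{i+1}.
-- The initial point of the side w_{i+1} is glued to the terminal point of
-- the side labelled w_{i+1}^{-1}, so corner i is identified with corner
-- σ i := pos (w_{i+1}^{-1}).  Vertices = classes of corners = σ-orbits.

σ : ∀ {k} → Word k → Fin (Len k) → Fin (Len k)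
σ w i = pos w (inv (letter w (i ⊕ 1)))

iter : ∀ {A : Set} → (A → A) → ℕ → A → A
iter f zero    a = a
iter f (suc m) a = f (iter f m a)

SameVertex : ∀ {k} → Word k → Fin (Len k) → Fin (Len k) → Set
SameVertex {k} w i j = ∃[ m ] (iter (σ w) (toℕ {Len k} m) i ≡ j)

sameVertex? : ∀ {k} (w : Word k) i j → Dec (SameVertex w i j)
sameVertex? w i j = any? (λ m → iter (σ w) (toℕ m) i Fin.≟ j)

VertexRep : ∀ {k} → Word k → Fin (Len k) → Set
VertexRep w i = ∀ j → SameVertex w i j → toℕ i ℕ.≤ toℕ j

vertexRep? : ∀ {k} (w : Word k) i → Dec (VertexRep w i)
vertexRep? w i = all? (λ j → sameVertex? w i j →-dec (toℕ i ℕ.≤? toℕ j))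

numVertices : ∀ {k} → Word k → ℕ
numVertices w = count (vertexRep? w)

-- Euler characteristic: V - E + F = 2 - 2g with E = e = suc k, F = 1.
HasGenus : ∀ {k} → Word k → ℕ → Set
HasGenus {k} w g = numVertices w + 2 * g ≡ suc (suc k)

-- Maximal oriented Wicks forms of genus g (g ≥ 1): e = 3(2g-1) = suc k
-- letters, i.e. k = 6g - 4, and length 2e = 6(2g-1).

Kg : ℕ → ℕ
Kg g = 6 * g ∸ 4

IsMaxWicks : (g : ℕ) → Word (Kg g) → Set
IsMaxWicks g w = IsWicks w × HasGenus w g

InvCompat : ∀ {e} → (Letter e → Letter e) → Set
InvCompat φ = ∀ x → φ (inv x) ≡ inv (φ x)

Iso : ∀ {k} → Word k → Word k → Set
Iso {k} w w' = Σ (Letter (suc k) → Letter (suc k)) λ φ →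
  InvCompat φ × Bijective _≡_ _≡_ φ ×
  ∃[ d ] (∀ i → φ (letter w i) ≡ letter w' (i ⊕ d))

-- Automorphisms: cyclic shifts μ_d (d ∈ Z/2e) with μ_d(w) = φ(w), where
-- μ_d(w)_i = w_{i+d}.  (Such a φ is automatically a bijection.)

AutWitness : ∀ {k} → Word k → Fin (Len k) → (Letter (suc k) → Letter (suc k)) → Set
AutWitness w d φ = InvCompat φ × (∀ i → letter w (i ⊕ toℕ d) ≡ φ (letter w i))

IsAut : ∀ {k} → Word k → Fin (Len k) → Set
IsAut {k} w d = Σ (Letter (suc k) → Letter (suc k)) (AutWitness w d)

isAut? : ∀ {k} (w : Word k) d → Dec (IsAut w d)
isAut? w d with allL? (λ x → φ₀ (inv x) ≟L inv (φ₀ x))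
  where φ₀ = λ x → letter w (pos w x ⊕ toℕ d)
... | yes c = yes (φ₀ , c , λ i → cong (λ j → letter w (j ⊕ toℕ d)) (sym (pos-letter w i)))
  where φ₀ = λ x → letter w (pos w x ⊕ toℕ d)
... | no ¬c = no λ { (φ , c , h) → ¬c λ x →
        let eq = λ y → trans (h (pos w y)) (cong φ (letter-pos w y)) in
        trans (eq (inv x)) (trans (c x) (cong inv (sym (eq x)))) }

autOrder : ∀ {k} → Word k → ℕ
autOrder w = count (isAut? w)

-- d has order exactly m (m prime) in Z/2e
HasPrimeOrder : ∀ {k} → ℕ → Fin (Len k) → Set
HasPrimeOrder {k} m d = toℕ d ≢ 0 × (m * toℕ d) % Len k ≡ 0

reversedEdges : ∀ {k} → (Letter (suc k) → Letter (suc k)) → ℕ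
reversedEdges φ = count (λ i → φ (i , true) ≟L (i , false))

-- sign of the vertex represented by corner c: corners i1, i2, i3 at that
-- vertex of the form  ab^{-1}, bc^{-1}, ca^{-1}  (a = w_{i1}, b = w_{i2},
-- c = w_{i3}, all oriented toward the vertex), in this cyclic order
-- (positive) or in the cyclic order i1, i3, i2 (negative).
CornerTriple : ∀ {k} → Word k → Fin (Len k) → (i1 i2 i3 : Fin (Len k)) → Set
CornerTriple w c i1 i2 i3 =
  SameVertex w c i1 × SameVertex w c i2 × SameVertex w c i3 ×
  letter w (i1 ⊕ 1) ≡ inv (letter w i2) ×
  letter w (i2 ⊕ 1) ≡ inv (letter w i3) ×
  letter w (i3 ⊕ 1) ≡ inv (letter w i1)

cornerTriple? : ∀ {k} (w : Word k) c i1 i2 i3 → Dec (CornerTriple w c i1 i2 i3)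
cornerTriple? w c i1 i2 i3 =
  sameVertex? w c i1 ×-dec sameVertex? w c i2 ×-dec sameVertex? w c i3 ×-dec
  (letter w (i1 ⊕ 1) ≟L inv (letter w i2)) ×-dec
  (letter w (i2 ⊕ 1) ≟L inv (letter w i3)) ×-dec
  (letter w (i3 ⊕ 1) ≟L inv (letter w i1))

PositiveVertex : ∀ {k} → Word k → Fin (Len k) → Set
PositiveVertex w c = ∃[ i1 ] ∃[ i2 ] ∃[ i3 ]
  (CornerTriple w c i1 i2 i3 × 0 ℕ.< rel i1 i2 × rel i1 i2 ℕ.< rel i1 i3)

NegativeVertex : ∀ {k} → Word k → Fin (Len k) → Set
NegativeVertex w c = ∃[ i1 ] ∃[ i2 ] ∃[ i3 ]
  (CornerTriple w c i1 i2 i3 × 0 ℕ.< rel i1 i3 × rel i1 i3 ℕ.< rel i1 i2)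

positive? : ∀ {k} (w : Word k) c → Dec (PositiveVertex w c)
positive? w c = any? λ i1 → any? λ i2 → any? λ i3 →
  cornerTriple? w c i1 i2 i3 ×-dec (0 ℕ.<? rel i1 i2) ×-dec (rel i1 i2 ℕ.<? rel i1 i3)

negative? : ∀ {k} (w : Word k) c → Dec (NegativeVertex w c)
negative? w c = any? λ i1 → any? λ i2 → any? λ i3 →
  cornerTriple? w c i1 i2 i3 ×-dec (0 ℕ.<? rel i1 i3) ×-dec (rel i1 i3 ℕ.<? rel i1 i2)

FixedVertex : ∀ {k} → Word k → Fin (Len k) → Fin (Len k) → Set
FixedVertex w d c = VertexRep w c × SameVertex w c (c ⊕ toℕ d)

fixedVertex? : ∀ {k} (w : Word k) d c → Dec (FixedVertex w d c)
fixedVertex? w d c = vertexRep? w c ×-dec sameVertex? w c (c ⊕ toℕ d)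

fixedPositive : ∀ {k} → Word k → Fin (Len k) → ℕ
fixedPositive w d = count (λ c → fixedVertex? w d c ×-dec positive? w c)

fixedNegative : ∀ {k} → Word k → Fin (Len k) → ℕ
fixedNegative w d = count (λ c → fixedVertex? w d c ×-dec negative? w c)

InW2 : ∀ {k} → ℕ → Word k → Set
InW2 {k} r w = ∃[ d ] (HasPrimeOrder 2 d ×
  Σ (Letter (suc k) → Letter (suc k)) λ φ → AutWitness w d φ × reversedEdges φ ≡ r)

InW3 : ∀ {k} → ℕ → ℕ → Word k → Set
InW3 s t w = ∃[ d ] (HasPrimeOrder 3 d × IsAut w d ×
  fixedPositive w d ≡ s × fixedNegative w d ≡ t)

InW6 : ∀ {k} → ℕ → ℕ → ℕ → Word k → Set
InW6 r s t w = InW2 (3 * r) w × InW3 (2 * s) (2 * t) w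

-- Masses.  A finite set of isomorphism classes is given by a list of
-- representatives, one for each class; its mass is Σ 1/|Aut(w)|.

RepSystem : (g : ℕ) → (Word (Kg g) → Set) → List (Word (Kg g)) → Set
RepSystem g P L =
  All (λ w → IsMaxWicks g w × P w) L ×
  (∀ w → IsMaxWicks g w → P w → Any (Iso w) L) ×
  AllPairs (λ u v → ¬ Iso u v) L

-- n/d as a rational (d = 0 never occurs in our uses; it is sent to 0)
frac : ℕ → ℕ → ℚ
frac n zero    = 0ℚ
frac n (suc d) = (+ n) ℚ./ suc d

_^ℚ_ : ℚ → ℕ → ℚ
q ^ℚ zero  = 1ℚ
q ^ℚ suc n = q ℚ.* (q ^ℚ n)

mass : ∀ {k} → List (Word k) → ℚ
mass L = foldr ℚ._+_ 0ℚ (map (λ w → frac 1 (autOrder w)) L)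

m1 : ℕ → ℚ
m1 g = frac 2 1 ℚ.* (frac (1 ^ 2) 12 ^ℚ g) ℚ.*
       frac ((6 * g ∸ 5) !) (g ! * (3 * g ∸ 3) !)

m2 : ℕ → ℕ → ℚ
m2 f r = frac 2 2 ℚ.* (frac (2 ^ 2) 12 ^ℚ f) ℚ.* frac 1 (r !) ℚ.*
         frac ((6 * f + 2 * r ∸ 5) !) (f ! * (3 * f + r ∸ 3) !)

m3 : ℕ → ℕ → ℕ → ℚ
m3 f s t = frac 2 3 ℚ.* (frac (3 ^ 2) 12 ^ℚ f) ℚ.* frac 1 (s ! * t !) ℚ.*
           frac ((6 * f + 2 * s + 2 * t ∸ 5) !) (f ! * (3 * f + s + t ∸ 3) !)

m6 : ℕ → ℕ → ℕ → ℕ → ℚ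
m6 f r s t = frac 2 6 ℚ.* (frac (6 ^ 2) 12 ^ℚ f) ℚ.* frac 1 (r ! * s ! * t !) ℚ.*
             frac ((6 * f + 2 * r + 2 * s + 2 * t ∸ 5) !) (f ! * (3 * f + r + s + t ∸ 3) !)

{-# OPTIONS --safe #-}

-- A word is an involution α of Z/N without fixed points, up to renaming the
-- letters; it is maximal iff σ = α ∘ (+1) is a product of 3-cycles.  By
-- orbit-stabiliser the mass of a class of words is the number of its
-- involutions divided by N.
--
-- Involutions commuting with the rotation by M = N/n correspond to one-face
-- maps on Z/M, with cubic vertices, leaves and half-edges, carrying a voltage
-- in Z/n on every edge.  They are counted for any finite abelian group G:
-- counting the descents of σ gives V + ν = E + 1 for the number ν of negative
-- vertices, so ν is twice the genus f; cutting a negative vertex into three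
-- leaves, which exchanges two adjacent blocks of the word, is a bijection onto
-- genus f - 1 with three marked leaves, whose monodromies have product 1, so
-- that 12 f A(f, p) = |G|² A(f - 1, p + 3); and erasing a labelled leaf on a
-- map of genus 0 with M corners gives A(0, p) = M A(0, p - 1).
--
-- Summing monodromies over the vertices and voltages over the edges shows that
-- the face monodromy, a generator of Z/n, is killed by 3 · 2: hence n ∣ 6.

module Submission where

open import Defs
open import Algebra.Bundles using (AbelianGroup)
open import Algebra.Structures using (IsAbelianGroup)
import Algebra.Properties.AbelianGroup as AbelianGroupₚ
import Algebra.Properties.CommutativeMonoid.Sum as Sum
import Algebra.Solver.CommutativeMonoid as CMSolver
open import Data.Bool using (Bool; true; false)
open import Data.Empty using (⊥; ⊥-elim)
open import Data.Fin using (Fin; zero; suc; toℕ; fromℕ; inject₁; fromℕ<; punchIn; punchOut; combine; remQuot; splitAt; join; _↑ˡ_; _↑ʳ_; funToFin; finToFun)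
import Data.Fin.Permutation as Perm
import Data.Fin.Properties as Fₚ
open import Data.Fin.Relation.Unary.Top using (view; ‵fromℕ; ‵inj₁; view-fromℕ; view-inject₁)
open import Data.Integer as ℤ using ()
import Data.Integer.Properties as ℤₚ
open import Data.List as List using (List; []; _∷_; filter; allFin)
open import Data.List.Membership.Propositional.Properties using (∈-filter⁺; ∈-filter⁻; ∈-allFin; ∈-lookup)
open import Data.List.Relation.Unary.Any.Properties using (lookup-index)
open import Data.List.Relation.Unary.All as All using (All; []; _∷_)
open import Data.List.Relation.Unary.AllPairs using (AllPairs; []; _∷_)
open import Data.List.Relation.Unary.Any as Any using (Any; here; there)
import Data.List.Relation.Unary.Unique.Propositional.Properties as Uniqueₚ
open import Data.Nat using (ℕ; zero; suc; _+_; _*_; _∸_; _^_; _!; _%_; _/_; _≤_; _<_; z≤n; s≤s; NonZero; ≢-nonZero; ≢-nonZero⁻¹)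
open import Data.Nat.DivMod using (_mod_)
import Data.Nat.DivMod as DM
import Data.Nat.Divisibility as Div
open import Data.Nat.GCD using (gcd; gcd-GCD; gcd[m,n]∣m; gcd[m,n]∣n; module Bézout)
import Data.Nat.Properties as ℕₚ
open import Data.Nat.Tactic.RingSolver using (solve-∀)
open import Data.Product using (Σ; ∃-syntax; _×_; _,_; proj₁; proj₂)
open import Data.Product.Relation.Binary.Pointwise.NonDependent using (×-setoid)
open import Data.Rational as ℚ using (ℚ; 0ℚ)
import Data.Rational.Properties as ℚₚ
import Data.Rational.Unnormalised as ℚᵘ
import Data.Rational.Unnormalised.Properties as ℚᵘₚ
open import Data.Sum using (_⊎_; inj₁; inj₂; [_,_]′)
open import Data.Unit using (⊤; tt)
open import Function using (_∘_; id)
open import Function.Bundles using (_⇔_; mk⇔; Equivalence)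
open import Level using (0ℓ)
open import Relation.Binary.Bundles using (Setoid)
open import Relation.Binary.Definitions using (tri<; tri≈; tri>)
open import Relation.Binary.PropositionalEquality using (_≡_; _≢_; _≗_; refl; sym; trans; cong; cong₂; subst; subst₂; module ≡-Reasoning)
import Relation.Binary.PropositionalEquality.Properties as ≡ₚ
open import Relation.Nullary using (¬_; Dec; yes; no; contradiction)
open import Relation.Nullary.Decidable using (_×-dec_; _→-dec_; ¬?; map′)

-- Finite cardinalities

-- Functions are compared pointwise, so sets of maps are counted in setoids. The face monodromy is
-- the generator 1 of Z/n: this makes the cover of the M-gon a single N-gon. A half-edge is the
-- image of an edge reversed by the rotation and has voltage of order 2; a leaf is the image of a
-- fixed vertex and has monodromy of order 3, and the two elements of order 3 are the two signs. So
-- r, s and t prescribe the voltages at all fixed points, subject to one equation: the product of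
-- the leaf monodromies is the face monodromy times the product of the half-edge voltages. Together
-- with Euler's relation it yields the congruences on s and t. The factor 12 f is 6 orders of three
-- leaves times 2 f negative vertices, and |G|² counts triples with product 1. The recursion needs
-- counts that do not depend on the individual monodromies, which is proved along with the formula.
-- Labels make every construction a bijection, and all divisions appear as cross-multiplied
-- identities. The closed form contains (2q)!/q! with q = 3f + p + r - 2; taking out a factor 2
-- gives the shape in the theorem. This requires q to be at least 1 and can fail only on the torus.

FunS : ℕ → Set → Setoid 0ℓ 0ℓ
FunS n A = record
  { Carrier = Fin n → A
  ; _≈_ = _≗_
  ; isEquivalence = record
      { refl = λ _ → refl ; sym = λ e i → sym (e i) ; trans = λ e f i → trans (e i) (f i) } }

EqS : Set → Setoid 0ℓ 0ℓ
EqS A = ≡ₚ.setoid A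

-- The elements of `P` are enumerated up to `≈` and without repetition; proofs of `P` are not
-- counted, so `P` may be any family of types.
record Card (S : Setoid 0ℓ 0ℓ) (P : Setoid.Carrier S → Set) (n : ℕ) : Set where
  open Setoid S
  field
    enum     : Fin n → Carrier
    sound    : ∀ i → P (enum i)
    index    : ∀ {a} → P a → Fin n
    index-≈  : ∀ {a} (p : P a) → a ≈ enum (index p)
    enum-inj : ∀ {i j} → enum i ≈ enum j → i ≡ j

module _ {S T : Setoid 0ℓ 0ℓ} where
  private
    module S = Setoid S
    module T = Setoid T
  open Card

  card-≤ : ∀ {P Q m n} → Card S P m → Card T Q n →
           (f : ∀ {a} → P a → T.Carrier) → (∀ {a} (p : P a) → Q (f p)) →
           (∀ {a b} (p : P a) (q : P b) → f p T.≈ f q → a S.≈ b) → m ≤ n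
  card-≤ cP cQ f ok inj = Fₚ.injective⇒≤ {f = λ i → index cQ (ok (sound cP i))} λ {i} {j} e →
    enum-inj cP (inj (sound cP i) (sound cP j)
      (T.trans (index-≈ cQ (ok (sound cP i)))
        (T.trans (T.reflexive (cong (enum cQ) e)) (T.sym (index-≈ cQ (ok (sound cP j)))))))

  card-map : ∀ {P Q n} → Card S P n → (f : S.Carrier → T.Carrier) →
             (∀ {a} → P a → Q (f a)) →
             (∀ {a b} → a S.≈ b → f a T.≈ f b) →
             (∀ {a b} → P a → P b → f a T.≈ f b → a S.≈ b) →
             (∀ {b} → Q b → ∃[ a ] (P a × b T.≈ f a)) → Card T Q n
  card-map c f ok f-cong inj surj = record
    { enum = f ∘ enum c ; sound = ok ∘ sound c
    ; index = λ q → index c (proj₁ (proj₂ (surj q)))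
    ; index-≈ = λ q → T.trans (proj₂ (proj₂ (surj q))) (f-cong (index-≈ c _))
    ; enum-inj = λ e → enum-inj c (inj (sound c _) (sound c _) e) }

  card-unmap : ∀ {P Q n} → Card T Q n → (f : S.Carrier → T.Carrier) →
               (∀ {a} → P a → Q (f a)) →
               (∀ {a b} → a S.≈ b → f a T.≈ f b) →
               (∀ {a b} → P a → P b → f a T.≈ f b → a S.≈ b) →
               (∀ {b} → Q b → ∃[ a ] (P a × b T.≈ f a)) → Card S P n
  card-unmap c f ok f-cong inj surj = record
    { enum = λ i → proj₁ (surj (sound c i)) ; sound = λ i → proj₁ (proj₂ (surj (sound c i)))
    ; index = λ p → index c (ok p)
    ; index-≈ = λ p → inj p (proj₁ (proj₂ (surj (sound c _)))) (T.trans (index-≈ c (ok p)) (proj₂ (proj₂ (surj (sound c _)))))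
    ; enum-inj = λ {i} {j} e → enum-inj c (T.trans (proj₂ (proj₂ (surj (sound c i))))
        (T.trans (f-cong e) (T.sym (proj₂ (proj₂ (surj (sound c j))))))) }

  -- The fibre `R a` may vary with `a` as long as its size does not. Every double counting below
  -- enters in this form.
  card-× : ∀ {P} {R : S.Carrier → T.Carrier → Set} {m n} → Card S P m →
           (∀ {a} → P a → Card T (R a) n) →
           (∀ {a a' b} → a S.≈ a' → R a b → R a' b) →
           Card (×-setoid S T) (λ x → P (proj₁ x) × R (proj₁ x) (proj₂ x)) (m * n)
  card-× {P} {R} {m} {n} cP cR resp = record
    { enum = λ k → f (remQuot {m} n k)
    ; sound = λ k → sound cP _ , sound (cR (sound cP _)) _
    ; index = λ { (p , r) → combine (index cP p) (index (cR (sound cP _)) (resp (index-≈ cP p) r)) }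
    ; index-≈ = λ { (p , r) →
        subst (λ z → _ S.≈ proj₁ (f z) × _ T.≈ proj₂ (f z)) (sym (Fₚ.remQuot-combine {m} {n} _ _))
          (index-≈ cP p , index-≈ (cR (sound cP _)) (resp (index-≈ cP p) r)) }
    ; enum-inj = λ {k} {l} e →
        trans (sym (Fₚ.combine-remQuot {m} n k))
          (trans (cong (λ z → combine (proj₁ z) (proj₂ z)) (f-inj _ _ e)) (Fₚ.combine-remQuot {m} n l)) }
    where
    f : Fin m × Fin n → S.Carrier × T.Carrier
    f (i , j) = enum cP i , enum (cR (sound cP i)) j
    f-inj : ∀ x y → (proj₁ (f x) S.≈ proj₁ (f y)) × (proj₂ (f x) T.≈ proj₂ (f y)) → x ≡ y
    f-inj (i , j) (i' , j') (e , e') with enum-inj cP {i} {i'} e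
    ... | refl = cong (i ,_) (enum-inj (cR (sound cP i)) e')

module _ {S : Setoid 0ℓ 0ℓ} where
  private module S = Setoid S
  open Card

  card-unique : ∀ {P m n} → Card S P m → Card S P n → m ≡ n
  card-unique c d = ℕₚ.≤-antisym (card-≤ c d (λ {a} _ → a) id (λ _ _ e → e))
                                 (card-≤ d c (λ {a} _ → a) id (λ _ _ e → e))

  card-cong : ∀ {P Q n} → (∀ {a} → P a → Q a) → (∀ {a} → Q a → P a) → Card S P n → Card S Q n
  card-cong f g c = card-map c id f id (λ _ _ e → e) (λ q → _ , g q , S.refl)

  card-∅ : ∀ {P} → (∀ {a} → ¬ P a) → Card S P 0
  card-∅ ¬p = record { enum = λ () ; sound = λ () ; index = λ p → ⊥-elim (¬p p)
                     ; index-≈ = λ p → ⊥-elim (¬p p) ; enum-inj = λ { {()} } }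

  card-1 : ∀ {P} a → P a → (∀ {b} → P b → b S.≈ a) → Card S P 1
  card-1 a p u = record { enum = λ _ → a ; sound = λ _ → p ; index = λ _ → zero ; index-≈ = u
                        ; enum-inj = λ { {zero} {zero} _ → refl } }

  card-⊎ : ∀ {P Q m n} → Card S P m → Card S Q n → (∀ {a b} → P a → Q b → ¬ (a S.≈ b)) →
           Card S (λ a → P a ⊎ Q a) (m + n)
  card-⊎ {P} {Q} {m} {n} c d disj = record
    { enum = f ∘ splitAt m
    ; sound = λ i → f-sound (splitAt m i)
    ; index = λ x → join m n (ix x)
    ; index-≈ = λ x → S.trans (ix-≈ x) (S.reflexive (cong f (sym (Fₚ.splitAt-join m n (ix x)))))
    ; enum-inj = λ {i} {j} e → trans (sym (Fₚ.join-splitAt m n i))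
        (trans (cong (join m n) (f-inj (splitAt m i) (splitAt m j) e)) (Fₚ.join-splitAt m n j)) }
    where
    f : Fin m ⊎ Fin n → S.Carrier
    f = [ enum c , enum d ]′
    f-sound : ∀ x → P (f x) ⊎ Q (f x)
    f-sound (inj₁ i) = inj₁ (sound c i)
    f-sound (inj₂ i) = inj₂ (sound d i)
    ix : ∀ {a} → P a ⊎ Q a → Fin m ⊎ Fin n
    ix (inj₁ p) = inj₁ (index c p)
    ix (inj₂ q) = inj₂ (index d q)
    ix-≈ : ∀ {a} (x : P a ⊎ Q a) → a S.≈ f (ix x)
    ix-≈ (inj₁ p) = index-≈ c p
    ix-≈ (inj₂ q) = index-≈ d q
    f-inj : ∀ x y → f x S.≈ f y → x ≡ y
    f-inj (inj₁ i) (inj₁ j) e = cong inj₁ (enum-inj c e)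
    f-inj (inj₁ i) (inj₂ j) e = ⊥-elim (disj (sound c i) (sound d j) e)
    f-inj (inj₂ i) (inj₁ j) e = ⊥-elim (disj (sound c j) (sound d i) (S.sym e))
    f-inj (inj₂ i) (inj₂ j) e = cong inj₂ (enum-inj d e)

  -- Provides a count whose value is still unknown; the value is found later by comparing two
  -- enumerations of the same set.
  card-filter : ∀ {n} {Q : S.Carrier → Set} → Card S (λ _ → ⊤) n → (∀ a → Dec (Q a)) →
                (∀ {a b} → a S.≈ b → Q a → Q b) → ∃[ m ] Card S Q m
  card-filter {n} {Q} c Q? resp with go n (enum c) (enum-inj c)
    where
    Img : ∀ k → (Fin k → S.Carrier) → S.Carrier → Set
    Img k e a = (∃[ i ] a S.≈ e i) × Q a
    go : ∀ k (e : Fin k → S.Carrier) → (∀ {i j} → e i S.≈ e j → i ≡ j) → ∃[ m ] Card S (Img k e) m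
    go zero e inj = 0 , card-∅ λ { ((() , _) , _) }
    go (suc k) e inj with go k (e ∘ suc) (Fₚ.suc-injective ∘ inj) | Q? (e zero)
    ... | m , d | no ¬q = m , card-cong (λ { ((i , x) , q) → (suc i , x) , q })
            (λ { ((zero , x) , q) → ⊥-elim (¬q (resp x q)) ; ((suc i , x) , q) → (i , x) , q }) d
    ... | m , d | yes q = suc m , card-cong
            (λ { (inj₁ x) → (zero , x) , resp (S.sym x) q ; (inj₂ ((i , x) , q)) → (suc i , x) , q })
            (λ { ((zero , x) , q) → inj₁ x ; ((suc i , x) , q) → inj₂ ((i , x) , q) })
            (card-⊎ (card-1 {P = S._≈ e zero} (e zero) S.refl id) d
              λ { x ((i , y) , _) z → contradiction (inj (S.trans (S.sym x) (S.trans z y))) λ () })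
  ... | m , d = m , card-cong proj₂ (λ q → (index c tt , index-≈ c tt) , q) d

card-Fin : ∀ n → Card (EqS (Fin n)) (λ _ → ⊤) n
card-Fin n = record { enum = id ; sound = λ _ → tt ; index = λ {a} _ → a
                    ; index-≈ = λ _ → refl ; enum-inj = id }

card-⊤× : ∀ {S T : Setoid 0ℓ 0ℓ} {m n} → Card S (λ _ → ⊤) m → Card T (λ _ → ⊤) n →
          Card (×-setoid S T) (λ _ → ⊤) (m * n)
card-⊤× c d = card-cong _ (λ _ → tt , tt) (card-× {R = λ _ _ → ⊤} c (λ _ → d) _)

funToFin-cong : ∀ {m n} {f g : Fin m → Fin n} → f ≗ g → funToFin f ≡ funToFin g
funToFin-cong {zero}  e = refl
funToFin-cong {suc m} e = cong₂ combine (e zero) (funToFin-cong (e ∘ suc))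

card-Fun : ∀ {A : Set} {n} k → Card (EqS A) (λ _ → ⊤) n → Card (FunS k A) (λ _ → ⊤) (n ^ k)
card-Fun {A} {n} k c = record
  { enum = λ i → enum ∘ finToFun {n} {k} i
  ; sound = λ _ → tt
  ; index = λ {f} _ → funToFin (λ j → index {f j} tt)
  ; index-≈ = λ {f} _ j → trans (index-≈ {f j} tt) (cong enum (sym (Fₚ.finToFun-funToFin _ j)))
  ; enum-inj = λ {i} {j} e → trans (sym (Fₚ.funToFin-finToFin {k} {n} i))
      (trans (funToFin-cong (λ l → enum-inj (e l))) (Fₚ.funToFin-finToFin {k} {n} j)) }
  where open Card c

-- Sums over finite sets and indicator functions

open Sum ℕₚ.+-0-commutativeMonoid using () renaming
  (sum to sumℕ; sum-cong-≗ to sumℕ-cong; ∑-distrib-+ to sumℕ-+; sum-permute to sumℕ-permute) public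

sumℕ-bij : ∀ {n} (f : Fin n → ℕ) (p q : Fin n → Fin n) → (∀ i → p (q i) ≡ i) → (∀ i → q (p i) ≡ i) →
           sumℕ f ≡ sumℕ (f ∘ p)
sumℕ-bij f p q pq qp = sumℕ-permute f (Perm.permutation p q pq qp)

sumℕ-const : ∀ n k → sumℕ {n} (λ _ → k) ≡ n * k
sumℕ-const zero    k = refl
sumℕ-const (suc n) k = cong (k +_) (sumℕ-const n k)

sumℕ-*ˡ : ∀ k {n} (f : Fin n → ℕ) → sumℕ (λ i → k * f i) ≡ k * sumℕ f
sumℕ-*ˡ k {zero}  f = sym (ℕₚ.*-zeroʳ k)
sumℕ-*ˡ k {suc n} f = trans (cong (k * f zero +_) (sumℕ-*ˡ k (f ∘ suc))) (sym (ℕₚ.*-distribˡ-+ k (f zero) _))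

⟦_⟧ : {P : Set} → Dec P → ℕ
⟦ yes _ ⟧ = 1
⟦ no _ ⟧  = 0

⟦⟧-yes : {P : Set} (d : Dec P) → P → ⟦ d ⟧ ≡ 1
⟦⟧-yes (yes _) _ = refl
⟦⟧-yes (no ¬p) p = ⊥-elim (¬p p)

⟦⟧-no : {P : Set} (d : Dec P) → ¬ P → ⟦ d ⟧ ≡ 0
⟦⟧-no (no _)  _  = refl
⟦⟧-no (yes p) ¬p = ⊥-elim (¬p p)

⟦⟧-cong : {P Q : Set} (d : Dec P) (e : Dec Q) → (P → Q) → (Q → P) → ⟦ d ⟧ ≡ ⟦ e ⟧
⟦⟧-cong (yes p) e f g = sym (⟦⟧-yes e (f p))
⟦⟧-cong (no ¬p) e f g = sym (⟦⟧-no e (¬p ∘ g))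

card-sum : ∀ {n} {P : Fin n → Set} (P? : ∀ i → Dec (P i)) → Card (EqS (Fin n)) P (sumℕ (λ i → ⟦ P? i ⟧))
card-sum {zero}  P? = card-∅ λ { {()} }
card-sum {suc n} {P} P? with P? zero | card-sum {n} (P? ∘ suc)
... | yes p | c = card-cong (λ { (inj₁ refl) → p ; (inj₂ (i , refl , q)) → q })
        (λ { {zero} q → inj₁ refl ; {suc i} q → inj₂ (i , refl , q) })
        (card-⊎ (card-1 {P = _≡ zero} zero refl id)
          (card-map {Q = λ a → ∃[ i ] (a ≡ suc i × P (suc i))} c suc (λ q → _ , refl , q) (cong suc)
            (λ _ _ → Fₚ.suc-injective) (λ { (i , refl , q) → i , q , refl }))
          λ { refl (i , refl , _) () })
... | no ¬p | c = card-map c suc id (cong suc) (λ _ _ → Fₚ.suc-injective)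
        (λ { {zero} q → ⊥-elim (¬p q) ; {suc i} q → i , q , refl })

card⇒sum : ∀ {n m} {P : Fin n → Set} (P? : ∀ i → Dec (P i)) → Card (EqS (Fin n)) P m →
           sumℕ (λ i → ⟦ P? i ⟧) ≡ m
card⇒sum P? c = card-unique (card-sum P?) c

lookup-unique : ∀ {A : Set} {xs : List A} → AllPairs _≢_ xs → ∀ {i j} →
                List.lookup xs i ≡ List.lookup xs j → i ≡ j
lookup-unique (_ ∷ _)  {zero}  {zero}  _ = refl
lookup-unique (a ∷ _)  {zero}  {suc j} e = ⊥-elim (All.lookup a (∈-lookup j) e)
lookup-unique (a ∷ _)  {suc i} {zero}  e = ⊥-elim (All.lookup a (∈-lookup i) (sym e))
lookup-unique (_ ∷ u)  {suc i} {suc j} e = cong suc (lookup-unique u e)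

card-count : ∀ {n} {P : Fin n → Set} (P? : ∀ i → Dec (P i)) → Card (EqS (Fin n)) P (count P?)
card-count {n} {P} P? = record
  { enum = List.lookup xs
  ; sound = λ i → proj₂ (∈-filter⁻ P? {xs = allFin n} (∈-lookup i))
  ; index = λ {a} p → Any.index (∈-filter⁺ P? (∈-allFin a) p)
  ; index-≈ = λ {a} p → lookup-index (∈-filter⁺ P? (∈-allFin a) p)
  ; enum-inj = lookup-unique (Uniqueₚ.filter⁺ P? (Uniqueₚ.allFin⁺ n)) }
  where
  xs = filter P? (allFin n)

-- The cyclic successor and the negative vertices of a one-face map

next : ∀ {m} → Fin (suc m) → Fin (suc m)
next i with view i
... | ‵fromℕ            = zero
... | ‵inj₁ {i = j} _ = suc j

prev : ∀ {m} → Fin (suc m) → Fin (suc m)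
prev {m} zero    = fromℕ m
prev     (suc j) = inject₁ j

next-fromℕ : ∀ m → next (fromℕ m) ≡ zero
next-fromℕ m rewrite view-fromℕ m = refl

next-inject₁ : ∀ {m} (j : Fin m) → next (inject₁ j) ≡ suc j
next-inject₁ j rewrite view-inject₁ j = refl

next-prev : ∀ {m} (i : Fin (suc m)) → next (prev i) ≡ i
next-prev zero    = next-fromℕ _
next-prev (suc j) = next-inject₁ j

prev-next : ∀ {m} (i : Fin (suc m)) → prev (next i) ≡ i
prev-next i with view i
... | ‵fromℕ  = refl
... | ‵inj₁ _ = refl

next-injective : ∀ {m} {i j : Fin (suc m)} → next i ≡ next j → i ≡ j
next-injective {i = i} {j} e = trans (sym (prev-next i)) (trans (cong prev e) (prev-next j))

next-last : ∀ {m} (i : Fin (suc m)) → toℕ i ≡ m → next i ≡ zero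
next-last {m} i e with Fₚ.toℕ-injective {i = i} {fromℕ m} (trans e (sym (Fₚ.toℕ-fromℕ m)))
... | refl = next-fromℕ m

toℕ-next : ∀ {m} (i : Fin (suc m)) → toℕ i ≢ m → toℕ (next i) ≡ suc (toℕ i)
toℕ-next {m} i ne with view i
... | ‵fromℕ          = ⊥-elim (ne (Fₚ.toℕ-fromℕ m))
... | ‵inj₁ {i = j} _ = cong suc (sym (Fₚ.toℕ-inject₁ j))

-- One step around a vertex, from corner to corner: the permutation `σ` of a word, for an arbitrary
-- gluing `α`.
vert : ∀ {m} → (Fin (suc m) → Fin (suc m)) → Fin (suc m) → Fin (suc m)
vert α i = α (next i)

-- i is the least corner of a 3-cycle i → k → j → i of corners with i < j < k.
Neg : ∀ {m} → (Fin (suc m) → Fin (suc m)) → Fin (suc m) → Set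
Neg α i = toℕ i < toℕ (vert α (vert α i)) × toℕ (vert α (vert α i)) < toℕ (vert α i)

neg? : ∀ {m} (α : Fin (suc m) → Fin (suc m)) i → Dec (Neg α i)
neg? α i = (toℕ i ℕₚ.<? toℕ (vert α (vert α i))) ×-dec (toℕ (vert α (vert α i)) ℕₚ.<? toℕ (vert α i))

-- A fixed corner is a leaf; the descents of a 3-cycle number one or two
-- according to its orientation.
descents-3-cycle : ∀ a b c → (a ≡ b → c ≡ a) → (b ≡ c → a ≡ b) → (c ≡ a → a ≡ b) →
  ⟦ b ℕₚ.≤? a ⟧ + ⟦ c ℕₚ.≤? b ⟧ + ⟦ a ℕₚ.≤? c ⟧ ≡
  1 + 2 * ⟦ b ℕₚ.≟ a ⟧ + (⟦ (a ℕₚ.<? c) ×-dec (c ℕₚ.<? b) ⟧ + ⟦ (b ℕₚ.<? a) ×-dec (a ℕₚ.<? c) ⟧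
                           + ⟦ (c ℕₚ.<? b) ×-dec (b ℕₚ.<? a) ⟧)
descents-3-cycle a b c ab bc ca with ℕₚ.<-cmp a b
... | tri≈ _ refl _ with ab refl
...   | refl rewrite ⟦⟧-yes (a ℕₚ.≤? a) ℕₚ.≤-refl | ⟦⟧-yes (a ℕₚ.≟ a) refl
            | ⟦⟧-no ((a ℕₚ.<? a) ×-dec (a ℕₚ.<? a)) (ℕₚ.<-irrefl refl ∘ proj₁) = refl
descents-3-cycle a b c ab bc ca | tri< a<b a≢b _
  rewrite ⟦⟧-no (b ℕₚ.≤? a) (ℕₚ.<⇒≱ a<b) | ⟦⟧-no (b ℕₚ.≟ a) (a≢b ∘ sym)
        | ⟦⟧-no ((b ℕₚ.<? a) ×-dec (a ℕₚ.<? c)) (ℕₚ.<-asym a<b ∘ proj₁)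
        | ⟦⟧-no ((c ℕₚ.<? b) ×-dec (b ℕₚ.<? a)) (ℕₚ.<-asym a<b ∘ proj₂)
  with ℕₚ.<-cmp a c
... | tri≈ _ a≡c _ = ⊥-elim (a≢b (ca (sym a≡c)))
... | tri> _ _ c<a
  rewrite ⟦⟧-yes (c ℕₚ.≤? b) (ℕₚ.<⇒≤ (ℕₚ.<-trans c<a a<b)) | ⟦⟧-no (a ℕₚ.≤? c) (ℕₚ.<⇒≱ c<a)
        | ⟦⟧-no ((a ℕₚ.<? c) ×-dec (c ℕₚ.<? b)) (ℕₚ.<-asym c<a ∘ proj₁) = refl
... | tri< a<c _ _ rewrite ⟦⟧-yes (a ℕₚ.≤? c) (ℕₚ.<⇒≤ a<c) with ℕₚ.<-cmp b c
...   | tri≈ _ b≡c _ = ⊥-elim (a≢b (bc b≡c))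
...   | tri< b<c _ _ rewrite ⟦⟧-no (c ℕₚ.≤? b) (ℕₚ.<⇒≱ b<c)
        | ⟦⟧-no ((a ℕₚ.<? c) ×-dec (c ℕₚ.<? b)) (ℕₚ.<-asym b<c ∘ proj₂) = refl
...   | tri> _ _ c<b rewrite ⟦⟧-yes (c ℕₚ.≤? b) (ℕₚ.<⇒≤ c<b)
        | ⟦⟧-yes ((a ℕₚ.<? c) ×-dec (c ℕₚ.<? b)) (a<c , c<b) = refl
descents-3-cycle a b c ab bc ca | tri> _ a≢b b<a
  rewrite ⟦⟧-yes (b ℕₚ.≤? a) (ℕₚ.<⇒≤ b<a) | ⟦⟧-no (b ℕₚ.≟ a) (a≢b ∘ sym)
        | ⟦⟧-no ((a ℕₚ.<? c) ×-dec (c ℕₚ.<? b)) (λ { (x , y) → ℕₚ.<-asym b<a (ℕₚ.<-trans x y) })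
  with ℕₚ.<-cmp a c
... | tri≈ _ a≡c _ = ⊥-elim (a≢b (ca (sym a≡c)))
... | tri< a<c _ _
  rewrite ⟦⟧-no (c ℕₚ.≤? b) (ℕₚ.<⇒≱ (ℕₚ.<-trans b<a a<c)) | ⟦⟧-yes (a ℕₚ.≤? c) (ℕₚ.<⇒≤ a<c)
        | ⟦⟧-yes ((b ℕₚ.<? a) ×-dec (a ℕₚ.<? c)) (b<a , a<c)
        | ⟦⟧-no ((c ℕₚ.<? b) ×-dec (b ℕₚ.<? a)) (λ { (x , _) → ℕₚ.<-asym x (ℕₚ.<-trans b<a a<c) }) = refl
... | tri> _ _ c<a
  rewrite ⟦⟧-no (a ℕₚ.≤? c) (ℕₚ.<⇒≱ c<a)
        | ⟦⟧-no ((b ℕₚ.<? a) ×-dec (a ℕₚ.<? c)) (ℕₚ.<-asym c<a ∘ proj₂) with ℕₚ.<-cmp b c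
...   | tri≈ _ b≡c _ = ⊥-elim (a≢b (bc b≡c))
...   | tri< b<c _ _ rewrite ⟦⟧-no (c ℕₚ.≤? b) (ℕₚ.<⇒≱ b<c)
        | ⟦⟧-no ((c ℕₚ.<? b) ×-dec (b ℕₚ.<? a)) (ℕₚ.<-asym b<c ∘ proj₁) = refl
...   | tri> _ _ c<b rewrite ⟦⟧-yes (c ℕₚ.≤? b) (ℕₚ.<⇒≤ c<b)
        | ⟦⟧-yes ((c ℕₚ.<? b) ×-dec (b ℕₚ.<? a)) (c<b , b<a) = refl

module NegativeCount {m} (α : Fin (suc m) → Fin (suc m)) (invol : ∀ i → α (α i) ≡ i)
                     (cub : ∀ i → vert α (vert α (vert α i)) ≡ i) where
  private
    M = suc m
    σ̂ = vert α
    σ⁻ : Fin M → Fin M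
    σ⁻ i = prev (α i)
    σσ⁻ : ∀ i → σ̂ (σ⁻ i) ≡ i
    σσ⁻ i = trans (cong α (next-prev (α i))) (invol i)
    σ⁻σ : ∀ i → σ⁻ (σ̂ i) ≡ i
    σ⁻σ i = trans (cong prev (invol (next i))) (prev-next i)
    turn : (f : Fin M → ℕ) → sumℕ f ≡ sumℕ (f ∘ σ̂)
    turn f = sumℕ-bij f σ̂ σ⁻ σσ⁻ σ⁻σ
    ≟-toℕ : ∀ {i j : Fin M} → ⟦ i Fₚ.≟ j ⟧ ≡ ⟦ toℕ i ℕₚ.≟ toℕ j ⟧
    ≟-toℕ {i} {j} = ⟦⟧-cong (i Fₚ.≟ j) _ (cong toℕ) Fₚ.toℕ-injective
    desc : Fin M → ℕ
    desc i = ⟦ toℕ (σ̂ i) ℕₚ.≤? toℕ i ⟧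
    down : Fin M → ℕ
    down x = ⟦ toℕ (α x) ℕₚ.<? toℕ x ⟧
    fixed : Fin M → ℕ
    fixed x = ⟦ α x Fₚ.≟ x ⟧
    leaf : Fin M → ℕ
    leaf i = ⟦ σ̂ i Fₚ.≟ i ⟧
    neg : Fin M → ℕ
    neg i = ⟦ neg? α i ⟧
    D = sumℕ desc
    E = sumℕ down

  σ̂-injective : ∀ {i j} → σ̂ i ≡ σ̂ j → i ≡ j
  σ̂-injective {i} {j} e = trans (sym (σ⁻σ i)) (trans (cong σ⁻ e) (σ⁻σ j))

  private
    orbit-sum : (f : Fin M → ℕ) → sumℕ (λ i → f i + f (σ̂ i) + f (σ̂ (σ̂ i))) ≡ 3 * sumℕ f
    orbit-sum f = trans (sumℕ-+ (λ i → f i + f (σ̂ i)) (λ i → f (σ̂ (σ̂ i))))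
      (trans (cong₂ _+_ (trans (sumℕ-+ f (f ∘ σ̂)) (cong (sumℕ f +_) (sym (turn f))))
                        (sym (trans (turn f) (turn (f ∘ σ̂)))))
             (lem (sumℕ f)))
      where
      lem : ∀ x → x + x + x ≡ 3 * x
      lem = solve-∀

    desc-eq : ∀ i → desc i + desc (σ̂ i) + desc (σ̂ (σ̂ i)) ≡ 1 + 2 * leaf i + (neg i + neg (σ̂ i) + neg (σ̂ (σ̂ i)))
    desc-eq i = trans (cong (λ z → desc i + desc (σ̂ i) + ⟦ toℕ z ℕₚ.≤? toℕ c ⟧) (cub i))
      (trans (descents-3-cycle (toℕ i) (toℕ (σ̂ i)) (toℕ c)
                (λ e → let e' = Fₚ.toℕ-injective e in cong toℕ (trans (cong σ̂ (sym e')) (sym e')))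
                (λ e → cong toℕ (σ̂-injective (Fₚ.toℕ-injective e)))
                (λ e → cong toℕ (trans (sym (cub i)) (cong σ̂ (Fₚ.toℕ-injective e)))))
             (sym (cong₂ (λ x y → 1 + 2 * x + y) (≟-toℕ {σ̂ i} {i})
               (cong₂ (λ x y → neg i + x + y)
                 (cong (λ z → ⟦ (toℕ (σ̂ i) ℕₚ.<? toℕ z) ×-dec (toℕ z ℕₚ.<? toℕ c) ⟧) (cub i))
                 (cong (λ z → ⟦ (toℕ c ℕₚ.<? toℕ (σ̂ z)) ×-dec (toℕ (σ̂ z) ℕₚ.<? toℕ z) ⟧) (cub i))))))
      where c = σ̂ (σ̂ i)

    desc-total : 3 * D ≡ M + 2 * sumℕ leaf + 3 * sumℕ neg
    desc-total = trans (sym (orbit-sum desc)) (trans (sumℕ-cong desc-eq)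
      (trans (sumℕ-+ (λ i → 1 + 2 * leaf i) (λ i → neg i + neg (σ̂ i) + neg (σ̂ (σ̂ i))))
        (cong₂ _+_ (trans (sumℕ-+ (λ _ → 1) (λ i → 2 * leaf i))
                     (cong₂ _+_ (trans (sumℕ-const M 1) (ℕₚ.*-identityʳ M)) (sumℕ-*ˡ 2 leaf)))
                   (orbit-sum neg))))

    -- A descent of `σ̂` at `i` means that `next i` is the larger end of its edge. The exception is
    -- the last corner: it is always a descent, while its successor 0 is never a larger end. This
    -- exception is the 1 in Euler's formula.
    desc-down : ∀ i → desc i ≡ ⟦ toℕ i ℕₚ.≟ m ⟧ + down (next i)
    desc-down i with toℕ i ℕₚ.≟ m
    ... | yes e rewrite next-last i e =
      trans (⟦⟧-yes (toℕ (α zero) ℕₚ.≤? toℕ i) (subst (toℕ (α zero) ≤_) (sym e) (ℕₚ.≤-pred (Fₚ.toℕ<n (α zero)))))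
            (cong suc (sym (⟦⟧-no (toℕ (α zero) ℕₚ.<? 0) λ ())))
    ... | no ne rewrite toℕ-next i ne = ⟦⟧-cong (_ ℕₚ.≤? _) (_ ℕₚ.<? _) s≤s ℕₚ.≤-pred

    one-last : sumℕ {M} (λ i → ⟦ toℕ i ℕₚ.≟ m ⟧) ≡ 1
    one-last = card⇒sum {P = λ i → toℕ i ≡ m} (λ i → toℕ i ℕₚ.≟ m)
      (card-1 (fromℕ m) (Fₚ.toℕ-fromℕ m) (λ e → Fₚ.toℕ-injective (trans e (sym (Fₚ.toℕ-fromℕ m)))))

    D≡1+E : D ≡ 1 + E
    D≡1+E = trans (sumℕ-cong desc-down) (trans (sumℕ-+ (λ i → ⟦ toℕ i ℕₚ.≟ m ⟧) (down ∘ next))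
      (cong₂ _+_ one-last (sym (sumℕ-bij down next prev next-prev prev-next))))

    edge : ∀ x → down x + down (α x) + fixed x ≡ 1
    edge x rewrite invol x | ≟-toℕ {α x} {x} with ℕₚ.<-cmp (toℕ (α x)) (toℕ x)
    ... | tri< a b c rewrite ⟦⟧-yes (toℕ (α x) ℕₚ.<? toℕ x) a | ⟦⟧-no (toℕ x ℕₚ.<? toℕ (α x)) c
                           | ⟦⟧-no (toℕ (α x) ℕₚ.≟ toℕ x) b = refl
    ... | tri≈ a b c rewrite ⟦⟧-no (toℕ (α x) ℕₚ.<? toℕ x) a | ⟦⟧-no (toℕ x ℕₚ.<? toℕ (α x)) c
                           | ⟦⟧-yes (toℕ (α x) ℕₚ.≟ toℕ x) b = refl
    ... | tri> a b c rewrite ⟦⟧-no (toℕ (α x) ℕₚ.<? toℕ x) a | ⟦⟧-yes (toℕ x ℕₚ.<? toℕ (α x)) c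
                           | ⟦⟧-no (toℕ (α x) ℕₚ.≟ toℕ x) b = refl

  edge-count : 2 * E + sumℕ fixed ≡ M
  edge-count = trans (cong (_+ sumℕ fixed) (trans (lem E) (cong (E +_) (sumℕ-bij down α α invol invol))))
    (trans (cong (_+ sumℕ fixed) (sym (sumℕ-+ down (down ∘ α))))
      (trans (sym (sumℕ-+ (λ x → down x + down (α x)) fixed))
        (trans (sumℕ-cong edge) (trans (sumℕ-const M 1) (ℕₚ.*-identityʳ M)))))
    where
    lem : ∀ x → 2 * x ≡ x + x
    lem = solve-∀

  -- Euler's formula: the number of negative vertices is E + 1 − V = 2 · genus.
  negative-count : ∀ {p r} → Card (EqS (Fin M)) (λ i → σ̂ i ≡ i) p → Card (EqS (Fin M)) (λ i → α i ≡ i) r →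
                   6 * sumℕ neg + 4 * p + 3 * r ≡ M + 6
  negative-count {p} {r} cp cr = ℕₚ.+-cancelˡ-≡ (2 * M) _ _ (begin
    -- D and E are eliminated from 3D = M + 2p + 3ν, D = 1 + E and 2E + r = M; adding 2M to both
    -- sides avoids subtraction.
    2 * M + (6 * ν + 4 * p + 3 * r)  ≡⟨ lem₁ M ν p r ⟩
    2 * (M + 2 * p + 3 * ν) + 3 * r  ≡⟨ cong (λ z → 2 * z + 3 * r) desc' ⟨
    2 * (3 * D) + 3 * r              ≡⟨ cong (λ z → 2 * (3 * z) + 3 * r) D≡1+E ⟩
    2 * (3 * (1 + E)) + 3 * r        ≡⟨ lem₂ E r ⟩
    3 * (2 * E + r) + 6              ≡⟨ cong (λ z → 3 * z + 6) edge' ⟩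
    3 * M + 6                        ≡⟨ lem₃ M ⟩
    2 * M + (M + 6)                  ∎)
    where
    open ≡-Reasoning
    ν = sumℕ neg
    desc' : 3 * D ≡ M + 2 * p + 3 * ν
    desc' = subst (λ z → 3 * D ≡ M + 2 * z + 3 * ν) (card⇒sum (λ i → σ̂ i Fₚ.≟ i) cp) desc-total
    edge' : 2 * E + r ≡ M
    edge' = subst (λ z → 2 * E + z ≡ M) (card⇒sum (λ i → α i Fₚ.≟ i) cr) edge-count
    lem₁ : ∀ M ν p r → 2 * M + (6 * ν + 4 * p + 3 * r) ≡ 2 * (M + 2 * p + 3 * ν) + 3 * r
    lem₁ = solve-∀
    lem₂ : ∀ E r → 2 * (3 * (1 + E)) + 3 * r ≡ 3 * (2 * E + r) + 6
    lem₂ = solve-∀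
    lem₃ : ∀ M → 3 * M + 6 ≡ 2 * M + (M + 6)
    lem₃ = solve-∀

-- One-face maps with voltages in a finite abelian group

record FinAb : Set₁ where
  infix 4 _≟G_
  infixl 7 _∙_
  infix 8 _⁻¹
  field
    G      : Set
    _∙_    : G → G → G
    ε      : G
    _⁻¹    : G → G
    isAb   : IsAbelianGroup _≡_ _∙_ ε _⁻¹
    _≟G_   : (x y : G) → Dec (x ≡ y)
    order  : ℕ
    card-G : Card (EqS G) (λ _ → ⊤) order
  abelianGroup : AbelianGroup 0ℓ 0ℓ
  abelianGroup = record { isAbelianGroup = isAb }
  open AbelianGroup abelianGroup public using (commutativeMonoid; assoc; comm; identityˡ; identityʳ; inverseˡ; inverseʳ)
  open AbelianGroupₚ abelianGroup public using (∙-cancelˡ; ∙-cancelʳ; inverseʳ-unique; inverseˡ-unique; ⁻¹-involutive; ⁻¹-∙-comm)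

-- Unlike in `Card`, the enumeration `v` is here part of the object being counted: it is the
-- labelling of leaves or half-edges.
record Lists {A : Set} {n} (P : A → Set) (v : Fin n → A) : Set where
  field
    all : ∀ j → P (v j)
    inj : ∀ {i j} → v i ≡ v j → i ≡ j
    hit : ∀ {a} → P a → ∃[ j ] v j ≡ a

lists⇒card : ∀ {A : Set} {n} {P : A → Set} {v : Fin n → A} → Lists P v → Card (EqS A) P n
lists⇒card {v = v} L = record { enum = v ; sound = all ; index = λ p → proj₁ (hit p)
                              ; index-≈ = λ p → sym (proj₂ (hit p)) ; enum-inj = inj }
  where open Lists L

lists-map : ∀ {A B : Set} {n} {P : A → Set} {Q : B → Set} {v : Fin n → A} {w : Fin n → B} (f : A → B) →
            (∀ {a b} → f a ≡ f b → a ≡ b) → (∀ {a} → P a → Q (f a)) →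
            (∀ {b} → Q b → ∃[ a ] (P a × b ≡ f a)) → (∀ j → f (v j) ≡ w j) → Lists P v → Lists Q w
lists-map {Q = Q} f f-inj ok surj e L = record
  { all = λ j → subst Q (e j) (ok (all j))
  ; inj = λ {i} {j} x → inj (f-inj (trans (e i) (trans x (sym (e j)))))
  ; hit = λ q → let a , p , b≡ = surj q ; j , x = hit p in j , trans (sym (e j)) (trans (cong f x) (sym b≡)) }
  where open Lists L

lists-∷ : ∀ {A : Set} {P : A → Set} {n} {v : Fin (suc n) → A} → Lists P v → Lists (λ b → P b × b ≢ v zero) (v ∘ suc)
lists-∷ {v = v} L = record
  { all = λ j → all (suc j) , λ e → contradiction (inj e) λ ()
  ; inj = λ e → Fₚ.suc-injective (inj e)
  ; hit = λ { (p , ne) → drop (hit p) ne } }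
  where
  open Lists L
  drop : ∀ {b} → ∃[ j ] v j ≡ b → b ≢ v zero → ∃[ j ] v (suc j) ≡ b
  drop (zero , e) ne  = ⊥-elim (ne (sym e))
  drop (suc j , e) ne = j , e

module Maps (𝔾 : FinAb) where
  open FinAb 𝔾

  -- Position i is glued to position α i with voltage c i, and corner i lies
  -- between positions i and i + 1; the monodromy κ of the face sits on the
  -- last corner.  The fixed points of vert α are the leaves, those of α the
  -- half-edges.
  wrap : ∀ {m} → G → Fin (suc m) → G
  wrap κ i with view i
  ... | ‵fromℕ  = κ
  ... | ‵inj₁ _ = ε

  wrap-fromℕ : ∀ m κ → wrap κ (fromℕ m) ≡ κ
  wrap-fromℕ m κ rewrite view-fromℕ m = refl

  wrap-inject₁ : ∀ {m} κ (j : Fin m) → wrap κ (inject₁ j) ≡ ε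
  wrap-inject₁ κ j rewrite view-inject₁ j = refl

  -- The change of sheet on turning from corner `i` to the next corner `vert α i` of the same
  -- vertex.
  mono : ∀ {m} → G → (Fin (suc m) → G) → Fin (suc m) → G
  mono κ c i = c (next i) ∙ wrap κ i

  -- Fixed points of `α` and of `vert α` are exempt from `anti` and `mon`: there the voltage and the
  -- monodromy are free data, prescribed by `Valid`.
  record Core {m} (κ : G) (α : Fin (suc m) → Fin (suc m)) (c : Fin (suc m) → G) : Set where
    field
      invol  : ∀ i → α (α i) ≡ i
      anti : ∀ i → α i ≢ i → c i ∙ c (α i) ≡ ε
      cub  : ∀ i → vert α (vert α (vert α i)) ≡ i
      mon  : ∀ i → vert α i ≢ i → mono κ c i ∙ mono κ c (vert α i) ∙ mono κ c (vert α (vert α i)) ≡ ε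
    α-injective : ∀ {i j} → α i ≡ α j → i ≡ j
    α-injective {i} {j} e = trans (sym (invol i)) (trans (cong α e) (invol j))
    vert-injective : ∀ {i j} → vert α i ≡ vert α j → i ≡ j
    vert-injective e = next-injective (α-injective e)

  Raw : ℕ → ℕ → ℕ → Set
  Raw m p r = (Fin (suc m) → Fin (suc m)) × (Fin (suc m) → G) × (Fin p → Fin (suc m)) × (Fin r → Fin (suc m))

  RawS : ℕ → ℕ → ℕ → Setoid 0ℓ 0ℓ
  RawS m p r = ×-setoid (FunS (suc m) (Fin (suc m))) (×-setoid (FunS (suc m) G)
                 (×-setoid (FunS p (Fin (suc m))) (FunS r (Fin (suc m)))))

  record Valid {m p r} (κ : G) (hs : Fin p → G) (es : Fin r → G) (x : Raw m p r) : Set where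
    α = proj₁ x
    c = proj₁ (proj₂ x)
    ℓ = proj₁ (proj₂ (proj₂ x))
    e = proj₂ (proj₂ (proj₂ x))
    field
      core     : Core κ α c
      leaf     : Lists (λ i → vert α i ≡ i) ℓ
      leaf-mon : ∀ j → mono κ c (ℓ j) ≡ hs j
      half     : Lists (λ i → α i ≡ i) e
      half-val : ∀ j → c (e j) ≡ es j
    open Core core public

  mono-cong : ∀ {m} κ {c d : Fin (suc m) → G} → c ≗ d → ∀ {i j} → i ≡ j → mono κ c i ≡ mono κ d j
  mono-cong κ F {i} refl = cong (_∙ wrap κ i) (F (next i))

  module _ {m : ℕ} {α β : Fin (suc m) → Fin (suc m)} (E : α ≗ β) where
    vert² : ∀ i → vert α (vert α i) ≡ vert β (vert β i)
    vert² i = trans (cong (vert α) (E (next i))) (E _)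

    vert³ : ∀ i → vert α (vert α (vert α i)) ≡ vert β (vert β (vert β i))
    vert³ i = trans (cong (vert α) (vert² i)) (E _)

    Core-resp : ∀ {c d : Fin (suc m) → G} {κ} → c ≗ d → Core κ α c → Core κ β d
    Core-resp {c} {d} {κ} F C = record
      { invol  = λ i → trans (sym (trans (cong α (E i)) (E (β i)))) (invol i)
      ; anti = λ i ne → trans (sym (cong₂ _∙_ (F i) (trans (F (α i)) (cong d (E i))))) (anti i (ne ∘ trans (sym (E i))))
      ; cub  = λ i → trans (sym (vert³ i)) (cub i)
      ; mon  = λ i ne → trans (sym (cong₂ _∙_ (cong₂ _∙_ (mono-cong κ F refl) (mono-cong κ F (E (next i)))) (mono-cong κ F (vert² i))))
                              (mon i (ne ∘ trans (sym (E (next i))))) }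
      where open Core C

  lists-resp : ∀ {A : Set} {n} {P Q : A → Set} {v w : Fin n → A} → (∀ {a} → P a → Q a) → (∀ {a} → Q a → P a) →
               v ≗ w → Lists P v → Lists Q w
  lists-resp f g e = lists-map id id f (λ q → _ , g q , refl) e

  Valid-resp : ∀ {m p r κ hs es} {x y : Raw m p r} → Setoid._≈_ (RawS m p r) x y → Valid κ hs es x → Valid κ hs es y
  Valid-resp {κ = κ} {y = β , d , l , g} (E , F , L , H) V = record
    { core = Core-resp E F core
    ; leaf = lists-resp (λ {i} → trans (sym (E (next i)))) (λ {i} → trans (E (next i))) L leaf
    ; leaf-mon = λ j → trans (sym (mono-cong κ F (L j))) (leaf-mon j)
    ; half = lists-resp (λ {i} → trans (sym (E i))) (λ {i} → trans (E i)) H half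
    ; half-val = λ j → trans (sym (trans (F _) (cong d (H j)))) (half-val j) }
    where open Valid V

  core? : ∀ {m} κ (α : Fin (suc m) → Fin (suc m)) c → Dec (Core κ α c)
  core? κ α c = map′ (λ { (a , b , d , e) → record { invol = a ; anti = b ; cub = d ; mon = e } })
                     (λ C → Core.invol C , Core.anti C , Core.cub C , Core.mon C)
    (Fₚ.all? (λ i → α (α i) Fₚ.≟ i) ×-dec
     Fₚ.all? (λ i → ¬? (α i Fₚ.≟ i) →-dec (c i ∙ c (α i) ≟G ε)) ×-dec
     Fₚ.all? (λ i → vert α (vert α (vert α i)) Fₚ.≟ i) ×-dec
     Fₚ.all? (λ i → ¬? (vert α i Fₚ.≟ i) →-dec (mono κ c i ∙ mono κ c (vert α i) ∙ mono κ c (vert α (vert α i)) ≟G ε)))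

  lists? : ∀ {n k} {P : Fin n → Set} → (∀ i → Dec (P i)) → (v : Fin k → Fin n) → Dec (Lists P v)
  lists? P? v = map′ (λ { (a , b , c) → record { all = a ; inj = λ {i} {j} → b i j ; hit = λ {i} → c i } })
                     (λ L → Lists.all L , (λ _ _ → Lists.inj L) , λ _ → Lists.hit L)
    (Fₚ.all? (λ j → P? (v j)) ×-dec
     Fₚ.all? (λ i → Fₚ.all? λ j → (v i Fₚ.≟ v j) →-dec (i Fₚ.≟ j)) ×-dec
     Fₚ.all? (λ a → P? a →-dec Fₚ.any? λ j → v j Fₚ.≟ a))

  valid? : ∀ {m p r} κ hs es (x : Raw m p r) → Dec (Valid κ hs es x)
  valid? κ hs es (α , c , ℓ , e) =
    map′ (λ { (a , b , d , f , g) → record { core = a ; leaf = b ; leaf-mon = d ; half = f ; half-val = g } })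
         (λ V → let open Valid V in core , leaf , leaf-mon , half , half-val)
    (core? κ α c ×-dec lists? (λ i → vert α i Fₚ.≟ i) ℓ ×-dec Fₚ.all? (λ j → mono κ c (ℓ j) ≟G hs j) ×-dec
     lists? (λ i → α i Fₚ.≟ i) e ×-dec Fₚ.all? (λ j → c (e j) ≟G es j))

  card-Raw : ∀ m p r → ∃[ n ] Card (RawS m p r) (λ _ → ⊤) n
  card-Raw m p r = _ , card-⊤× (card-Fun (suc m) (card-Fin (suc m))) (card-⊤× (card-Fun (suc m) card-G)
    (card-⊤× (card-Fun p (card-Fin (suc m))) (card-Fun r (card-Fin (suc m)))))

  abstract
    card-Valid : ∀ {m p r} κ hs es → ∃[ n ] Card (RawS m p r) (Valid κ hs es) n
    card-Valid {m} {p} {r} κ hs es = card-filter (proj₂ (card-Raw m p r)) (valid? κ hs es) Valid-resp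

  -- Moving the root one step forward conjugates α by the deck-equivariant
  -- rotation (i , u) ↦ (next i , u ∙ wrap i).
  module _ {m : ℕ} (κ : G) where
    private
      t : Fin (suc m) → G
      t = wrap κ
      open CMSolver commutativeMonoid using (solve; _⊜_) renaming (_⊕_ to infixl 6 _⊞_)

    rot-α : (Fin (suc m) → Fin (suc m)) → Fin (suc m) → Fin (suc m)
    rot-α α i = next (α (prev i))

    rot-c : (Fin (suc m) → Fin (suc m)) → (Fin (suc m) → G) → Fin (suc m) → G
    rot-c α c i = c (prev i) ∙ t (α (prev i)) ∙ t (prev i) ⁻¹

    rot : ∀ {p r} → Raw m p r → Raw m p r
    rot (α , c , ℓ , e) = rot-α α , rot-c α c , next ∘ ℓ , next ∘ e

    module _ (α : Fin (suc m) → Fin (suc m)) (c : Fin (suc m) → G) where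
      rot-α-next : ∀ i → rot-α α (next i) ≡ next (α i)
      rot-α-next i = cong (next ∘ α) (prev-next i)

      rot-c-next : ∀ i → rot-c α c (next i) ≡ c i ∙ t (α i) ∙ t i ⁻¹
      rot-c-next i = cong (λ z → c z ∙ t (α z) ∙ t z ⁻¹) (prev-next i)

      rot-vert : ∀ i → vert (rot-α α) (next i) ≡ next (vert α i)
      rot-vert i = rot-α-next (next i)

      -- Conjugation moves the wrap from the source of a turn to its target. Around a whole vertex
      -- the product is unchanged, and at a leaf source and target coincide.
      rot-mono : ∀ i → mono κ (rot-c α c) (next i) ≡ c (next i) ∙ t (vert α i)
      rot-mono i = trans (cong (_∙ t (next i)) (rot-c-next (next i)))
        (trans (assoc _ _ _) (trans (cong (c (next i) ∙ t (vert α i) ∙_) (inverseˡ _)) (identityʳ _)))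

    next-ind : {P : Fin (suc m) → Set} → (∀ i → P (next i)) → ∀ i → P i
    next-ind {P} h i = subst P (next-prev i) (h (prev i))

    rot-valid : ∀ {p r hs es} {x : Raw m p r} → Valid κ hs es x → Valid κ hs es (rot x)
    rot-valid {x = α , c , ℓ , e} V = record
      { core = record
        { invol = next-ind λ i → trans (cong α' (αn i)) (trans (αn (α i)) (cong next (invol i)))
        ; anti = next-ind λ i ne → anti' i (λ z → ne (trans (αn i) (cong next z)))
        ; cub = next-ind λ i → trans (v3 i) (cong next (cub i))
        ; mon = next-ind λ i ne → mon' i (λ z → ne (trans (vn i) (cong next z))) }
      ; leaf = lists-map next next-injective (λ {i} z → trans (vn i) (cong next z))
          (λ {i} z → prev i , next-injective (trans (sym (vn (prev i))) (trans (cong (vert α') (next-prev i)) (trans z (sym (next-prev i))))) , sym (next-prev i))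
          (λ _ → refl) leaf
      ; leaf-mon = λ j → trans (rot-mono α c (ℓ j)) (trans (cong (λ z → c (next (ℓ j)) ∙ t z) (Lists.all leaf j)) (leaf-mon j))
      ; half = lists-map next next-injective (λ {i} z → trans (αn i) (cong next z))
          (λ {i} z → prev i , next-injective (trans z (sym (next-prev i))) , sym (next-prev i))
          (λ _ → refl) half
      ; half-val = λ j → trans (rot-c-next α c (e j)) (trans (cong (λ z → c (e j) ∙ t z ∙ t (e j) ⁻¹) (Lists.all half j))
          (trans (assoc _ _ _) (trans (cong (c (e j) ∙_) (inverseʳ _)) (trans (identityʳ _) (half-val j))))) }
      where
      open Valid V using (core; leaf; leaf-mon; half; half-val; invol; anti; cub; mon)
      open ≡-Reasoning
      α' = rot-α α
      c' = rot-c α c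
      αn = rot-α-next α c
      vn = rot-vert α c
      v2 : ∀ i → vert α' (vert α' (next i)) ≡ next (vert α (vert α i))
      v2 i = trans (cong (vert α') (vn i)) (vn _)
      v3 : ∀ i → vert α' (vert α' (vert α' (next i))) ≡ next (vert α (vert α (vert α i)))
      v3 i = trans (cong (vert α') (v2 i)) (vn _)
      anti' : ∀ i → α i ≢ i → c' (next i) ∙ c' (α' (next i)) ≡ ε
      anti' i ne = begin
        c' (next i) ∙ c' (α' (next i))
          ≡⟨ cong₂ _∙_ (rot-c-next α c i) (trans (cong c' (αn i)) (rot-c-next α c (α i))) ⟩
        c i ∙ t (α i) ∙ t i ⁻¹ ∙ (c (α i) ∙ t (α (α i)) ∙ t (α i) ⁻¹)
          ≡⟨ cong (λ z → c i ∙ t (α i) ∙ t i ⁻¹ ∙ (c (α i) ∙ t z ∙ t (α i) ⁻¹)) (invol i) ⟩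
        c i ∙ t (α i) ∙ t i ⁻¹ ∙ (c (α i) ∙ t i ∙ t (α i) ⁻¹)
          ≡⟨ solve 6 (λ a b d f g h → a ⊞ b ⊞ d ⊞ (f ⊞ g ⊞ h) ⊜ (a ⊞ f) ⊞ (b ⊞ h) ⊞ (d ⊞ g)) refl (c i) (t (α i)) (t i ⁻¹) (c (α i)) (t i) (t (α i) ⁻¹) ⟩
        (c i ∙ c (α i)) ∙ (t (α i) ∙ t (α i) ⁻¹) ∙ (t i ⁻¹ ∙ t i)
          ≡⟨ cong₂ _∙_ (cong₂ _∙_ (anti i ne) (inverseʳ _)) (inverseˡ _) ⟩
        ε ∙ ε ∙ ε ≡⟨ trans (identityʳ _) (identityʳ _) ⟩
        ε ∎
      mon' : ∀ i → vert α i ≢ i → mono κ c' (next i) ∙ mono κ c' (vert α' (next i)) ∙ mono κ c' (vert α' (vert α' (next i))) ≡ ε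
      mon' i ne = begin
        mono κ c' (next i) ∙ mono κ c' (vert α' (next i)) ∙ mono κ c' (vert α' (vert α' (next i)))
          ≡⟨ cong₂ _∙_ (cong₂ _∙_ (rot-mono α c i) (trans (cong (mono κ c') (vn i)) (rot-mono α c _))) (trans (cong (mono κ c') (v2 i)) (rot-mono α c _)) ⟩
        c n₁ ∙ t i₁ ∙ (c n₂ ∙ t i₂) ∙ (c n₃ ∙ t (vert α i₂))
          ≡⟨ cong (λ z → c n₁ ∙ t i₁ ∙ (c n₂ ∙ t i₂) ∙ (c n₃ ∙ t z)) (cub i) ⟩
        c n₁ ∙ t i₁ ∙ (c n₂ ∙ t i₂) ∙ (c n₃ ∙ t i)
          ≡⟨ solve 6 (λ a b d x y z → a ⊞ y ⊞ (b ⊞ z) ⊞ (d ⊞ x) ⊜ a ⊞ x ⊞ (b ⊞ y) ⊞ (d ⊞ z)) refl (c n₁) (c n₂) (c n₃) (t i) (t i₁) (t i₂) ⟩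
        c n₁ ∙ t i ∙ (c n₂ ∙ t i₁) ∙ (c n₃ ∙ t i₂) ≡⟨ mon i ne ⟩
        ε ∎
        where
        i₁ = vert α i
        i₂ = vert α i₁
        n₁ = next i
        n₂ = next i₁
        n₃ = next i₂

    rot-injective : ∀ {p r} {x y : Raw m p r} → Setoid._≈_ (RawS m p r) (rot x) (rot y) → Setoid._≈_ (RawS m p r) x y
    rot-injective {x = α , c , ℓ , e} {β , d , l , g} (E , F , L , H) =
      E' , (λ i → ∙-cancelʳ (t (α i)) _ _ (∙-cancelʳ (t i ⁻¹) _ _
              (trans (sym (rot-c-next α c i)) (trans (F (next i)) (trans (rot-c-next β d i) (cong (λ z → d i ∙ t z ∙ t i ⁻¹) (sym (E' i)))))))) ,
      (λ j → next-injective (L j)) , (λ j → next-injective (H j))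
      where
      E' : α ≗ β
      E' i = next-injective (trans (sym (rot-α-next α c i)) (trans (E (next i)) (rot-α-next β d i)))

    -- Rotation embeds the maps with root `i` into those with root `next i`. Going once around the
    -- cycle, these inequalities become equalities, so each of the positions is the root equally
    -- often.
    root-count : ∀ {p r hs es A B} (root : Raw m p r → Fin (suc m)) →
      (∀ x → root (rot x) ≡ next (root x)) →
      (∀ {x y} → Setoid._≈_ (RawS m p r) x y → root x ≡ root y) →
      Card (RawS m p r) (Valid κ hs es) A →
      Card (RawS m p r) (λ x → Valid κ hs es x × root x ≡ zero) B → A ≡ suc m * B
    root-count {p} {r} {hs} {es} {A} {B} root root-next root-resp cA cB =
      card-unique cA (card-map {S = ×-setoid (EqS (Fin (suc m))) (RawS m p r)} (card-× {R = At} (card-Fin (suc m)) (λ {i} _ → at i) (λ { refl z → z }))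
        proj₂ (proj₁ ∘ proj₂) proj₂ (λ { (_ , _ , e) (_ , _ , e') x → trans (sym e) (trans (root-resp x) e') , x })
        (λ {x} v → (root x , x) , (tt , v , refl) , Setoid.refl (RawS m p r)))
      where
      open import Data.Fin.Induction using (<-weakInduction; >-weakInduction)
      At : Fin (suc m) → Raw m p r → Set
      At i x = Valid κ hs es x × root x ≡ i
      fin : ∀ i → ∃[ n ] Card (RawS m p r) (At i) n
      fin i = card-filter (proj₂ (card-Raw m p r)) (λ x → valid? κ hs es x ×-dec (root x Fₚ.≟ i))
        λ e (v , z) → Valid-resp e v , trans (sym (root-resp e)) z
      b : Fin (suc m) → ℕ
      b i = proj₁ (fin i)
      step : ∀ i → b i ≤ b (next i)
      step i = card-≤ (proj₂ (fin i)) (proj₂ (fin (next i))) (λ {x} _ → rot x)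
        (λ { {x} (v , z) → rot-valid v , trans (root-next x) (cong next z) }) (λ _ _ → rot-injective)
      up : ∀ i → b zero ≤ b i
      up = <-weakInduction (λ i → b zero ≤ b i) ℕₚ.≤-refl
        λ i z → ℕₚ.≤-trans z (subst (λ k → b (inject₁ i) ≤ b k) (next-inject₁ i) (step (inject₁ i)))
      down : ∀ i → b i ≤ b zero
      down = >-weakInduction (λ i → b i ≤ b zero) (subst (λ k → b (fromℕ m) ≤ b k) (next-fromℕ m) (step (fromℕ m)))
        λ i z → ℕₚ.≤-trans (subst (λ k → b (inject₁ i) ≤ b k) (next-inject₁ i) (step (inject₁ i))) z
      at : ∀ i → Card (RawS m p r) (At i) B
      at i = subst (Card (RawS m p r) (At i))
        (trans (ℕₚ.≤-antisym (down i) (up i)) (card-unique (proj₂ (fin zero)) cB)) (proj₂ (fin i))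

infixr 5 _◂_
_◂_ : ∀ {A : Set} {n} → A → (Fin n → A) → Fin (suc n) → A
(a ◂ v) zero    = a
(a ◂ v) (suc j) = v j

-- A half-edge h is the same as a leaf: replace the letter h by a a⁻¹.
module HalfEdgeToLeaf (𝔾 : FinAb) (κ : FinAb.G 𝔾) {m : ℕ} where
  open FinAb 𝔾
  open Maps 𝔾

  grow-α : (Fin (suc m) → Fin (suc m)) → Fin (suc (suc m)) → Fin (suc (suc m))
  grow-α α zero          = suc zero
  grow-α α (suc zero)    = zero
  grow-α α (suc (suc y)) = suc (α (suc y))

  grow-c : (Fin (suc m) → G) → Fin (suc (suc m)) → G
  grow-c c zero          = c zero
  grow-c c (suc zero)    = c zero ⁻¹
  grow-c c (suc (suc y)) = c (suc y)

  grow : ∀ {p r} → Raw m p (suc r) → Raw (suc m) (suc p) r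
  grow (α , c , ℓ , e) = grow-α α , grow-c c , zero ◂ (suc ∘ ℓ) , λ j → suc (e (suc j))

  module _ (α : Fin (suc m) → Fin (suc m)) (c : Fin (suc m) → G) (α0 : α zero ≡ zero) where
    -- The new leaf takes corner 0 and the old corners move up by one. The last corner used to turn
    -- at the half-edge in position 0; it now turns at the first side of the new edge and arrives at
    -- the same place.
    grow-vert : ∀ y → vert (grow-α α) (suc y) ≡ suc (vert α y)
    grow-vert y with view y
    ... | ‵fromℕ  = cong suc (sym α0)
    ... | ‵inj₁ _ = refl

    grow-mono : ∀ y → mono κ (grow-c c) (suc y) ≡ mono κ c y
    grow-mono y with view y
    ... | ‵fromℕ  = refl
    ... | ‵inj₁ _ = refl

    grow-α-suc : ∀ {y} → y ≢ zero → grow-α α (suc y) ≡ suc (α y)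
    grow-α-suc {zero}  ne = ⊥-elim (ne refl)
    grow-α-suc {suc y} ne = refl

    grow-c-suc : ∀ {y} → y ≢ zero → grow-c c (suc y) ≡ c y
    grow-c-suc {zero}  ne = ⊥-elim (ne refl)
    grow-c-suc {suc y} ne = refl

    grow-vert² : ∀ y → vert (grow-α α) (vert (grow-α α) (suc y)) ≡ suc (vert α (vert α y))
    grow-vert² y = trans (cong (vert (grow-α α)) (grow-vert y)) (grow-vert _)

    grow-vert³ : ∀ y → vert (grow-α α) (vert (grow-α α) (vert (grow-α α) (suc y))) ≡ suc (vert α (vert α (vert α y)))
    grow-vert³ y = trans (cong (vert (grow-α α)) (grow-vert² y)) (grow-vert _)

    grow-mon : ∀ y → let v = vert (grow-α α) in
      mono κ (grow-c c) (suc y) ∙ mono κ (grow-c c) (v (suc y)) ∙ mono κ (grow-c c) (v (v (suc y)))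
        ≡ mono κ c y ∙ mono κ c (vert α y) ∙ mono κ c (vert α (vert α y))
    grow-mon y = cong₂ _∙_ (cong₂ _∙_ (grow-mono y) (trans (cong (mono κ (grow-c c)) (grow-vert y)) (grow-mono _)))
      (trans (cong (mono κ (grow-c c)) (grow-vert² y)) (grow-mono _))

  module _ {p r} {hs : Fin p → G} {es : Fin (suc r) → G} where
    private
      RootedHalf : Raw m p (suc r) → Set
      RootedHalf x = Valid κ hs es x × proj₂ (proj₂ (proj₂ x)) zero ≡ zero

      RootedLeaf : Raw (suc m) (suc p) r → Set
      RootedLeaf y = Valid κ (es zero ⁻¹ ◂ hs) (es ∘ suc) y × proj₁ (proj₂ (proj₂ y)) zero ≡ zero

    half-at-0 : ∀ {x} → RootedHalf x → proj₁ x zero ≡ zero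
    half-at-0 {α , _} (V , e0) = subst (λ z → α z ≡ z) e0 (Lists.all (Valid.half V) zero)

    grow-valid : ∀ {x} → RootedHalf x → RootedLeaf (grow x)
    grow-valid {α , c , ℓ , e} R@(V , e0) = record
      { core = record
        { invol = λ { zero → refl ; (suc zero) → refl ; (suc (suc y)) → trans (grow-α-suc α c α0 (α≢0 y)) (cong suc (invol (suc y))) }
        ; anti = λ { zero _ → inverseʳ _ ; (suc zero) _ → inverseˡ _
                   ; (suc (suc y)) ne → trans (cong (c (suc y) ∙_) (grow-c-suc α c α0 (α≢0 y))) (anti (suc y) (ne ∘ cong suc)) }
        ; cub = λ { zero → refl ; (suc y) → trans (grow-vert³ α c α0 y) (cong suc (cub y)) }
        ; mon = λ { zero ne → ⊥-elim (ne refl)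
                  ; (suc y) ne → trans (grow-mon α c α0 y) (mon y (λ z → ne (trans (grow-vert α c α0 y) (cong suc z)))) } }
      ; leaf = record
        { all = λ { zero → refl ; (suc j) → trans (grow-vert α c α0 (ℓ j)) (cong suc (Lists.all leaf j)) }
        ; inj = λ { {zero} {zero} _ → refl ; {suc i} {suc j} z → cong suc (Lists.inj leaf (Fₚ.suc-injective z)) }
        ; hit = λ { {zero} _ → zero , refl
                  ; {suc y} z → let j , w = Lists.hit leaf (Fₚ.suc-injective (trans (sym (grow-vert α c α0 y)) z)) in suc j , cong suc w } }
      ; leaf-mon = λ { zero → trans (identityʳ _) (cong _⁻¹ (trans (cong c (sym e0)) (half-val zero)))
                     ; (suc j) → trans (grow-mono α c α0 (ℓ j)) (leaf-mon j) }
      ; half = record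
        { all = λ j → trans (grow-α-suc α c α0 (e≢0 j)) (cong suc (Lists.all half (suc j)))
        ; inj = λ z → Fₚ.suc-injective (Lists.inj half (Fₚ.suc-injective z))
        ; hit = λ { {suc (suc y)} z → hit' (Lists.hit half (Fₚ.suc-injective z)) } }
      ; half-val = λ j → trans (grow-c-suc α c α0 (e≢0 j)) (half-val (suc j)) } , refl
      where
      open Valid V using (core; leaf; leaf-mon; half; half-val; invol; anti; cub; mon; α-injective)
      α0 = half-at-0 R
      α≢0 : ∀ y → α (suc y) ≢ zero
      α≢0 y z = contradiction (α-injective (trans z (sym α0))) λ ()
      e≢0 : ∀ j → e (suc j) ≢ zero
      e≢0 j z = contradiction (Lists.inj half (trans z (sym e0))) λ ()
      hit' : ∀ {y} → ∃[ j ] e j ≡ suc y → ∃[ j ] suc (e (suc j)) ≡ suc (suc y)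
      hit' (zero , z)  = contradiction (trans (sym e0) z) λ ()
      hit' (suc j , z) = j , cong suc z

    shrink-valid : ∀ {x} → proj₁ x zero ≡ zero → proj₂ (proj₂ (proj₂ x)) zero ≡ zero → RootedLeaf (grow x) → RootedHalf x
    shrink-valid {α , c , ℓ , e} α0 e0 (V , _) = record
      { core = record
        { invol = λ { zero → trans (cong α α0) α0
                    ; (suc y) → Fₚ.suc-injective (trans (sym (grow-α-suc α c α0 (α≢0 y))) (invol (suc (suc y)))) }
        ; anti = λ { zero ne → ⊥-elim (ne α0)
                   ; (suc y) ne → trans (cong (c (suc y) ∙_) (sym (grow-c-suc α c α0 (α≢0 y)))) (anti (suc (suc y)) (ne ∘ Fₚ.suc-injective)) }
        ; cub = λ y → Fₚ.suc-injective (trans (sym (grow-vert³ α c α0 y)) (cub (suc y)))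
        ; mon = λ y ne → trans (sym (grow-mon α c α0 y)) (mon (suc y) (λ z → ne (Fₚ.suc-injective (trans (sym (grow-vert α c α0 y)) z)))) }
      ; leaf = record
        { all = λ j → Fₚ.suc-injective (trans (sym (grow-vert α c α0 (ℓ j))) (Lists.all leaf (suc j)))
        ; inj = λ z → Fₚ.suc-injective (Lists.inj leaf (cong suc z))
        ; hit = λ {y} z → lhit (Lists.hit leaf (trans (grow-vert α c α0 y) (cong suc z))) }
      ; leaf-mon = λ j → trans (sym (grow-mono α c α0 (ℓ j))) (leaf-mon (suc j))
      ; half = record
        { all = λ { zero → trans (cong α e0) (trans α0 (sym e0))
                  ; (suc j) → Fₚ.suc-injective (trans (sym (grow-α-suc α c α0 (e≢0 j))) (Lists.all half j)) }
        ; inj = λ { {zero} {zero} _ → refl ; {zero} {suc j} z → ⊥-elim (e≢0 j (trans (sym z) e0))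
                  ; {suc i} {zero} z → ⊥-elim (e≢0 i (trans z e0)) ; {suc i} {suc j} z → cong suc (Lists.inj half (cong suc z)) }
        ; hit = λ { {zero} _ → zero , e0
                  ; {suc y} z → let j , w = Lists.hit half {suc (suc y)} (cong suc z) in suc j , Fₚ.suc-injective w } }
      ; half-val = λ { zero → trans (cong c e0) (∙-cancelˡ (es zero ⁻¹) _ _ (trans (cong (_∙ c zero) (sym (trans (sym (identityʳ _)) (leaf-mon zero)))) (trans (inverseˡ _) (sym (inverseˡ _)))))
                     ; (suc j) → trans (sym (grow-c-suc α c α0 (e≢0 j))) (half-val j) } } , e0
      where
      open Valid V using (core; leaf; leaf-mon; half; half-val; invol; anti; cub; mon; α-injective)
      α≢0 : ∀ y → α (suc y) ≢ zero
      α≢0 y z = contradiction (α-injective {suc (suc y)} {zero} (cong suc z)) λ ()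
      e≢0 : ∀ j → e (suc j) ≢ zero
      e≢0 j z = contradiction (trans (cong (grow-α α ∘ suc) (sym z)) (trans (Lists.all half j) (cong suc z))) λ ()
      lhit : ∀ {y} → ∃[ j ] (zero ◂ (suc ∘ ℓ)) j ≡ suc y → ∃[ j ] ℓ j ≡ y
      lhit (zero , ())
      lhit (suc j , z) = j , Fₚ.suc-injective z

    grow-injective : ∀ {x y} → RootedHalf x → RootedHalf y →
      Setoid._≈_ (RawS (suc m) (suc p) r) (grow x) (grow y) → Setoid._≈_ (RawS m p (suc r)) x y
    grow-injective {x} {y} Rx Ry (E , F , L , H) =
      (λ { zero → trans (half-at-0 Rx) (sym (half-at-0 Ry)) ; (suc i) → Fₚ.suc-injective (E (suc (suc i))) }) ,
      (λ { zero → F zero ; (suc i) → F (suc (suc i)) }) ,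
      (λ j → Fₚ.suc-injective (L (suc j))) ,
      (λ { zero → trans (proj₂ Rx) (sym (proj₂ Ry)) ; (suc j) → Fₚ.suc-injective (H j) })

    grow-surjective : ∀ {y} → RootedLeaf y → ∃[ x ] (RootedHalf x × Setoid._≈_ (RawS (suc m) (suc p) r) y (grow x))
    grow-surjective {β , d , l , g} (V , l0) = x , shrink-valid refl refl (Valid-resp y≈ V , refl) , y≈
      where
      open Valid V using (leaf; half; invol; anti; α-injective)
      down : Fin (suc (suc m)) → Fin (suc m)
      down zero    = zero
      down (suc i) = i
      up-down : ∀ {i} → i ≢ zero → suc (down i) ≡ i
      up-down {zero}  ne = ⊥-elim (ne refl)
      up-down {suc i} _  = refl
      x : Raw m p (suc r)
      x = (λ { zero → zero ; (suc y) → down (β (suc (suc y))) }) , (λ { zero → d zero ; (suc y) → d (suc (suc y)) })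
        , (λ j → down (l (suc j))) , zero ◂ (λ j → down (g j))
      β1 : β (suc zero) ≡ zero
      β1 = subst (λ z → vert β z ≡ z) l0 (Lists.all leaf zero)
      β0 : β zero ≡ suc zero
      β0 = trans (cong β (sym β1)) (invol _)
      y≈ : Setoid._≈_ (RawS (suc m) (suc p) r) (β , d , l , g) (grow x)
      y≈ = (λ { zero → β0 ; (suc zero) → β1
              ; (suc (suc y)) → sym (up-down λ z → contradiction (α-injective (trans z (sym β1))) λ ()) }) ,
           (λ { zero → refl
              ; (suc zero) → inverseʳ-unique _ _ (trans (cong (d zero ∙_) (cong d (sym β0))) (anti zero λ z → contradiction (trans (sym β0) z) λ ()))
              ; (suc (suc y)) → refl }) ,
           (λ { zero → l0 ; (suc j) → sym (up-down λ z → contradiction (Lists.inj leaf (trans z (sym l0))) λ ()) }) ,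
           (λ j → sym (up-down λ z → contradiction (trans (sym β0) (trans (cong β (sym z)) (trans (Lists.all half j) z))) λ ()))

    -- Rooting at the half-edge on one side and at the new leaf on the other gives the same number
    -- `B`, and the factors are the numbers of positions. The leaf is read across the second side of
    -- the new edge, whence the inverse of `es zero`.
    half-leaf : ∀ {A A'} → Card (RawS m p (suc r)) (Valid κ hs es) A →
      Card (RawS (suc m) (suc p) r) (Valid κ (es zero ⁻¹ ◂ hs) (es ∘ suc)) A' →
      ∃[ B ] (Card (RawS m p (suc r)) RootedHalf B × A ≡ suc m * B × A' ≡ suc (suc m) * B)
    half-leaf cA cA' = B , cB ,
      root-count κ (λ x → proj₂ (proj₂ (proj₂ x)) zero) (λ _ → refl) (λ { (_ , _ , _ , H) → H zero }) cA cB ,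
      root-count κ (λ x → proj₁ (proj₂ (proj₂ x)) zero) (λ _ → refl) (λ { (_ , _ , L , _) → L zero }) cA'
        (card-map cB grow grow-valid grow-cong grow-injective grow-surjective)
      where
      fin = card-filter (proj₂ (card-Raw m p (suc r)))
              (λ x → valid? κ hs es x ×-dec (proj₂ (proj₂ (proj₂ x)) zero Fₚ.≟ zero))
              λ { z@(_ , _ , _ , H) (v , w) → Valid-resp z v , trans (sym (H zero)) w }
      B = proj₁ fin
      cB = proj₂ fin
      grow-cong : ∀ {x y} → Setoid._≈_ (RawS m p (suc r)) x y → Setoid._≈_ (RawS (suc m) (suc p) r) (grow x) (grow y)
      grow-cong (E , F , L , H) =
        (λ { zero → refl ; (suc zero) → refl ; (suc (suc i)) → cong suc (E (suc i)) }) ,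
        (λ { zero → F zero ; (suc zero) → cong _⁻¹ (F zero) ; (suc (suc i)) → F (suc i) }) ,
        (λ { zero → refl ; (suc j) → cong suc (L j) }) , (λ j → cong suc (H (suc j)))

-- Removing a half-edge h together with the vertex it is attached to turns
-- the word  h b U b⁻¹ d V d⁻¹  into  b U b⁻¹ V.

-- Names for the positions of the long word: `first` is h, `new` is d, `last` is its inverse at the
-- end, and `old` are the letters that survive. The same names serve for the corners.
data Spot (n : ℕ) : Set where
  first last new : Spot n
  old            : Fin n → Spot n

old-injective : ∀ {n} {y z : Fin n} → old y ≡ old z → y ≡ z
old-injective refl = refl

module _ {m : ℕ} where
  private
    N : ℕ
    N = suc (suc (suc (suc m)))

  mid : Fin (suc (suc m)) → Fin N
  mid q = suc (inject₁ q)

  mid-injective : ∀ {q r} → mid q ≡ mid r → q ≡ r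
  mid-injective e = Fₚ.inject₁-injective (Fₚ.suc-injective e)

  encode : Fin (suc (suc m)) → Spot (suc m) → Fin N
  encode k first   = zero
  encode k last    = fromℕ _
  encode k new     = mid k
  encode k (old y) = mid (punchIn k y)

  private
    decode-mid : Fin (suc (suc m)) → Fin (suc (suc m)) → Spot (suc m)
    decode-mid k q with k Fₚ.≟ q
    ... | yes _ = new
    ... | no ne = old (punchOut ne)

    encode-decode-mid : ∀ k q → encode k (decode-mid k q) ≡ mid q
    encode-decode-mid k q with k Fₚ.≟ q
    ... | yes refl = refl
    ... | no ne    = cong mid (Fₚ.punchIn-punchOut ne)

  decode : Fin (suc (suc m)) → Fin N → Spot (suc m)
  decode k zero = first
  decode k (suc p) with view p
  ... | ‵fromℕ          = last
  ... | ‵inj₁ {i = q} _ = decode-mid k q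

  encode-decode : ∀ k i → encode k (decode k i) ≡ i
  encode-decode k zero = refl
  encode-decode k (suc p) with view p
  ... | ‵fromℕ          = refl
  ... | ‵inj₁ {i = q} _ = encode-decode-mid k q

  encode-injective : ∀ k {s t} → encode k s ≡ encode k t → s ≡ t
  encode-injective k {first} {first} e = refl
  encode-injective k {last}  {last}  e = refl
  encode-injective k {last}  {new}   e = ⊥-elim (Fₚ.fromℕ≢inject₁ (Fₚ.suc-injective e))
  encode-injective k {last}  {old y} e = ⊥-elim (Fₚ.fromℕ≢inject₁ (Fₚ.suc-injective e))
  encode-injective k {new}   {last}  e = ⊥-elim (Fₚ.fromℕ≢inject₁ (Fₚ.suc-injective (sym e)))
  encode-injective k {new}   {new}   e = refl
  encode-injective k {new}   {old y} e = ⊥-elim (Fₚ.punchInᵢ≢i k y (sym (mid-injective e)))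
  encode-injective k {old y} {last}  e = ⊥-elim (Fₚ.fromℕ≢inject₁ (Fₚ.suc-injective (sym e)))
  encode-injective k {old y} {new}   e = ⊥-elim (Fₚ.punchInᵢ≢i k y (mid-injective e))
  encode-injective k {old y} {old z} e = cong old (Fₚ.punchIn-injective k y z (mid-injective e))

  decode-encode : ∀ k s → decode k (encode k s) ≡ s
  decode-encode k s = encode-injective k (encode-decode k (encode k s))

  encode-ind : ∀ k {P : Fin N → Set} → (∀ s → P (encode k s)) → ∀ i → P i
  encode-ind k {P} h i = subst P (encode-decode k i) (h (decode k i))

punchIn-inject₁-fromℕ : ∀ {n} (x : Fin (suc n)) → punchIn (inject₁ x) (fromℕ n) ≡ fromℕ (suc n)
punchIn-inject₁-fromℕ zero            = refl
punchIn-inject₁-fromℕ {suc n} (suc x) = cong suc (punchIn-inject₁-fromℕ x)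

punchIn-inject₁² : ∀ {n} (x : Fin (suc n)) (y : Fin n) → punchIn (inject₁ x) (inject₁ y) ≡ inject₁ (punchIn x y)
punchIn-inject₁² zero    y       = refl
punchIn-inject₁² (suc x) zero    = refl
punchIn-inject₁² (suc x) (suc y) = cong suc (punchIn-inject₁² x y)

punchIn-suc-same : ∀ {n} (x : Fin n) → punchIn (suc x) x ≡ inject₁ x
punchIn-suc-same zero    = refl
punchIn-suc-same (suc x) = cong suc (punchIn-suc-same x)

punchIn-inject₁-same : ∀ {n} (x : Fin n) → punchIn (inject₁ x) x ≡ suc x
punchIn-inject₁-same zero    = refl
punchIn-inject₁-same (suc x) = cong suc (punchIn-inject₁-same x)

punchIn-suc-other : ∀ {n} (x z : Fin n) → z ≢ x → punchIn (suc x) z ≡ punchIn (inject₁ x) z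
punchIn-suc-other zero    zero    ne = ⊥-elim (ne refl)
punchIn-suc-other zero    (suc z) ne = refl
punchIn-suc-other (suc x) zero    ne = refl
punchIn-suc-other (suc x) (suc z) ne = cong suc (punchIn-suc-other x z (ne ∘ cong suc))

module RemoveHalfEdge (𝔾 : FinAb) (κ e₀ : FinAb.G 𝔾) {m : ℕ} where
  open FinAb 𝔾
  open Maps 𝔾
  private
    N₀ m⁺ : ℕ
    N₀ = suc m
    m⁺ = suc (suc (suc m))
    -- Without h, the last corner of the shorter word also takes over the voltage of h.
    κ' = κ ∙ e₀

  -- Positions are encoded with the new letter d right after b⁻¹, corners
  -- with the new corner right before d.
  pos-α : (Fin N₀ → Fin N₀) → Spot N₀ → Spot N₀
  pos-α α first   = first
  pos-α α last    = new
  pos-α α new     = last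
  pos-α α (old y) = old (α y)

  -- The voltage of d is forced: the corners of the vertex to be removed have monodromies `c zero`,
  -- the voltage of d, and `e₀ ∙ κ`, and their product must be `ε`.
  pos-c : (Fin N₀ → G) → Spot N₀ → G
  pos-c c first   = e₀
  pos-c c last    = e₀ ∙ κ ∙ c zero
  pos-c c new     = (e₀ ∙ κ ∙ c zero) ⁻¹
  pos-c c (old y) = c y

  corner-σ : (Fin N₀ → Fin N₀) → Spot N₀ → Spot N₀
  corner-σ α first   = new
  corner-σ α new     = last
  corner-σ α last    = first
  corner-σ α (old y) = old (vert α y)

  corner-μ : (Fin N₀ → G) → Spot N₀ → G
  corner-μ c first   = c zero
  corner-μ c new     = (e₀ ∙ κ ∙ c zero) ⁻¹
  corner-μ c last    = e₀ ∙ κ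
  corner-μ c (old y) = mono κ' c y

  module _ (x : Fin N₀) where
    ins-α : (Fin N₀ → Fin N₀) → Fin (suc m⁺) → Fin (suc m⁺)
    ins-α α i = encode (suc x) (pos-α α (decode (suc x) i))

    ins-c : (Fin N₀ → G) → Fin (suc m⁺) → G
    ins-c c i = pos-c c (decode (suc x) i)

    ins : ∀ {p} → Raw m p 0 → Raw m⁺ p 1
    ins (α , c , ℓ , _) = ins-α α , ins-c c , (λ j → encode (inject₁ x) (old (ℓ j))) , λ _ → zero

    module _ (α : Fin N₀ → Fin N₀) (c : Fin N₀ → G) where
      ins-α-enc : ∀ s → ins-α α (encode (suc x) s) ≡ encode (suc x) (pos-α α s)
      ins-α-enc s = cong (encode (suc x) ∘ pos-α α) (decode-encode (suc x) s)

      ins-c-enc : ∀ s → ins-c c (encode (suc x) s) ≡ pos-c c s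
      ins-c-enc s = cong (pos-c c) (decode-encode (suc x) s)

      module _ (αx : α zero ≡ x) (α-inj : ∀ {i j} → α i ≡ α j → i ≡ j) where
        private
          corner = encode (inject₁ x)
          place = encode (suc x)

        next-corner : ∀ y → next (corner (old (inject₁ y))) ≡ place (old (suc y))
        next-corner y = trans (cong (λ q → next (mid q)) (punchIn-inject₁² x y)) (next-inject₁ _)

        next-corner-last : next (corner (old (fromℕ m))) ≡ place last
        next-corner-last = trans (cong (λ q → next (mid q)) (punchIn-inject₁-fromℕ x)) (next-inject₁ _)

        next-corner-new : next (corner new) ≡ place new
        next-corner-new = next-inject₁ _

        -- The corners `first`, `new` and `last` form the inserted vertex. All others turn as
        -- before, except that at the last old corner the inverse of d takes over the part of b.
        ins-vert : ∀ s → vert (ins-α α) (corner s) ≡ corner (corner-σ α s)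
        ins-vert first = trans (ins-α-enc (old zero)) (trans (cong (place ∘ old) αx) (cong mid (punchIn-suc-same x)))
        ins-vert last  = trans (cong (ins-α α) (next-fromℕ m⁺)) (ins-α-enc first)
        ins-vert new   = trans (cong (ins-α α) next-corner-new) (ins-α-enc new)
        ins-vert (old y) with view y
        ... | ‵fromℕ = trans (cong (ins-α α) next-corner-last) (trans (ins-α-enc last)
                (trans (cong mid (sym (punchIn-inject₁-same x))) (cong (corner ∘ old) (sym αx))))
        ... | ‵inj₁ {i = j} _ = trans (cong (ins-α α) (next-corner j)) (trans (ins-α-enc (old (suc j)))
                (cong mid (punchIn-suc-other x (α (suc j)) λ e → contradiction (α-inj (trans e (sym αx))) λ ())))

        ins-mono : ∀ s → mono κ (ins-c c) (corner s) ≡ corner-μ c s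
        ins-mono first = trans (identityʳ _) (ins-c-enc (old zero))
        ins-mono last  = cong₂ _∙_ (trans (cong (ins-c c) (next-fromℕ m⁺)) (ins-c-enc first)) (wrap-fromℕ m⁺ κ)
        ins-mono new   = trans (cong₂ _∙_ (trans (cong (ins-c c) next-corner-new) (ins-c-enc new)) (wrap-inject₁ κ (suc (inject₁ x)))) (identityʳ _)
        ins-mono (old y) with view y
        ... | ‵fromℕ = trans (cong₂ _∙_ (trans (cong (ins-c c) next-corner-last) (ins-c-enc last)) (wrap-inject₁ κ (suc (punchIn (inject₁ x) (fromℕ m)))))
                (trans (identityʳ _) (trans (comm _ _) (cong (c zero ∙_) (comm e₀ κ))))
        ... | ‵inj₁ {i = j} _ = cong₂ _∙_ (trans (cong (ins-c c) (next-corner j)) (ins-c-enc (old (suc j)))) (wrap-inject₁ κ (suc (punchIn (inject₁ x) (inject₁ j))))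

        ins-vert² : ∀ s → vert (ins-α α) (vert (ins-α α) (corner s)) ≡ corner (corner-σ α (corner-σ α s))
        ins-vert² s = trans (cong (vert (ins-α α)) (ins-vert s)) (ins-vert (corner-σ α s))

        ins-vert³ : ∀ s → vert (ins-α α) (vert (ins-α α) (vert (ins-α α) (corner s))) ≡ corner (corner-σ α (corner-σ α (corner-σ α s)))
        ins-vert³ s = trans (cong (vert (ins-α α)) (ins-vert² s)) (ins-vert (corner-σ α (corner-σ α s)))

        ins-mon : ∀ s → let v = vert (ins-α α) in
          mono κ (ins-c c) (corner s) ∙ mono κ (ins-c c) (v (corner s)) ∙ mono κ (ins-c c) (v (v (corner s)))
            ≡ corner-μ c s ∙ corner-μ c (corner-σ α s) ∙ corner-μ c (corner-σ α (corner-σ α s))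
        ins-mon s = cong₂ _∙_ (cong₂ _∙_ (ins-mono s) (trans (cong (mono κ (ins-c c)) (ins-vert s)) (ins-mono (corner-σ α s))))
          (trans (cong (mono κ (ins-c c)) (ins-vert² s)) (ins-mono (corner-σ α (corner-σ α s))))

  module _ {p} {hs : Fin p → G} {es : Fin 1 → G} (es₀ : es zero ≡ e₀) {no-es : Fin 0 → G} where
    Rooted : Raw m⁺ p 1 → Set
    Rooted y = Valid κ hs es y × proj₂ (proj₂ (proj₂ y)) zero ≡ zero

    ins-valid : ∀ {y} → Valid κ' hs no-es y → Rooted (ins (proj₁ y zero) y)
    ins-valid {α , c , ℓ , e} V = record
      { core = record
        { invol = encode-ind (suc x) λ s → trans (cong α⁺ (αE s)) (trans (αE (pos-α α s)) (cong (encode (suc x)) (pos-invol s)))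
        ; anti = encode-ind (suc x) λ s ne → trans (cong₂ _∙_ (cE s) (trans (cong c⁺ (αE s)) (cE (pos-α α s))))
            (pos-anti s (λ z → ne (trans (αE s) (cong (encode (suc x)) z))))
        ; cub = encode-ind (inject₁ x) λ s → trans (ins-vert³ x α c refl α-injective s) (cong (encode (inject₁ x)) (corner-cub s))
        ; mon = encode-ind (inject₁ x) λ s ne → trans (ins-mon x α c refl α-injective s)
            (corner-mon s (λ z → ne (trans (vE s) (cong (encode (inject₁ x)) z)))) }
      ; leaf = lists-map (encode (inject₁ x) ∘ old) (old-injective ∘ encode-injective _) (λ {a} z → trans (vE (old a)) (cong (encode (inject₁ x) ∘ old) z))
          (λ {i} z → leaf-surj (decode (inject₁ x) i) (sym (encode-decode (inject₁ x) i)) z) (λ _ → refl) leaf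
      ; leaf-mon = λ j → trans (ins-mono x α c refl α-injective (old (ℓ j))) (leaf-mon j)
      ; half = record { all = λ _ → αE first ; inj = λ { {zero} {zero} _ → refl }
                      ; hit = λ {i} z → zero , half-hit (decode (suc x) i) (encode-decode (suc x) i) z }
      ; half-val = λ { zero → trans (cE first) (sym es₀) } } , refl
      where
      open Valid V using (core; leaf; leaf-mon; half; half-val; invol; anti; cub; mon; α-injective)
      x = α zero
      α⁺ = ins-α x α
      c⁺ = ins-c x c
      αE = ins-α-enc x α c
      cE = ins-c-enc x α c
      vE = ins-vert x α c refl α-injective
      pos-invol : ∀ s → pos-α α (pos-α α s) ≡ s
      pos-invol first   = refl
      pos-invol last    = refl
      pos-invol new     = refl
      pos-invol (old y) = cong old (invol y)
      pos-anti : ∀ s → pos-α α s ≢ s → pos-c c s ∙ pos-c c (pos-α α s) ≡ ε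
      pos-anti first   ne = ⊥-elim (ne refl)
      pos-anti last    _  = inverseʳ _
      pos-anti new     _  = inverseˡ _
      pos-anti (old y) ne = anti y (ne ∘ cong old)
      corner-cub : ∀ s → corner-σ α (corner-σ α (corner-σ α s)) ≡ s
      corner-cub first   = refl
      corner-cub last    = refl
      corner-cub new     = refl
      corner-cub (old y) = cong old (cub y)
      corner-mon : ∀ s → corner-σ α s ≢ s → corner-μ c s ∙ corner-μ c (corner-σ α s) ∙ corner-μ c (corner-σ α (corner-σ α s)) ≡ ε
      corner-mon first _ = trans (assoc _ _ _) (trans (comm _ _) (trans (assoc _ _ _) (inverseˡ _)))
      corner-mon last  _ = inverseʳ _
      corner-mon new   _ = trans (assoc _ _ _) (inverseˡ _)
      corner-mon (old y) ne = mon y (ne ∘ cong old)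
      leaf-surj : ∀ {i} s → i ≡ encode (inject₁ x) s → vert α⁺ i ≡ i → ∃[ a ] (vert α a ≡ a × i ≡ encode (inject₁ x) (old a))
      leaf-surj s refl z with encode-injective (inject₁ x) {corner-σ α s} {s} (trans (sym (vE s)) z)
      leaf-surj first   refl z | ()
      leaf-surj last    refl z | ()
      leaf-surj new     refl z | ()
      leaf-surj (old y) refl z | w = y , old-injective w , refl
      half-hit : ∀ {i} s → encode (suc x) s ≡ i → α⁺ i ≡ i → zero ≡ i
      half-hit s refl z with encode-injective (suc x) {pos-α α s} {s} (trans (sym (αE s)) z)
      half-hit first   refl z | _ = refl
      half-hit last    refl z | ()
      half-hit new     refl z | ()
      half-hit (old y) refl z | w with Lists.hit half (old-injective w)
      ... | () , _

    del-valid : ∀ x {y} → proj₁ y zero ≡ x → Valid κ hs es (ins x y) → Valid κ' hs no-es y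
    del-valid x {α , c , ℓ , e} αx V = record
      { core = record
        { invol = λ y → old-injective (encode-injective (suc x) (trans (sym (trans (cong α⁺ (αE (old y))) (αE (old (α y))))) (invol (encode (suc x) (old y)))))
        ; anti = λ y ne → trans (sym (cong₂ _∙_ (cE (old y)) (trans (cong c⁺ (αE (old y))) (cE (old (α y))))))
            (anti (encode (suc x) (old y)) (λ z → ne (old-injective (encode-injective (suc x) (trans (sym (αE (old y))) z)))))
        ; cub = λ y → old-injective (encode-injective (inject₁ x) (trans (sym (ins-vert³ x α c αx α-inj (old y))) (cub (encode (inject₁ x) (old y)))))
        ; mon = λ y ne → trans (sym (ins-mon x α c αx α-inj (old y)))
            (mon (encode (inject₁ x) (old y)) (λ z → ne (old-injective (encode-injective (inject₁ x) (trans (sym (vE (old y))) z))))) }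
      ; leaf = record
        { all = λ j → old-injective (encode-injective (inject₁ x) (trans (sym (vE (old (ℓ j)))) (Lists.all leaf j)))
        ; inj = λ z → Lists.inj leaf (cong (encode (inject₁ x) ∘ old) z)
        ; hit = λ {y} z → let j , w = Lists.hit leaf (trans (vE (old y)) (cong (encode (inject₁ x) ∘ old) z))
                          in j , old-injective (encode-injective (inject₁ x) w) }
      ; leaf-mon = λ j → trans (sym (ins-mono x α c αx α-inj (old (ℓ j)))) (leaf-mon j)
      ; half = record { all = λ () ; inj = λ { {()} }
          ; hit = λ {y} z → contradiction (proj₂ (Lists.hit half (trans (αE (old y)) (cong (encode (suc x) ∘ old) z)))) λ () }
      ; half-val = λ () }
      where
      open Valid V using (core; leaf; leaf-mon; half; half-val; invol; anti; cub; mon; α-injective)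
      α⁺ = ins-α x α
      c⁺ = ins-c x c
      αE = ins-α-enc x α c
      cE = ins-c-enc x α c
      α-inj : ∀ {i j} → α i ≡ α j → i ≡ j
      α-inj {i} {j} z = old-injective (encode-injective (suc x)
        (α-injective (trans (αE (old i)) (trans (cong (encode (suc x) ∘ old) z) (sym (αE (old j)))))))
      vE = ins-vert x α c αx α-inj

    ins-injective : ∀ {y z} → Setoid._≈_ (RawS m⁺ p 1) (ins (proj₁ y zero) y) (ins (proj₁ z zero) z) → Setoid._≈_ (RawS m p 0) y z
    ins-injective {α , c , ℓ , e} {β , d , l , g} (E , F , L , _) = E' , F' ,
      (λ j → old-injective (encode-injective (inject₁ x) (trans (L j) (cong (λ w → encode (inject₁ w) (old (l j))) (sym x≡))))) , λ ()
      where
      x = α zero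
      x≡ : α zero ≡ β zero
      x≡ = Fₚ.inject₁-injective (mid-injective (trans (sym (cong mid (punchIn-suc-same (α zero))))
             (trans (sym (ins-α-enc (α zero) α c (old zero))) (trans (E (suc zero))
               (trans (ins-α-enc (β zero) β d (old zero)) (cong mid (punchIn-suc-same (β zero))))))))
      E' : α ≗ β
      E' i = old-injective (encode-injective (suc x) (trans (sym (ins-α-enc x α c (old i)))
        (trans (E (encode (suc x) (old i))) (trans (cong (λ w → ins-α w β (encode (suc x) (old i))) (sym x≡)) (ins-α-enc x β d (old i))))))
      F' : c ≗ d
      F' i = trans (sym (ins-c-enc x α c (old i)))
        (trans (F (encode (suc x) (old i))) (trans (cong (λ w → ins-c w d (encode (suc x) (old i))) (sym x≡)) (ins-c-enc x β d (old i))))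

    ins-surjective : ∀ {y} → Rooted y → ∃[ z ] (Valid κ' hs no-es z × Setoid._≈_ (RawS m⁺ p 1) y (ins (proj₁ z zero) z))
    ins-surjective {β , d , l , g} (V , g0) = go (β (suc zero)) refl
      where
      open Valid V using (leaf; leaf-mon; half; half-val; invol; anti; cub; mon; α-injective)
      L = fromℕ m⁺
      β0 : β zero ≡ zero
      β0 = subst (λ z → β z ≡ z) g0 (Lists.all half zero)
      only-half : ∀ {i} → β i ≡ i → i ≡ zero
      only-half z with Lists.hit half z
      ... | zero , w = trans (sym w) g0
      vL : vert β L ≡ zero
      vL = trans (cong β (next-fromℕ m⁺)) β0
      v1 : vert β (β (suc zero)) ≡ L
      v1 = trans (cong (vert β ∘ vert β) (sym vL)) (cub L)
      un : Spot N₀ → Fin N₀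
      un (old y) = y
      un _       = zero
      module Found (x : Fin N₀) (e : β (suc zero) ≡ mid (inject₁ x)) where
        k = suc x
        place = encode k
        corner = encode (inject₁ x)
        βd : β (place new) ≡ L
        βd = trans (cong β (sym (next-inject₁ (suc (inject₁ x))))) (trans (cong (vert β) (sym e)) v1)
        βL : β L ≡ place new
        βL = trans (cong β (sym βd)) (invol _)
        old-un : ∀ s → s ≢ first → s ≢ last → s ≢ new → s ≡ old (un s)
        old-un first   a b c = ⊥-elim (a refl)
        old-un last    a b c = ⊥-elim (b refl)
        old-un new     a b c = ⊥-elim (c refl)
        old-un (old y) a b c = refl
        to : Fin N₀ → Spot N₀
        to y = decode k (β (place (old y)))
        to-β : ∀ y s → to y ≡ s → β (place (old y)) ≡ place s
        to-β y s z = trans (sym (encode-decode k _)) (cong place z)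
        to-old : ∀ y → to y ≡ old (un (to y))
        to-old y = old-un (to y)
          (λ z → contradiction (encode-injective k {old y} {first} (α-injective (trans (to-β y first z) (sym β0)))) λ ())
          (λ z → contradiction (encode-injective k {old y} {new} (α-injective (trans (to-β y last z) (sym βd)))) λ ())
          (λ z → contradiction (encode-injective k {old y} {last} (α-injective (trans (to-β y new z) (sym βL)))) λ ())
        lf : Fin p → Spot N₀
        lf j = decode (inject₁ x) (l j)
        lf-l : ∀ j s → lf j ≡ s → l j ≡ corner s
        lf-l j s z = trans (sym (encode-decode (inject₁ x) (l j))) (cong corner z)
        lf-old : ∀ j → lf j ≡ old (un (lf j))
        lf-old j = old-un (lf j)
          (λ z → contradiction (trans (sym e) (fix z refl)) λ ())
          (λ z → contradiction (trans (sym (fix z refl)) vL) λ ())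
          (λ z → contradiction (encode-injective (inject₁ x) {last} {new} (trans (sym v1) (trans (cong (vert β) e) (fix z refl)))) λ ())
          where
          fix : ∀ {s i} → lf j ≡ s → corner s ≡ i → vert β i ≡ i
          fix {s} z refl = subst (λ w → vert β w ≡ w) (lf-l j s z) (Lists.all leaf j)
        z : Raw m p 0
        z = (λ y → un (to y)) , (λ y → d (place (old y))) , (λ j → un (lf j)) , λ ()
        z0 : un (to zero) ≡ x
        z0 = cong un (trans (cong (decode k) (trans e (cong mid (sym (punchIn-suc-same x))))) (decode-encode k (old x)))
        d0 : d zero ≡ e₀
        d0 = trans (cong d (sym g0)) (trans (half-val zero) es₀)
        dnew : d (place new) ≡ (e₀ ∙ κ ∙ d (place (old zero))) ⁻¹
        dnew = inverseʳ-unique _ _ (trans (cong₂ _∙_ (cong₂ _∙_ (sym mL) (trans (sym (identityʳ _)) (cong (mono κ d) (sym vL)))) (sym mN))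
          (mon L λ w → contradiction (trans (sym w) vL) λ ()))
          where
          mL : mono κ d L ≡ e₀ ∙ κ
          mL = cong₂ _∙_ (trans (cong d (next-fromℕ m⁺)) d0) (wrap-fromℕ m⁺ κ)
          mN : mono κ d (vert β (vert β L)) ≡ d (place new)
          mN = trans (cong (mono κ d) (trans (cong (vert β) vL) e))
            (trans (cong₂ _∙_ (cong d (next-inject₁ (suc (inject₁ x)))) (wrap-inject₁ κ (suc (inject₁ x)))) (identityʳ _))
        dlast : d L ≡ e₀ ∙ κ ∙ d (place (old zero))
        dlast = trans (inverseˡ-unique _ _ (trans (cong (d L ∙_) (trans (sym dnew) (cong d (sym βL))))
          (anti L λ w → contradiction (encode-injective k {new} {last} (trans (sym βL) w)) λ ()))) (⁻¹-involutive _)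
        y≈ : Setoid._≈_ (RawS m⁺ p 1) (β , d , l , g) (ins x z)
        y≈ = encode-ind k (λ s → trans (βE s) (sym (ins-α-enc x (proj₁ z) (proj₁ (proj₂ z)) s))) ,
             encode-ind k (λ s → trans (dE s) (sym (ins-c-enc x (proj₁ z) (proj₁ (proj₂ z)) s))) ,
             (λ j → lf-l j _ (lf-old j)) , (λ { zero → g0 })
          where
          βE : ∀ s → β (place s) ≡ place (pos-α (proj₁ z) s)
          βE first   = β0
          βE last    = βL
          βE new     = βd
          βE (old y) = to-β y _ (to-old y)
          dE : ∀ s → d (place s) ≡ pos-c (proj₁ (proj₂ z)) s
          dE first   = d0
          dE last    = dlast
          dE new     = dnew
          dE (old y) = refl
        res : ∃[ z ] (Valid κ' hs no-es z × Setoid._≈_ (RawS m⁺ p 1) (β , d , l , g) (ins (proj₁ z zero) z))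
        res = z , del-valid x {z} z0 (Valid-resp y≈ V) , subst (λ w → Setoid._≈_ (RawS m⁺ p 1) (β , d , l , g) (ins w z)) (sym z0) y≈
      -- The partner of b sits at `β (suc zero)`. It is not h. Were it the final letter, the final
      -- corner would be fixed although it turns to corner 0; were it the letter before, the final
      -- letter would be a second half-edge. So there is room for d.
      go : ∀ i → β (suc zero) ≡ i → ∃[ z ] (Valid κ' hs no-es z × Setoid._≈_ (RawS m⁺ p 1) (β , d , l , g) (ins (proj₁ z zero) z))
      go zero e = contradiction (α-injective (trans e (sym β0))) λ ()
      go (suc i) e with view i
      ... | ‵fromℕ = contradiction (trans (sym v1) (trans (cong (vert β) e) vL)) λ ()
      ... | ‵inj₁ {i = q} _ with view q
      ...   | ‵fromℕ = contradiction (only-half (trans (cong β (sym (next-inject₁ (suc (fromℕ (suc m)))))) (trans (cong (vert β) (sym e)) v1))) λ ()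
      ...   | ‵inj₁ {i = x} _ = Found.res x e

    -- The root at h becomes the root at b, which is an arbitrary position of the shorter word;
    -- hence no factor appears.
    remove-half : ∀ {A B} → Card (RawS m p 0) (Valid κ' hs no-es) A → Card (RawS m⁺ p 1) Rooted B → B ≡ A
    remove-half cA cB = card-unique cB (card-map cA (λ y → ins (proj₁ y zero) y) ins-valid
      (λ { {y} {z} (E , F , L , _) → ins-cong y z (E zero) E F L }) (λ {y} {z} _ _ → ins-injective {y} {z}) ins-surjective)
      where
      ins-cong : ∀ (y z : Raw m p 0) → proj₁ y zero ≡ proj₁ z zero → proj₁ y ≗ proj₁ z → proj₁ (proj₂ y) ≗ proj₁ (proj₂ z) →
        proj₁ (proj₂ (proj₂ y)) ≗ proj₁ (proj₂ (proj₂ z)) → Setoid._≈_ (RawS m⁺ p 1) (ins (proj₁ y zero) y) (ins (proj₁ z zero) z)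
      ins-cong y z e E F L rewrite e =
        (λ i → cong (encode _) (pE (decode _ i))) , (λ i → cE (decode _ i)) , (λ j → cong (encode _ ∘ old) (L j)) , λ _ → refl
        where
        pE : ∀ s → pos-α (proj₁ y) s ≡ pos-α (proj₁ z) s
        pE first   = refl
        pE last    = refl
        pE new     = refl
        pE (old i) = cong old (E i)
        cE : ∀ s → pos-c (proj₁ (proj₂ y)) s ≡ pos-c (proj₁ (proj₂ z)) s
        cE first   = refl
        cE last    = cong (e₀ ∙ κ ∙_) (F zero)
        cE new     = cong (λ w → (e₀ ∙ κ ∙ w) ⁻¹) (F zero)
        cE (old i) = F i

-- Exchanging two adjacent blocks of positions

data Zone (i B C x : ℕ) : Set where
  zone₀ : x ≤ i → Zone i B C x
  zone₁ : i < x → x ≤ i + B → Zone i B C x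
  zone₂ : i + B < x → x ≤ i + B + C → Zone i B C x
  zone₃ : i + B + C < x → Zone i B C x

zone : ∀ i B C x → Zone i B C x
zone i B C x with x ℕₚ.≤? i | x ℕₚ.≤? i + B | x ℕₚ.≤? i + B + C
... | yes p | _     | _     = zone₀ p
... | no p  | yes q | _     = zone₁ (ℕₚ.≰⇒> p) q
... | no _  | no q  | yes r = zone₂ (ℕₚ.≰⇒> q) r
... | no _  | no _  | no r  = zone₃ (ℕₚ.≰⇒> r)

abstract
  swapℕ : ℕ → ℕ → ℕ → ℕ → ℕ
  swapℕ i B C x with x ℕₚ.≤? i | x ℕₚ.≤? i + B | x ℕₚ.≤? i + B + C
  ... | yes _ | _     | _     = x
  ... | no _  | yes _ | _     = x + C
  ... | no _  | no _  | yes _ = x ∸ B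
  ... | no _  | no _  | no _  = x

  swap₀ : ∀ {i B C x} → x ≤ i → swapℕ i B C x ≡ x
  swap₀ {i} {B} {C} {x} p with x ℕₚ.≤? i | x ℕₚ.≤? i + B | x ℕₚ.≤? i + B + C
  ... | yes _ | _ | _ = refl
  ... | no ¬p | _ | _ = ⊥-elim (¬p p)

  swap₁ : ∀ {i B C x} → i < x → x ≤ i + B → swapℕ i B C x ≡ x + C
  swap₁ {i} {B} {C} {x} p q with x ℕₚ.≤? i | x ℕₚ.≤? i + B | x ℕₚ.≤? i + B + C
  ... | yes a | _     | _ = ⊥-elim (ℕₚ.<⇒≱ p a)
  ... | no _  | yes _ | _ = refl
  ... | no _  | no ¬q | _ = ⊥-elim (¬q q)

  swap₂ : ∀ {i B C x} → i + B < x → x ≤ i + B + C → swapℕ i B C x ≡ x ∸ B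
  swap₂ {i} {B} {C} {x} p q with x ℕₚ.≤? i | x ℕₚ.≤? i + B | x ℕₚ.≤? i + B + C
  ... | yes a | _     | _     = ⊥-elim (ℕₚ.<⇒≱ p (ℕₚ.≤-trans a (ℕₚ.m≤m+n i B)))
  ... | no _  | yes a | _     = ⊥-elim (ℕₚ.<⇒≱ p a)
  ... | no _  | no _  | yes _ = refl
  ... | no _  | no _  | no ¬q = ⊥-elim (¬q q)

  swap₃ : ∀ {i B C x} → i + B + C < x → swapℕ i B C x ≡ x
  swap₃ {i} {B} {C} {x} p with x ℕₚ.≤? i | x ℕₚ.≤? i + B | x ℕₚ.≤? i + B + C
  ... | yes _ | _     | _     = refl
  ... | no _  | yes a | _     = ⊥-elim (ℕₚ.<⇒≱ p (ℕₚ.≤-trans a (ℕₚ.m≤m+n (i + B) C)))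
  ... | no _  | no _  | yes a = ⊥-elim (ℕₚ.<⇒≱ p a)
  ... | no _  | no _  | no _  = refl

module _ {i B C : ℕ} where
  swap-bound : ∀ {n x} → i + B + C < n → x < n → swapℕ i B C x < n
  swap-bound {n} {x} k<n x<n with zone i B C x
  ... | zone₀ p   = subst (_< n) (sym (swap₀ p)) x<n
  ... | zone₁ p q = subst (_< n) (sym (swap₁ p q)) (ℕₚ.≤-<-trans (ℕₚ.+-monoˡ-≤ C q) k<n)
  ... | zone₂ p q = subst (_< n) (sym (swap₂ p q)) (ℕₚ.≤-<-trans (ℕₚ.m∸n≤m x B) x<n)
  ... | zone₃ p   = subst (_< n) (sym (swap₃ p)) x<n

+-exchange : ∀ i B C → i + B + C ≡ i + C + B
+-exchange = solve-∀

swap-inverse : ∀ i B C x → swapℕ i C B (swapℕ i B C x) ≡ x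
swap-inverse i B C x with zone i B C x
... | zone₀ p   = trans (cong (swapℕ i C B) (swap₀ p)) (swap₀ p)
... | zone₁ p q = trans (cong (swapℕ i C B) (swap₁ p q))
        (trans (swap₂ (ℕₚ.+-monoˡ-< C p) (subst (x + C ≤_) (+-exchange i B C) (ℕₚ.+-monoˡ-≤ C q))) (ℕₚ.m+n∸n≡m x C))
... | zone₃ p   = trans (cong (swapℕ i C B) (swap₃ p)) (swap₃ (subst (_< x) (+-exchange i B C) p))
... | zone₂ p q = trans (cong (swapℕ i C B) (swap₂ p q))
        (trans (swap₁ (ℕₚ.+-cancelʳ-< B i (x ∸ B) (subst (i + B <_) (sym x≡) p))
                      (ℕₚ.+-cancelʳ-≤ B (x ∸ B) (i + C) (subst₂ _≤_ (sym x≡) (+-exchange i B C) q))) x≡)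
  where
  x≡ : x ∸ B + B ≡ x
  x≡ = ℕₚ.m∸n+n≡m (ℕₚ.≤-trans (ℕₚ.m≤n+m B i) (ℕₚ.<⇒≤ p))

module _ {i B C : ℕ} (1≤B : 1 ≤ B) (1≤C : 1 ≤ C) where
  private
    s = swapℕ i B C
    j k : ℕ
    j = i + B
    k = i + B + C
    i<j : i < j
    i<j = ℕₚ.m<m+n i 1≤B
    j<k : j < k
    j<k = ℕₚ.m<m+n j 1≤C

  -- The exchange respects successors except at the ends i, j, k of the blocks, which acquire the
  -- successors of j, k, i. So the cyclic order is altered by a single 3-cycle.
  suc-swap-i : suc (s i) ≡ s (suc j)
  suc-swap-i = trans (cong suc (swap₀ ℕₚ.≤-refl))
    (sym (trans (swap₂ ℕₚ.≤-refl j<k) (ℕₚ.m+n∸n≡m (suc i) B)))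

  suc-swap-j : suc (s j) ≡ s (suc k)
  suc-swap-j = trans (cong suc (swap₁ i<j ℕₚ.≤-refl)) (sym (swap₃ ℕₚ.≤-refl))

  suc-swap-k : suc (s k) ≡ s (suc i)
  suc-swap-k = trans (cong suc (trans (swap₂ j<k ℕₚ.≤-refl) (trans (cong (_∸ B) (+-exchange i B C)) (ℕₚ.m+n∸n≡m (i + C) B))))
    (sym (swap₁ ℕₚ.≤-refl i<j))

  suc-swap : ∀ x → x ≢ i → x ≢ j → x ≢ k → suc (s x) ≡ s (suc x)
  suc-swap x ≢i ≢j ≢k with zone i B C x
  ... | zone₀ p   = trans (cong suc (swap₀ p)) (sym (swap₀ (ℕₚ.≤∧≢⇒< p ≢i)))
  ... | zone₁ p q = trans (cong suc (swap₁ p q)) (sym (swap₁ (ℕₚ.m≤n⇒m≤1+n p) (ℕₚ.≤∧≢⇒< q ≢j)))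
  ... | zone₂ p q = trans (cong suc (swap₂ p q)) (trans (sym (ℕₚ.+-∸-assoc 1 (ℕₚ.≤-trans (ℕₚ.m≤n+m B i) (ℕₚ.<⇒≤ p))))
                      (sym (swap₂ (ℕₚ.m≤n⇒m≤1+n p) (ℕₚ.≤∧≢⇒< q ≢k))))
  ... | zone₃ p   = trans (cong suc (swap₃ p)) (sym (swap₃ (ℕₚ.m≤n⇒m≤1+n p)))

abstract
  -- (the identity where the blocks do not fit)
  swapF : ∀ {n} → ℕ → ℕ → ℕ → Fin n → Fin n
  swapF {n} i B C x with swapℕ i B C (toℕ x) ℕₚ.<? n
  ... | yes p = fromℕ< p
  ... | no _  = x

  toℕ-swapF : ∀ {n i B C} → i + B + C < n → (x : Fin n) → toℕ (swapF i B C x) ≡ swapℕ i B C (toℕ x)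
  toℕ-swapF {n} {i} {B} {C} k<n x with swapℕ i B C (toℕ x) ℕₚ.<? n
  ... | yes p = Fₚ.toℕ-fromℕ< p
  ... | no ¬p = ⊥-elim (¬p (swap-bound {i} {B} {C} k<n (Fₚ.toℕ<n x)))

module BlockSwap (𝔾 : FinAb) (κ : FinAb.G 𝔾) {m : ℕ} where
  open FinAb 𝔾
  open Maps 𝔾
  open CMSolver commutativeMonoid using (solve; _⊜_) renaming (_⊕_ to infixl 6 _⊞_)

  wrap-last : (x : Fin (suc m)) → toℕ x ≡ m → wrap κ x ≡ κ
  wrap-last x e with Fₚ.toℕ-injective {i = x} {fromℕ m} (trans e (sym (Fₚ.toℕ-fromℕ m)))
  ... | refl = wrap-fromℕ m κ

  wrap-not-last : (x : Fin (suc m)) → toℕ x ≢ m → wrap κ x ≡ ε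
  wrap-not-last x ne with view x
  ... | ‵fromℕ  = ⊥-elim (ne (Fₚ.toℕ-fromℕ m))
  ... | ‵inj₁ _ = refl

  swap-α : ℕ → ℕ → ℕ → (Fin (suc m) → Fin (suc m)) → Fin (suc m) → Fin (suc m)
  swap-α i B C α x = swapF i B C (α (swapF i C B x))

  swap-c : ℕ → ℕ → ℕ → (Fin (suc m) → G) → Fin (suc m) → G
  swap-c i B C c x = c (swapF i C B x)

  record Triple (a b d : Fin (suc m)) (i B C : ℕ) : Set where
    field
      ia  : toℕ a ≡ i
      ib  : toℕ b ≡ i + B
      id′ : toℕ d ≡ i + B + C
      1≤B : 1 ≤ B
      1≤C : 1 ≤ C

  module Surgery {a b d : Fin (suc m)} {i B C : ℕ} (T : Triple a b d i B C) where
    open Triple T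
    fits : i + B + C < suc m
    fits = subst (_< suc m) id′ (Fₚ.toℕ<n d)

    fits' : i + C + B < suc m
    fits' = subst (_< suc m) (+-exchange i B C) fits

    π π' : Fin (suc m) → Fin (suc m)
    π  = swapF i B C
    π' = swapF i C B

    toℕ-π : ∀ x → toℕ (π x) ≡ swapℕ i B C (toℕ x)
    toℕ-π = toℕ-swapF fits

    π'π : ∀ x → π' (π x) ≡ x
    π'π x = Fₚ.toℕ-injective (trans (toℕ-swapF fits' (π x)) (trans (cong (swapℕ i C B) (toℕ-π x)) (swap-inverse i B C (toℕ x))))

    ππ' : ∀ x → π (π' x) ≡ x
    ππ' x = Fₚ.toℕ-injective (trans (toℕ-π (π' x)) (trans (cong (swapℕ i B C) (toℕ-swapF fits' x)) (swap-inverse i C B (toℕ x))))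

    π-injective : ∀ {x y} → π x ≡ π y → x ≡ y
    π-injective {x} {y} e = trans (sym (π'π x)) (trans (cong π' e) (π'π y))

    π-ind : {P : Fin (suc m) → Set} → (∀ x → P (π x)) → ∀ x → P x
    π-ind {P} h x = subst P (ππ' x) (h (π' x))

    i<j : i < i + B
    i<j = ℕₚ.m<m+n i 1≤B
    j<k : i + B < i + B + C
    j<k = ℕₚ.m<m+n (i + B) 1≤C

    πa : toℕ (π a) ≡ i
    πa = trans (toℕ-π a) (trans (cong (swapℕ i B C) ia) (swap₀ ℕₚ.≤-refl))
    πb : toℕ (π b) ≡ i + B + C
    πb = trans (toℕ-π b) (trans (cong (swapℕ i B C) ib) (swap₁ i<j ℕₚ.≤-refl))
    πd : toℕ (π d) ≡ i + C
    πd = trans (toℕ-π d) (trans (cong (swapℕ i B C) id′) (trans (swap₂ j<k ℕₚ.≤-refl) (trans (cong (_∸ B) (+-exchange i B C)) (ℕₚ.m+n∸n≡m (i + C) B))))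

    πa<πd : toℕ (π a) < toℕ (π d)
    πa<πd = subst₂ _<_ (sym πa) (sym πd) (ℕₚ.m<m+n i 1≤C)
    πd<πb : toℕ (π d) < toℕ (π b)
    πd<πb = subst₂ _<_ (sym πd) (sym πb) (ℕₚ.+-monoˡ-< C i<j)

    a≢b : a ≢ b
    a≢b refl = ℕₚ.<-irrefl (trans (sym ia) ib) i<j
    b≢d : b ≢ d
    b≢d refl = ℕₚ.<-irrefl (trans (sym ib) id′) j<k
    a≢d : a ≢ d
    a≢d refl = ℕₚ.<-irrefl (trans (sym ia) id′) (ℕₚ.<-trans i<j j<k)

    -- y is the corner whose successor follows π x in the new word.
    module _ (x y : Fin (suc m)) (e : suc (swapℕ i B C (toℕ x)) ≡ swapℕ i B C (suc (toℕ y))) where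
      private
        last⇒ : toℕ (π x) ≡ m → toℕ y ≡ m
        last⇒ z = ℕₚ.suc-injective (trans (sym (swap-inverse i B C (suc (toℕ y))))
          (trans (cong (swapℕ i C B) (trans (sym e) (cong suc (trans (sym (toℕ-π x)) z)))) (swap₃ fits')))
        last⇐ : toℕ y ≡ m → toℕ (π x) ≡ m
        last⇐ z = ℕₚ.suc-injective (trans (cong suc (toℕ-π x)) (trans e (trans (cong (swapℕ i B C ∘ suc) z) (swap₃ fits))))

      next-π′ : next (π x) ≡ π (next y)
      next-π′ with toℕ y ℕₚ.≟ m
      ... | yes z = trans (next-last (π x) (last⇐ z))
              (sym (trans (cong π (next-last y z)) (Fₚ.toℕ-injective (trans (toℕ-π zero) (swap₀ z≤n)))))
      ... | no z = Fₚ.toℕ-injective (trans (toℕ-next (π x) (z ∘ last⇒)) (trans (cong suc (toℕ-π x))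
              (trans e (trans (cong (swapℕ i B C) (sym (toℕ-next y z))) (sym (toℕ-π (next y)))))))

      wrap-π′ : wrap κ (π x) ≡ wrap κ y
      wrap-π′ with toℕ y ℕₚ.≟ m
      ... | yes z = trans (wrap-last (π x) (last⇐ z)) (sym (wrap-last y z))
      ... | no z  = trans (wrap-not-last (π x) (z ∘ last⇒)) (sym (wrap-not-last y z))

    Off : Fin (suc m) → Set
    Off x = x ≢ a × x ≢ b × x ≢ d

    data Place (x : Fin (suc m)) : Set where
      at-a : x ≡ a → Place x
      at-b : x ≡ b → Place x
      at-d : x ≡ d → Place x
      at-off : Off x → Place x

    -- The graph of the 3-cycle (a b d). By `vertπ`, up to renaming by `π`, the new `vert` is
    -- `vert α` composed with it: this breaks the inverse 3-cycle into three fixed points and joins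
    -- three fixed points into one 3-cycle.
    data Turn : Fin (suc m) → Fin (suc m) → Set where
      a↦b : Turn a b
      b↦d : Turn b d
      d↦a : Turn d a
      off : ∀ {x} → Off x → Turn x x

    place : ∀ x → Place x
    place x with x Fₚ.≟ a | x Fₚ.≟ b | x Fₚ.≟ d
    ... | yes e | _     | _     = at-a e
    ... | no _  | yes e | _     = at-b e
    ... | no _  | no _  | yes e = at-d e
    ... | no p  | no q  | no r  = at-off (p , q , r)

    turn-suc : ∀ {x y} → Turn x y → suc (swapℕ i B C (toℕ x)) ≡ swapℕ i B C (suc (toℕ y))
    turn-suc a↦b rewrite ia | ib  = suc-swap-i {i} {B} {C} 1≤B 1≤C
    turn-suc b↦d rewrite ib | id′ = suc-swap-j {i} {B} {C} 1≤B 1≤C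
    turn-suc d↦a rewrite ia | id′ = suc-swap-k {i} {B} {C} 1≤B 1≤C
    turn-suc {x} (off (p , q , r)) = suc-swap {i} {B} {C} 1≤B 1≤C (toℕ x)
      (λ e → p (Fₚ.toℕ-injective (trans e (sym ia)))) (λ e → q (Fₚ.toℕ-injective (trans e (sym ib))))
      (λ e → r (Fₚ.toℕ-injective (trans e (sym id′))))

    module _ (α : Fin (suc m) → Fin (suc m)) (c : Fin (suc m) → G) where
      α' = swap-α i B C α
      c' = swap-c i B C c

      α'π : ∀ x → α' (π x) ≡ π (α x)
      α'π x = cong (π ∘ α) (π'π x)

      c'π : ∀ x → c' (π x) ≡ c x
      c'π x = cong c (π'π x)

      vertπ : ∀ {x y} → Turn x y → vert α' (π x) ≡ π (vert α y)
      vertπ {x} {y} t = trans (cong α' (next-π′ x y (turn-suc t))) (α'π (next y))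

      monoπ : ∀ {x y} → Turn x y → mono κ c' (π x) ≡ mono κ c y
      monoπ {x} {y} t = cong₂ _∙_ (trans (cong c' (next-π′ x y (turn-suc t))) (c'π (next y))) (wrap-π′ x y (turn-suc t))

      module _ (C₀ : Core κ α c) where
        open Core C₀

        swap-invol : ∀ x → α' (α' x) ≡ x
        swap-invol = π-ind λ x → trans (cong α' (α'π x)) (trans (α'π (α x)) (cong π (invol x)))

        swap-anti : ∀ x → α' x ≢ x → c' x ∙ c' (α' x) ≡ ε
        swap-anti = π-ind λ x ne → trans (cong₂ _∙_ (c'π x) (trans (cong c' (α'π x)) (c'π (α x))))
          (anti x (λ z → ne (trans (α'π x) (cong π z))))

        module _ (closed : ∀ {x} → Off x → Off (vert α x)) where
          off-vert² : ∀ {x} → Off x → vert α' (vert α' (π x)) ≡ π (vert α (vert α x))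
          off-vert² o = trans (cong (vert α') (vertπ (off o))) (vertπ (off (closed o)))

          off-cub : ∀ {x} → Off x → vert α' (vert α' (vert α' (π x))) ≡ π x
          off-cub {x} o = trans (cong (vert α') (off-vert² o)) (trans (vertπ (off (closed (closed o)))) (cong π (cub x)))

          off-mon : ∀ {x} → Off x → vert α' (π x) ≢ π x →
            mono κ c' (π x) ∙ mono κ c' (vert α' (π x)) ∙ mono κ c' (vert α' (vert α' (π x))) ≡ ε
          off-mon {x} o ne = trans
            (cong₂ _∙_ (cong₂ _∙_ (monoπ (off o)) (trans (cong (mono κ c') (vertπ (off o))) (monoπ (off (closed o)))))
                       (trans (cong (mono κ c') (off-vert² o)) (monoπ (off (closed (closed o))))))
            (mon x (λ z → ne (trans (vertπ (off o)) (cong π z))))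

        swap-half : ∀ {r} {e : Fin r → Fin (suc m)} → Lists (λ x → α x ≡ x) e → Lists (λ x → α' x ≡ x) (π ∘ e)
        swap-half = lists-map π π-injective (λ {x} z → trans (α'π x) (cong π z))
          (λ {y} z → π' y , π-injective (trans (sym (α'π (π' y))) (trans (cong α' (ππ' y)) (trans z (sym (ππ' y))))) , sym (ππ' y))
          (λ _ → refl)

        module Split (va : vert α a ≡ d) (vd : vert α d ≡ b) (vb : vert α b ≡ a) where
          closed : ∀ {x} → Off x → Off (vert α x)
          closed (p , q , r) = (λ z → q (vert-injective (trans z (sym vb)))) ,
            (λ z → r (vert-injective (trans z (sym vd)))) , (λ z → p (vert-injective (trans z (sym va))))

          fix-a : vert α' (π a) ≡ π a
          fix-a = trans (vertπ a↦b) (cong π vb)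
          fix-b : vert α' (π b) ≡ π b
          fix-b = trans (vertπ b↦d) (cong π vd)
          fix-d : vert α' (π d) ≡ π d
          fix-d = trans (vertπ d↦a) (cong π va)

          fixed³ : ∀ {x} → vert α' x ≡ x → vert α' (vert α' (vert α' x)) ≡ x
          fixed³ z = trans (cong (vert α' ∘ vert α') z) (trans (cong (vert α') z) z)

          split-core : Core κ α' c'
          split-core = record { invol = swap-invol ; anti = swap-anti ; cub = π-ind cub' ; mon = π-ind mon' }
            where
            cub' : ∀ x → vert α' (vert α' (vert α' (π x))) ≡ π x
            cub' x with place x
            ... | at-a refl = fixed³ fix-a
            ... | at-b refl = fixed³ fix-b
            ... | at-d refl = fixed³ fix-d
            ... | at-off o  = off-cub closed o
            mon' : ∀ x → vert α' (π x) ≢ π x → mono κ c' (π x) ∙ mono κ c' (vert α' (π x)) ∙ mono κ c' (vert α' (vert α' (π x))) ≡ ε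
            mon' x ne with place x
            ... | at-a refl = ⊥-elim (ne fix-a)
            ... | at-b refl = ⊥-elim (ne fix-b)
            ... | at-d refl = ⊥-elim (ne fix-d)
            ... | at-off o  = off-mon closed o ne

          not-leaf : ∀ {x} → vert α x ≡ x → Off x
          not-leaf z = (λ { refl → a≢d (trans (sym z) va) }) , (λ { refl → a≢b (trans (sym vb) z) }) , (λ { refl → b≢d (trans (sym vd) z) })

          split-leaf : ∀ {p} {ℓ : Fin p → Fin (suc m)} → Lists (λ x → vert α x ≡ x) ℓ →
            Lists (λ x → vert α' x ≡ x) (π a ◂ π d ◂ π b ◂ (π ∘ ℓ))
          split-leaf {ℓ = ℓ} L = record
            { all = λ { zero → fix-a ; (suc zero) → fix-d ; (suc (suc zero)) → fix-b
                      ; (suc (suc (suc j))) → trans (vertπ (off (not-leaf (all j)))) (cong π (all j)) }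
            ; inj = inj'
            ; hit = λ {y} z → hit' (π' y) (place (π' y)) (sym (ππ' y)) z }
            where
            open Lists L
            inj' : ∀ {s t} → (π a ◂ π d ◂ π b ◂ (π ∘ ℓ)) s ≡ (π a ◂ π d ◂ π b ◂ (π ∘ ℓ)) t → s ≡ t
            inj' {zero} {zero} z = refl
            inj' {zero} {suc zero} z = ⊥-elim (a≢d (π-injective z))
            inj' {zero} {suc (suc zero)} z = ⊥-elim (a≢b (π-injective z))
            inj' {zero} {suc (suc (suc t))} z = ⊥-elim (proj₁ (not-leaf (all t)) (sym (π-injective z)))
            inj' {suc zero} {zero} z = ⊥-elim (a≢d (sym (π-injective z)))
            inj' {suc zero} {suc zero} z = refl
            inj' {suc zero} {suc (suc zero)} z = ⊥-elim (b≢d (sym (π-injective z)))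
            inj' {suc zero} {suc (suc (suc t))} z = ⊥-elim (proj₂ (proj₂ (not-leaf (all t))) (sym (π-injective z)))
            inj' {suc (suc zero)} {zero} z = ⊥-elim (a≢b (sym (π-injective z)))
            inj' {suc (suc zero)} {suc zero} z = ⊥-elim (b≢d (π-injective z))
            inj' {suc (suc zero)} {suc (suc zero)} z = refl
            inj' {suc (suc zero)} {suc (suc (suc t))} z = ⊥-elim (proj₁ (proj₂ (not-leaf (all t))) (sym (π-injective z)))
            inj' {suc (suc (suc s))} {zero} z = ⊥-elim (proj₁ (not-leaf (all s)) (π-injective z))
            inj' {suc (suc (suc s))} {suc zero} z = ⊥-elim (proj₂ (proj₂ (not-leaf (all s))) (π-injective z))
            inj' {suc (suc (suc s))} {suc (suc zero)} z = ⊥-elim (proj₁ (proj₂ (not-leaf (all s))) (π-injective z))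
            inj' {suc (suc (suc s))} {suc (suc (suc t))} z = cong (λ w → suc (suc (suc w))) (inj (π-injective z))
            hit' : ∀ {y} x → Place x → y ≡ π x → vert α' y ≡ y → ∃[ j ] (π a ◂ π d ◂ π b ◂ (π ∘ ℓ)) j ≡ y
            hit' _ (at-a refl) refl z = zero , refl
            hit' _ (at-b refl) refl z = suc (suc zero) , refl
            hit' _ (at-d refl) refl z = suc zero , refl
            hit' x (at-off o) refl z =
              let j , w = hit (π-injective (trans (sym (vertπ (off o))) z)) in suc (suc (suc j)) , cong π w

          split-mono-product : mono κ c' (π a) ∙ mono κ c' (π d) ∙ mono κ c' (π b) ≡ ε
          split-mono-product = trans (cong₂ _∙_ (cong₂ _∙_ (monoπ a↦b) (monoπ d↦a)) (monoπ b↦d))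
            (trans (cong₂ _∙_ (cong₂ _∙_ (cong (mono κ c) (sym (trans (cong (vert α) va) vd))) refl) (cong (mono κ c) (sym va)))
              (trans (solve 3 (λ x y z → z ⊞ x ⊞ y ⊜ x ⊞ y ⊞ z) refl (mono κ c a) (mono κ c (vert α a)) (mono κ c (vert α (vert α a))))
                (mon a (λ z → a≢d (trans (sym z) va)))))

        module Join (fa : vert α a ≡ a) (fb : vert α b ≡ b) (fd : vert α d ≡ d)
                    (prod : mono κ c a ∙ mono κ c b ∙ mono κ c d ≡ ε) where
          closed : ∀ {x} → Off x → Off (vert α x)
          closed (p , q , r) = (λ z → p (vert-injective (trans z (sym fa)))) ,
            (λ z → q (vert-injective (trans z (sym fb)))) , (λ z → r (vert-injective (trans z (sym fd))))

          go-a : vert α' (π a) ≡ π b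
          go-a = trans (vertπ a↦b) (cong π fb)
          go-b : vert α' (π b) ≡ π d
          go-b = trans (vertπ b↦d) (cong π fd)
          go-d : vert α' (π d) ≡ π a
          go-d = trans (vertπ d↦a) (cong π fa)

          thrice : ∀ {x y z} → vert α' x ≡ y → vert α' y ≡ z → vert α' z ≡ x → vert α' (vert α' (vert α' x)) ≡ x
          thrice p q r = trans (cong (vert α' ∘ vert α') p) (trans (cong (vert α') q) r)

          product : ∀ {x y z} → vert α' x ≡ y → vert α' y ≡ z → mono κ c' x ∙ mono κ c' y ∙ mono κ c' z ≡ ε →
                    mono κ c' x ∙ mono κ c' (vert α' x) ∙ mono κ c' (vert α' (vert α' x)) ≡ ε
          product refl refl e = e

          prod-a : mono κ c' (π a) ∙ mono κ c' (π b) ∙ mono κ c' (π d) ≡ ε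
          prod-a = trans (cong₂ _∙_ (cong₂ _∙_ (monoπ a↦b) (monoπ b↦d)) (monoπ d↦a))
            (trans (solve 3 (λ x y z → y ⊞ z ⊞ x ⊜ x ⊞ y ⊞ z) refl (mono κ c a) (mono κ c b) (mono κ c d)) prod)

          rotate : ∀ {x y z} → x ∙ y ∙ z ≡ ε → y ∙ z ∙ x ≡ ε
          rotate {x} {y} {z} e = trans (solve 3 (λ x y z → y ⊞ z ⊞ x ⊜ x ⊞ y ⊞ z) refl x y z) e

          join-core : Core κ α' c'
          join-core = record { invol = swap-invol ; anti = swap-anti ; cub = π-ind cub' ; mon = π-ind mon' }
            where
            cub' : ∀ x → vert α' (vert α' (vert α' (π x))) ≡ π x
            cub' x with place x
            ... | at-a refl = thrice go-a go-b go-d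
            ... | at-b refl = thrice go-b go-d go-a
            ... | at-d refl = thrice go-d go-a go-b
            ... | at-off o  = off-cub closed o
            mon' : ∀ x → vert α' (π x) ≢ π x → mono κ c' (π x) ∙ mono κ c' (vert α' (π x)) ∙ mono κ c' (vert α' (vert α' (π x))) ≡ ε
            mon' x ne with place x
            ... | at-a refl = product go-a go-b prod-a
            ... | at-b refl = product go-b go-d (rotate prod-a)
            ... | at-d refl = product go-d go-a (rotate (rotate prod-a))
            ... | at-off o  = off-mon closed o ne

          join-leaf : ∀ {p} {ℓ : Fin (suc (suc (suc p))) → Fin (suc m)} → ℓ zero ≡ a → ℓ (suc zero) ≡ b → ℓ (suc (suc zero)) ≡ d →
            Lists (λ x → vert α x ≡ x) ℓ → Lists (λ x → vert α' x ≡ x) (λ j → π (ℓ (suc (suc (suc j)))))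
          join-leaf {ℓ = ℓ} la lb ld L = record
            { all = λ j → trans (vertπ (off (ℓ-off j))) (cong π (all (suc (suc (suc j)))))
            ; inj = λ z → 3-injective (inj (π-injective z))
            ; hit = λ {y} z → hit' (π' y) (place (π' y)) (sym (ππ' y)) z }
            where
            open Lists L
            3-injective : ∀ {n} {s t : Fin n} → _≡_ {A = Fin (suc (suc (suc n)))} (suc (suc (suc s))) (suc (suc (suc t))) → s ≡ t
            3-injective refl = refl
            ℓ-off : ∀ j → Off (ℓ (suc (suc (suc j))))
            ℓ-off j = (λ z → contradiction (inj (trans z (sym la))) λ ()) , (λ z → contradiction (inj (trans z (sym lb))) λ ()) ,
                      (λ z → contradiction (inj (trans z (sym ld))) λ ())
            hit' : ∀ {y} x → Place x → y ≡ π x → vert α' y ≡ y → ∃[ j ] π (ℓ (suc (suc (suc j)))) ≡ y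
            hit' _ (at-a refl) refl z = ⊥-elim (a≢b (π-injective (trans (sym z) go-a)))
            hit' _ (at-b refl) refl z = ⊥-elim (b≢d (π-injective (trans (sym z) go-b)))
            hit' _ (at-d refl) refl z = ⊥-elim (a≢d (π-injective (trans (sym go-d) z)))
            hit' x (at-off (p , q , r)) refl z with hit (π-injective (trans (sym (vertπ (off (p , q , r)))) z))
            ... | zero , w = ⊥-elim (p (trans (sym w) la))
            ... | suc zero , w = ⊥-elim (q (trans (sym w) lb))
            ... | suc (suc zero) , w = ⊥-elim (r (trans (sym w) ld))
            ... | suc (suc (suc j)) , w = j , cong π w

-- Gluing three leaves into a negative vertex

module Trisection (𝔾 : FinAb) (κ : FinAb.G 𝔾) {m p r : ℕ} (hs : Fin p → FinAb.G 𝔾) (es : Fin r → FinAb.G 𝔾) where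
  open FinAb 𝔾
  open Maps 𝔾
  open BlockSwap 𝔾 κ {m}
  open CMSolver commutativeMonoid using (solve; _⊜_) renaming (_⊕_ to infixl 6 _⊞_)
  private
    R₀ = RawS m p r
    R₃ = RawS m (suc (suc (suc p))) r
    module R₃ = Setoid R₃

  lab : Raw m (suc (suc (suc p))) r → Fin (suc (suc (suc p))) → Fin (suc m)
  lab y = proj₁ (proj₂ (proj₂ y))

  μ : Raw m (suc (suc (suc p))) r → Fin (suc (suc (suc p))) → G
  μ y j = mono κ (proj₁ (proj₂ y)) (lab y j)

  l₀ l₁ l₂ : Raw m (suc (suc (suc p))) r → ℕ
  l₀ y = toℕ (lab y zero)
  l₁ y = toℕ (lab y (suc zero))
  l₂ y = toℕ (lab y (suc (suc zero)))

  -- The monodromies of the first three leaves are read off the map rather than prescribed; only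
  -- their product is constrained, which is what `Join` requires.
  GluingTriple : Raw m (suc (suc (suc p))) r → Set
  GluingTriple y = Valid κ (μ y zero ◂ μ y (suc zero) ◂ μ y (suc (suc zero)) ◂ hs) es y ×
                   μ y zero ∙ μ y (suc zero) ∙ μ y (suc (suc zero)) ≡ ε

  Sorted : Raw m (suc (suc (suc p))) r → Set
  Sorted y = GluingTriple y × l₀ y < l₁ y × l₁ y < l₂ y

  Marked : Raw m p r × Fin (suc m) → Set
  Marked (x , a) = Valid κ hs es x × Neg (proj₁ x) a

  -- The new leaves are listed as a, d, b because this is their order after the exchange. The three
  -- corners are separate arguments so that equal corners can be substituted without touching `x`.
  split′ : Fin (suc m) → Fin (suc m) → Fin (suc m) → Raw m p r → Raw m (suc (suc (suc p))) r
  split′ a b d (α , c , ℓ , e) = swap-α i B C α , swap-c i B C c , (π a ◂ π d ◂ π b ◂ (π ∘ ℓ)) , π ∘ e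
    where
    i = toℕ a
    B = toℕ b ∸ i
    C = toℕ d ∸ toℕ b
    π = swapF i B C

  split : Raw m p r × Fin (suc m) → Raw m (suc (suc (suc p))) r
  split (x , a) = split′ a (vert (proj₁ x) (vert (proj₁ x) a)) (vert (proj₁ x) a) x

  triple : ∀ {a b d : Fin (suc m)} → toℕ a < toℕ b → toℕ b < toℕ d → Triple a b d (toℕ a) (toℕ b ∸ toℕ a) (toℕ d ∸ toℕ b)
  triple {a} {b} {d} p q = record
    { ia = refl ; ib = sym (ℕₚ.m+[n∸m]≡n (ℕₚ.<⇒≤ p))
    ; id′ = sym (trans (cong (_+ (toℕ d ∸ toℕ b)) (ℕₚ.m+[n∸m]≡n (ℕₚ.<⇒≤ p))) (ℕₚ.m+[n∸m]≡n (ℕₚ.<⇒≤ q)))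
    ; 1≤B = ℕₚ.m<n⇒0<n∸m p ; 1≤C = ℕₚ.m<n⇒0<n∸m q }

  split-sorted : ∀ {x} → Marked x → Sorted (split x)
  split-sorted {x@(α , c , ℓ , e) , a} (V , p , q) = (record
      { core = split-core
      ; leaf = split-leaf leaf
      ; leaf-mon = λ { zero → refl ; (suc zero) → refl ; (suc (suc zero)) → refl
                     ; (suc (suc (suc j))) → trans (monoπ α c (off (not-leaf (Lists.all leaf j)))) (leaf-mon j) }
      ; half = swap-half α c core half
      ; half-val = λ j → trans (c'π α c (e j)) (half-val j) } , split-mono-product) ,
    πa<πd , πd<πb
    where
    open Valid V using (core; leaf; leaf-mon; half; half-val; cub)
    t = triple p q
    open Surgery t
    open Split α c core refl refl (cub a)

  private
    -- After the exchange the three leaves are at i, i + C and i + B + C, which determines i, B and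
    -- C.
    triple-determined : ∀ {a b d a' b' d' : Fin (suc m)} (p : toℕ a < toℕ b) (q : toℕ b < toℕ d) (p' : toℕ a' < toℕ b') (q' : toℕ b' < toℕ d') →
      Surgery.π (triple p q) a ≡ Surgery.π (triple p' q') a' → Surgery.π (triple p q) d ≡ Surgery.π (triple p' q') d' →
      Surgery.π (triple p q) b ≡ Surgery.π (triple p' q') b' → a ≡ a' × b ≡ b' × d ≡ d'
    triple-determined {a} {b} {d} {a'} {b'} {d'} p q p' q' ea ed eb = Fₚ.toℕ-injective i≡ , Fₚ.toℕ-injective j≡ , Fₚ.toℕ-injective k≡
      where
      module S = Surgery (triple p q)
      module S' = Surgery (triple p' q')
      i≡ : toℕ a ≡ toℕ a'
      i≡ = trans (sym S.πa) (trans (cong toℕ ea) S'.πa)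
      k≡ : toℕ d ≡ toℕ d'
      k≡ = trans (Triple.id′ (triple p q)) (trans (sym S.πb) (trans (cong toℕ eb) (trans S'.πb (sym (Triple.id′ (triple p' q'))))))
      C≡ : toℕ d ∸ toℕ b ≡ toℕ d' ∸ toℕ b'
      C≡ = ℕₚ.+-cancelˡ-≡ (toℕ a) _ _ (trans (sym S.πd) (trans (cong toℕ ed) (trans S'.πd (cong (_+ (toℕ d' ∸ toℕ b')) (sym i≡)))))
      j≡ : toℕ b ≡ toℕ b'
      j≡ = ℕₚ.+-cancelʳ-≡ (toℕ d ∸ toℕ b) _ _ (trans (ℕₚ.m+[n∸m]≡n (ℕₚ.<⇒≤ q))
             (trans k≡ (trans (sym (ℕₚ.m+[n∸m]≡n (ℕₚ.<⇒≤ q'))) (cong (toℕ b' +_) (sym C≡)))))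

    split′-injective : ∀ {a b d : Fin (suc m)} (p : toℕ a < toℕ b) (q : toℕ b < toℕ d) x y →
      split′ a b d x R₃.≈ split′ a b d y → Setoid._≈_ R₀ x y
    split′-injective p q (α , c , ℓ , e) (β , d , l , g) (E , F , L , H) =
      (λ i → π-injective (trans (sym (α'π α c i)) (trans (E (π i)) (α'π β d i)))) ,
      (λ i → trans (sym (c'π α c i)) (trans (F (π i)) (c'π β d i))) ,
      (λ j → π-injective (L (suc (suc (suc j))))) , (λ j → π-injective (H j))
      where open Surgery (triple p q)

    split-injective : ∀ {x y} → Marked x → Marked y → split x R₃.≈ split y → Setoid._≈_ (×-setoid R₀ (EqS (Fin (suc m)))) x y
    split-injective {x , a} {y , a'} (V , p , q) (W , p' , q') S@(_ , _ , L , _) =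
      split′-injective p q x y (subst (λ { (a , b , d) → split (x , _) R₃.≈ split′ a b d y }) (cong₂ _,_ (sym a≡) (cong₂ _,_ (sym b≡) (sym d≡))) S) , a≡
      where
      det = triple-determined p q p' q' (L zero) (L (suc zero)) (L (suc (suc zero)))
      a≡ = proj₁ det
      b≡ = proj₁ (proj₂ det)
      d≡ = proj₂ (proj₂ det)

    split-cong : ∀ {x y} → Setoid._≈_ (×-setoid R₀ (EqS (Fin (suc m)))) x y → split x R₃.≈ split y
    split-cong {x@(α , c , ℓ , e) , a} {y@(β , d , l , g) , .a} ((E , F , L , H) , refl) =
      subst (λ { (b , d) → split (x , a) R₃.≈ split′ a b d y }) (cong₂ _,_ (vert² E a) (E (next a)))
        ((λ i → cong (swapF _ _ _) (E _)) , (λ i → F _) ,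
         (λ { zero → refl ; (suc zero) → refl ; (suc (suc zero)) → refl ; (suc (suc (suc j))) → cong (swapF _ _ _) (L j) }) ,
         (λ j → cong (swapF _ _ _) (H j)))

  -- Exchanging the blocks between the three leaves joins them. The joined vertex has the block
  -- lengths C and B, in this order, so splitting it performs the inverse exchange.
  split-surjective : ∀ {y} → Sorted y → ∃[ x ] (Marked x × y R₃.≈ split x)
  split-surjective {β , d , l , g} ((V , pr) , p , q) = (x , π a₀) , (VX , neg) , y≈
    where
    open Valid V using (core; leaf; leaf-mon; half; half-val)
    a₀ = l zero
    b₀ = l (suc zero)
    d₀ = l (suc (suc zero))
    t = triple {a₀} {b₀} {d₀} p q
    open Surgery t
    i B C : ℕ
    i = toℕ a₀
    B = toℕ b₀ ∸ i
    C = toℕ d₀ ∸ toℕ b₀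
    open Join β d core (Lists.all leaf zero) (Lists.all leaf (suc zero)) (Lists.all leaf (suc (suc zero))) pr
    x : Raw m _ _
    x = swap-α i B C β , swap-c i B C d , (λ j → π (l (suc (suc (suc j))))) , π ∘ g
    VX : Valid κ hs es x
    VX = record
      { core = join-core ; leaf = join-leaf refl refl refl leaf
      ; leaf-mon = λ j → trans (monoπ β d (off ((λ z → contradiction (Lists.inj leaf z) λ ()) , (λ z → contradiction (Lists.inj leaf z) λ ()) ,
          (λ z → contradiction (Lists.inj leaf z) λ ())))) (leaf-mon (suc (suc (suc j))))
      ; half = swap-half β d core half ; half-val = λ j → trans (c'π β d (g j)) (half-val j) }
    v2 : vert (proj₁ x) (vert (proj₁ x) (π a₀)) ≡ π d₀
    v2 = trans (cong (vert (proj₁ x)) go-a) go-b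
    neg : Neg (proj₁ x) (π a₀)
    neg = subst₂ (λ v w → toℕ (π a₀) < toℕ v × toℕ v < toℕ w) (sym v2) (sym go-a) (πa<πd , πd<πb)
    B' : toℕ (π d₀) ∸ toℕ (π a₀) ≡ C
    B' = trans (cong₂ _∸_ πd πa) (ℕₚ.m+n∸m≡n i C)
    C' : toℕ (π b₀) ∸ toℕ (π d₀) ≡ B
    C' = trans (cong₂ _∸_ (trans πb (+-exchange i B C)) πd) (ℕₚ.m+n∸m≡n (i + C) B)
    back : swapF (toℕ (π a₀)) (toℕ (π d₀) ∸ toℕ (π a₀)) (toℕ (π b₀) ∸ toℕ (π d₀)) ≡ π'
    back = trans (cong₂ (swapF (toℕ (π a₀))) B' C') (cong (λ w → swapF w C B) πa)
    forth : swapF (toℕ (π a₀)) (toℕ (π b₀) ∸ toℕ (π d₀)) (toℕ (π d₀) ∸ toℕ (π a₀)) ≡ π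
    forth = trans (cong₂ (swapF (toℕ (π a₀))) C' B') (cong (λ w → swapF w B C) πa)
    y≈′ : (β , d , l , g) R₃.≈ split′ (π a₀) (π d₀) (π b₀) x
    y≈′ = (λ z → sym (trans (cong₂ (λ f h → f (π (β (π' (h z))))) back forth) (trans (π'π _) (cong β (π'π z))))) ,
          (λ z → sym (trans (cong (λ h → d (π' (h z))) forth) (cong d (π'π z)))) ,
          (λ { zero → at a₀ ; (suc zero) → at b₀ ; (suc (suc zero)) → at d₀ ; (suc (suc (suc j))) → at _ }) , (λ j → at (g j))
      where
      at : ∀ w → w ≡ swapF (toℕ (π a₀)) (toℕ (π d₀) ∸ toℕ (π a₀)) (toℕ (π b₀) ∸ toℕ (π d₀)) (π w)
      at w = sym (trans (cong (λ h → h (π w)) back) (π'π w))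
    y≈ : (β , d , l , g) R₃.≈ split (x , π a₀)
    y≈ = subst₂ (λ v w → (β , d , l , g) R₃.≈ split′ (π a₀) v w x) (sym v2) (sym go-a) y≈′

  card-Sorted : ∀ {n} → Card (×-setoid R₀ (EqS (Fin (suc m)))) Marked n → Card R₃ Sorted n
  card-Sorted c = card-map c split split-sorted split-cong split-injective split-surjective

  private
    relabel : (Fin (suc (suc (suc p))) → Fin (suc (suc (suc p)))) → Raw m (suc (suc (suc p))) r → Raw m (suc (suc (suc p))) r
    relabel ρ (α , c , ℓ , e) = α , c , ℓ ∘ ρ , e

    ρ₀ ρ₁ : Fin (suc (suc (suc p))) → Fin (suc (suc (suc p)))
    ρ₀ zero          = suc zero
    ρ₀ (suc zero)    = zero
    ρ₀ (suc (suc j)) = suc (suc j)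
    ρ₁ zero                = zero
    ρ₁ (suc zero)          = suc (suc zero)
    ρ₁ (suc (suc zero))    = suc zero
    ρ₁ (suc (suc (suc j))) = suc (suc (suc j))

    ρ₀² : ∀ j → ρ₀ (ρ₀ j) ≡ j
    ρ₀² zero          = refl
    ρ₀² (suc zero)    = refl
    ρ₀² (suc (suc j)) = refl
    ρ₁² : ∀ j → ρ₁ (ρ₁ j) ≡ j
    ρ₁² zero                = refl
    ρ₁² (suc zero)          = refl
    ρ₁² (suc (suc zero))    = refl
    ρ₁² (suc (suc (suc j))) = refl

    relabel-valid : ∀ ρ → (∀ j → ρ (ρ j) ≡ j) → ∀ {ks ks' y} → (∀ j → ks (ρ j) ≡ ks' j) → Valid κ ks es y → Valid κ ks' es (relabel ρ y)
    relabel-valid ρ ρ² {y = α , c , ℓ , e} kE V = record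
      { core = core
      ; leaf = record { all = λ j → Lists.all leaf (ρ j)
                      ; inj = λ {i} {j} z → trans (sym (ρ² i)) (trans (cong ρ (Lists.inj leaf z)) (ρ² j))
                      ; hit = λ z → let j , w = Lists.hit leaf z in ρ j , trans (cong ℓ (ρ² j)) w }
      ; leaf-mon = λ j → trans (leaf-mon (ρ j)) (kE j) ; half = half ; half-val = half-val }
      where open Valid V using (core; leaf; leaf-mon; half; half-val)

    glue₀ : ∀ {y} → GluingTriple y → GluingTriple (relabel ρ₀ y)
    glue₀ {y} (V , e) = relabel-valid ρ₀ ρ₀² (λ { zero → refl ; (suc zero) → refl ; (suc (suc j)) → refl }) V ,
      trans (cong (_∙ μ y (suc (suc zero))) (comm (μ y (suc zero)) (μ y zero))) e
    glue₁ : ∀ {y} → GluingTriple y → GluingTriple (relabel ρ₁ y)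
    glue₁ {y} (V , e) = relabel-valid ρ₁ ρ₁² (λ { zero → refl ; (suc zero) → refl ; (suc (suc zero)) → refl ; (suc (suc (suc j))) → refl }) V ,
      trans (solve 3 (λ a b d → a ⊞ d ⊞ b ⊜ a ⊞ b ⊞ d) refl (μ y zero) (μ y (suc zero)) (μ y (suc (suc zero)))) e

    card-relabel : ∀ ρ → (∀ j → ρ (ρ j) ≡ j) → ∀ {P Q n} → (∀ {y} → P y → Q (relabel ρ y)) → (∀ {y} → Q y → P (relabel ρ y)) →
      Card R₃ P n → Card R₃ Q n
    card-relabel ρ ρ² PQ QP c = card-map c (relabel ρ) PQ (λ { (E , F , L , H) → E , F , L ∘ ρ , H })
      (λ { {α , c , ℓ , e} {β , d , l , g} _ _ (E , F , L , H) → E , F , (λ j → trans (cong ℓ (sym (ρ² j))) (trans (L (ρ j)) (cong l (ρ² j)))) , H })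
      (λ { {α , c , ℓ , e} q → _ , QP q , (λ _ → refl) , (λ _ → refl) , (λ j → cong ℓ (sym (ρ² j))) , λ _ → refl })

    lt-≈ : ∀ {y z} → y R₃.≈ z → ∀ j → toℕ (lab y j) ≡ toℕ (lab z j)
    lt-≈ (_ , _ , L , _) j = cong toℕ (L j)

    lab-≢ : ∀ {y} → GluingTriple y → ∀ {i j} → toℕ (lab y i) ≡ toℕ (lab y j) → i ≡ j
    lab-≢ (V , _) e = Lists.inj (Valid.leaf V) (Fₚ.toℕ-injective e)

  -- The positions of the three leaves are distinct, so they are in one of six orders; relabelling
  -- by two transpositions carries the sorted order to each of them.
  card-GluingTriple : ∀ {n} → Card R₃ Sorted n → Card R₃ GluingTriple (6 * n)
  card-GluingTriple {n} c₀ = subst (Card R₃ GluingTriple) (lem n)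
    (card-cong (λ { (inj₁ (g , _)) → g ; (inj₂ (g , _)) → g }) (λ g → split₂ g (ℕₚ.<-cmp _ _))
      (card-⊎ c₁ c₁' λ { (_ , x) (_ , y) e → ℕₚ.<-asym x (subst₂ _<_ (sym (lt-≈ e (suc zero))) (sym (lt-≈ e zero)) y) }))
    where
    lem : ∀ n → (n + (n + n)) + (n + (n + n)) ≡ 6 * n
    lem = solve-∀
    c₂ : Card R₃ (λ y → GluingTriple y × l₀ y < l₂ y × l₂ y < l₁ y) n
    c₂ = card-relabel ρ₁ ρ₁² (λ { (g , x) → glue₁ g , x }) (λ { (g , x) → glue₁ g , x }) c₀
    c₃ : Card R₃ (λ y → GluingTriple y × l₂ y < l₀ y × l₀ y < l₁ y) n
    c₃ = card-relabel ρ₁ ρ₁² {P = λ y → GluingTriple y × l₁ y < l₀ y × l₀ y < l₂ y} (λ { (g , x) → glue₁ g , x }) (λ { (g , x) → glue₁ g , x })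
          (card-relabel ρ₀ ρ₀² (λ { (g , x) → glue₀ g , x }) (λ { (g , x) → glue₀ g , x }) c₀)
    split₁ : ∀ {y} → GluingTriple y → l₀ y < l₁ y → Sorted y ⊎ ((GluingTriple y × l₀ y < l₂ y × l₂ y < l₁ y) ⊎ (GluingTriple y × l₂ y < l₀ y × l₀ y < l₁ y))
    split₁ {y} g x with ℕₚ.<-cmp (l₁ y) (l₂ y) | ℕₚ.<-cmp (l₀ y) (l₂ y)
    ... | tri< a _ _ | _          = inj₁ (g , x , a)
    ... | tri≈ _ a _ | _          = contradiction (lab-≢ g a) λ ()
    ... | tri> _ _ a | tri< b _ _ = inj₂ (inj₁ (g , b , a))
    ... | tri> _ _ a | tri≈ _ b _ = contradiction (lab-≢ g b) λ ()
    ... | tri> _ _ a | tri> _ _ b = inj₂ (inj₂ (g , b , x))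
    c₁ : Card R₃ (λ y → GluingTriple y × l₀ y < l₁ y) (n + (n + n))
    c₁ = card-cong (λ { (inj₁ (g , x , _)) → g , x ; (inj₂ (inj₁ (g , x , y))) → g , ℕₚ.<-trans x y ; (inj₂ (inj₂ (g , _ , x))) → g , x })
           (λ { (g , x) → split₁ g x })
           (card-⊎ c₀ (card-⊎ c₂ c₃ λ { (_ , x , _) (_ , y , _) e → ℕₚ.<-asym x (subst₂ _<_ (sym (lt-≈ e (suc (suc zero)))) (sym (lt-≈ e zero)) y) })
             λ { (_ , x , y) (inj₁ (_ , _ , z)) e → ℕₚ.<-asym y (subst₂ _<_ (sym (lt-≈ e (suc (suc zero)))) (sym (lt-≈ e (suc zero))) z)
               ; (_ , x , y) (inj₂ (_ , z , _)) e → ℕₚ.<-asym (ℕₚ.<-trans x y) (subst₂ _<_ (sym (lt-≈ e (suc (suc zero)))) (sym (lt-≈ e zero)) z) })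
    c₁' : Card R₃ (λ y → GluingTriple y × l₁ y < l₀ y) (n + (n + n))
    c₁' = card-relabel ρ₀ ρ₀² (λ { (g , x) → glue₀ g , x }) (λ { (g , x) → glue₀ g , x }) c₁
    split₂ : ∀ {y} → GluingTriple y → _ → (GluingTriple y × l₀ y < l₁ y) ⊎ (GluingTriple y × l₁ y < l₀ y)
    split₂ g (tri< a _ _) = inj₁ (g , a)
    split₂ g (tri≈ _ a _) = contradiction (lab-≢ g {zero} {suc zero} a) λ ()
    split₂ g (tri> _ _ a) = inj₂ (g , a)

  -- Two monodromies are free and the third is then forced. That one number `a` serves all choices
  -- is supplied by the induction in `leaf-count`.
  card-by-monodromy : ∀ {a} → (∀ h₁ h₂ → Card R₃ (Valid κ (h₁ ◂ h₂ ◂ (h₁ ∙ h₂) ⁻¹ ◂ hs) es) a) → Card R₃ GluingTriple (order * order * a)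
  card-by-monodromy cs = card-map {S = ×-setoid (×-setoid (EqS G) (EqS G)) R₃}
    (card-× {R = λ { (h₁ , h₂) → Valid κ (h₁ ◂ h₂ ◂ (h₁ ∙ h₂) ⁻¹ ◂ hs) es }} (card-⊤× card-G card-G) (λ {h} _ → cs (proj₁ h) (proj₂ h))
      λ { (refl , refl) z → z })
    proj₂
    (λ { {(h₁ , h₂) , y} (_ , V) → let open Valid V in
         monodromies {y = y} V (λ { zero → sym (leaf-mon zero) ; (suc zero) → sym (leaf-mon (suc zero))
                          ; (suc (suc zero)) → sym (leaf-mon (suc (suc zero))) ; (suc (suc (suc j))) → refl }) ,
         trans (cong₂ _∙_ (cong₂ _∙_ (leaf-mon zero) (leaf-mon (suc zero))) (leaf-mon (suc (suc zero)))) (inverseʳ _) })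
    proj₂
    (λ { (_ , V) (_ , W) x@(E , F , L , _) →
         (trans (sym (Valid.leaf-mon V zero)) (trans (mono-cong κ F (L zero)) (Valid.leaf-mon W zero)) ,
          trans (sym (Valid.leaf-mon V (suc zero))) (trans (mono-cong κ F (L (suc zero))) (Valid.leaf-mon W (suc zero)))) , x })
    (λ { {y} (V , e) → ((μ y zero , μ y (suc zero)) , y) ,
         (tt , monodromies {y = y} V (λ { zero → refl ; (suc zero) → refl ; (suc (suc zero)) → inverseʳ-unique _ _ e ; (suc (suc (suc j))) → refl })) ,
         R₃.refl {y} })
    where
    monodromies : ∀ {ks ks'} {y : Raw m (suc (suc (suc p))) r} → Valid κ ks es y → (∀ j → ks j ≡ ks' j) → Valid κ ks' es y
    monodromies V kE = record { core = core ; leaf = leaf ; leaf-mon = λ j → trans (leaf-mon j) (kE j) ; half = half ; half-val = half-val }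
      where open Valid V

  neg-card : ∀ {x ν} → Valid κ hs es x → 6 * ν + 4 * p + 3 * r ≡ suc m + 6 → Card (EqS (Fin (suc m))) (Neg (proj₁ x)) ν
  neg-card {α , c , ℓ , e} {ν} V eq = subst (Card _ _)
    (ℕₚ.*-cancelˡ-≡ _ _ 6 (ℕₚ.+-cancelʳ-≡ (4 * p) _ _ (ℕₚ.+-cancelʳ-≡ (3 * r) _ _
      (trans (NegativeCount.negative-count α invol cub (lists⇒card leaf) (lists⇒card half)) (sym eq)))))
    (card-sum (neg? α))
    where open Valid V using (invol; cub; leaf; half)

  trisection : ∀ {A a ν} → 6 * ν + 4 * p + 3 * r ≡ suc m + 6 → Card R₀ (Valid κ hs es) A →
    (∀ h₁ h₂ → Card R₃ (Valid κ (h₁ ◂ h₂ ◂ (h₁ ∙ h₂) ⁻¹ ◂ hs) es) a) → 6 * (A * ν) ≡ order * order * a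
  trisection {ν = ν} eq cA cs = card-unique
    (card-GluingTriple (card-Sorted (card-× {R = λ x → Neg (proj₁ x)} cA (λ V → neg-card V eq)
      λ { {x} {y} {a} (E , _) → subst₂ (λ v w → toℕ a < toℕ v × toℕ v < toℕ w) (vert² E a) (E (next a)) })))
    (card-by-monodromy cs)

-- Splitting a negative vertex lowers their number by two.
genus-exists : ∀ (𝔾 : FinAb) (κ : FinAb.G 𝔾) k {m p r hs es ν} {x : Maps.Raw 𝔾 m p r} → ν ≤ k → Maps.Valid 𝔾 κ hs es x →
  6 * ν + 4 * p + 3 * r ≡ suc m + 6 → ∃[ f ] 12 * f + 4 * p + 3 * r ≡ suc m + 6
genus-exists 𝔾 κ k {ν = zero} _ V eq = 0 , eq
genus-exists 𝔾 κ (suc k) {m} {p} {r} {hs} {es} {suc ν} {x} (s≤s ν≤k) V eq =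
  let f , e = genus-exists 𝔾 κ k {ν = ν'} ν'≤k (proj₁ (proj₁ glued)) eq'
  in suc f , trans (cong (λ z → z + 4 * p + 3 * r) (ℕₚ.*-suc 12 f)) (trans (sym (lem 12 f p r)) e)
  where
  open Trisection 𝔾 κ hs es
  neg = neg-card {ν = suc ν} V eq
  glued = split-sorted {x , Card.enum neg zero} (V , Card.sound neg zero)
  W = proj₁ (proj₁ glued)
  open Maps.Valid W using (invol; cub; leaf; half; α)
  ν' = sumℕ (λ i → ⟦ neg? α i ⟧)
  eq' : 6 * ν' + 4 * suc (suc (suc p)) + 3 * r ≡ suc m + 6
  eq' = NegativeCount.negative-count α invol cub (lists⇒card leaf) (lists⇒card half)
  lem : ∀ k f p r → k * f + 4 * (3 + p) + 3 * r ≡ (12 + k * f) + 4 * p + 3 * r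
  lem = solve-∀
  lem' : ∀ ν → 12 + 6 * ν ≡ 6 * (2 + ν)
  lem' = solve-∀
  -- Three more leaves at the same M add 12 to 4p, so 6ν drops by 12; in particular a single
  -- negative vertex is impossible.
  ν≡ : 2 + ν' ≡ suc ν
  ν≡ = ℕₚ.*-cancelˡ-≡ _ _ 6 (ℕₚ.+-cancelʳ-≡ (4 * p) _ _ (ℕₚ.+-cancelʳ-≡ (3 * r) _ _
    (trans (cong (λ z → z + 4 * p + 3 * r) (sym (lem' ν'))) (trans (sym (lem 6 ν' p r)) (trans eq' (sym eq))))))
  ν'≤k : ν' ≤ k
  ν'≤k = ℕₚ.≤-trans (ℕₚ.n≤1+n ν') (subst (_≤ k) (ℕₚ.suc-injective (sym ν≡)) ν≤k)

-- The number of labelled one-face maps with prescribed monodromies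

module LabelledCount (𝔾 : FinAb) where
  open FinAb 𝔾
  open Maps 𝔾
  open Sum commutativeMonoid using () renaming (sum to sumG)

  valid-labels : ∀ {m p r κ hs hs' es es'} {x : Raw m p r} → hs ≗ hs' → es ≗ es' → Valid κ hs es x → Valid κ hs' es' x
  valid-labels e e' V = record { core = core ; leaf = leaf ; leaf-mon = λ j → trans (leaf-mon j) (e j)
                               ; half = half ; half-val = λ j → trans (half-val j) (e' j) }
    where open Valid V using (core; leaf; leaf-mon; half; half-val)

  card-labels : ∀ {m p r κ hs hs' es es' A} → hs ≗ hs' → es ≗ es' → Card (RawS m p r) (Valid κ hs es) A → Card (RawS m p r) (Valid κ hs' es') A
  card-labels e e' = card-cong (valid-labels e e') (valid-labels (λ j → sym (e j)) (λ j → sym (e' j)))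

  private
    -- `half-leaf` read backwards: the first leaf is turned into a half-edge at the root, ready to
    -- be removed.
    from-root : ∀ {m p A} κ (hs : Fin (suc p) → G) → Card (RawS (suc m) (suc p) 0) (Valid κ hs (λ ())) A →
      ∃[ B ] (Card (RawS m p 1) (λ x → Valid κ (hs ∘ suc) (λ _ → hs zero ⁻¹) x × proj₂ (proj₂ (proj₂ x)) zero ≡ zero) B × A ≡ suc (suc m) * B)
    from-root {m} {p} κ hs cA =
      let B , cB , _ , e = HalfEdgeToLeaf.half-leaf 𝔾 κ {m} {p} {0} {hs ∘ suc} {λ _ → hs zero ⁻¹}
                             (proj₂ (card-Valid κ (hs ∘ suc) (λ _ → hs zero ⁻¹)))
                             (card-labels (λ { zero → sym (⁻¹-involutive _) ; (suc j) → refl }) (λ ()) cA)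
      in B , cB , e

    -- The smallest tree: its only position is a half-edge and its only corner a leaf. Going round
    -- the face picks up `e₀` and `κ`, and this is the monodromy of the leaf.
    stick : ∀ κ (hs : Fin 1 → G) e₀ → e₀ ∙ κ ≡ hs zero →
      Card (RawS 0 1 1) (λ x → Valid κ hs (λ _ → e₀) x × proj₂ (proj₂ (proj₂ x)) zero ≡ zero) 1
    stick κ hs e₀ eq = card-1 x₀ (V , refl) (λ { {α , c , ℓ , e} (W , e0) →
        (λ { zero → one (α zero) }) , (λ { zero → trans (cong c (sym (one (e zero)))) (Valid.half-val W zero) }) ,
        (λ { zero → one (ℓ zero) }) , (λ { zero → one (e zero) }) })
      where
      one : (i : Fin 1) → i ≡ zero
      one zero = refl
      x₀ : Raw 0 1 1
      x₀ = id , (λ _ → e₀) , (λ _ → zero) , (λ _ → zero)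
      V : Valid κ hs (λ _ → e₀) x₀
      V = record
        { core = record { invol = λ _ → refl ; anti = λ i ne → ⊥-elim (ne refl) ; cub = λ { zero → refl }
                        ; mon = λ { zero ne → ⊥-elim (ne refl) } }
        ; leaf = record { all = λ _ → refl ; inj = λ { {zero} {zero} _ → refl } ; hit = λ { {zero} _ → zero , refl } }
        ; leaf-mon = λ { zero → eq }
        ; half = record { all = λ _ → refl ; inj = λ { {zero} {zero} _ → refl } ; hit = λ { {zero} _ → zero , refl } }
        ; half-val = λ _ → refl }

  -- A plane cubic tree with 2 + q leaves has 2 + 4q positions. Its first leaf is made a half-edge
  -- at the root, at the cost of a factor M, and then removed with its vertex; `κ` absorbs its
  -- monodromy, so the sum condition persists. The factorials come from (q + 1)(4q + 2) = (2q +
  -- 2)(2q + 1).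
  planar-count : ∀ q {m κ} (hs : Fin (2 + q) → G) {A} → suc m ≡ 2 + 4 * q → sumG hs ≡ κ →
    Card (RawS m (2 + q) 0) (Valid κ hs (λ ())) A → A * q ! ≡ suc m * (2 * q) !
  planar-count zero {κ = κ} hs refl Σ≡ cA =
    let B , cB , e = from-root κ hs cA
    in trans (ℕₚ.*-identityʳ _) (trans e (cong (2 *_) (card-unique cB (stick κ (hs ∘ suc) (hs zero ⁻¹) eq))))
    where
    eq : hs zero ⁻¹ ∙ κ ≡ hs (suc zero)
    eq = trans (cong (hs zero ⁻¹ ∙_) (trans (sym Σ≡) (cong (hs zero ∙_) (identityʳ _))))
           (trans (sym (assoc _ _ _)) (trans (cong (_∙ hs (suc zero)) (inverseˡ _)) (identityˡ _)))
  planar-count (suc q) {m} {κ} hs {A} M≡ Σ≡ cA with ℕₚ.suc-injective (trans M≡ (lem q))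
    where
    lem : ∀ q → 2 + 4 * (1 + q) ≡ 6 + 4 * q
    lem = solve-∀
  ... | refl =
    let B , cB , e = from-root κ hs cA
        A″ , cA″ = card-Valid {suc (4 * q)} {2 + q} {0} (κ ∙ hs zero ⁻¹) (hs ∘ suc) (λ ())
        B≡A″ = RemoveHalfEdge.remove-half 𝔾 κ (hs zero ⁻¹) refl cA″ cB
        ih = planar-count q (hs ∘ suc) refl Σ′ cA″
    in begin
      A * (suc q * q !)                         ≡⟨ cong (_* (suc q * q !)) (trans e (cong ((6 + 4 * q) *_) B≡A″)) ⟩
      (6 + 4 * q) * A″ * (suc q * q !)          ≡⟨ lem₁ (6 + 4 * q) A″ (suc q) (q !) ⟩
      (6 + 4 * q) * (suc q * (A″ * q !))        ≡⟨ cong (λ z → (6 + 4 * q) * (suc q * z)) ih ⟩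
      (6 + 4 * q) * (suc q * ((2 + 4 * q) * (2 * q) !)) ≡⟨ cong ((6 + 4 * q) *_) (lem₂ q ((2 * q) !)) ⟩
      (6 + 4 * q) * ((2 + 2 * q) * ((1 + 2 * q) * (2 * q) !)) ≡⟨ cong (λ z → (6 + 4 * q) * z !) (lem₃ q) ⟩
      (6 + 4 * q) * (2 * suc q) ! ∎
    where
    open ≡-Reasoning
    lem₁ : ∀ a b c d → a * b * (c * d) ≡ a * (c * (b * d))
    lem₁ = solve-∀
    lem₂ : ∀ q F → (1 + q) * ((2 + 4 * q) * F) ≡ (2 + 2 * q) * ((1 + 2 * q) * F)
    lem₂ = solve-∀
    lem₃ : ∀ q → 2 + 2 * q ≡ 2 * (1 + q)
    lem₃ = solve-∀
    Σ′ : sumG (hs ∘ suc) ≡ κ ∙ hs zero ⁻¹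
    Σ′ = trans (sym (identityʳ _)) (trans (cong (sumG (hs ∘ suc) ∙_) (sym (inverseʳ (hs zero))))
           (trans (sym (assoc _ _ _)) (cong (_∙ hs zero ⁻¹) (trans (comm _ _) Σ≡))))

  private
    K : ℕ → ℕ → ℕ
    K f q = 12 ^ f * (f ! * q !)

    K≢0 : ∀ f q → NonZero (K f q)
    K≢0 f q = ℕₚ.m*n≢0 (12 ^ f) (f ! * q !) {{ℕₚ.m^n≢0 12 f}} {{ℕₚ.m*n≢0 (f !) (q !) {{ℕₚ._!≢0 f}} {{ℕₚ._!≢0 q}}}}

  -- Both M and q = 3f + p - 2 stay the same when f drops by one and p grows by three, so each
  -- trisection contributes only the factor |G|² / 12f.
  leaf-count : ∀ f {p q m κ} (hs : Fin p → G) {A} → 3 * f + p ≡ 2 + q → suc m + 6 ≡ 12 * f + 4 * p → sumG hs ≡ κ →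
    Card (RawS m p 0) (Valid κ hs (λ ())) A → A * (12 ^ f * (f ! * q !)) ≡ suc m * ((order * order) ^ f * (2 * q) !)
  leaf-count zero {q = q} {m} {κ} hs {A} refl M≡ Σ≡ cA = trans (cong (A *_) (lem₁ (q !)))
    (trans (planar-count q hs (ℕₚ.+-cancelʳ-≡ 6 _ _ (trans M≡ (lem₂ q))) Σ≡ cA) (cong (suc m *_) (sym (ℕₚ.*-identityˡ ((2 * q) !)))))
    where
    lem₁ : ∀ x → 1 * (1 * x) ≡ x
    lem₁ = solve-∀
    lem₂ : ∀ q → 12 * 0 + 4 * (2 + q) ≡ 2 + 4 * q + 6
    lem₂ = solve-∀
  leaf-count (suc f) {p} {q} {m} {κ} hs {A} p≡ M≡ Σ≡ cA = begin
    A * (12 * 12 ^ f * (suc f * f ! * q !))         ≡⟨ lem₁ A (12 ^ f) f (f !) (q !) ⟩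
    6 * (A * (2 * suc f)) * K f q                   ≡⟨ cong (_* K f q) (trisection {ν = 2 * suc f} ν≡ cA cards) ⟩
    order * order * a * K f q                       ≡⟨ lem₂ (order * order) a (K f q) ⟩
    order * order * (a * K f q)                     ≡⟨ cong (order * order *_) (count-of ε ε ca) ⟩
    order * order * (suc m * ((order * order) ^ f * (2 * q) !)) ≡⟨ lem₃ (order * order) (suc m) ((order * order) ^ f) ((2 * q) !) ⟩
    suc m * (order * order * (order * order) ^ f * (2 * q) !) ∎
    where
    open ≡-Reasoning
    open Trisection 𝔾 κ {m} {p} {0} hs (λ ()) using (trisection)
    lem₁ : ∀ A t f F Q → A * (12 * t * ((1 + f) * F * Q)) ≡ 6 * (A * (2 * (1 + f))) * (t * (F * Q))
    lem₁ = solve-∀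
    lem₂ : ∀ o a k → o * a * k ≡ o * (a * k)
    lem₂ = solve-∀
    lem₃ : ∀ o M P F → o * (M * (P * F)) ≡ M * (o * P * F)
    lem₃ = solve-∀
    lem₄ : ∀ f p → 6 * (2 * (1 + f)) + 4 * p + 3 * 0 ≡ 12 * (1 + f) + 4 * p
    lem₄ = solve-∀
    lem₅ : ∀ f p → 3 * f + (3 + p) ≡ 3 * (1 + f) + p
    lem₅ = solve-∀
    lem₆ : ∀ f p → 12 * (1 + f) + 4 * p ≡ 12 * f + 4 * (3 + p)
    lem₆ = solve-∀
    ν≡ : 6 * (2 * suc f) + 4 * p + 3 * 0 ≡ suc m + 6
    ν≡ = trans (lem₄ f p) (sym M≡)
    Σ₃ : ∀ h₁ h₂ → sumG (h₁ ◂ h₂ ◂ (h₁ ∙ h₂) ⁻¹ ◂ hs) ≡ κ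
    Σ₃ h₁ h₂ = trans (sym (assoc _ _ _)) (trans (sym (assoc _ _ _)) (trans (cong (_∙ sumG hs) (inverseʳ _)) (trans (identityˡ _) Σ≡)))
    count-of : ∀ h₁ h₂ {n} → Card (RawS m (3 + p) 0) (Valid κ (h₁ ◂ h₂ ◂ (h₁ ∙ h₂) ⁻¹ ◂ hs) (λ ())) n →
      n * K f q ≡ suc m * ((order * order) ^ f * (2 * q) !)
    count-of h₁ h₂ = leaf-count f {q = q} _ (trans (lem₅ f p) p≡) (trans M≡ (lem₆ f p)) (Σ₃ h₁ h₂)
    a = proj₁ (card-Valid {m} {3 + p} {0} κ (ε ◂ ε ◂ (ε ∙ ε) ⁻¹ ◂ hs) (λ ()))
    ca = proj₂ (card-Valid {m} {3 + p} {0} κ (ε ◂ ε ◂ (ε ∙ ε) ⁻¹ ◂ hs) (λ ()))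
    -- By induction the counts for all pairs `h₁`, `h₂` satisfy the same equation, so they agree
    -- after cancelling the nonzero `K f q`.
    cards : ∀ h₁ h₂ → Card (RawS m (3 + p) 0) (Valid κ (h₁ ◂ h₂ ◂ (h₁ ∙ h₂) ⁻¹ ◂ hs) (λ ())) a
    cards h₁ h₂ = let n , c = card-Valid κ (h₁ ◂ h₂ ◂ (h₁ ∙ h₂) ⁻¹ ◂ hs) (λ ())
      in subst (Card _ _) (ℕₚ.*-cancelʳ-≡ n a (K f q) {{K≢0 f q}} (trans (count-of h₁ h₂ {n} c) (sym (count-of ε ε {a} ca)))) c

  -- Half-edges are traded one by one for leaves of inverse monodromy, M growing by one each time.
  -- The rooted count `B` is common to both sides, so M enters only as the outer factor; the sum
  -- condition just moves `es zero` across.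
  labelled-count : ∀ r {f p q m κ} (hs : Fin p → G) (es : Fin r → G) {A} → 3 * f + (p + r) ≡ 2 + q → suc m + 6 ≡ 12 * f + 4 * p + 3 * r →
    sumG hs ≡ κ ∙ sumG es → Card (RawS m p r) (Valid κ hs es) A →
    A * (12 ^ f * (f ! * q !)) ≡ suc m * ((order * order) ^ f * (2 * q) !)
  labelled-count zero {f} {p} hs es p≡ M≡ Σ≡ cA = leaf-count f hs (trans (cong (3 * f +_) (sym (ℕₚ.+-identityʳ p))) p≡)
    (trans M≡ (ℕₚ.+-identityʳ _)) (trans Σ≡ (identityʳ _)) (card-labels (λ _ → refl) (λ ()) cA)
  labelled-count (suc r) {f} {p} {q} {m} {κ} hs es {A} p≡ M≡ Σ≡ cA =
    let A′ , cA′ = card-Valid {suc m} {suc p} {r} κ (es zero ⁻¹ ◂ hs) (es ∘ suc)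
        B , _ , e , e′ = HalfEdgeToLeaf.half-leaf 𝔾 κ cA cA′
        ih = labelled-count r {f} {suc p} {q} {suc m} (es zero ⁻¹ ◂ hs) (es ∘ suc)
               (trans (cong (3 * f +_) (sym (ℕₚ.+-suc p r))) p≡) (trans (cong suc M≡) (lem₁ f p r)) Σ′ cA′
        BK≡ = ℕₚ.*-cancelˡ-≡ (B * K f q) X (suc (suc m)) (trans (sym (ℕₚ.*-assoc (suc (suc m)) B (K f q))) (trans (cong (_* K f q) (sym e′)) ih))
    in trans (cong (_* K f q) e) (trans (ℕₚ.*-assoc (suc m) B (K f q)) (cong (suc m *_) BK≡))
    where
    X = (order * order) ^ f * (2 * q) !
    lem₁ : ∀ f p r → 1 + (12 * f + 4 * p + 3 * (1 + r)) ≡ 12 * f + 4 * (1 + p) + 3 * r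
    lem₁ = solve-∀
    Σ′ : es zero ⁻¹ ∙ sumG hs ≡ κ ∙ sumG (es ∘ suc)
    Σ′ = trans (cong (es zero ⁻¹ ∙_) (trans Σ≡ (trans (comm _ _) (assoc _ _ _)))) (trans (sym (assoc _ _ _))
      (trans (cong (_∙ (sumG (es ∘ suc) ∙ κ)) (inverseˡ _)) (trans (identityˡ _) (comm _ _))))

-- The product of all monodromies

module MonodromySum (𝔾 : FinAb) where
  open FinAb 𝔾
  open Maps 𝔾
  open Sum commutativeMonoid using () renaming
    (sum to sumG; sum-cong-≗ to sumG-cong; ∑-distrib-+ to sumG-∙; sum-permute to sumG-permute; sum-replicate-zero to sumG-ε)
  open CMSolver commutativeMonoid using (solve; _⊜_) renaming (_⊕_ to infixl 6 _⊞_)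

  sumG-bij : ∀ {n} (f : Fin n → G) (p q : Fin n → Fin n) → (∀ i → p (q i) ≡ i) → (∀ i → q (p i) ≡ i) → sumG f ≡ sumG (f ∘ p)
  sumG-bij f p q pq qp = sumG-permute f (Perm.permutation p q pq qp)

  sumG-wrap : ∀ m κ → sumG (wrap {m} κ) ≡ κ
  sumG-wrap zero    κ = identityʳ κ
  sumG-wrap (suc m) κ = trans (identityˡ _) (trans (sumG-cong wrap-suc) (sumG-wrap m κ))
    where
    wrap-suc : ∀ i → wrap κ (suc i) ≡ wrap {m} κ i
    wrap-suc i with view i
    ... | ‵fromℕ  = refl
    ... | ‵inj₁ _ = refl

  sumG-mono : ∀ {m} κ (c : Fin (suc m) → G) → sumG (mono κ c) ≡ sumG c ∙ κ
  sumG-mono {m} κ c = trans (sumG-∙ (c ∘ next) (wrap κ))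
    (cong₂ _∙_ (sym (sumG-bij c next prev next-prev prev-next)) (sumG-wrap m κ))

  -- The face monodromy is killed by 6: vertices contribute 3-torsion, edges 2-torsion.
  six-torsion : ∀ {m κ} (α : Fin (suc m) → Fin (suc m)) c → (∀ i → α (α i) ≡ i) → (∀ i → c i ∙ c (α i) ≡ ε) →
    (∀ i → vert α (vert α (vert α i)) ≡ i) → (∀ i → mono κ c i ∙ mono κ c (vert α i) ∙ mono κ c (vert α (vert α i)) ≡ ε) →
    κ ∙ κ ∙ κ ∙ κ ∙ κ ∙ κ ≡ ε
  -- In additive notation 2y = 0 and 3(y + κ) = 0, hence 6κ = 6(y + κ) - 6y = 0.
  six-torsion {m} {κ} α c invol anti cub mon = trans (sym (identityˡ _)) (trans (cong (_∙ (κ ∙ κ ∙ κ ∙ κ ∙ κ ∙ κ)) (sym y6))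
    (trans (solve 2 (λ y k → y ⊞ y ⊞ (y ⊞ y) ⊞ (y ⊞ y) ⊞ (k ⊞ k ⊞ k ⊞ k ⊞ k ⊞ k)
                          ⊜ (y ⊞ k) ⊞ (y ⊞ k) ⊞ (y ⊞ k) ⊞ ((y ⊞ k) ⊞ (y ⊞ k) ⊞ (y ⊞ k))) refl y κ)
      (trans (cong (λ z → z ∙ z ∙ z ∙ (z ∙ z ∙ z)) (sym (sumG-mono κ c))) (trans (cong₂ _∙_ x3 x3) (identityˡ _)))))
    where
    v = vert α
    x = sumG (mono κ c)
    y = sumG c
    turn : (f : Fin (suc m) → G) → sumG f ≡ sumG (f ∘ v)
    turn f = sumG-bij f v (v ∘ v) cub cub
    y2 : y ∙ y ≡ ε
    y2 = trans (cong (y ∙_) (sumG-bij c α α invol invol)) (trans (sym (sumG-∙ c (c ∘ α))) (trans (sumG-cong anti) (sumG-ε (suc m))))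
    y6 : y ∙ y ∙ (y ∙ y) ∙ (y ∙ y) ≡ ε
    y6 = trans (cong (λ z → z ∙ z ∙ z) y2) (trans (identityʳ _) (identityʳ _))
    x3 : x ∙ x ∙ x ≡ ε
    x3 = trans (cong₂ _∙_ (cong (x ∙_) (turn (mono κ c))) (trans (turn (mono κ c)) (turn (mono κ c ∘ v))))
      (trans (cong (_∙ sumG (mono κ c ∘ v ∘ v)) (sym (sumG-∙ (mono κ c) (mono κ c ∘ v))))
        (trans (sym (sumG-∙ (λ i → mono κ c i ∙ mono κ c (v i)) (mono κ c ∘ v ∘ v))) (trans (sumG-cong mon) (sumG-ε (suc m)))))

  sel : {P : Set} → Dec P → G → G
  sel (yes _) g = g
  sel (no _)  g = ε

  sel-yes : {P : Set} (d : Dec P) → P → ∀ g → sel d g ≡ g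
  sel-yes (yes _) p g = refl
  sel-yes (no ¬p) p g = ⊥-elim (¬p p)

  sel-no : {P : Set} (d : Dec P) → ¬ P → ∀ g → sel d g ≡ ε
  sel-no (no _)  ¬p g = refl
  sel-no (yes p) ¬p g = ⊥-elim (¬p p)

  sel-cong : {P Q : Set} (d : Dec P) (d' : Dec Q) → (P → Q) → (Q → P) → ∀ g → sel d g ≡ sel d' g
  sel-cong (yes p) d' f h g = sym (sel-yes d' (f p) g)
  sel-cong (no ¬p) d' f h g = sym (sel-no d' (¬p ∘ h) g)

  sel-∙ : {P : Set} (d : Dec P) → ∀ g h → sel d g ∙ sel d h ≡ sel d (g ∙ h)
  sel-∙ (yes _) g h = refl
  sel-∙ (no _)  g h = identityˡ ε

  sum-single : ∀ {n} (a : Fin n) (f : Fin n → G) → sumG (λ i → sel (i Fₚ.≟ a) (f i)) ≡ f a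
  sum-single {suc n} zero f = trans (cong (f zero ∙_) (sumG-ε n)) (identityʳ _)
  sum-single {suc n} (suc a) f = trans (identityˡ _)
    (trans (sumG-cong (λ i → sel-cong (suc i Fₚ.≟ suc a) (i Fₚ.≟ a) Fₚ.suc-injective (cong suc) (f (suc i)))) (sum-single a (f ∘ suc)))

  sum-lists : ∀ {n p} {P : Fin n → Set} (P? : ∀ i → Dec (P i)) {v : Fin p → Fin n} (f : Fin n → G) → Lists P v →
    sumG (λ i → sel (P? i) (f i)) ≡ sumG (f ∘ v)
  sum-lists {n} {zero} P? f L = trans (sumG-cong (λ i → sel-no (P? i) (λ q → contradiction (proj₁ (Lists.hit L q)) λ ()) (f i))) (sumG-ε n)
  sum-lists {n} {suc p} {P} P? {v} f L = trans (sumG-cong split)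
    (trans (sumG-∙ (λ i → sel (i Fₚ.≟ v zero) (f i)) (λ i → sel (P'? i) (f i))) (cong₂ _∙_ (sum-single (v zero) f) (sum-lists P'? f (lists-∷ L))))
    where
    open Lists L
    P' : Fin n → Set
    P' i = P i × i ≢ v zero
    P'? : ∀ i → Dec (P' i)
    P'? i = P? i ×-dec ¬? (i Fₚ.≟ v zero)
    split : ∀ i → sel (P? i) (f i) ≡ sel (i Fₚ.≟ v zero) (f i) ∙ sel (P'? i) (f i)
    split i with i Fₚ.≟ v zero
    ... | yes e = trans (sel-yes (P? i) (subst P (sym e) (all zero)) (f i))
            (sym (trans (cong (f i ∙_) (sel-no (P? i ×-dec no (λ ne → ne e)) (λ { (_ , ne) → ne e }) (f i))) (identityʳ _)))
    ... | no ne = trans (sel-cong (P? i) (P? i ×-dec yes ne) (λ q → q , ne) proj₁ (f i)) (sym (identityˡ _))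

  module _ {m p r} {κ : G} {hs : Fin p → G} {es : Fin r → G} {x : Raw m p r} (V : Valid κ hs es x) where
    open Valid V using (α; c; invol; anti; cub; mon; leaf; leaf-mon; half; half-val; vert-injective)
    private
      v = vert α
      μ = mono κ c
      N : ℕ
      N = suc m
      Rep : Fin N → Set
      Rep i = toℕ i < toℕ (v i) × toℕ i < toℕ (v (v i))
      rep? : ∀ i → Dec (Rep i)
      rep? i = (toℕ i ℕₚ.<? toℕ (v i)) ×-dec (toℕ i ℕₚ.<? toℕ (v (v i)))

      leaf? : ∀ i → Dec (v i ≡ i)
      leaf? i = v i Fₚ.≟ i

      Rep-v : ∀ {i} → Rep (v i) → toℕ (v i) < toℕ (v (v i)) × toℕ (v i) < toℕ i
      Rep-v {i} (a , b) = a , subst (λ z → toℕ (v i) < toℕ z) (cub i) b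
      Rep-vv : ∀ {i} → Rep (v (v i)) → toℕ (v (v i)) < toℕ i × toℕ (v (v i)) < toℕ (v i)
      Rep-vv {i} (a , b) = subst (λ z → toℕ (v (v i)) < toℕ z) (cub i) a , subst (λ z → toℕ (v (v i)) < toℕ z) (cong v (cub i)) b

      -- Summing over orbits as in `six-torsion` would only give three times the total and lose the
      -- 3-torsion. Therefore the corners of each cubic vertex are collected at its least corner
      -- `Rep`.
      cubic-split : ∀ i → μ i ≡ sel (leaf? i) (μ i) ∙ (sel (rep? i) (μ i) ∙ sel (rep? (v i)) (μ i) ∙ sel (rep? (v (v i))) (μ i))
      cubic-split i with leaf? i
      ... | yes e = sym (trans (cong (μ i ∙_) (trans (cong₂ _∙_ (cong₂ _∙_ (none (rep? i) n₁) (none (rep? (v i)) n₂)) (none (rep? (v (v i))) n₃))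
                      (trans (identityʳ _) (identityʳ _)))) (identityʳ _))
        where
        none : {P : Set} (d : Dec P) → ¬ P → sel d (μ i) ≡ ε
        none d np = sel-no d np (μ i)
        n₁ : ¬ Rep i
        n₁ (a , _) = ℕₚ.<-irrefl (cong toℕ (sym e)) a
        n₂ : ¬ Rep (v i)
        n₂ (a , _) = ℕₚ.<-irrefl (cong (toℕ ∘ v) (sym e)) a
        n₃ : ¬ Rep (v (v i))
        n₃ (a , _) = ℕₚ.<-irrefl (cong (toℕ ∘ v ∘ v) (sym e)) a
      ... | no ne with ℕₚ.<-cmp (toℕ i) (toℕ (v i)) | ℕₚ.<-cmp (toℕ (v i)) (toℕ (v (v i))) | ℕₚ.<-cmp (toℕ i) (toℕ (v (v i)))
      ... | tri≈ _ e _ | _ | _ = ⊥-elim (ne (sym (Fₚ.toℕ-injective e)))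
      ... | _ | tri≈ _ e _ | _ = ⊥-elim (ne (sym (vert-injective (Fₚ.toℕ-injective e))))
      ... | _ | _ | tri≈ _ e _ = ⊥-elim (ne (trans (cong v (Fₚ.toℕ-injective e)) (cub i)))
      ... | tri< a _ _ | _ | tri< b _ _ = sym (trans (identityˡ _) (trans (cong₂ _∙_ (cong₂ _∙_ (sel-yes (rep? i) (a , b) (μ i))
              (sel-no (rep? (v i)) (λ z → ℕₚ.<-asym a (proj₂ (Rep-v z))) (μ i))) (sel-no (rep? (v (v i))) (λ z → ℕₚ.<-asym b (proj₁ (Rep-vv z))) (μ i)))
              (trans (identityʳ _) (identityʳ _))))
      ... | tri> _ _ a | tri< b _ _ | _ = sym (trans (identityˡ _) (trans (cong₂ _∙_ (cong₂ _∙_ (sel-no (rep? i) (λ z → ℕₚ.<-asym a (proj₁ z)) (μ i))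
              (sel-yes (rep? (v i)) (b , subst (λ z → toℕ (v i) < toℕ z) (sym (cub i)) a) (μ i)))
              (sel-no (rep? (v (v i))) (λ z → ℕₚ.<-asym b (proj₂ (Rep-vv z))) (μ i))) (trans (identityʳ _) (identityˡ _))))
      ... | _ | tri> _ _ a | tri> _ _ b = sym (trans (identityˡ _) (trans (cong₂ _∙_ (cong₂ _∙_ (sel-no (rep? i) (λ z → ℕₚ.<-asym b (proj₂ z)) (μ i))
              (sel-no (rep? (v i)) (λ z → ℕₚ.<-asym a (proj₁ (Rep-v z))) (μ i)))
              (sel-yes (rep? (v (v i))) (subst (λ z → toℕ (v (v i)) < toℕ z) (sym (cub i)) b , subst (λ z → toℕ (v (v i)) < toℕ z) (sym (cong v (cub i))) a) (μ i)))
              (trans (cong (_∙ μ i) (identityʳ _)) (identityˡ _))))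
      ... | tri< a _ _ | tri< b _ _ | tri> _ _ d = ⊥-elim (ℕₚ.<-asym d (ℕₚ.<-trans a b))
      ... | tri> _ _ a | tri> _ _ b | tri< d _ _ = ⊥-elim (ℕₚ.<-asym d (ℕₚ.<-trans b a))

      turn : (f : Fin N → G) → sumG f ≡ sumG (f ∘ v)
      turn f = sumG-bij f v (v ∘ v) cub cub

      shift₁ : sumG (λ i → sel (rep? (v i)) (μ i)) ≡ sumG (λ i → sel (rep? i) (μ (v (v i))))
      shift₁ = trans (turn (λ i → sel (rep? (v i)) (μ i))) (trans (turn (λ i → sel (rep? (v (v i))) (μ (v i)))) (sumG-cong λ i → sel-cong (rep? (v (v (v i)))) (rep? i) (subst Rep (cub i)) (subst Rep (sym (cub i))) (μ (v (v i)))))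

      shift₂ : sumG (λ i → sel (rep? (v (v i))) (μ i)) ≡ sumG (λ i → sel (rep? i) (μ (v i)))
      shift₂ = trans (turn (λ i → sel (rep? (v (v i))) (μ i))) (sumG-cong λ i → sel-cong (rep? (v (v (v i)))) (rep? i) (subst Rep (cub i)) (subst Rep (sym (cub i))) (μ (v i)))

      around : ∀ i → sel (rep? i) (μ i) ∙ sel (rep? i) (μ (v (v i))) ∙ sel (rep? i) (μ (v i)) ≡ ε
      around i = trans (cong (_∙ sel (rep? i) (μ (v i))) (sel-∙ (rep? i) _ _)) (trans (sel-∙ (rep? i) _ _) (zero-sum (rep? i)))
        where
        zero-sum : (d : Dec (Rep i)) → sel d (μ i ∙ μ (v (v i)) ∙ μ (v i)) ≡ ε
        zero-sum (no _) = refl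
        zero-sum (yes (a , _)) = trans (solve 3 (λ x y z → x ⊞ z ⊞ y ⊜ x ⊞ y ⊞ z) refl (μ i) (μ (v i)) (μ (v (v i))))
          (mon i (λ e → ℕₚ.<-irrefl (cong toℕ (sym e)) a))

    leaf-sum : sumG μ ≡ sumG hs
    leaf-sum = trans (sumG-cong cubic-split)
      (trans (sumG-∙ (λ i → sel (leaf? i) (μ i)) (λ i → r₀ i ∙ r₁ i ∙ r₂ i))
        (trans (cong₂ _∙_ (trans (sum-lists leaf? μ leaf) (sumG-cong leaf-mon)) rest) (identityʳ _)))
      where
      r₀ r₁ r₂ : Fin N → G
      r₀ i = sel (rep? i) (μ i)
      r₁ i = sel (rep? (v i)) (μ i)
      r₂ i = sel (rep? (v (v i))) (μ i)
      s₁ s₂ : Fin N → G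
      s₁ i = sel (rep? i) (μ (v (v i)))
      s₂ i = sel (rep? i) (μ (v i))
      rest : sumG (λ i → r₀ i ∙ r₁ i ∙ r₂ i) ≡ ε
      rest = trans (sumG-∙ (λ i → r₀ i ∙ r₁ i) r₂) (trans (cong₂ _∙_ (trans (sumG-∙ r₀ r₁) (cong (sumG r₀ ∙_) shift₁)) shift₂)
        (trans (cong (_∙ sumG s₂) (sym (sumG-∙ r₀ s₁))) (trans (sym (sumG-∙ (λ i → r₀ i ∙ s₁ i) s₂)) (trans (sumG-cong around) (sumG-ε N)))))

    half-sum : sumG c ≡ sumG es
    half-sum = trans (sumG-cong edge-split) (trans (sumG-∙ (λ i → sel (half? i) (c i)) (λ i → up i ∙ down i))
      (trans (cong₂ _∙_ (trans (sum-lists half? c half) (sumG-cong half-val)) rest) (identityʳ _)))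
      where
      half? : ∀ i → Dec (α i ≡ i)
      half? i = α i Fₚ.≟ i
      lt? : ∀ i j → Dec (toℕ {N} i < toℕ {N} j)
      lt? i j = toℕ i ℕₚ.<? toℕ j
      up down : Fin N → G
      up i = sel (lt? i (α i)) (c i)
      down i = sel (lt? (α i) i) (c i)
      edge-split : ∀ i → c i ≡ sel (half? i) (c i) ∙ (up i ∙ down i)
      edge-split i with half? i
      ... | yes e = sym (trans (cong (c i ∙_) (trans (cong₂ _∙_ (sel-no (lt? i (α i)) (ℕₚ.<-irrefl (cong toℕ (sym e))) (c i))
                      (sel-no (lt? (α i) i) (ℕₚ.<-irrefl (cong toℕ e)) (c i))) (identityʳ _))) (identityʳ _))
      ... | no ne with ℕₚ.<-cmp (toℕ i) (toℕ (α i))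
      ... | tri≈ _ e _ = ⊥-elim (ne (sym (Fₚ.toℕ-injective e)))
      ... | tri< a _ b = sym (trans (identityˡ _) (trans (cong₂ _∙_ (sel-yes (lt? i (α i)) a (c i)) (sel-no (lt? (α i) i) b (c i))) (identityʳ _)))
      ... | tri> a _ b = sym (trans (identityˡ _) (trans (cong₂ _∙_ (sel-no (lt? i (α i)) a (c i)) (sel-yes (lt? (α i) i) b (c i))) (identityˡ _)))
      cancel : ∀ i → up i ∙ sel (lt? i (α i)) (c (α i)) ≡ ε
      cancel i = trans (sel-∙ (lt? i (α i)) _ _) (zero-sum (lt? i (α i)))
        where
        zero-sum : (d : Dec (toℕ i < toℕ (α i))) → sel d (c i ∙ c (α i)) ≡ ε
        zero-sum (no _)  = refl
        zero-sum (yes a) = anti i (λ e → ℕₚ.<-irrefl (cong toℕ (sym e)) a)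
      flip : sumG down ≡ sumG (λ i → sel (lt? i (α i)) (c (α i)))
      flip = trans (sumG-bij down α α invol invol) (sumG-cong λ i → sel-cong (lt? (α (α i)) (α i)) (lt? i (α i))
        (subst (λ z → toℕ z < toℕ (α i)) (invol i)) (subst (λ z → toℕ z < toℕ (α i)) (sym (invol i))) (c (α i)))
      rest : sumG (λ i → up i ∙ down i) ≡ ε
      rest = trans (sumG-∙ up down) (trans (cong (sumG up ∙_) flip) (trans (sym (sumG-∙ up (λ i → sel (lt? i (α i)) (c (α i)))))
        (trans (sumG-cong cancel) (sumG-ε N))))

    -- The total over all corners reduces to the leaves, the total over all positions to the
    -- half-edges, and the two totals differ by one passage around the face. Read in Z/n, this is
    -- the necessary condition on the numbers of fixed edges and vertices.
    monodromy-sum : sumG hs ≡ κ ∙ sumG es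
    monodromy-sum = trans (sym leaf-sum) (trans (sumG-mono κ c) (trans (cong (_∙ κ) half-sum) (comm _ _)))

-- Forgetting the labels

card-remove : ∀ {A : Set} {P : A → Set} {n} → Card (EqS A) P (suc n) → ∀ {a} → P a → Card (EqS A) (λ b → P b × b ≢ a) n
card-remove {P = P} {n} c {a} pa = record
  { enum = λ i → enum (punchIn k i)
  ; sound = λ i → sound _ , λ e → Fₚ.punchInᵢ≢i k i (enum-inj (trans e (index-≈ pa)))
  ; index = λ { (pb , ne) → punchOut (k≢ pb ne) }
  ; index-≈ = λ { (pb , ne) → trans (index-≈ pb) (cong enum (sym (Fₚ.punchIn-punchOut (k≢ pb ne)))) }
  ; enum-inj = λ e → Fₚ.punchIn-injective k _ _ (enum-inj e) }
  where
  open Card c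
  k = index pa
  k≢ : ∀ {b} (pb : P b) → b ≢ a → k ≢ index pb
  k≢ pb ne e = ne (trans (index-≈ pb) (trans (cong enum (sym e)) (sym (index-≈ pa))))

card-Lists : ∀ {A : Set} n {P : A → Set} → ((a b : A) → Dec (a ≡ b)) → Card (EqS A) P n → Card (FunS n A) (Lists P) (n !)
card-Lists zero {P} _ c = card-1 (λ ()) (record { all = λ () ; inj = λ { {()} } ; hit = λ p → contradiction (Card.index c p) λ () }) (λ _ ())
card-Lists {A} (suc n) {P} _≟_ c = card-map {S = ×-setoid (EqS A) (FunS n A)}
  (card-× {R = λ a → Lists (λ b → P b × b ≢ a)} c (λ {a} p → card-Lists n {λ b → P b × b ≢ a} _≟_ (card-remove c p)) (λ { refl z → z }))
  (λ { (a , v) → a ◂ v })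
  (λ { {a , v} (p , L) → record
       { all = λ { zero → p ; (suc j) → proj₁ (Lists.all L j) }
       ; inj = λ { {zero} {zero} _ → refl ; {zero} {suc j} e → ⊥-elim (proj₂ (Lists.all L j) (sym e))
                 ; {suc i} {zero} e → ⊥-elim (proj₂ (Lists.all L i) e) ; {suc i} {suc j} e → cong suc (Lists.inj L e) }
       ; hit = λ {b} q → find {a} {v} {b} L q (b ≟ a) } })
  (λ { (refl , e) → λ { zero → refl ; (suc j) → e j } })
  (λ _ _ e → e zero , e ∘ suc)
  (λ { {v} L → (v zero , v ∘ suc) , (Lists.all L zero , lists-∷ {P = P} {v = v} L) , λ { zero → refl ; (suc j) → refl } })
  where
  find : ∀ {a} {v : Fin n → A} {b} → Lists (λ b → P b × b ≢ a) v → P b → Dec (b ≡ a) → ∃[ j ] (a ◂ v) j ≡ b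
  find L q (yes e) = zero , sym e
  find L q (no ne) = let j , e = Lists.hit L (q , ne) in suc j , e

module Unlabelled (𝔾 : FinAb) (κ : FinAb.G 𝔾) {m : ℕ} where
  open FinAb 𝔾
  open Maps 𝔾
  open Sum commutativeMonoid using () renaming (sum to sumG)

  PairS : Setoid 0ℓ 0ℓ
  PairS = ×-setoid (FunS (suc m) (Fin (suc m))) (FunS (suc m) G)

  module _ (r : ℕ) (η : G) (s : ℕ) (h₁ : G) (t : ℕ) (h₂ : G) where
    LeafOf : G → Setoid.Carrier PairS → Fin (suc m) → Set
    LeafOf h (α , c) i = vert α i ≡ i × mono κ c i ≡ h

    -- One value `η` for half-edges and two values `h₁`, `h₂` for leaves are enough: for n dividing
    -- 6, Z/n has at most one element of order 2 and at most two of order 3.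
    record Map (x : Setoid.Carrier PairS) : Set where
      α = proj₁ x
      c = proj₂ x
      field
        core   : Core κ α c
        halves : Card (EqS (Fin (suc m))) (λ i → α i ≡ i) r
        half-η : ∀ i → α i ≡ i → c i ≡ η
        leaf₁  : Card (EqS (Fin (suc m))) (LeafOf h₁ x) s
        leaf₂  : Card (EqS (Fin (suc m))) (LeafOf h₂ x) t
        leaf-h : ∀ i → vert α i ≡ i → mono κ c i ≡ h₁ ⊎ mono κ c i ≡ h₂

    mixed : ∀ a b → Fin (a + b) → G
    mixed zero    b = λ _ → h₂
    mixed (suc a) b = h₁ ◂ mixed a b

    mixed-ˡ : ∀ a b i → mixed a b (i ↑ˡ b) ≡ h₁
    mixed-ˡ (suc a) b zero    = refl
    mixed-ˡ (suc a) b (suc i) = mixed-ˡ a b i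

    mixed-ʳ : ∀ a b i → mixed a b (a ↑ʳ i) ≡ h₂
    mixed-ʳ zero    b i = refl
    mixed-ʳ (suc a) b i = mixed-ʳ a b i

    -- If the two values coincide, the two kinds of leaves could not be told apart. This happens
    -- only where both are absent and `h₁`, `h₂` are placeholders.
    module _ (separate : h₁ ≡ h₂ → s ≡ 0 × t ≡ 0) where
      private
        F = Fin (suc m)
        LabS : Setoid 0ℓ 0ℓ
        LabS = ×-setoid (FunS s F) (×-setoid (FunS t F) (FunS r F))
        Labels : Setoid.Carrier PairS → Setoid.Carrier LabS → Set
        Labels x (u , v , e) = Lists (LeafOf h₁ x) u × Lists (LeafOf h₂ x) v × Lists (λ i → proj₁ x i ≡ i) e

        leaf-resp : ∀ h x y → Setoid._≈_ PairS x y → ∀ i → LeafOf h x i → LeafOf h y i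
        leaf-resp h x y (E , C) i (a , b) = trans (sym (E (next i))) a , trans (sym (mono-cong κ C {i} {i} refl)) b

        leaves-resp : ∀ h x y {n} {v : Fin n → F} → Setoid._≈_ PairS x y → Lists (LeafOf h x) v → Lists (LeafOf h y) v
        leaves-resp h x y e = lists-resp {P = LeafOf h x} {Q = LeafOf h y} (λ {i} → leaf-resp h x y e i)
          (λ {i} → leaf-resp h y x (Setoid.sym PairS {x} {y} e) i) (λ _ → refl)

        labels-resp : ∀ {x y l} → Setoid._≈_ PairS x y → Labels x l → Labels y l
        labels-resp {x} {y} e@(E , _) (a , b , d) = leaves-resp h₁ x y e a , leaves-resp h₂ x y e b ,
          lists-resp (λ {i} → trans (sym (E i))) (λ {i} → trans (E i)) (λ _ → refl) d

        card-Labels : ∀ {x} → Map x → Card LabS (Labels x) (s ! * (t ! * r !))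
        card-Labels {x} U = card-× {R = λ _ l → Lists (LeafOf h₂ x) (proj₁ l) × Lists (λ i → proj₁ x i ≡ i) (proj₂ l)} (card-Lists s Fₚ._≟_ leaf₁)
          (λ _ → card-× {R = λ _ → Lists (λ i → proj₁ x i ≡ i)} (card-Lists t Fₚ._≟_ leaf₂) (λ _ → card-Lists r Fₚ._≟_ halves) (λ _ z → z)) (λ _ z → z)
          where open Map U

        glue : Setoid.Carrier PairS × Setoid.Carrier LabS → Raw m (s + t) r
        glue ((α , c) , (u , v , e)) = α , c , (λ j → [ u , v ]′ (splitAt s j)) , e

        apart : ∀ {x u v} → Lists (LeafOf h₁ x) u → Lists (LeafOf h₂ x) v → ∀ (i : Fin s) (j : Fin t) → u i ≢ v j
        apart {x} {u} {v} L L' i j e = contradiction (subst Fin (proj₁ (separate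
          (trans (sym (proj₂ (Lists.all L i))) (trans (cong (mono κ (proj₂ x)) e) (proj₂ (Lists.all L' j)))))) i) λ ()

        labelled : ∀ {x} → Map (proj₁ x) × Labels (proj₁ x) (proj₂ x) → Valid κ (mixed s t) (λ _ → η) (glue x)
        labelled {(α , c) , (u , v , e)} (U , L , L' , H) = record
          { core = core
          ; leaf = record { all = λ j → all′ (splitAt s j) ; inj = λ {i} {j} z → trans (sym (Fₚ.join-splitAt s t i))
                      (trans (cong (join s t) (inj′ (splitAt s i) (splitAt s j) z)) (Fₚ.join-splitAt s t j)) ; hit = λ {i} z → hit′ z (leaf-h i z) }
          ; leaf-mon = λ j → subst (λ w → mono κ c ([ u , v ]′ (splitAt s j)) ≡ mixed s t w) (Fₚ.join-splitAt s t j) (mon′ (splitAt s j))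
          ; half = H ; half-val = λ j → half-η (e j) (Lists.all H j) }
          where
          open Map U using (core; leaf-h; half-η)
          all′ : ∀ k → vert α ([ u , v ]′ k) ≡ [ u , v ]′ k
          all′ (inj₁ i) = proj₁ (Lists.all L i)
          all′ (inj₂ i) = proj₁ (Lists.all L' i)
          mon′ : ∀ k → mono κ c ([ u , v ]′ k) ≡ mixed s t (join s t k)
          mon′ (inj₁ i) = trans (proj₂ (Lists.all L i)) (sym (mixed-ˡ s t i))
          mon′ (inj₂ i) = trans (proj₂ (Lists.all L' i)) (sym (mixed-ʳ s t i))
          inj′ : ∀ k l → [ u , v ]′ k ≡ [ u , v ]′ l → k ≡ l
          inj′ (inj₁ i) (inj₁ j) z = cong inj₁ (Lists.inj L z)
          inj′ (inj₁ i) (inj₂ j) z = ⊥-elim (apart {α , c} L L' i j z)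
          inj′ (inj₂ i) (inj₁ j) z = ⊥-elim (apart {α , c} L L' j i (sym z))
          inj′ (inj₂ i) (inj₂ j) z = cong inj₂ (Lists.inj L' z)
          hit′ : ∀ {i} → vert α i ≡ i → mono κ c i ≡ h₁ ⊎ mono κ c i ≡ h₂ → ∃[ j ] [ u , v ]′ (splitAt s j) ≡ i
          hit′ z (inj₁ w) = let k , x = Lists.hit L (z , w) in k ↑ˡ t , trans (cong [ u , v ]′ (Fₚ.splitAt-↑ˡ s k t)) x
          hit′ z (inj₂ w) = let k , x = Lists.hit L' (z , w) in s ↑ʳ k , trans (cong [ u , v ]′ (Fₚ.splitAt-↑ʳ s t k)) x

      module _ {α : F → F} {c : F → G} {ℓ : Fin (s + t) → F} {e : Fin r → F} (V : Valid κ (mixed s t) (λ _ → η) (α , c , ℓ , e)) where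
        open Valid V using (core; leaf; leaf-mon; half; half-val)

        private
          lists₁ : Lists (LeafOf h₁ (α , c)) (λ i → ℓ (i ↑ˡ t))
          lists₁ = record
            { all = λ i → Lists.all leaf _ , trans (leaf-mon _) (mixed-ˡ s t i)
            ; inj = λ z → Fₚ.↑ˡ-injective t _ _ (Lists.inj leaf z)
            ; hit = λ { (z , w) → let j , x = Lists.hit leaf z in find (splitAt s j) (Fₚ.join-splitAt s t j) x w } }
            where
            find : ∀ {i j} (k : Fin s ⊎ Fin t) → join s t k ≡ j → ℓ j ≡ i → mono κ c i ≡ h₁ → ∃[ k ] ℓ (k ↑ˡ t) ≡ i
            find (inj₁ k) refl x w = k , x
            find (inj₂ k) refl x w = contradiction (subst Fin (proj₂ (separate
              (trans (sym w) (trans (cong (mono κ c) (sym x)) (trans (leaf-mon _) (mixed-ʳ s t k)))))) k) λ ()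

          lists₂ : Lists (LeafOf h₂ (α , c)) (λ i → ℓ (s ↑ʳ i))
          lists₂ = record
            { all = λ i → Lists.all leaf _ , trans (leaf-mon _) (mixed-ʳ s t i)
            ; inj = λ z → Fₚ.↑ʳ-injective s _ _ (Lists.inj leaf z)
            ; hit = λ { (z , w) → let j , x = Lists.hit leaf z in find (splitAt s j) (Fₚ.join-splitAt s t j) x w } }
            where
            find : ∀ {i j} (k : Fin s ⊎ Fin t) → join s t k ≡ j → ℓ j ≡ i → mono κ c i ≡ h₂ → ∃[ k ] ℓ (s ↑ʳ k) ≡ i
            find (inj₂ k) refl x w = k , x
            find (inj₁ k) refl x w = contradiction (subst Fin (proj₁ (separate
              (trans (sym (trans (cong (mono κ c) (sym x)) (trans (leaf-mon _) (mixed-ˡ s t k)))) w))) k) λ ()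

        unlabelled : Map (α , c)
        unlabelled = record
          { core = core ; halves = lists⇒card half
          ; half-η = λ i z → let j , w = Lists.hit half z in trans (cong c (sym w)) (half-val j)
          ; leaf₁ = lists⇒card lists₁ ; leaf₂ = lists⇒card lists₂
          ; leaf-h = λ i z → let j , w = Lists.hit leaf z in type (splitAt s j) (Fₚ.join-splitAt s t j) w }
          where
          type : ∀ {i j} (k : Fin s ⊎ Fin t) → join s t k ≡ j → ℓ j ≡ i → mono κ c i ≡ h₁ ⊎ mono κ c i ≡ h₂
          type (inj₁ k) refl x = inj₁ (trans (cong (mono κ c) (sym x)) (trans (leaf-mon _) (mixed-ˡ s t k)))
          type (inj₂ k) refl x = inj₂ (trans (cong (mono κ c) (sym x)) (trans (leaf-mon _) (mixed-ʳ s t k)))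

        private
          unglue : Labels (α , c) ((λ i → ℓ (i ↑ˡ t)) , (λ i → ℓ (s ↑ʳ i)) , e)
          unglue = lists₁ , lists₂ , half

        label-surj : ∃[ x ] ((Map (proj₁ x) × Labels (proj₁ x) (proj₂ x)) × Setoid._≈_ (RawS m (s + t) r) (α , c , ℓ , e) (glue x))
        label-surj = ((α , c) , _) , (unlabelled , unglue) , (λ _ → refl) , (λ _ → refl) ,
          (λ j → trans (cong ℓ (sym (Fₚ.join-splitAt s t j))) (cat (splitAt s j))) , (λ _ → refl)
          where
          cat : ∀ k → ℓ (join s t k) ≡ [ (λ i → ℓ (i ↑ˡ t)) , (λ i → ℓ (s ↑ʳ i)) ]′ k
          cat (inj₁ _) = refl
          cat (inj₂ _) = refl

      card-labelled : ∀ {A} → Card PairS Map A → Card (RawS m (s + t) r) (Valid κ (mixed s t) (λ _ → η)) (A * (s ! * (t ! * r !)))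
      card-labelled cA = card-map (card-× {R = Labels} cA card-Labels (λ {x} {y} {l} → labels-resp {x} {y} {l}))
        glue (λ {x} → labelled {x})
        (λ { ((E , C) , (L , L' , H)) → E , C , (λ j → both L L' (splitAt s j)) , H })
        (λ { {(_ , _) , (u , v , _)} {(_ , _) , (u' , v' , _)} _ _ (E , C , L , H) → (E , C) ,
             (λ i → trans (sym (cong [ u , v ]′ (Fₚ.splitAt-↑ˡ s i t))) (trans (L (i ↑ˡ t)) (cong [ u' , v' ]′ (Fₚ.splitAt-↑ˡ s i t)))) ,
             (λ i → trans (sym (cong [ u , v ]′ (Fₚ.splitAt-↑ʳ s t i))) (trans (L (s ↑ʳ i)) (cong [ u' , v' ]′ (Fₚ.splitAt-↑ʳ s t i)))) , H })
        label-surj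
        where
        both : ∀ {u u' : Fin s → F} {v v' : Fin t → F} → u ≗ u' → v ≗ v' → ∀ k → [ u , v ]′ k ≡ [ u' , v' ]′ k
        both e e' (inj₁ i) = e i
        both e e' (inj₂ i) = e' i

      map⇒valid : ∀ {x} → Map x → ∃[ y ] Valid {m} {s + t} {r} κ (mixed s t) (λ _ → η) y
      map⇒valid {x} U = glue (x , u , v , e) , labelled {x , u , v , e} (U , L₁ , L₂ , H)
        where
        open Map U using (leaf₁; leaf₂; halves)
        u = Card.enum leaf₁
        v = Card.enum leaf₂
        e = Card.enum halves
        enum-lists : ∀ {n} {P : F → Set} (k : Card (EqS F) P n) → Lists P (Card.enum k)
        enum-lists k = record { all = Card.sound k ; inj = Card.enum-inj k ; hit = λ p → Card.index k p , sym (Card.index-≈ k p) }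
        L₁ = enum-lists leaf₁
        L₂ = enum-lists leaf₂
        H = enum-lists halves

      -- M + 6 = 12 f + 4 (s + t) + 3 r, where f is the genus of the quotient surface
      map-conditions : ∀ {x} → Map x → (∃[ f ] 12 * f + 4 * (s + t) + 3 * r ≡ suc m + 6) × sumG (mixed s t) ≡ κ ∙ sumG {r} (λ _ → η)
      map-conditions {x} U = genus-exists 𝔾 κ ν {ν = ν} ℕₚ.≤-refl V
          (NegativeCount.negative-count α invol cub (lists⇒card leaf) (lists⇒card half)) , MonodromySum.monodromy-sum 𝔾 V
        where
        V = proj₂ (map⇒valid {x} U)
        open Valid V using (α; invol; cub; leaf; half)
        ν = sumℕ (λ i → ⟦ neg? α i ⟧)

      map-count : ∀ {f q A} → 3 * f + (s + t + r) ≡ 2 + q → suc m + 6 ≡ 12 * f + 4 * (s + t) + 3 * r →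
        sumG (mixed s t) ≡ κ ∙ sumG {r} (λ _ → η) → Card PairS Map A →
        A * (s ! * (t ! * r !)) * (12 ^ f * (f ! * q !)) ≡ suc m * ((order * order) ^ f * (2 * q) !)
      map-count {f} p≡ M≡ Σ≡ cA = LabelledCount.labelled-count 𝔾 r {f} (mixed s t) (λ _ → η) p≡ M≡ Σ≡ (card-labelled cA)

-- Cyclic groups

module _ {k : ℕ} where
  private
    n : ℕ
    n = suc k

  shift : Fin n → ℕ → Fin n
  shift x d = (toℕ x + d) mod n

  toℕ-mod : ∀ a → toℕ (a mod n) ≡ a % n
  toℕ-mod a = Fₚ.toℕ-fromℕ< (DM.m%n<n a n)

  toℕ-shift : ∀ x d → toℕ (shift x d) ≡ (toℕ x + d) % n
  toℕ-shift x d = toℕ-mod (toℕ x + d)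

  mod-cong : ∀ a b → a % n ≡ b % n → a mod n ≡ b mod n
  mod-cong a b e = Fₚ.toℕ-injective (trans (toℕ-mod a) (trans e (sym (toℕ-mod b))))

  toℕ-% : ∀ (x : Fin n) → toℕ x % n ≡ toℕ x
  toℕ-% x = DM.m<n⇒m%n≡m (Fₚ.toℕ<n x)

  mod-toℕ : ∀ (x : Fin n) → toℕ x mod n ≡ x
  mod-toℕ x = Fₚ.toℕ-injective (trans (toℕ-mod (toℕ x)) (toℕ-% x))

  +-% : ∀ a b → (a % n + b) % n ≡ (a + b) % n
  +-% a b = trans (DM.%-distribˡ-+ (a % n) b n) (trans (cong (λ z → (z + b % n) % n) (DM.m%n%n≡m%n a n)) (sym (DM.%-distribˡ-+ a b n)))

  %-+ : ∀ a b → (a + b % n) % n ≡ (a + b) % n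
  %-+ a b = trans (cong (_% n) (ℕₚ.+-comm a (b % n))) (trans (+-% b a) (cong (_% n) (ℕₚ.+-comm b a)))

  shift-mod : ∀ a d → shift (a mod n) d ≡ (a + d) mod n
  shift-mod a d = mod-cong (toℕ (a mod n) + d) (a + d) (trans (cong (λ z → (z + d) % n) (toℕ-mod a)) (+-% a d))

  shift-0 : ∀ x → shift x 0 ≡ x
  shift-0 x = trans (cong (_mod n) (ℕₚ.+-identityʳ (toℕ x))) (mod-toℕ x)

  shift-+ : ∀ x d e → shift (shift x d) e ≡ shift x (d + e)
  shift-+ x d e = trans (shift-mod (toℕ x + d) e) (cong (_mod n) (ℕₚ.+-assoc (toℕ x) d e))

  shift-% : ∀ x d → shift x (d % n) ≡ shift x d
  shift-% x d = mod-cong (toℕ x + d % n) (toℕ x + d) (%-+ (toℕ x) d)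

  shift-n : ∀ x → shift x n ≡ x
  shift-n x = trans (mod-cong (toℕ x + n) (toℕ x) (DM.[m+n]%n≡m%n (toℕ x) n)) (mod-toℕ x)

  shift-comm : ∀ x d e → shift (shift x d) e ≡ shift (shift x e) d
  shift-comm x d e = trans (shift-+ x d e) (trans (cong (shift x) (ℕₚ.+-comm d e)) (sym (shift-+ x e d)))

  shift-back : ∀ x d → shift (shift x d) (n ∸ d % n) ≡ x
  shift-back x d = trans (shift-+ x d _) (trans (sym (shift-% x (d + (n ∸ d % n))))
    (trans (cong (shift x) (trans (sym (+-% d _)) (cong (_% n) (ℕₚ.m+[n∸m]≡n (ℕₚ.<⇒≤ (DM.m%n<n d n)))))) (trans (shift-% x n) (shift-n x))))

  shift-forth : ∀ x d → shift (shift x (n ∸ d % n)) d ≡ x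
  shift-forth x d = trans (shift-comm x _ d) (shift-back x d)

  shift-injective : ∀ d {x y} → shift x d ≡ shift y d → x ≡ y
  shift-injective d {x} {y} e = trans (sym (shift-back x d)) (trans (cong (λ z → shift z (n ∸ d % n)) e) (shift-back y d))

  next≡shift : ∀ x → next x ≡ shift x 1
  next≡shift x with toℕ x ℕₚ.≟ k
  ... | yes e = trans (next-last x e) (Fₚ.toℕ-injective (sym (trans (toℕ-shift x 1)
          (trans (cong (λ z → (z + 1) % n) e) (trans (cong (_% n) (ℕₚ.+-comm k 1)) (DM.n%n≡0 n))))))
  ... | no ne = Fₚ.toℕ-injective (trans (toℕ-next x ne) (sym (trans (toℕ-shift x 1) (trans (cong (_% n) (ℕₚ.+-comm (toℕ x) 1))
          (DM.m<n⇒m%n≡m (s≤s (ℕₚ.≤∧≢⇒< (ℕₚ.≤-pred (Fₚ.toℕ<n x)) ne)))))))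

  next-shift : ∀ x d → next (shift x d) ≡ shift (next x) d
  next-shift x d = trans (next≡shift (shift x d)) (trans (shift-comm x d 1) (cong (λ z → shift z d) (sym (next≡shift x))))

ℤmod : ℕ → FinAb
ℤmod k = record
  { G = Fin n ; _∙_ = λ a b → shift a (toℕ b) ; ε = zero ; _⁻¹ = λ a → (n ∸ toℕ a) mod n
  ; isAb = record
    { isGroup = record
      { isMonoid = record
        { isSemigroup = record
          { isMagma = record { isEquivalence = ≡ₚ.isEquivalence ; ∙-cong = cong₂ (λ a b → shift a (toℕ b)) }
          ; assoc = λ a b c → trans (shift-+ a (toℕ b) (toℕ c)) (trans (sym (shift-% a _)) (cong (shift a) (sym (toℕ-shift b (toℕ c))))) }
        ; identity = (λ a → mod-toℕ a) , shift-0 }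
      ; inverse = inverseˡ′ , (λ a → trans (comm′ a _) (inverseˡ′ a))
      ; ⁻¹-cong = cong (λ a → (n ∸ toℕ a) mod n) }
    ; comm = comm′ }
  ; _≟G_ = Fₚ._≟_ ; order = n ; card-G = card-Fin n }
  where
  n = suc k
  comm′ : ∀ (a b : Fin n) → shift a (toℕ b) ≡ shift b (toℕ a)
  comm′ a b = cong (_mod n) (ℕₚ.+-comm (toℕ a) (toℕ b))
  inverseˡ′ : ∀ (a : Fin n) → shift ((n ∸ toℕ a) mod n) (toℕ a) ≡ zero
  inverseˡ′ a = trans (shift-mod (n ∸ toℕ a) (toℕ a)) (trans (cong (_mod n) (ℕₚ.m∸n+n≡m (ℕₚ.<⇒≤ (Fₚ.toℕ<n a))))
    (Fₚ.toℕ-injective (trans (toℕ-mod n) (DM.n%n≡0 n))))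

-- Z/N as an extension of Z/M by Z/n, where N = n M
module Extension (k m N' : ℕ) (N≡ : suc N' ≡ suc k * suc m) where
  open FinAb (ℤmod k)
  open Maps (ℤmod k)
  private
    n M N : ℕ
    n = suc k
    M = suc m
    N = suc N'

  one : Fin n
  one = 1 mod n

  private
    E : ℕ → Fin N
    E a = a mod N

  enc : Fin M → Fin n → Fin N
  enc i u = E (toℕ i + toℕ u * M)

  private
    E-% : ∀ a d → E (a + (d % n) * M) ≡ E (a + d * M)
    E-% a d = sym (mod-cong (a + d * M) (a + (d % n) * M) (trans (cong (_% N) eq) (DM.[m+kn]%n≡m%n (a + (d % n) * M) (d / n) N)))
      where
      eq : a + d * M ≡ a + (d % n) * M + (d / n) * N
      eq = trans (cong (λ z → a + z * M) (DM.m≡m%n+[m/n]*n d n))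
        (trans (cong (a +_) (ℕₚ.*-distribʳ-+ M (d % n) (d / n * n)))
          (trans (sym (ℕₚ.+-assoc a _ _)) (cong (a + (d % n) * M +_) (trans (ℕₚ.*-assoc (d / n) n M) (cong (d / n *_) (sym N≡))))))

  enc-shift : ∀ i u d → shift (enc i u) (d * M) ≡ enc i (shift u d)
  enc-shift i u d = trans (shift-mod (toℕ i + toℕ u * M) (d * M))
    (trans (cong E (lem (toℕ i) (toℕ u) d M)) (trans (sym (E-% (toℕ i) (toℕ u + d))) (cong (λ z → E (toℕ i + z * M)) (sym (toℕ-shift u d)))))
    where
    lem : ∀ i u d M → i + u * M + d * M ≡ i + (u + d) * M
    lem = solve-∀

  -- The carry of the addition is the cocycle of the extension: stepping past the last of the M
  -- positions raises the sheet by one. Hence the face monodromy of a quotient is `one`.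
  enc-next : ∀ i u → next (enc i u) ≡ enc (next i) (u ∙ wrap one i)
  enc-next i u = trans (next≡shift (enc i u)) (trans (shift-mod (toℕ i + toℕ u * M) 1) step)
    where
    step : E (toℕ i + toℕ u * M + 1) ≡ enc (next i) (u ∙ wrap one i)
    step with view i
    ... | ‵fromℕ = trans (cong E (trans (cong (λ z → z + toℕ u * M + 1) (Fₚ.toℕ-fromℕ m)) (lem m (toℕ u))))
            (trans (sym (E-% 0 (toℕ u + 1))) (cong (λ z → E (z * M)) (trans (sym (toℕ-shift u 1))
              (cong toℕ (trans (sym (shift-% u 1)) (cong (shift u) (sym (toℕ-mod 1))))))))
      where
      lem : ∀ m u → m + u * (1 + m) + 1 ≡ (u + 1) * (1 + m)
      lem = solve-∀
    ... | ‵inj₁ {i = j} _ = trans (cong E (trans (cong (λ z → z + toℕ u * M + 1) (Fₚ.toℕ-inject₁ j)) (lem (toℕ j) (toℕ u * M))))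
            (cong (λ z → E (suc (toℕ j) + toℕ z * M)) (sym (shift-0 u)))
      where
      lem : ∀ j u → j + u + 1 ≡ 1 + j + u
      lem = solve-∀

  toℕ-enc : ∀ i u → toℕ (enc i u) ≡ toℕ i + toℕ u * M
  toℕ-enc i u = trans (toℕ-mod (toℕ i + toℕ u * M)) (DM.m<n⇒m%n≡m (ℕₚ.<-≤-trans (ℕₚ.+-monoˡ-< (toℕ u * M) (Fₚ.toℕ<n i))
    (ℕₚ.≤-trans (ℕₚ.*-monoˡ-≤ M (Fₚ.toℕ<n u)) (ℕₚ.≤-reflexive (sym N≡)))))

  enc-injective : ∀ {i j u v} → enc i u ≡ enc j v → i ≡ j × u ≡ v
  enc-injective {i} {j} {u} {v} e = i≡j , Fₚ.toℕ-injective (ℕₚ.*-cancelʳ-≡ (toℕ u) (toℕ v) M (ℕₚ.+-cancelˡ-≡ (toℕ i) _ _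
      (trans eq (cong (λ z → toℕ z + toℕ v * M) (sym i≡j)))))
    where
    eq : toℕ i + toℕ u * M ≡ toℕ j + toℕ v * M
    eq = trans (sym (toℕ-enc i u)) (trans (cong toℕ e) (toℕ-enc j v))
    i≡j : i ≡ j
    i≡j = Fₚ.toℕ-injective (trans (sym (toℕ-% i)) (trans (sym (DM.[m+kn]%n≡m%n (toℕ i) (toℕ u) M))
      (trans (cong (_% M) eq) (trans (DM.[m+kn]%n≡m%n (toℕ j) (toℕ v) M) (toℕ-% j)))))

  base : Fin N → Fin M
  base x = toℕ x mod M

  private
    sheet< : ∀ x → toℕ x / M < n
    sheet< x = DM.m<n*o⇒m/o<n {toℕ x} {n} {M} (subst (toℕ x <_) N≡ (Fₚ.toℕ<n x))

  sheet : Fin N → Fin n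
  sheet x = fromℕ< (sheet< x)

  enc-dec : ∀ x → enc (base x) (sheet x) ≡ x
  enc-dec x = Fₚ.toℕ-injective (trans (toℕ-enc (base x) (sheet x))
    (trans (cong₂ (λ a b → a + b * M) (toℕ-mod (toℕ x)) (Fₚ.toℕ-fromℕ< (sheet< x))) (sym (DM.m≡m%n+[m/n]*n (toℕ x) M))))

  enc-ind : {P : Fin N → Set} → (∀ i u → P (enc i u)) → ∀ x → P x
  enc-ind {P} h x = subst P (enc-dec x) (h (base x) (sheet x))

  base-enc : ∀ i u → base (enc i u) ≡ i
  base-enc i u = proj₁ (enc-injective {base (enc i u)} {i} {sheet (enc i u)} {u} (enc-dec (enc i u)))

  sheet-enc : ∀ i u → sheet (enc i u) ≡ u
  sheet-enc i u = proj₂ (enc-injective {base (enc i u)} {i} {sheet (enc i u)} {u} (enc-dec (enc i u)))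

  card-enc : ∀ {P : Fin M → Set} {Q : Fin N → Set} → (∀ i u → P i → Q (enc i u)) → (∀ i u → Q (enc i u) → P i) →
    ∀ {r} → Card (EqS (Fin M)) P r → Card (EqS (Fin N)) Q (n * r)
  card-enc {P} {Q} PQ QP {r} c = subst (Card _ Q) (ℕₚ.*-comm r n)
    (card-map {S = ×-setoid (EqS (Fin M)) (EqS (Fin n))} (card-× {R = λ _ _ → ⊤} c (λ _ → card-Fin n) (λ _ z → z))
      (λ { (i , u) → enc i u }) (λ { {i , u} (p , _) → PQ i u p }) (λ { (refl , refl) → refl })
      (λ { {i , u} {j , v} _ _ e → enc-injective {i} {j} {u} {v} e })
      (λ {x} q → (base x , sheet x) , (QP (base x) (sheet x) (subst Q (sym (enc-dec x)) q) , tt) , sym (enc-dec x)))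

  card-dec : ∀ {P : Fin M → Set} {Q : Fin N → Set} → (∀ i → Dec (P i)) → (∀ i u → P i → Q (enc i u)) → (∀ i u → Q (enc i u) → P i) →
    ∀ {r} → Card (EqS (Fin N)) Q (n * r) → Card (EqS (Fin M)) P r
  card-dec {P} P? PQ QP {r} c = subst (Card _ P) (ℕₚ.*-cancelˡ-≡ _ r n (card-unique (card-enc PQ QP (card-sum P?)) c)) (card-sum P?)

-- Symmetric gluings of an N-gon and their quotients

module _ {N' : ℕ} where
  private
    N : ℕ
    N = suc N'

  record Gluing (α : Fin N → Fin N) : Set where
    field
      invol   : ∀ x → α (α x) ≡ x
      fpf     : ∀ x → α x ≢ x
      cub     : ∀ x → vert α (vert α (vert α x)) ≡ x
      no-leaf : ∀ x → vert α x ≢ x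

  -- The numbers η, h₁, h₂ are displacements in units of M; an edge or vertex of
  -- the quotient has n preimages of each of its positions or corners.
  record Symmetric (M r η s h₁ t h₂ n : ℕ) (α : Fin N → Fin N) : Set where
    field
      gluing : Gluing α
      equi   : ∀ x → α (shift x M) ≡ shift (α x) M
      halves : Card (EqS (Fin N)) (λ x → α x ≡ shift x (η * M)) (n * r)
      leaf₁  : Card (EqS (Fin N)) (λ x → vert α x ≡ shift x (h₁ * M)) (n * s)
      leaf₂  : Card (EqS (Fin N)) (λ x → vert α x ≡ shift x (h₂ * M)) (n * t)
    open Gluing gluing public

  Gluing-resp : ∀ {α β} → α ≗ β → Gluing α → Gluing β
  Gluing-resp {α} {β} E g = record
    { invol = λ x → trans (sym (trans (cong α (E x)) (E (β x)))) (invol x)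
    ; fpf = λ x e → fpf x (trans (E x) e)
    ; cub = λ x → trans (sym (v³ x)) (cub x)
    ; no-leaf = λ x e → no-leaf x (trans (E (next x)) e) }
    where
    open Gluing g
    v³ : ∀ x → vert α (vert α (vert α x)) ≡ vert β (vert β (vert β x))
    v³ x = trans (cong (vert α ∘ vert α) (E (next x))) (trans (cong (vert α) (E _)) (E _))

  Symmetric-resp : ∀ {M r η s h₁ t h₂ n α β} → α ≗ β → Symmetric M r η s h₁ t h₂ n α → Symmetric M r η s h₁ t h₂ n β
  Symmetric-resp {M} {α = α} {β} E S = record
    { gluing = Gluing-resp E gluing
    ; equi = λ x → trans (sym (E _)) (trans (equi x) (cong (λ z → shift z M) (E x)))
    ; halves = card-cong (λ {x} → trans (sym (E x))) (λ {x} → trans (E x)) halves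
    ; leaf₁ = card-cong (λ {x} → trans (sym (E (next x)))) (λ {x} → trans (E (next x))) leaf₁
    ; leaf₂ = card-cong (λ {x} → trans (sym (E (next x)))) (λ {x} → trans (E (next x))) leaf₂ }
    where open Symmetric S

module Quotient (k m N' : ℕ) (N≡ : suc N' ≡ suc k * suc m) where
  open FinAb (ℤmod k)
  open Maps (ℤmod k)
  open Extension k m N' N≡
  open CMSolver commutativeMonoid using (solve; _⊜_) renaming (_⊕_ to infixl 6 _⊞_)
  private
    n M N : ℕ
    n = suc k
    M = suc m
    N = suc N'
    cancelʳ : ∀ {a u : Fin n} → a ∙ u ≡ u → a ≡ ε
    cancelʳ {a} {u} e = ∙-cancelʳ u a ε (trans e (sym (identityˡ u)))

  lift : (Fin M → Fin M) × (Fin M → Fin n) → Fin N → Fin N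
  lift (α , c) x = enc (α (base x)) (c (base x) ∙ sheet x)

  lift-enc : ∀ y i u → lift y (enc i u) ≡ enc (proj₁ y i) (proj₂ y i ∙ u)
  lift-enc (α , c) i u = cong₂ (λ j v → enc (α j) (c j ∙ v)) (base-enc i u) (sheet-enc i u)

  lift-vert : ∀ y i u → vert (lift y) (enc i u) ≡ enc (vert (proj₁ y) i) (mono one (proj₂ y) i ∙ u)
  lift-vert y@(α , c) i u = trans (cong (lift y) (enc-next i u)) (trans (lift-enc y (next i) _)
    (cong (enc (vert α i)) (solve 3 (λ a b d → a ⊞ (b ⊞ d) ⊜ a ⊞ d ⊞ b) refl (c (next i)) u (wrap one i))))

  -- A map commuting with the rotation by M is determined by its values on sheet 0; their base and
  -- sheet are the gluing and the voltage of the quotient.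
  descend : (α : Fin N → Fin N) → (∀ x → α (shift x M) ≡ shift (α x) M) → ∃[ y ] α ≗ lift y
  descend α equi = y , enc-ind λ i u → trans (go i u) (sym (lift-enc y i u))
    where
    y : (Fin M → Fin M) × (Fin M → Fin n)
    y = (λ i → base (α (enc i zero))) , (λ i → sheet (α (enc i zero)))
    equi* : ∀ d x → α (shift x (d * M)) ≡ shift (α x) (d * M)
    equi* zero    x = trans (cong α (shift-0 x)) (sym (shift-0 (α x)))
    equi* (suc d) x = trans (cong α (sym (shift-+ x M (d * M)))) (trans (equi* d (shift x M))
      (trans (cong (λ z → shift z (d * M)) (equi x)) (shift-+ (α x) M (d * M))))
    go : ∀ i u → α (enc i u) ≡ enc (proj₁ y i) (proj₂ y i ∙ u)
    go i u = trans (cong (λ z → α (enc i z)) (sym (mod-toℕ u))) (trans (cong α (sym (enc-shift i zero (toℕ u))))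
      (trans (equi* (toℕ u) (enc i zero)) (trans (cong (λ z → shift z (toℕ u * M)) (sym (enc-dec (α (enc i zero)))))
        (enc-shift (base (α (enc i zero))) (sheet (α (enc i zero))) (toℕ u)))))

  module _ (y : (Fin M → Fin M) × (Fin M → Fin n)) where
    private
      α = proj₁ y
      c = proj₂ y
      μ = mono one c
      v = vert α

    -- What `Gluing` of the lift means below: the relations hold at fixed points too, where they
    -- become 2-torsion and 3-torsion, and freeness above excludes the trivial element there.
    record Regular : Set where
      field
        invol : ∀ i → α (α i) ≡ i
        anti  : ∀ i → c i ∙ c (α i) ≡ ε
        free  : ∀ i → α i ≡ i → c i ≢ ε
        cub   : ∀ i → v (v (v i)) ≡ i
        mon   : ∀ i → μ i ∙ μ (v i) ∙ μ (v (v i)) ≡ ε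
        free′ : ∀ i → v i ≡ i → μ i ≢ ε

    private
      twice : ∀ i u → lift y (lift y (enc i u)) ≡ enc (α (α i)) (c i ∙ c (α i) ∙ u)
      twice i u = trans (cong (lift y) (lift-enc y i u)) (trans (lift-enc y (α i) _)
        (cong (enc (α (α i))) (trans (sym (assoc (c (α i)) (c i) u)) (cong (_∙ u) (comm (c (α i)) (c i))))))

      thrice : ∀ i u → vert (lift y) (vert (lift y) (vert (lift y) (enc i u))) ≡ enc (v (v (v i))) (μ i ∙ μ (v i) ∙ μ (v (v i)) ∙ u)
      thrice i u = trans (cong (vert (lift y) ∘ vert (lift y)) (lift-vert y i u)) (trans (cong (vert (lift y)) (lift-vert y (v i) _))
        (trans (lift-vert y (v (v i)) _) (cong (enc (v (v (v i))))
          (solve 4 (λ a b d e → d ⊞ (b ⊞ (a ⊞ e)) ⊜ a ⊞ b ⊞ d ⊞ e) refl (μ i) (μ (v i)) (μ (v (v i))) u))))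

    regular⇒gluing : Regular → Gluing (lift y)
    regular⇒gluing R = record
      { invol = enc-ind λ i u → trans (twice i u) (cong₂ enc (invol i) (trans (cong (_∙ u) (anti i)) (identityˡ u)))
      ; fpf = enc-ind λ i u e → let a , b = enc-injective (trans (sym (lift-enc y i u)) e) in free i a (cancelʳ b)
      ; cub = enc-ind λ i u → trans (thrice i u) (cong₂ enc (cub i) (trans (cong (_∙ u) (mon i)) (identityˡ u)))
      ; no-leaf = enc-ind λ i u e → let a , b = enc-injective (trans (sym (lift-vert y i u)) e) in free′ i a (cancelʳ b) }
      where open Regular R

    gluing⇒regular : Gluing (lift y) → Regular
    gluing⇒regular g = record
      { invol = λ i → proj₁ (enc-injective {α (α i)} {i} {c i ∙ c (α i) ∙ zero} {zero} (trans (sym (twice i zero)) (invol (enc i zero))))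
      ; anti = λ i → cancelʳ (proj₂ (enc-injective {α (α i)} {i} {c i ∙ c (α i) ∙ zero} {zero} (trans (sym (twice i zero)) (invol (enc i zero)))))
      ; free = λ i a e → fpf (enc i zero) (trans (lift-enc y i zero) (cong₂ enc a (trans (identityʳ (c i)) e)))
      ; cub = λ i → proj₁ (enc-injective {v (v (v i))} {i} {μ i ∙ μ (v i) ∙ μ (v (v i)) ∙ zero} {zero} (trans (sym (thrice i zero)) (cub (enc i zero))))
      ; mon = λ i → cancelʳ (proj₂ (enc-injective {v (v (v i))} {i} {μ i ∙ μ (v i) ∙ μ (v (v i)) ∙ zero} {zero} (trans (sym (thrice i zero)) (cub (enc i zero)))))
      ; free′ = λ i a e → no-leaf (enc i zero) (trans (lift-vert y i zero) (cong₂ enc a (trans (identityʳ (μ i)) e))) }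
      where open Gluing g

    lift-equi : ∀ x → lift y (shift x M) ≡ shift (lift y x) M
    lift-equi = enc-ind λ i u → trans (cong (lift y) (by-M i u)) (trans (lift-enc y i (shift u 1))
      (trans (cong (enc (α i)) (assoc′ (c i) u)) (trans (sym (by-M (α i) (c i ∙ u))) (cong (λ z → shift z M) (sym (lift-enc y i u))))))
      where
      by-M : ∀ i u → shift (enc i u) M ≡ enc i (shift u 1)
      by-M i u = trans (cong (shift (enc i u)) (sym (ℕₚ.*-identityˡ M))) (enc-shift i u 1)
      assoc′ : ∀ a u → a ∙ shift u 1 ≡ shift (a ∙ u) 1
      assoc′ a u = trans (cong (shift a) (toℕ-shift u 1)) (trans (shift-% a (toℕ u + 1)) (sym (shift-+ a (toℕ u) 1)))

    module _ (h : Fin n) where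
      private
        target : ∀ i u → shift (enc i u) (toℕ h * M) ≡ enc i (h ∙ u)
        target i u = trans (enc-shift i u (toℕ h)) (cong (enc i) (comm u h))

      half-up : ∀ i u → α i ≡ i × c i ≡ h → lift y (enc i u) ≡ shift (enc i u) (toℕ h * M)
      half-up i u (a , b) = trans (lift-enc y i u) (trans (cong₂ enc a (cong (_∙ u) b)) (sym (target i u)))

      half-down : ∀ i u → lift y (enc i u) ≡ shift (enc i u) (toℕ h * M) → α i ≡ i × c i ≡ h
      half-down i u e = let a , b = enc-injective (trans (sym (lift-enc y i u)) (trans e (target i u))) in a , ∙-cancelʳ u _ _ b

      leaf-up : ∀ i u → v i ≡ i × μ i ≡ h → vert (lift y) (enc i u) ≡ shift (enc i u) (toℕ h * M)
      leaf-up i u (a , b) = trans (lift-vert y i u) (trans (cong₂ enc a (cong (_∙ u) b)) (sym (target i u)))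

      leaf-down : ∀ i u → vert (lift y) (enc i u) ≡ shift (enc i u) (toℕ h * M) → v i ≡ i × μ i ≡ h
      leaf-down i u e = let a , b = enc-injective (trans (sym (lift-vert y i u)) (trans e (target i u))) in a , ∙-cancelʳ u _ _ b

  module _ (r : ℕ) (η : Fin n) (s : ℕ) (h₁ : Fin n) (t : ℕ) (h₂ : Fin n) where
    open Unlabelled (ℤmod k) one {m} using (PairS) renaming (Map to Map′)
    private
      Map = Map′ r η s h₁ t h₂
      Sym = Symmetric {N'} M r (toℕ η) s (toℕ h₁) t (toℕ h₂) n

    -- The first two fields say that no other voltage can occur at a half-edge or a leaf. The others
    -- are conditional on the number being nonzero, so that an absent type may carry the placeholder
    -- 0.
    record Types : Set where
      field
        torsion₂ : ∀ a → a ∙ a ≡ ε → a ≢ ε → a ≡ η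
        torsion₃ : ∀ a → a ∙ a ∙ a ≡ ε → a ≢ ε → a ≡ h₁ ⊎ a ≡ h₂
        half-ok  : r ≢ 0 → η ∙ η ≡ ε × η ≢ ε
        leaf₁-ok : s ≢ 0 → h₁ ∙ h₁ ∙ h₁ ≡ ε × h₁ ≢ ε
        leaf₂-ok : t ≢ 0 → h₂ ∙ h₂ ∙ h₂ ≡ ε × h₂ ≢ ε

    module _ (types : Types) where
      open Types types

      private
        nonempty : ∀ {l} {P : Fin M → Set} → Card (EqS (Fin M)) P l → ∀ {i} → P i → l ≢ 0
        nonempty c p refl = contradiction (Card.index c p) λ ()

      map⇒symmetric : ∀ {y} → Map y → Sym (lift y)
      map⇒symmetric {y@(α , c)} U = record
        { gluing = regular⇒gluing y (record
            { invol = invol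
            ; anti = λ i → anti′ i (α i Fₚ.≟ i)
            ; free = λ i e z → proj₂ (half-ok (nonempty halves e)) (trans (sym (half-η i e)) z)
            ; cub = cub
            ; mon = λ i → mon′ i (vert α i Fₚ.≟ i)
            ; free′ = λ i e z → proj₂ (leaf-torsion i e (leaf-h i e)) z })
        ; equi = lift-equi y
        ; halves = card-enc (λ i u e → half-up y η i u (e , half-η i e)) (λ i u e → proj₁ (half-down y η i u e)) halves
        ; leaf₁ = card-enc (leaf-up y h₁) (leaf-down y h₁) leaf₁
        ; leaf₂ = card-enc (leaf-up y h₂) (leaf-down y h₂) leaf₂ }
        where
        open Unlabelled.Map U using (core; halves; half-η; leaf₁; leaf₂; leaf-h)
        open Core core
        μ = mono one c
        anti′ : ∀ i → Dec (α i ≡ i) → c i ∙ c (α i) ≡ ε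
        anti′ i (no ne) = anti i ne
        anti′ i (yes e) = trans (cong₂ _∙_ (half-η i e) (trans (cong c e) (half-η i e))) (proj₁ (half-ok (nonempty halves e)))
        leaf-torsion : ∀ i → vert α i ≡ i → μ i ≡ h₁ ⊎ μ i ≡ h₂ → μ i ∙ μ i ∙ μ i ≡ ε × μ i ≢ ε
        leaf-torsion i e (inj₁ z) = subst (λ w → w ∙ w ∙ w ≡ ε × w ≢ ε) (sym z) (leaf₁-ok (nonempty leaf₁ (e , z)))
        leaf-torsion i e (inj₂ z) = subst (λ w → w ∙ w ∙ w ≡ ε × w ≢ ε) (sym z) (leaf₂-ok (nonempty leaf₂ (e , z)))
        mon′ : ∀ i → Dec (vert α i ≡ i) → μ i ∙ μ (vert α i) ∙ μ (vert α (vert α i)) ≡ ε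
        mon′ i (no ne) = mon i ne
        mon′ i (yes e) = trans (cong₂ (λ a b → μ i ∙ μ a ∙ μ b) e (trans (cong (vert α) e) e)) (proj₁ (leaf-torsion i e (leaf-h i e)))

      symmetric⇒map : ∀ {y} → Sym (lift y) → Map y
      symmetric⇒map {y@(α , c)} S = record
        { core = record { invol = invol ; anti = λ i _ → anti i ; cub = cub ; mon = λ i _ → mon i }
        ; halves = card-dec (λ i → α i Fₚ.≟ i) (λ i u e → half-up y η i u (e , half i e)) (λ i u e → proj₁ (half-down y η i u e)) halves
        ; half-η = half
        ; leaf₁ = card-dec (λ i → (vert α i Fₚ.≟ i) ×-dec (μ i Fₚ.≟ h₁)) (leaf-up y h₁) (leaf-down y h₁) leaf₁
        ; leaf₂ = card-dec (λ i → (vert α i Fₚ.≟ i) ×-dec (μ i Fₚ.≟ h₂)) (leaf-up y h₂) (leaf-down y h₂) leaf₂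
        ; leaf-h = λ i e → torsion₃ (μ i) (trans (sym (cong₂ (λ a b → μ i ∙ μ a ∙ μ b) e (trans (cong (vert α) e) e))) (mon i)) (free′ i e) }
        where
        open Symmetric S using (gluing; halves; leaf₁; leaf₂)
        open Regular (gluing⇒regular y gluing)
        μ = mono one c
        half : ∀ i → α i ≡ i → c i ≡ η
        half i e = torsion₂ (c i) (trans (cong (λ z → c i ∙ c z) (sym e)) (anti i)) (free i e)

      symmetric-descends : ∀ {α} → Sym α → ∃[ y ] (Map y × α ≗ lift y)
      symmetric-descends {α} S = let y , e = descend α (Symmetric.equi S) in y , symmetric⇒map (Symmetric-resp e S) , e

      card-Map : ∀ {A} → Card (FunS N (Fin N)) Sym A → Card PairS Map A
      card-Map c = card-unmap c lift map⇒symmetric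
        (λ { {α , c} (E , F) x → cong₂ enc (E (base x)) (cong (_∙ sheet x) (F (base x))) })
        (λ { {y} {z} _ _ e → (λ i → proj₁ (inj y z e i)) , (λ i → ∙-cancelʳ zero _ _ (proj₂ (inj y z e i))) })
        symmetric-descends
        where
        inj : ∀ y z → lift y ≗ lift z → ∀ i → proj₁ y i ≡ proj₁ z i × proj₂ y i ∙ zero ≡ proj₂ z i ∙ zero
        inj y z e i = enc-injective (trans (sym (lift-enc y i zero)) (trans (e (enc i zero)) (lift-enc z i zero)))

-- Words and gluings

inv-invol : ∀ {e} (x : Letter e) → inv (inv x) ≡ x
inv-invol (i , true)  = refl
inv-invol (i , false) = refl

inv-≢ : ∀ {e} (x : Letter e) → inv x ≢ x
inv-≢ (i , true)  ()
inv-≢ (i , false) ()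

module _ {k : ℕ} (w : Word k) where
  letter-injective : ∀ {i j} → letter w i ≡ letter w j → i ≡ j
  letter-injective {i} {j} e = trans (sym (pos-letter w i)) (trans (cong (pos w) e) (pos-letter w j))

  edge : Fin (Len k) → Fin (Len k)
  edge i = pos w (inv (letter w i))

  letter-edge : ∀ i → letter w (edge i) ≡ inv (letter w i)
  letter-edge i = letter-pos w _

  edge-invol : ∀ i → edge (edge i) ≡ i
  edge-invol i = letter-injective (trans (letter-edge (edge i)) (trans (cong inv (letter-edge i)) (inv-invol _)))

  edge-fpf : ∀ i → edge i ≢ i
  edge-fpf i e = inv-≢ (letter w i) (trans (sym (letter-edge i)) (cong (letter w) e))

  σ≡vert : ∀ i → σ w i ≡ vert edge i
  σ≡vert i = cong edge (sym (next≡shift i))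

  vert-letter : ∀ {i j} → letter w (i ⊕ 1) ≡ inv (letter w j) → vert edge i ≡ j
  vert-letter {i} {j} e = trans (sym (σ≡vert i)) (trans (cong (λ z → pos w (inv z)) e) (trans (cong (pos w) (inv-invol _)) (pos-letter w j)))

  letter-vert : ∀ {i j} → vert edge i ≡ j → letter w (i ⊕ 1) ≡ inv (letter w j)
  letter-vert {i} {j} e = trans (sym (inv-invol _)) (cong inv (trans (sym (letter-pos w _)) (cong (letter w) (trans (σ≡vert i) e))))

  -- The absence of cancelling factors excludes vertices of degree one, and the condition on pairs
  -- of factors excludes vertices of degree two.
  wicks⇒ : IsWicks w → (∀ i → vert edge i ≢ i) × (∀ i → vert edge (vert edge i) ≢ i)
  wicks⇒ (nc , nip) = (λ i e → nc i (letter-vert e)) , λ i e → nip i (vert edge i)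
    (trans (sym (inv-invol _)) (cong inv (sym (letter-vert refl))) , letter-vert e)

  ⇒wicks : (∀ i → vert edge i ≢ i) → (∀ i → vert edge (vert edge i) ≢ i) → IsWicks w
  ⇒wicks n₁ n₂ = (λ i e → n₁ i (vert-letter e)) , λ { i j (e , e') → n₂ i (trans (cong (vert edge)
    (vert-letter (trans (sym (inv-invol _)) (cong inv (sym e))))) (vert-letter e')) }

-- Orbits of a permutation of a finite set

iter-+ : ∀ {A : Set} (f : A → A) a b x → iter f (a + b) x ≡ iter f a (iter f b x)
iter-+ f zero    b x = refl
iter-+ f (suc a) b x = cong f (iter-+ f a b x)

module Orbits {N : ℕ} (f : Fin N → Fin N) (f-inj : ∀ {x y} → f x ≡ f y → x ≡ y) where
  iter-injective : ∀ n {x y} → iter f n x ≡ iter f n y → x ≡ y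
  iter-injective zero    e = e
  iter-injective (suc n) e = iter-injective n (f-inj e)

  period : ∀ x → ∃[ p ] (suc p ≤ N × iter f (suc p) x ≡ x)
  period x with Fₚ.pigeonhole (ℕₚ.n<1+n N) (λ (i : Fin (suc N)) → iter f (toℕ i) x)
  ... | i , j , i<j , e = p , p<N , iter-injective (toℕ i) (trans (sym (iter-+ f (toℕ i) (suc p) x)) (trans (cong (λ z → iter f z x) sum) (sym e)))
    where
    p = toℕ j ∸ suc (toℕ i)
    sum : toℕ i + suc p ≡ toℕ j
    sum = trans (ℕₚ.+-suc (toℕ i) p) (ℕₚ.m+[n∸m]≡n i<j)
    p<N : suc p ≤ N
    p<N = ℕₚ.≤-trans (ℕₚ.m≤n+m (suc p) (toℕ i)) (subst (_≤ N) (sym sum) (ℕₚ.≤-pred (Fₚ.toℕ<n j)))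

  iter-period : ∀ {x} p → iter f p x ≡ x → ∀ q → iter f (q * p) x ≡ x
  iter-period p e zero    = refl
  iter-period {x} p e (suc q) = trans (iter-+ f p (q * p) x) (trans (cong (iter f p) (iter-period p e q)) e)

  -- Reduction modulo the period bounds the number of steps below N, as `SameVertex` demands.
  reach : ∀ {x y} a → iter f a x ≡ y → ∃[ m ] iter f (toℕ {N} m) x ≡ y
  reach {x} {y} a e = fromℕ< b<N , trans (cong (λ z → iter f z x) (Fₚ.toℕ-fromℕ< b<N)) (trans (sym (trans (cong (λ z → iter f z x) (DM.m≡m%n+[m/n]*n a (suc p)))
      (trans (iter-+ f (a % suc p) _ x) (cong (iter f (a % suc p)) (iter-period (suc p) pe (a / suc p)))))) e)
    where
    p = proj₁ (period x)
    pe = proj₂ (proj₂ (period x))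
    b<N : a % suc p < N
    b<N = ℕₚ.<-≤-trans (DM.m%n<n a (suc p)) (proj₁ (proj₂ (period x)))

  reach-back : ∀ {x y} a → iter f a x ≡ y → ∃[ b ] iter f b y ≡ x
  reach-back {x} {y} a e = a * p , trans (cong (iter f (a * p)) (sym e)) (trans (sym (iter-+ f (a * p) a x))
      (trans (cong (λ z → iter f z x) (trans (ℕₚ.+-comm (a * p) a) (sym (ℕₚ.*-suc a p)))) (iter-period (suc p) (proj₂ (proj₂ (period x))) a)))
    where p = proj₁ (period x)

  -- For `f = σ w` this is `VertexRep w`.
  IsMin : Fin N → Set
  IsMin x = ∀ y → ∃[ m ] iter f (toℕ {N} m) x ≡ y → toℕ x ≤ toℕ y

  same-min : ∀ {x y} a b → IsMin x → IsMin y → iter f a x ≡ iter f b y → x ≡ y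
  same-min {x} {y} a b mx my e = Fₚ.toℕ-injective (ℕₚ.≤-antisym
      (mx y (let d , e' = reach-back b (sym e) in reach (d + a) (trans (iter-+ f d a x) e')))
      (my x (let d , e' = reach-back a e in reach (d + b) (trans (iter-+ f d b y) e'))))

  -- N/3 orbits of at least three elements already exhaust Fin N.
  cubic : (∀ x → f x ≢ x) → (∀ x → f (f x) ≢ x) → ∀ {R} → Card (EqS (Fin N)) IsMin R → R * 3 ≡ N → ∀ x → f (f (f x)) ≡ x
  cubic n₁ n₂ {R} c R≡ x with f (f (f x)) Fₚ.≟ x
  ... | yes e = e
  ... | no ne = ⊥-elim (full x λ { (i , a , mi , refl) → ne (trans (sym (iter-+ f 3 (toℕ a) i))
        (trans (cong (λ z → iter f z i) (ℕₚ.+-comm 3 (toℕ a))) (trans (iter-+ f (toℕ a) 3 i) (cong (iter f (toℕ a)) (three i mi))))) })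
    where
    Hit : Fin N → Set
    Hit y = ∃[ i ] ∃[ a ] (IsMin i × y ≡ iter f (toℕ {3} a) i)
    step-inj : ∀ (a b : Fin 3) {i} → iter f (toℕ a) i ≡ iter f (toℕ b) i → a ≡ b
    step-inj zero zero e = refl
    step-inj zero (suc zero) {i} e = ⊥-elim (n₁ i (sym e))
    step-inj zero (suc (suc zero)) {i} e = ⊥-elim (n₂ i (sym e))
    step-inj (suc zero) zero {i} e = ⊥-elim (n₁ i e)
    step-inj (suc zero) (suc zero) e = refl
    step-inj (suc zero) (suc (suc zero)) {i} e = ⊥-elim (n₁ i (sym (f-inj e)))
    step-inj (suc (suc zero)) zero {i} e = ⊥-elim (n₂ i e)
    step-inj (suc (suc zero)) (suc zero) {i} e = ⊥-elim (n₁ i (f-inj e))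
    step-inj (suc (suc zero)) (suc (suc zero)) e = refl
    card-Hit : Card (EqS (Fin N)) Hit N
    card-Hit = subst (Card _ Hit) R≡ (card-map {S = ×-setoid (EqS (Fin N)) (EqS (Fin 3))} (card-× {R = λ _ _ → ⊤} c (λ _ → card-Fin 3) (λ _ z → z))
      (λ { (i , a) → iter f (toℕ a) i }) (λ { {i , a} (mi , _) → i , a , mi , refl }) (λ { (refl , refl) → refl })
      (λ { {i , a} {j , b} (mi , _) (mj , _) e → inj i a mi j b mj e (same-min (toℕ a) (toℕ b) mi mj e) })
      (λ { (i , a , mi , e) → (i , a) , (mi , tt) , e }))
      where
      inj : ∀ i a → IsMin i → ∀ j b → IsMin j → iter f (toℕ {3} a) i ≡ iter f (toℕ {3} b) j → i ≡ j → i ≡ j × a ≡ b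
      inj i a mi .i b mj e refl = refl , step-inj a b e
    -- A point outside `Hit` would give N + 1 distinct elements of `Fin N`.
    full : ∀ y → ¬ ¬ Hit y
    full y ¬h = ℕₚ.<-irrefl refl (card-≤ (card-⊎ (card-1 {S = EqS (Fin N)} {P = _≡ y} y refl id) card-Hit
      (λ { refl h refl → ¬h h })) (card-Fin N) (λ {a} _ → a) (λ _ → tt) (λ _ _ e → e))
    -- The third iterate of a least element lies within two steps of some least element, necessarily
    -- the same one; one or two steps would contradict `n₂` or `n₁`.
    three : ∀ i → IsMin i → f (f (f i)) ≡ i
    three i mi with f (f (f i)) Fₚ.≟ i
    ... | yes e = e
    ... | no ne = ⊥-elim (full (f (f (f i))) λ { (j , d , mj , e) → back d e (same-min 3 (toℕ d) mi mj e) })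
      where
      back : ∀ d {j} → iter f 3 i ≡ iter f (toℕ {3} d) j → i ≡ j → ⊥
      back zero             e refl = ne e
      back (suc zero)       e refl = n₂ i (f-inj e)
      back (suc (suc zero)) e refl = n₁ i (f-inj (f-inj e))

below? : ∀ a b c → Dec (a < b × a < c)
below? a b c = (a ℕₚ.<? b) ×-dec (a ℕₚ.<? c)

one-minimum : ∀ a b c → a ≢ b → b ≢ c → c ≢ a → ⟦ below? a b c ⟧ + ⟦ below? b c a ⟧ + ⟦ below? c a b ⟧ ≡ 1
one-minimum a b c a≢b b≢c c≢a with ℕₚ.<-cmp a b | ℕₚ.<-cmp b c | ℕₚ.<-cmp c a
... | tri≈ _ e _ | _ | _ = ⊥-elim (a≢b e)
... | _ | tri≈ _ e _ | _ = ⊥-elim (b≢c e)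
... | _ | _ | tri≈ _ e _ = ⊥-elim (c≢a e)
... | tri< x _ x' | _ | tri> z' _ z = cong₂ _+_ (cong₂ _+_ (⟦⟧-yes (below? a b c) (x , z)) (⟦⟧-no (below? b c a) (x' ∘ proj₂))) (⟦⟧-no (below? c a b) (z' ∘ proj₁))
... | tri> x' _ x | tri< y _ y' | _ = cong₂ _+_ (cong₂ _+_ (⟦⟧-no (below? a b c) (x' ∘ proj₁)) (⟦⟧-yes (below? b c a) (y , x))) (⟦⟧-no (below? c a b) (y' ∘ proj₂))
... | _ | tri> y' _ y | tri< z _ z' = cong₂ _+_ (cong₂ _+_ (⟦⟧-no (below? a b c) (z' ∘ proj₂)) (⟦⟧-no (below? b c a) (y' ∘ proj₁))) (⟦⟧-yes (below? c a b) (z , y))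
... | tri< x _ _ | tri< y _ _ | tri< z _ _ = ⊥-elim (ℕₚ.<-asym z (ℕₚ.<-trans x y))
... | tri> _ _ x | tri> _ _ y | tri> _ _ z = ⊥-elim (ℕₚ.<-asym z (ℕₚ.<-trans y x))

module CubicOrbits {N : ℕ} (f : Fin N → Fin N) (f³ : ∀ x → f (f (f x)) ≡ x) (n₁ : ∀ x → f x ≢ x) where
  f-injective : ∀ {x y} → f x ≡ f y → x ≡ y
  f-injective {x} {y} e = trans (sym (f³ x)) (trans (cong (f ∘ f) e) (f³ y))
  open Orbits f f-injective

  n₂ : ∀ x → f (f x) ≢ x
  n₂ x e = n₁ x (trans (cong f (sym e)) (f³ x))

  orbit-cases : ∀ a x → iter f a x ≡ x ⊎ iter f a x ≡ f x ⊎ iter f a x ≡ f (f x)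
  orbit-cases zero x = inj₁ refl
  orbit-cases (suc a) x with orbit-cases a x
  ... | inj₁ e        = inj₂ (inj₁ (cong f e))
  ... | inj₂ (inj₁ e) = inj₂ (inj₂ (cong f e))
  ... | inj₂ (inj₂ e) = inj₁ (trans (cong f e) (f³ x))

  Least : Fin N → Set
  Least x = toℕ x < toℕ (f x) × toℕ x < toℕ (f (f x))

  min⇒least : ∀ {x} → IsMin x → Least x
  min⇒least {x} mx = ℕₚ.≤∧≢⇒< (mx (f x) (reach 1 refl)) (λ e → n₁ x (Fₚ.toℕ-injective (sym e))) ,
                     ℕₚ.≤∧≢⇒< (mx (f (f x)) (reach 2 refl)) (λ e → n₂ x (Fₚ.toℕ-injective (sym e)))

  least⇒min : ∀ {x} → Least x → IsMin x
  least⇒min {x} (a , b) y (m , e) with orbit-cases (toℕ m) x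
  ... | inj₁ z        = ℕₚ.≤-reflexive (cong toℕ (trans (sym z) e))
  ... | inj₂ (inj₁ z) = ℕₚ.<⇒≤ (subst (λ w → toℕ x < toℕ w) (trans (sym z) e) a)
  ... | inj₂ (inj₂ z) = ℕₚ.<⇒≤ (subst (λ w → toℕ x < toℕ w) (trans (sym z) e) b)

  private
    least? : ∀ x → Dec (Least x)
    least? x = (toℕ x ℕₚ.<? toℕ (f x)) ×-dec (toℕ x ℕₚ.<? toℕ (f (f x)))
    turn : ∀ (g : Fin N → ℕ) → sumℕ g ≡ sumℕ (g ∘ f)
    turn g = sumℕ-bij g f (f ∘ f) f³ f³

  -- Exactly one of `x`, `f x`, `f (f x)` is the least of its orbit. Summing this over the invariant
  -- set `P` counts every least element three times.
  card-orbits : ∀ {P : Fin N → Set} {R} → (∀ x → Dec (P x)) → (∀ {x} → P x → P (f x)) →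
    Card (EqS (Fin N)) (λ x → IsMin x × P x) R → Card (EqS (Fin N)) P (3 * R)
  card-orbits {P} {R} P? Pf c = subst (Card _ P) (trans eq (cong (3 *_) (card⇒sum lp? c'))) (card-sum P?)
    where
    c' : Card (EqS (Fin N)) (λ x → Least x × P x) R
    c' = card-cong (λ { (a , b) → min⇒least a , b }) (λ { (a , b) → least⇒min a , b }) c
    lp? : ∀ x → Dec (Least x × P x)
    lp? x = least? x ×-dec P? x
    u : Fin N → ℕ
    u x = ⟦ lp? x ⟧
    back : ∀ {x} → P (f x) → P x
    back {x} p = subst P (f³ x) (Pf (Pf p))
    toℕ-≢ : ∀ {x y : Fin N} → x ≢ y → toℕ x ≢ toℕ y
    toℕ-≢ ne e = ne (Fₚ.toℕ-injective e)
    pointwise : ∀ x → ⟦ P? x ⟧ ≡ u x + u (f x) + u (f (f x))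
    pointwise x with P? x
    ... | no np = sym (cong₂ _+_ (cong₂ _+_ (⟦⟧-no (least? x ×-dec no np) (np ∘ proj₂)) (⟦⟧-no (lp? (f x)) (np ∘ back ∘ proj₂))) (⟦⟧-no (lp? (f (f x))) (np ∘ back ∘ back ∘ proj₂)))
    ... | yes p = sym (trans (cong₂ _+_ (cong₂ _+_
            (⟦⟧-cong (least? x ×-dec yes p) (below? (toℕ x) (toℕ (f x)) (toℕ (f (f x)))) proj₁ (λ z → z , p))
            (⟦⟧-cong (lp? (f x)) (below? (toℕ (f x)) (toℕ (f (f x))) (toℕ x)) (λ z → L₁ (proj₁ z)) (λ z → L₁′ z , Pf p)))
            (⟦⟧-cong (lp? (f (f x))) (below? (toℕ (f (f x))) (toℕ x) (toℕ (f x))) (λ z → L₂ (proj₁ z)) (λ z → L₂′ z , Pf (Pf p))))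
            (one-minimum (toℕ x) (toℕ (f x)) (toℕ (f (f x))) (toℕ-≢ (n₁ x ∘ sym)) (toℕ-≢ (n₁ (f x) ∘ sym)) (toℕ-≢ (n₂ x))))
      where
      L₁ : Least (f x) → toℕ (f x) < toℕ (f (f x)) × toℕ (f x) < toℕ x
      L₁ (a , b) = a , subst (λ z → toℕ (f x) < toℕ z) (f³ x) b
      L₁′ : toℕ (f x) < toℕ (f (f x)) × toℕ (f x) < toℕ x → Least (f x)
      L₁′ (a , b) = a , subst (λ z → toℕ (f x) < toℕ z) (sym (f³ x)) b
      L₂ : Least (f (f x)) → toℕ (f (f x)) < toℕ x × toℕ (f (f x)) < toℕ (f x)
      L₂ (a , b) = subst (λ z → toℕ (f (f x)) < toℕ z) (f³ x) a , subst (λ z → toℕ (f (f x)) < toℕ z) (cong f (f³ x)) b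
      L₂′ : toℕ (f (f x)) < toℕ x × toℕ (f (f x)) < toℕ (f x) → Least (f (f x))
      L₂′ (a , b) = subst (λ z → toℕ (f (f x)) < toℕ z) (sym (f³ x)) a , subst (λ z → toℕ (f (f x)) < toℕ z) (sym (cong f (f³ x))) b
    eq : sumℕ (λ x → ⟦ P? x ⟧) ≡ 3 * sumℕ u
    eq = trans (sumℕ-cong pointwise) (trans (sumℕ-+ (λ x → u x + u (f x)) (λ x → u (f (f x))))
      (trans (cong₂ _+_ (trans (sumℕ-+ u (u ∘ f)) (cong (sumℕ u +_) (sym (turn u)))) (sym (trans (turn u) (turn (u ∘ f))))) (lem (sumℕ u))))
      where
      lem : ∀ z → z + z + z ≡ 3 * z
      lem = solve-∀

-- Maximality of a word in terms of its gluing

module _ {k : ℕ} (w : Word k) where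
  private
    σ-injective : ∀ {i j} → σ w i ≡ σ w j → i ≡ j
    σ-injective {i} {j} e = next-injective (trans (sym (edge-invol w (next i)))
      (trans (cong (edge w) (trans (sym (σ≡vert w i)) (trans e (σ≡vert w j)))) (edge-invol w (next j))))
    N≡ : ∀ {h} → k ≡ 2 + 6 * h → Len k ≡ 6 + 12 * h
    N≡ {h} refl = lem h
      where
      lem : ∀ h → 1 + (2 + 6 * h) + (1 + (2 + 6 * h)) ≡ 6 + 12 * h
      lem = solve-∀
    σ² : ∀ i → σ w (σ w i) ≡ vert (edge w) (vert (edge w) i)
    σ² i = trans (σ≡vert w (σ w i)) (cong (vert (edge w)) (σ≡vert w i))
    σ³ : ∀ i → σ w (σ w (σ w i)) ≡ vert (edge w) (vert (edge w) (vert (edge w) i))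
    σ³ i = trans (σ≡vert w (σ w (σ w i))) (cong (vert (edge w)) (σ² i))

  -- Euler's relation leaves exactly N / 3 vertices for N corners, while the Wicks conditions give
  -- each vertex at least three corners.
  maximal⇒gluing : ∀ h → k ≡ 2 + 6 * h → IsWicks w → HasGenus w (suc h) → Gluing (edge w)
  maximal⇒gluing h k≡ W hg = record
    { invol = edge-invol w ; fpf = edge-fpf w
    ; cub = λ i → trans (sym (σ³ i)) (Orbits.cubic (σ w) σ-injective (λ x e → n₁ x (trans (sym (σ≡vert w x)) e))
              (λ x e → n₂ x (trans (sym (σ² x)) e)) (card-count (vertexRep? w)) R≡ i)
    ; no-leaf = n₁ }
    where
    n₁ = proj₁ (wicks⇒ w W)
    n₂ = proj₂ (wicks⇒ w W)
    lem₁ : ∀ h → 2 + (2 + 6 * h) ≡ 2 + 4 * h + 2 * (1 + h)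
    lem₁ = solve-∀
    lem₂ : ∀ h → (2 + 4 * h) * 3 ≡ 6 + 12 * h
    lem₂ = solve-∀
    R≡ : numVertices w * 3 ≡ Len k
    R≡ = trans (cong (_* 3) (ℕₚ.+-cancelʳ-≡ (2 * suc h) (numVertices w) (2 + 4 * h) (trans hg (trans (cong (λ z → 2 + z) k≡) (lem₁ h)))))
           (trans (lem₂ h) (sym (N≡ {h} k≡)))

  module _ (g : Gluing (edge w)) where
    open Gluing g
    σ-cub : ∀ i → σ w (σ w (σ w i)) ≡ i
    σ-cub i = trans (σ³ i) (cub i)
    σ-no-leaf : ∀ i → σ w i ≢ i
    σ-no-leaf i e = no-leaf i (trans (sym (σ≡vert w i)) e)

    gluing⇒maximal : ∀ h → k ≡ 2 + 6 * h → IsWicks w × HasGenus w (suc h)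
    gluing⇒maximal h k≡ = ⇒wicks w no-leaf (λ i e → no-leaf i (trans (cong (vert (edge w)) (sym e)) (cub i))) ,
      ℕₚ.*-cancelˡ-≡ _ _ 3 (trans (ℕₚ.*-distribˡ-+ 3 (numVertices w) (2 * suc h)) (trans (cong (_+ 3 * (2 * suc h)) 3V≡) (trans (cong (_+ 3 * (2 * suc h)) (N≡ {h} k≡))
        (trans (lem h) (cong (λ z → 3 * (2 + z)) (sym k≡))))))
      where
      lem : ∀ h → 6 + 12 * h + 3 * (2 * (1 + h)) ≡ 3 * (2 + (2 + 6 * h))
      lem = solve-∀
      3V≡ : 3 * numVertices w ≡ Len k
      3V≡ = card-unique (CubicOrbits.card-orbits (σ w) σ-cub σ-no-leaf {P = λ _ → ⊤} (λ _ → yes tt) _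
        (card-cong (λ m → m , tt) proj₁ (card-count (vertexRep? w)))) (card-Fin (Len k))

-- The letters name the edges {x , α x} by their larger ends.
module _ {k : ℕ} {α : Fin (Len k) → Fin (Len k)} (g : Gluing α) where
  open Gluing g
  private
    Low : Fin (Len k) → Set
    Low x = toℕ (α x) < toℕ x
    low? : ∀ x → Dec (Low x)
    low? x = toℕ (α x) ℕₚ.<? toℕ x
    E≡ : sumℕ (λ x → ⟦ low? x ⟧) ≡ suc k
    E≡ = ℕₚ.*-cancelˡ-≡ _ _ 2 (trans (sym (ℕₚ.+-identityʳ _)) (trans (cong (2 * sumℕ (λ x → ⟦ low? x ⟧) +_)
           (sym (card⇒sum (λ x → α x Fₚ.≟ x) (card-∅ λ {x} → fpf x)))) (trans (NegativeCount.edge-count α invol cub) (lem k))))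
      where
      lem : ∀ k → 1 + k + (1 + k) ≡ 2 * (1 + k)
      lem = solve-∀
    c : Card (EqS (Fin (Len k))) Low (suc k)
    c = subst (Card _ Low) E≡ (card-sum low?)
    open Card c
    high : ∀ {x} → ¬ Low x → Low (α x)
    high {x} n = subst (λ z → toℕ z < toℕ (α x)) (sym (invol x)) (ℕₚ.≤∧≢⇒< (ℕₚ.≮⇒≥ n) (λ e → fpf x (sym (Fₚ.toℕ-injective e))))
    name : ∀ x → Dec (Low x) → Letter (suc k)
    name x (yes p) = index p , true
    name x (no n)  = index (high n) , false
    place : Letter (suc k) → Fin (Len k)
    place (j , true)  = enum j
    place (j , false) = α (enum j)
    place-name : ∀ x d → place (name x d) ≡ x
    place-name x (yes p) = sym (index-≈ p)
    place-name x (no n)  = trans (cong α (sym (index-≈ (high n)))) (invol x)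
    name-place : ∀ l (d : Dec (Low (place l))) → name (place l) d ≡ l
    name-place (j , true)  (yes p) = cong (_, true) (enum-inj (sym (index-≈ p)))
    name-place (j , true)  (no n)  = ⊥-elim (n (sound j))
    name-place (j , false) (yes p) = ⊥-elim (ℕₚ.<-asym (sound j) (subst (λ z → toℕ z < toℕ (α (enum j))) (invol (enum j)) p))
    name-place (j , false) (no n)  = cong (_, false) (enum-inj (trans (sym (index-≈ (high n))) (invol (enum j))))

  word : Word k
  word = record { letter = λ x → name x (low? x) ; pos = place
                ; pos-letter = λ x → place-name x (low? x) ; letter-pos = λ l → name-place l (low? (place l)) }

  edge-word : edge word ≗ α
  edge-word x = go (low? x)
    where
    go : ∀ d → place (inv (name x d)) ≡ α x
    go (yes p) = cong α (sym (index-≈ p))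
    go (no n)  = sym (index-≈ (high n))

-- Automorphisms, isomorphisms and masses

-- `α` is `β` conjugated by the rotation by `d`. Isomorphisms and automorphisms of words both reduce
-- to this, because the shift determines the renaming of the letters.
record Conj {n} (d : ℕ) (β α : Fin (suc n) → Fin (suc n)) : Set where
  constructor conj
  field
    at : ∀ x → α (shift x d) ≡ shift (β x) d
open Conj public

module _ {k : ℕ} (w : Word k) where
  aut⇒conj : ∀ {d} → IsAut w d → Conj (toℕ d) (edge w) (edge w)
  aut⇒conj {d} (φ , φ-inv , h) .at x = letter-injective w (trans (letter-edge w _) (sym (trans (h (edge w x))
    (trans (cong φ (letter-edge w x)) (trans (φ-inv _) (cong inv (sym (h x))))))))

  conj⇒aut : ∀ {d} → Conj (toℕ d) (edge w) (edge w) → IsAut w d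
  conj⇒aut {d} e = φ , (λ x → trans (cong (λ z → letter w (z ⊕ toℕ d)) (pos-inv x))
      (trans (cong (letter w) (sym (at e (pos w x)))) (letter-edge w _))) , λ i → cong (λ z → letter w (z ⊕ toℕ d)) (sym (pos-letter w i))
    where
    φ : Letter (suc k) → Letter (suc k)
    φ x = letter w (pos w x ⊕ toℕ d)
    pos-inv : ∀ x → pos w (inv x) ≡ edge w (pos w x)
    pos-inv x = cong (λ z → pos w (inv z)) (sym (letter-pos w x))

module _ {k : ℕ} (w w' : Word k) where
  iso⇒conj : Iso w w' → ∃[ d ] Conj d (edge w) (edge w')
  iso⇒conj (φ , φ-inv , _ , d , h) = d , conj λ x → letter-injective w' (trans (letter-edge w' _)
    (sym (trans (sym (h (edge w x))) (trans (cong φ (letter-edge w x)) (trans (φ-inv _) (cong inv (h x)))))))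

  conj⇒iso : ∀ d → Conj d (edge w) (edge w') → Iso w w'
  conj⇒iso d e = φ , (λ x → trans (cong (λ z → letter w' (z ⊕ d)) (cong (λ z → pos w (inv z)) (sym (letter-pos w x))))
      (trans (cong (letter w') (sym (at e (pos w x)))) (letter-edge w' _))) ,
    ((λ {x} {y} z → trans (sym (letter-pos w x)) (trans (cong (letter w) (shift-injective d (letter-injective w' z))) (letter-pos w y))) ,
     (λ y → letter w (shift (pos w' y) (Len k ∸ d % Len k)) , λ { refl → trans (cong (λ z → letter w' (shift z d)) (pos-letter w _))
       (trans (cong (letter w') (shift-forth (pos w' y) d)) (letter-pos w' y)) })) ,
    d , λ i → cong (λ z → letter w' (z ⊕ d)) (pos-letter w i)
    where
    φ : Letter (suc k) → Letter (suc k)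
    φ x = letter w' (pos w x ⊕ d)

module _ {n : ℕ} where
  private
    N : ℕ
    N = suc n
    F = Fin N → Fin N

  rotate : ℕ → F → F
  rotate d β x = shift (β (shift x (N ∸ d % N))) d

  rotate-conj : ∀ d β → Conj d β (rotate d β)
  rotate-conj d β .at x = cong (λ z → shift (β z) d) (shift-back x d)

  conj-rotate : ∀ {d} {β α : F} → Conj d β α → α ≗ rotate d β
  conj-rotate {d} {β} {α} e x = trans (cong α (sym (shift-forth x d))) (at e _)

  conj-resp : ∀ {d} {β α α' : F} → α ≗ α' → Conj d β α → Conj d β α'
  conj-resp E e .at x = trans (sym (E _)) (at e x)

  conj-% : ∀ {d} {β α : F} → Conj d β α → Conj (toℕ (d mod N)) β α
  conj-% {d} {β} {α} e .at x = trans (cong α (eq x)) (trans (at e x) (sym (eq (β x))))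
    where
    eq : ∀ y → shift y (toℕ (d mod N)) ≡ shift y d
    eq y = trans (cong (shift y) (toℕ-mod d)) (shift-% y d)

  conj-%′ : ∀ {d} {β α : F} → Conj d β α → Conj (d % N) β α
  conj-%′ {d} e = subst (λ z → Conj z _ _) (toℕ-mod d) (conj-% e)

  conj-∘ : ∀ {d e} {β γ α : F} → Conj e β γ → Conj d γ α → Conj (e + d) β α
  conj-∘ {d} {e} {β} {γ} {α} p q .at x = trans (cong α (sym (shift-+ x e d))) (trans (at q (shift x e)) (trans (cong (λ z → shift z d) (at p x)) (shift-+ (β x) e d)))

  conj-inverse : ∀ {d} {β α : F} → Conj d β α → Conj (N ∸ d % N) α β
  conj-inverse {d} {β} {α} e .at x = shift-injective d (trans (sym (at e _)) (trans (cong α (shift-forth x d)) (sym (shift-forth (α x) d))))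

  card-F : ∃[ c ] Card (FunS N (Fin N)) (λ _ → ⊤) c
  card-F = _ , card-Fun N (card-Fin N)

  conj? : ∀ d (β α : F) → Dec (Conj d β α)
  conj? d β α = map′ conj at (Fₚ.all? (λ x → α (shift x d) Fₚ.≟ shift (β x) d))

module _ {k : ℕ} where
  private
    N : ℕ
    N = Len k
    F = Fin N → Fin N

  Orbit : Word k → F → Set
  Orbit w α = ∃[ d ] Conj (toℕ {N} d) (edge w) α

  orbit-from : ∀ {w} {α : F} d → Conj d (edge w) α → Orbit w α
  orbit-from d e = d mod N , conj-% e

  orbit-resp : ∀ {w} {α α' : F} → α ≗ α' → Orbit w α → Orbit w α'
  orbit-resp E (d , e) = d , conj-resp E e

  private
    card-stabiliser : ∀ w {α : F} → Orbit w α → Card (EqS (Fin N)) (λ d → Conj (toℕ d) (edge w) α) (autOrder w)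
    card-stabiliser w {α} (d₀ , e₀) = card-map (card-count (isAut? w)) (λ e → shift e (toℕ d₀))
      (λ {e} a → subst (λ z → Conj z (edge w) α) (sym (toℕ-shift e (toℕ d₀))) (conj-%′ (conj-∘ (aut⇒conj w {e} a) e₀)))
      (λ { refl → refl }) (λ _ _ → shift-injective (toℕ d₀))
      (λ {d} a → let b = shift d (N ∸ toℕ d₀ % N) in b ,
        conj⇒aut w {b} (subst (λ z → Conj z (edge w) (edge w)) (sym (toℕ-shift d (N ∸ toℕ d₀ % N))) (conj-%′ (conj-∘ a (conj-inverse e₀)))) ,
        sym (shift-forth d (toℕ d₀)))

  -- Pairs of a gluing and a shift that carries `edge w` to it are counted twice: every shift occurs
  -- once, and over a fixed gluing the shifts form a coset of the automorphism group.
  card-Orbit : ∀ w → ∃[ m ] (Card (FunS N (Fin N)) (Orbit w) m × m * autOrder w ≡ N)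
  card-Orbit w = m , c , card-unique (card-× {R = λ α d → Conj (toℕ d) (edge w) α} c (card-stabiliser w) (λ E e → conj-resp E e))
      (card-map (card-Fin N) (λ d → rotate (toℕ d) (edge w) , d) (λ {d} _ → (d , rotate-conj (toℕ d) (edge w)) , rotate-conj (toℕ d) (edge w))
        (λ { refl → (λ _ → refl) , refl }) (λ _ _ → proj₂) (λ { {α , d} (_ , e) → d , tt , conj-rotate e , refl }))
    where
    fin = card-filter {Q = Orbit w} (proj₂ card-F) (λ α → Fₚ.any? (λ d → conj? (toℕ d) (edge w) α)) (orbit-resp {w})
    m = proj₁ fin
    c = proj₂ fin

  orbits-meet : ∀ {w v} {α : F} → Orbit w α → Orbit v α → Iso w v
  orbits-meet {w} {v} {α} (d , e) (d' , e') = conj⇒iso w v _ (conj-∘ e (conj-inverse e'))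

-- Fractions and the mass of a system of representatives

frac-cong : ∀ {a b c d} .{{_ : NonZero b}} .{{_ : NonZero d}} → a * d ≡ c * b → frac a b ≡ frac c d
frac-cong {a} {suc b} {c} {suc d} e = ℚₚ.fromℚᵘ-cong {ℚᵘ.mkℚᵘ (ℤ.+ a) b} {ℚᵘ.mkℚᵘ (ℤ.+ c) d} (ℚᵘ.*≡* (trans (sym (ℤₚ.pos-* a (suc d))) (trans (cong ℤ.+_ e) (ℤₚ.pos-* c (suc b)))))

private
  toℚᵘ-frac : ∀ a b → ℚ.toℚᵘ (frac a (suc b)) ℚᵘ.≃ ℚᵘ.mkℚᵘ (ℤ.+ a) b
  toℚᵘ-frac a b = ℚₚ.toℚᵘ-fromℚᵘ (ℚᵘ.mkℚᵘ (ℤ.+ a) b)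

frac-* : ∀ a b c d .{{_ : NonZero b}} .{{_ : NonZero d}} → frac a b ℚ.* frac c d ≡ frac (a * c) (b * d)
frac-* a (suc b) c (suc d) = ℚₚ.toℚᵘ-injective (ℚᵘₚ.≃-trans (ℚₚ.toℚᵘ-homo-* (frac a (suc b)) (frac c (suc d)))
  (ℚᵘₚ.≃-trans (ℚᵘₚ.*-cong (toℚᵘ-frac a b) (toℚᵘ-frac c d))
    (ℚᵘₚ.≃-trans (ℚᵘ.*≡* (cong (λ z → z ℤ.* (ℤ.+ (suc b * suc d))) (sym (ℤₚ.pos-* a c)))) (ℚᵘₚ.≃-sym (toℚᵘ-frac (a * c) _)))))

frac-+ : ∀ a b n .{{_ : NonZero n}} → frac a n ℚ.+ frac b n ≡ frac (a + b) n
frac-+ a b (suc n) = ℚₚ.toℚᵘ-injective (ℚᵘₚ.≃-trans (ℚₚ.toℚᵘ-homo-+ (frac a (suc n)) (frac b (suc n)))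
  (ℚᵘₚ.≃-trans (ℚᵘₚ.+-cong (toℚᵘ-frac a n) (toℚᵘ-frac b n))
    (ℚᵘₚ.≃-trans (ℚᵘ.*≡* eq) (ℚᵘₚ.≃-sym (toℚᵘ-frac (a + b) n)))))
  where
  N = suc n
  lem : ∀ a b n → (a * n + b * n) * n ≡ (a + b) * (n * n)
  lem = solve-∀
  eq : (ℤ.+ a ℤ.* ℤ.+ N ℤ.+ ℤ.+ b ℤ.* ℤ.+ N) ℤ.* ℤ.+ N ≡ ℤ.+ (a + b) ℤ.* ℤ.+ (N * N)
  eq = trans (cong (ℤ._* ℤ.+ N) (trans (cong₂ ℤ._+_ (sym (ℤₚ.pos-* a N)) (sym (ℤₚ.pos-* b N))) refl))
    (trans (sym (ℤₚ.pos-* (a * N + b * N) N)) (trans (cong ℤ.+_ (lem a b N)) (ℤₚ.pos-* (a + b) (N * N))))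

frac-pos : ∀ {a n} .{{_ : NonZero n}} → a ≢ 0 → 0ℚ ℚ.< frac a n
frac-pos {zero}  ne = ⊥-elim (ne refl)
frac-pos {suc a} {suc n} _ = ℚₚ.positive⁻¹ (frac (suc a) (suc n)) {{ℚₚ.normalize-pos (suc a) (suc n)}}

frac-0 : ∀ n → frac 0 n ≡ 0ℚ
frac-0 zero    = refl
frac-0 (suc n) = frac-cong {0} {suc n} {0} {1} refl

module _ {k : ℕ} where
  private
    N : ℕ
    N = Len k
    InOrbits : List (Word k) → (Fin N → Fin N) → Set
    InOrbits L α = Any (λ w → Orbit w α) L

    card-orbits-mass : ∀ L → AllPairs (λ u v → ¬ Iso u v) L → ∃[ A ] (Card (FunS N (Fin N)) (InOrbits L) A × mass L ≡ frac A N)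
    card-orbits-mass [] _ = 0 , card-∅ (λ ()) , sym (frac-0 N)
    card-orbits-mass (w ∷ L) (ne ∷ apart) =
      let m , cm , m≡ = card-Orbit w
          A , cA , mass≡ = card-orbits-mass L apart
      in m + A , card-cong (λ { (inj₁ o) → here o ; (inj₂ o) → there o }) (λ { (here o) → inj₁ o ; (there o) → inj₂ o })
           (card-⊎ cm cA λ {α} {β} o os E → disjoint ne (orbit-resp {w = w} E o) os) ,
         trans (cong₂ ℚ._+_ (reciprocal m (autOrder w) m≡) mass≡) (frac-+ m A N)
      where
      disjoint : ∀ {L α} → All (λ v → ¬ Iso w v) L → Orbit w α → InOrbits L α → ⊥
      disjoint {v ∷ _} (n ∷ _)  o (here o')  = n (orbits-meet {w = w} {v} o o')
      disjoint (_ ∷ ns) o (there os) = disjoint ns o os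
      reciprocal : ∀ m a → m * a ≡ N → frac 1 a ≡ frac m N
      reciprocal m zero    e = contradiction (trans (sym (ℕₚ.*-zeroʳ m)) e) λ ()
      reciprocal m (suc a) e = frac-cong {1} {suc a} {m} {N} (trans (ℕₚ.*-identityˡ N) (sym e))

  -- `X` is invariant under rotation and splits into one orbit for each class. An orbit has N /
  -- |Aut| elements, so the mass is the size of `X` divided by N.
  mass-count : ∀ {Good : Word k → Set} {X : (Fin N → Fin N) → Set} L →
    (∀ {w} → Good w → X (edge w)) → (∀ {w} → X (edge w) → Good w) →
    (∀ {α β} → α ≗ β → X α → X β) → (∀ {α} → X α → Gluing α) → (∀ {d α β} → Conj d α β → X α → X β) →
    All Good L → (∀ w → Good w → Any (Iso w) L) → AllPairs (λ u v → ¬ Iso u v) L →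
    ∃[ A ] (Card (FunS N (Fin N)) X A × mass L ≡ frac A N)
  mass-count {Good} {X} L good⇒ ⇒good resp glu move good complete apart =
    let A , cA , e = card-orbits-mass L apart in A , card-cong (into good) outof cA , e
    where
    into : ∀ {L α} → All Good L → InOrbits L α → X α
    into (g ∷ _)  (here (d , e)) = move e (good⇒ g)
    into (_ ∷ gs) (there os)     = into gs os
    -- Every gluing in `X` comes from the word that it spells, to which `complete` applies.
    outof : ∀ {α} → X α → InOrbits L α
    outof {α} x = Any.map (λ {v} i → let d , e = iso⇒conj w v i in orbit-from {w = v} {α = α} _ (conj-resp (edge-word g) (conj-inverse e)))
        (complete w (⇒good (resp (λ y → sym (edge-word g y)) x)))
      where
      g = glu x
      w = word g

-- Symmetric gluings and the sets W₂, W₃, W₆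

module _ {n : ℕ} {d : ℕ} {β α : Fin (suc n) → Fin (suc n)} (C : Conj d β α) where
  private
    ρ : Fin (suc n) → Fin (suc n)
    ρ x = shift x d
    ρ-ind : {P : Fin (suc n) → Set} → (∀ x → P (ρ x)) → ∀ x → P x
    ρ-ind {P} h x = subst P (shift-forth x d) (h (shift x (suc n ∸ d % suc n)))

  conj-vert : ∀ x → vert α (ρ x) ≡ ρ (vert β x)
  conj-vert x = trans (cong α (next-shift x d)) (at C (next x))

  conj-gluing : Gluing β → Gluing α
  conj-gluing g = record
    { invol = ρ-ind λ x → trans (cong α (at C x)) (trans (at C (β x)) (cong ρ (invol x)))
    ; fpf = ρ-ind λ x e → fpf x (shift-injective d (trans (sym (at C x)) e))
    ; cub = ρ-ind λ x → trans (cong (vert α ∘ vert α) (conj-vert x)) (trans (cong (vert α) (conj-vert _)) (trans (conj-vert _) (cong ρ (cub x))))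
    ; no-leaf = ρ-ind λ x e → no-leaf x (shift-injective d (trans (sym (conj-vert x)) e)) }
    where open Gluing g

  private
    card-ρ : ∀ {f g : Fin (suc n) → Fin (suc n)} {e c} → (∀ x → g (ρ x) ≡ ρ (f x)) →
      Card (EqS (Fin (suc n))) (λ x → f x ≡ shift x e) c → Card (EqS (Fin (suc n))) (λ x → g x ≡ shift x e) c
    card-ρ {f} {g} {e} E c = card-map c ρ (λ {x} z → trans (E x) (trans (cong ρ z) (shift-comm x e d))) (cong ρ) (λ _ _ → shift-injective d)
      (λ {y} z → let x = shift y (suc n ∸ d % suc n) ; y≡ = shift-forth y d in x ,
        shift-injective d (trans (sym (E x)) (trans (cong g y≡) (trans z (trans (cong (λ w → shift w e) (sym y≡)) (shift-comm x d e))))) , sym y≡)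

  conj-symmetric : ∀ {M r η s h₁ t h₂ k} → Symmetric M r η s h₁ t h₂ k β → Symmetric M r η s h₁ t h₂ k α
  conj-symmetric {M} S = record
    { gluing = conj-gluing gluing
    ; equi = ρ-ind λ x → trans (cong α (shift-comm x d M)) (trans (at C (shift x M)) (trans (cong ρ (equi x))
               (trans (shift-comm (β x) M d) (cong (λ z → shift z M) (sym (at C x))))))
    ; halves = card-ρ (at C) halves ; leaf₁ = card-ρ conj-vert leaf₁ ; leaf₂ = card-ρ conj-vert leaf₂ }
    where open Symmetric S

module _ {k : ℕ} (w : Word k) where
  private
    N : ℕ
    N = Len k
    α = edge w
    Aut : ℕ → Set
    Aut d = Conj d α α
    card-Bool : Card (EqS Bool) (λ _ → ⊤) 2
    card-Bool = record
      { enum = λ { zero → true ; (suc zero) → false } ; sound = λ _ → tt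
      ; index = λ { {true} _ → zero ; {false} _ → suc zero } ; index-≈ = λ { {true} _ → refl ; {false} _ → refl }
      ; enum-inj = λ { {zero} {zero} _ → refl ; {zero} {suc zero} () ; {suc zero} {zero} () ; {suc zero} {suc zero} _ → refl } }

  -- An edge is reversed when the shift carries each of its two positions to the other, whence the
  -- factor 2.
  reversed-card : ∀ {d φ} → AutWitness w d φ → Card (EqS (Fin N)) (λ x → α x ≡ shift x (toℕ d)) (2 * reversedEdges φ)
  reversed-card {d} {φ} (φ-inv , h) = subst (Card _ _) (ℕₚ.*-comm (reversedEdges φ) 2)
    (card-map {S = ×-setoid (EqS (Fin (suc k))) (EqS Bool)}
      (card-× {R = λ _ _ → ⊤} (card-count (λ i → φ (i , true) ≟L (i , false))) (λ _ → card-Bool) (λ _ z → z))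
      (pos w) (λ { {i , b} (e , _) → up b e }) (λ { (refl , refl) → refl }) (λ _ _ e → same (pos-injective e))
      (λ {x} e → letter w x , (down (letter w x) (trans (sym (h x)) (trans (cong (letter w) (sym e)) (letter-edge w x))) , tt) , sym (pos-letter w x)))
    where
    pos-injective : ∀ {x y} → pos w x ≡ pos w y → x ≡ y
    pos-injective {x} {y} e = trans (sym (letter-pos w x)) (trans (cong (letter w) e) (letter-pos w y))
    same : ∀ {x y : Letter (suc k)} → x ≡ y → proj₁ x ≡ proj₁ y × proj₂ x ≡ proj₂ y
    same refl = refl , refl
    φ≡inv : ∀ {i} b → φ (i , true) ≡ (i , false) → φ (i , b) ≡ inv (i , b)
    φ≡inv true  e = e
    φ≡inv {i} false e = trans (φ-inv (i , true)) (cong inv e)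
    up : ∀ {i} b → φ (i , true) ≡ (i , false) → α (pos w (i , b)) ≡ shift (pos w (i , b)) (toℕ d)
    up {i} b e = letter-injective w (trans (letter-edge w _) (trans (cong inv (letter-pos w _)) (sym (trans (h _) (trans (cong φ (letter-pos w (i , b))) (φ≡inv b e))))))
    down : ∀ l → φ l ≡ inv l → φ (proj₁ l , true) ≡ (proj₁ l , false)
    down (i , true)  e = e
    down (i , false) e = trans (φ-inv (i , false)) (cong inv e)

  -- M = N / 2 is the only element of order two in Z/N, so the choice of `d` disappears.
  InW2⇔ : ∀ {M r} → N ≡ 2 * M → InW2 r w ⇔ (Aut M × Card (EqS (Fin N)) (λ x → α x ≡ shift x M) (2 * r))
  InW2⇔ {M} {r} N≡ = mk⇔
    (λ { (d , (d≢0 , 2d) , φ , a , e) → let d≡ = half d d≢0 2d in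
         subst Aut d≡ (aut⇒conj w {d} (φ , a)) , subst₂ (λ z c → Card (EqS (Fin N)) (λ x → α x ≡ shift x z) (2 * c)) d≡ e (reversed-card a) })
    (λ { (a , c) → let φ , b = conj⇒aut w {M̂} (subst Aut (sym toℕ-M) a) in
         M̂ , (subst (_≢ 0) (sym toℕ-M) M≢0 , subst (λ z → (2 * z) % N ≡ 0) (sym toℕ-M) (trans (cong (_% N) (sym N≡)) (DM.n%n≡0 N))) , φ , b ,
         ℕₚ.*-cancelˡ-≡ _ _ 2 (card-unique (subst (λ z → Card (EqS (Fin N)) (λ x → α x ≡ shift x z) (2 * reversedEdges φ)) toℕ-M (reversed-card b)) c) })
    where
    M≢0 : M ≢ 0
    M≢0 refl = contradiction N≡ λ ()
    M<N : M < N
    M<N = subst (M <_) (sym N≡) (subst (M <_) (cong (M +_) (sym (ℕₚ.+-identityʳ M))) (ℕₚ.m<m+n M (ℕₚ.n≢0⇒n>0 M≢0)))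
    M̂ : Fin N
    M̂ = M mod N
    toℕ-M : toℕ M̂ ≡ M
    toℕ-M = trans (toℕ-mod M) (DM.m<n⇒m%n≡m M<N)
    half : ∀ d → toℕ d ≢ 0 → (2 * toℕ d) % N ≡ 0 → toℕ d ≡ M
    half d ne e with Div.m%n≡0⇒n∣m (2 * toℕ d) N e
    ... | Div.divides zero eq = ⊥-elim (ne (ℕₚ.m+n≡0⇒m≡0 (toℕ d) eq))
    ... | Div.divides (suc zero) eq = ℕₚ.*-cancelˡ-≡ _ _ 2 (trans eq (trans (ℕₚ.*-identityˡ N) N≡))
    ... | Div.divides (suc (suc q)) eq = ⊥-elim (ℕₚ.<⇒≱ (ℕₚ.*-monoʳ-< 2 (Fₚ.toℕ<n d)) (subst (2 * N ≤_) (sym eq) (ℕₚ.*-monoˡ-≤ N (s≤s (s≤s (z≤n {q}))))))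

  rel-shift : ∀ i e → rel {k} i (shift i e) ≡ e % N
  rel-shift i e = trans (cong (λ z → (z + (N ∸ toℕ i)) % N) (toℕ-shift i e)) (trans (+-% (toℕ i + e) (N ∸ toℕ i))
    (trans (cong (_% N) (trans (cong (_+ (N ∸ toℕ i)) (ℕₚ.+-comm (toℕ i) e)) (trans (ℕₚ.+-assoc e (toℕ i) _) (cong (e +_) (ℕₚ.m+[n∸m]≡n (ℕₚ.<⇒≤ (Fₚ.toℕ<n i)))))))
      (DM.[m+n]%n≡m%n e N)))

  module _ (g : Gluing α) {M : ℕ} (N≡ : N ≡ 3 * M) where
    open Gluing g
    private
      v = vert α
      module O = CubicOrbits (σ w) (σ-cub w g) (σ-no-leaf w g)
      module R = Orbits (σ w) O.f-injective
      M≢0 : M ≢ 0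
      M≢0 refl = contradiction N≡ λ ()
      0<M : 0 < M
      0<M = ℕₚ.n≢0⇒n>0 M≢0
      M<2M : M < 2 * M
      M<2M = subst (M <_) (cong (M +_) (sym (ℕₚ.+-identityʳ M))) (ℕₚ.m<m+n M 0<M)
      2M<N : 2 * M < N
      2M<N = subst (2 * M <_) (sym N≡) (ℕₚ.m<n+m (2 * M) 0<M)
      M<N : M < N
      M<N = ℕₚ.<-trans M<2M 2M<N
      rel-M : ∀ x → rel {k} x (shift x M) ≡ M
      rel-M x = trans (rel-shift x M) (DM.m<n⇒m%n≡m M<N)
      rel-2M : ∀ x → rel {k} x (shift x (2 * M)) ≡ 2 * M
      rel-2M x = trans (rel-shift x (2 * M)) (DM.m<n⇒m%n≡m 2M<N)
      M+2M : M + 2 * M ≡ N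
      M+2M = sym N≡
      2M+2M : 2 * M + 2 * M ≡ N + M
      2M+2M = trans (lem M) (cong (_+ M) (sym N≡))
        where
        lem : ∀ M → 2 * M + 2 * M ≡ 3 * M + M
        lem = solve-∀
      shift-N+ : ∀ x e → shift x (N + e) ≡ shift x e
      shift-N+ x e = trans (sym (shift-+ x N e)) (cong (λ z → shift z e) (shift-n x))

    third : ∀ d → toℕ {N} d ≢ 0 → (3 * toℕ d) % N ≡ 0 → toℕ d ≡ M ⊎ toℕ d ≡ 2 * M
    third d ne e with Div.m%n≡0⇒n∣m (3 * toℕ d) N e
    ... | Div.divides zero eq = ⊥-elim (ne (ℕₚ.m+n≡0⇒m≡0 (toℕ d) eq))
    ... | Div.divides (suc zero) eq = inj₁ (ℕₚ.*-cancelˡ-≡ _ _ 3 (trans eq (trans (ℕₚ.*-identityˡ N) N≡)))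
    ... | Div.divides (suc (suc zero)) eq = inj₂ (ℕₚ.*-cancelˡ-≡ _ _ 3 (trans eq (trans (cong (2 *_) N≡) (lem M))))
      where
      lem : ∀ M → 2 * (3 * M) ≡ 3 * (2 * M)
      lem = solve-∀
    ... | Div.divides (suc (suc (suc q))) eq = ⊥-elim (ℕₚ.<⇒≱ (ℕₚ.*-monoʳ-< 3 (Fₚ.toℕ<n d)) (subst (3 * N ≤_) (sym eq) (ℕₚ.*-monoˡ-≤ N (s≤s (s≤s (s≤s (z≤n {q})))))))

    -- The two elements of order three, M and 2M, generate the same subgroup, as 2M + 2M = N + M.
    aut-M : ∀ {d : Fin N} → toℕ d ≡ M ⊎ toℕ d ≡ 2 * M → Aut (toℕ d) → Aut M
    aut-M (inj₁ e) a = subst Aut e a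
    aut-M {d} (inj₂ e) a = conj λ x → trans (cong α (eq x)) (trans (at (conj-∘ a a) x) (sym (eq (α x))))
      where
      eq : ∀ x → shift x M ≡ shift x (toℕ d + toℕ d)
      eq x = sym (trans (cong (λ z → shift x (z + z)) e) (trans (cong (shift x) 2M+2M) (shift-N+ x M)))

    module _ (aM : Aut M) where
      private
        v-shift : ∀ x → v (shift x M) ≡ shift (v x) M
        v-shift = conj-vert aM

        v-shift² : ∀ x → v (shift x (2 * M)) ≡ shift (v x) (2 * M)
        v-shift² x = trans (cong v (two x)) (trans (v-shift (shift x M)) (trans (cong (λ z → shift z M) (v-shift x)) (sym (two (v x)))))
          where
          two : ∀ x → shift x (2 * M) ≡ shift (shift x M) M
          two x = sym (trans (shift-+ x M M) (cong (λ z → shift x (M + z)) (sym (ℕₚ.+-identityʳ M))))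

        Turn : ℕ → Fin N → Set
        Turn e x = v x ≡ shift x e

        turn²M : ∀ {x} → Turn M x → v (v x) ≡ shift x (2 * M)
        turn²M {x} t = trans (cong v t) (trans (v-shift x) (trans (cong (λ z → shift z M) t) (trans (shift-+ x M M) (cong (λ z → shift x (M + z)) (sym (ℕₚ.+-identityʳ M))))))

        turn²2M : ∀ {x} → Turn (2 * M) x → v (v x) ≡ shift x M
        turn²2M {x} t = trans (cong v t) (trans (v-shift² x) (trans (cong (λ z → shift z (2 * M)) t)
          (trans (shift-+ x (2 * M) (2 * M)) (trans (cong (shift x) 2M+2M) (shift-N+ x M)))))

        turn-next : ∀ {x} → Turn M x → Turn M (v x)
        turn-next {x} t = trans (cong v t) (v-shift x)
        turn-next² : ∀ {x} → Turn (2 * M) x → Turn (2 * M) (v x)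
        turn-next² {x} t = trans (cong v t) (v-shift² x)

        iter-turn : ∀ {e} → (∀ {x} → Turn e x → Turn e (v x)) → ∀ a {x} → Turn e x → Turn e (iter (σ w) a x)
        iter-turn nx zero    t = t
        iter-turn {e} nx (suc a) {x} t = subst (Turn e) (sym (σ≡vert w (iter (σ w) a x))) (nx (iter-turn nx a t))

        same : ∀ {x y} a → iter (σ w) a x ≡ y → SameVertex w x y
        same a e = R.reach a e

        same₁ : ∀ {x y} → v x ≡ y → SameVertex w x y
        same₁ {x} e = same 1 (trans (σ≡vert w x) e)

        same₂ : ∀ {x y} → v (v x) ≡ y → SameVertex w x y
        same₂ {x} e = same 2 (trans (cong (σ w) (σ≡vert w x)) (trans (σ≡vert w (v x)) e))

        -- The corner c + d is `v c` or `v (v c)`, since it differs from c. If `v (v c)` is c + M,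
        -- then c, being `v` of it, is `v c` + M, so `v c` is c + 2M; the same holds with M and 2M
        -- exchanged. Thus the turn of a fixed vertex does not depend on `d`.
        fixed-turn : ∀ {d : Fin N} {c} → toℕ d ≡ M ⊎ toℕ d ≡ 2 * M → SameVertex w c (c ⊕ toℕ d) → Turn M c ⊎ Turn (2 * M) c
        fixed-turn {c = c} d≡ (a , e) with O.orbit-cases (toℕ a) c | d≡
        ... | inj₁ z | inj₁ f = ⊥-elim (ℕₚ.<⇒≢ 0<M (trans (sym (trans (cong (λ y → rel {k} c y) (sym (shift-0 c))) (trans (rel-shift c 0) refl)))
               (trans (cong (rel {k} c) (trans (sym z) (trans e (cong (shift c) f)))) (rel-M c))))
        ... | inj₁ z | inj₂ f = ⊥-elim (ℕₚ.<⇒≢ (ℕₚ.<-trans 0<M M<2M) (trans (sym (trans (cong (λ y → rel {k} c y) (sym (shift-0 c))) (rel-shift c 0)))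
               (trans (cong (rel {k} c) (trans (sym z) (trans e (cong (shift c) f)))) (rel-2M c))))
        ... | inj₂ (inj₁ z) | inj₁ f = inj₁ (trans (sym (σ≡vert w c)) (trans (sym z) (trans e (cong (shift c) f))))
        ... | inj₂ (inj₁ z) | inj₂ f = inj₂ (trans (sym (σ≡vert w c)) (trans (sym z) (trans e (cong (shift c) f))))
        ... | inj₂ (inj₂ z) | inj₁ f = inj₂ (shift-injective M (trans (sym (v-shift c)) (trans (cong v (sym vv)) (trans (cub c)
               (sym (trans (shift-+ c (2 * M) M) (trans (cong (shift c) (trans (ℕₚ.+-comm (2 * M) M) M+2M)) (shift-n c))))))))
          where
          vv : v (v c) ≡ shift c M
          vv = trans (sym (trans (cong (σ w) (σ≡vert w c)) (σ≡vert w (v c)))) (trans (sym z) (trans e (cong (shift c) f)))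
        ... | inj₂ (inj₂ z) | inj₂ f = inj₁ (shift-injective (2 * M) (trans (sym (v-shift² c)) (trans (cong v (sym vv)) (trans (cub c)
               (sym (trans (shift-+ c M (2 * M)) (trans (cong (shift c) M+2M) (shift-n c))))))))
          where
          vv : v (v c) ≡ shift c (2 * M)
          vv = trans (sym (trans (cong (σ w) (σ≡vert w c)) (σ≡vert w (v c)))) (trans (sym z) (trans e (cong (shift c) f)))

        turn-fixed : ∀ {d : Fin N} {c} → toℕ d ≡ M ⊎ toℕ d ≡ 2 * M → Turn M c ⊎ Turn (2 * M) c → SameVertex w c (c ⊕ toℕ d)
        turn-fixed {c = c} d≡ t with d≡ | t
        ... | inj₁ f | inj₁ t = same₁ (trans t (cong (shift c) (sym f)))
        ... | inj₁ f | inj₂ t = same₂ (trans (turn²2M t) (cong (shift c) (sym f)))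
        ... | inj₂ f | inj₁ t = same₂ (trans (turn²M t) (cong (shift c) (sym f)))
        ... | inj₂ f | inj₂ t = same₁ (trans t (cong (shift c) (sym f)))

        triple : ∀ c → CornerTriple w c c (v c) (v (v c))
        triple c = same 0 refl , same₁ refl , same₂ refl , letter-vert w refl , letter-vert w refl , letter-vert w (cub c)

        -- The corners c, c + M, c + 2M come in this order in the word. If `v` visits them in the
        -- same order the vertex is positive; a turn by 2M visits them in the opposite order, giving
        -- a negative vertex.
        turn-positive : ∀ {c} → Turn M c → PositiveVertex w c
        turn-positive {c} t = c , v c , v (v c) , triple c ,
          subst (0 <_) (sym r₁) 0<M , subst₂ _<_ (sym r₁) (sym (trans (cong (rel {k} c) (turn²M t)) (rel-2M c))) M<2M
          where
          r₁ : rel {k} c (v c) ≡ M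
          r₁ = trans (cong (rel {k} c) t) (rel-M c)

        turn-negative : ∀ {c} → Turn (2 * M) c → NegativeVertex w c
        turn-negative {c} t = c , v c , v (v c) , triple c ,
          subst (0 <_) (sym r₂) 0<M , subst₂ _<_ (sym r₂) (sym (trans (cong (rel {k} c) t) (rel-2M c))) M<2M
          where
          r₂ : rel {k} c (v (v c)) ≡ M
          r₂ = trans (cong (rel {k} c) (turn²2M t)) (rel-M c)

        not-positive : ∀ {c} → Turn (2 * M) c → ¬ PositiveVertex w c
        not-positive {c} t (i , j , l , ((a , e) , _ , _ , e₁ , e₂ , _) , _ , lt) = ℕₚ.<-asym M<2M (subst₂ _<_
            (trans (cong (rel {k} i) (trans (sym (vert-letter w e₁)) ti)) (rel-2M i))
            (trans (cong (rel {k} i) (trans (sym (trans (cong v (vert-letter w e₁)) (vert-letter w e₂))) (turn²2M ti))) (rel-M i)) lt)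
          where
          ti : Turn (2 * M) i
          ti = subst (Turn (2 * M)) e (iter-turn turn-next² (toℕ a) t)

        not-negative : ∀ {c} → Turn M c → ¬ NegativeVertex w c
        not-negative {c} t (i , j , l , ((a , e) , _ , _ , e₁ , e₂ , _) , _ , lt) = ℕₚ.<-asym M<2M (subst₂ _<_
            (trans (cong (rel {k} i) (trans (sym (trans (cong v (vert-letter w e₁)) (vert-letter w e₂))) (turn²M ti))) (rel-2M i))
            (trans (cong (rel {k} i) (trans (sym (vert-letter w e₁)) ti)) (rel-M i)) lt)
          where
          ti : Turn M i
          ti = subst (Turn M) e (iter-turn turn-next (toℕ a) t)

        σ-turn : ∀ {e} → (∀ {x} → Turn e x → Turn e (v x)) → ∀ {x} → Turn e x → Turn e (σ w x)
        σ-turn {e} nx {x} t = subst (Turn e) (sym (σ≡vert w x)) (nx t)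

      positive-card : ∀ {d} → toℕ d ≡ M ⊎ toℕ d ≡ 2 * M → Card (EqS (Fin N)) (λ x → v x ≡ shift x M) (3 * fixedPositive w d)
      positive-card {d} d≡ = O.card-orbits (λ x → v x Fₚ.≟ shift x M) (σ-turn turn-next)
        (card-cong (λ { ((rep , fix) , p) → rep , [ id , (λ t → ⊥-elim (not-positive t p)) ]′ (fixed-turn d≡ fix) })
                   (λ { (rep , t) → (rep , turn-fixed d≡ (inj₁ t)) , turn-positive t })
                   (card-count (λ c → fixedVertex? w d c ×-dec positive? w c)))

      negative-card : ∀ {d} → toℕ d ≡ M ⊎ toℕ d ≡ 2 * M → Card (EqS (Fin N)) (λ x → v x ≡ shift x (2 * M)) (3 * fixedNegative w d)
      negative-card {d} d≡ = O.card-orbits (λ x → v x Fₚ.≟ shift x (2 * M)) (σ-turn turn-next²)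
        (card-cong (λ { ((rep , fix) , p) → rep , [ (λ t → ⊥-elim (not-negative t p)) , id ]′ (fixed-turn d≡ fix) })
                   (λ { (rep , t) → (rep , turn-fixed d≡ (inj₂ t)) , turn-negative t })
                   (card-count (λ c → fixedVertex? w d c ×-dec negative? w c)))

    -- Both generators of the group of order three fix the same vertices with the same signs, so `d`
    -- may be taken to be M. The factor 3 counts the corners of a vertex.
    InW3⇔ : ∀ {s t} → InW3 s t w ⇔ (Aut M × Card (EqS (Fin N)) (λ x → v x ≡ shift x M) (3 * s)
                                            × Card (EqS (Fin N)) (λ x → v x ≡ shift x (2 * M)) (3 * t))
    InW3⇔ {s} {t} = mk⇔
      (λ { (d , (d≢0 , 3d) , a , refl , refl) → let d≡ = third d d≢0 3d ; aM = aut-M {d} d≡ (aut⇒conj w {d} a)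
           in aM , positive-card aM d≡ , negative-card aM d≡ })
      (λ { (aM , c , c') → M̂ , (subst (_≢ 0) (sym toℕ-M) M≢0 , subst (λ z → (3 * z) % N ≡ 0) (sym toℕ-M) (trans (cong (_% N) (sym N≡)) (DM.n%n≡0 N))) ,
           conj⇒aut w {M̂} (subst Aut (sym toℕ-M) aM) ,
           ℕₚ.*-cancelˡ-≡ _ _ 3 (card-unique (positive-card aM {M̂} (inj₁ toℕ-M)) c) ,
           ℕₚ.*-cancelˡ-≡ _ _ 3 (card-unique (negative-card aM {M̂} (inj₁ toℕ-M)) c') })
      where
      M̂ : Fin N
      M̂ = M mod N
      toℕ-M : toℕ M̂ ≡ M
      toℕ-M = trans (toℕ-mod M) (DM.m<n⇒m%n≡m M<N)

-- The automorphism group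

module _ {n : ℕ} {α : Fin (suc n) → Fin (suc n)} where
  private
    N : ℕ
    N = suc n

  conj-0 : Conj 0 α α
  conj-0 = conj λ x → trans (cong α (shift-0 x)) (sym (shift-0 (α x)))

  conj-* : ∀ {d} c → Conj d α α → Conj (c * d) α α
  conj-* zero    a = conj-0
  conj-* (suc c) a = conj-∘ a (conj-* c a)

  conj-mod : ∀ {d e} → d % N ≡ e % N → Conj d α α → Conj e α α
  conj-mod {d} {e} eq a = conj λ x → trans (cong α (same x)) (trans (at a x) (sym (same (α x))))
    where
    same : ∀ x → shift x e ≡ shift x d
    same x = trans (sym (shift-% x e)) (trans (cong (shift x) (sym eq)) (shift-% x d))

  conj-cancel : ∀ d {e} → (d + e) % N ≡ 0 → Conj e α α → Conj d α α
  conj-cancel d {e} eq a = conj λ x → shift-injective e (trans (sym (at a (shift x d))) (trans (cong α (home x)) (sym (home (α x)))))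
    where
    home : ∀ x → shift (shift x d) e ≡ x
    home x = trans (shift-+ x d e) (trans (sym (shift-% x (d + e))) (trans (cong (shift x) eq) (shift-0 x)))

  -- Shifts that are automorphisms form a subgroup of Z/N, and Bézout's identity puts the gcd with N
  -- into the subgroup generated by d. Over the natural numbers the identity has two forms, one of
  -- which gives the negative of the gcd.
  conj-gcd : ∀ {d} → Conj d α α → Conj (gcd d N) α α
  conj-gcd {d} a with Bézout.identity (gcd-GCD d N)
  ... | Bézout.+- x y eq = conj-mod {x * d} {gcd d N} (trans (cong (_% N) (sym eq)) (DM.[m+kn]%n≡m%n (gcd d N) y N)) (conj-* x a)
  ... | Bézout.-+ x y eq = conj-cancel (gcd d N) (trans (cong (_% N) eq) (DM.m*n%n≡0 y N)) (conj-* x a)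

one^6 : ∀ k m N' N≡ → let open FinAb (ℤmod k) ; κ = Extension.one k m N' N≡ in κ ∙ κ ∙ κ ∙ κ ∙ κ ∙ κ ≡ ε → suc k Div.∣ 6
one^6 k m N' N≡ e = Div.m%n≡0⇒n∣m 6 n (trans (sym (toℕ-mod 6)) (cong toℕ (trans (sym (step 5 (step 4 (step 3 (step 2 (step 1 refl)))))) e)))
  where
  open FinAb (ℤmod k)
  n = suc k
  κ = Extension.one k m N' N≡
  step : ∀ a {x} → x ≡ a mod n → x ∙ κ ≡ suc a mod n
  step a refl = trans (cong (shift (a mod n)) (toℕ-mod 1)) (trans (shift-% (a mod n) 1) (trans (shift-mod a 1) (cong (_mod n) (ℕₚ.+-comm a 1))))

-- The quotient by an automorphism of order n has a face monodromy of
-- order n, so n divides 6.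
abstract
  aut-6-torsion : ∀ {n α d} → Gluing α → Conj {n} d α α → suc n Div.∣ 6 * d
  aut-6-torsion {N'} {α} {d} g a with gcd d (suc N') in eq | gcd[m,n]∣m d (suc N') | gcd[m,n]∣n d (suc N') | conj-gcd a
  ... | M | Div.divides c d≡ | Div.divides zero () | aM
  ... | zero | Div.divides c d≡ | Div.divides (suc k) N≡ | aM = contradiction (trans N≡ (ℕₚ.*-zeroʳ k)) λ ()
  ... | suc m | Div.divides c d≡ | Div.divides (suc k) N≡ | aM =
    Div.∣-trans (subst (Div._∣ 6 * suc m) (sym N≡) (Div.*-monoˡ-∣ (suc m) k∣6)) (Div.*-monoʳ-∣ 6 (Div.divides c d≡))
    where
    open Quotient k m N' N≡
    y : ∃[ y ] α ≗ lift y
    y = descend α (at aM)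
    k∣6 : suc k Div.∣ 6
    k∣6 = let R = gluing⇒regular (proj₁ y) (Gluing-resp (proj₂ y) g) in
      one^6 k m N' N≡ (MonodromySum.six-torsion (ℤmod k) (proj₁ (proj₁ y)) (proj₂ (proj₁ y))
        (Regular.invol R) (Regular.anti R) (Regular.cub R) (Regular.mon R))

module _ {k : ℕ} (w : Word k) where
  private
    N : ℕ
    N = Len k
    α = edge w
    Conclusion : Set
    Conclusion = (Σ (Fin N) λ d₀ → ((d : Fin N) → IsAut w d ⇔ (Σ ℕ λ m → (toℕ d ≡ (m * toℕ d₀) % N)))) ×
      (autOrder w ≡ 1 ⊎ autOrder w ≡ 2 ⊎ autOrder w ≡ 3 ⊎ autOrder w ≡ 6)

  -- The group consists of the q multiples of D. Its generator is D reduced modulo N, which for D =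
  -- N is 0 and gives the trivial group.
  multiples : ∀ q D → q * D ≡ N → (∀ {d} → Conj (toℕ d) α α → D Div.∣ toℕ {N} d) → Conj D α α →
    (Σ (Fin N) λ d₀ → ((d : Fin N) → IsAut w d ⇔ (Σ ℕ λ m → (toℕ d ≡ (m * toℕ d₀) % N)))) × autOrder w ≡ q
  multiples q D q≡ only aD = (D mod N , λ d → mk⇔ (λ a → to (only {d} (aut⇒conj w {d} a)))
      (λ { (m , e) → conj⇒aut w {d} (mult (subst (D Div.∣_) (sym e) (Div.%-presˡ-∣ (Div.∣n⇒∣m*n m D∣d₀) D∣N))) })) ,
    card-unique (card-cong (λ {d} a → only {d} (aut⇒conj w {d} a)) (λ {d} z → conj⇒aut w {d} (mult z)) (card-count (isAut? w))) card-mult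
    where
    D∣N : D Div.∣ N
    D∣N = Div.divides q (sym q≡)
    D∣d₀ : D Div.∣ toℕ (D mod N)
    D∣d₀ = subst (D Div.∣_) (sym (toℕ-mod D)) (Div.%-presˡ-∣ (Div.divides 1 (sym (ℕₚ.*-identityˡ D))) D∣N)
    mult : ∀ {d} → D Div.∣ d → Conj d α α
    mult (Div.divides c refl) = conj-* c aD
    to : ∀ {d : Fin N} → D Div.∣ toℕ d → Σ ℕ λ m → toℕ d ≡ (m * toℕ (D mod N)) % N
    to {d} (Div.divides c e) = c , trans (sym (toℕ-% d)) (trans (cong (_% N) e) (trans (DM.%-distribˡ-* c D N)
      (trans (cong (λ z → (c % N * z) % N) (sym (DM.m%n%n≡m%n D N))) (trans (sym (DM.%-distribˡ-* c (D % N) N)) (cong (λ z → (c * z) % N) (sym (toℕ-mod D)))))))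
    D≢0 : D ≢ 0
    D≢0 refl = contradiction (trans (sym q≡) (ℕₚ.*-zeroʳ q)) λ ()
    small : ∀ (j : Fin q) → toℕ j * D < N
    small j = subst (toℕ j * D <_) q≡ (ℕₚ.*-monoˡ-< D {{≢-nonZero D≢0}} (Fₚ.toℕ<n j))
    toℕ-jD : ∀ (j : Fin q) → toℕ ((toℕ j * D) mod N) ≡ toℕ j * D
    toℕ-jD j = trans (toℕ-mod (toℕ j * D)) (DM.m<n⇒m%n≡m (small j))
    card-mult : Card (EqS (Fin N)) (λ d → D Div.∣ toℕ d) q
    card-mult = card-map (card-Fin q) (λ j → (toℕ j * D) mod N) (λ {j} _ → Div.divides (toℕ j) (toℕ-jD j)) (λ { refl → refl })
      (λ {i} {j} _ _ e → Fₚ.toℕ-injective (ℕₚ.*-cancelʳ-≡ (toℕ i) (toℕ j) D {{≢-nonZero D≢0}} (trans (sym (toℕ-jD i)) (trans (cong toℕ e) (toℕ-jD j)))))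
      (λ { {d} (Div.divides c e) → let c<q = ℕₚ.*-cancelʳ-< D c q (subst₂ _<_ e (sym q≡) (Fₚ.toℕ<n d)) in
           fromℕ< c<q , tt , Fₚ.toℕ-injective (trans e (trans (cong (_* D) (sym (Fₚ.toℕ-fromℕ< c<q))) (sym (toℕ-jD (fromℕ< c<q))))) })

  -- By `aut-6-torsion` every automorphism is a multiple of M = N / 6. So the group is a subgroup of
  -- Z/6, identified by testing M, 3M and 2M.
  automorphism-group : ∀ M → N ≡ 6 * M → Gluing α → Conclusion
  automorphism-group M N≡ g with conj? (1 * M) α α | conj? (3 * M) α α | conj? (2 * M) α α
  ... | yes a₁ | _ | _ = let c , o = multiples 6 M (sym N≡) (λ {d} → steps {d}) (subst (λ z → Conj z α α) (ℕₚ.*-identityˡ M) a₁)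
                         in c , inj₂ (inj₂ (inj₂ o))
    where
    steps : ∀ {d : Fin N} → Conj (toℕ d) α α → M Div.∣ toℕ d
    steps {d} a = Div.*-cancelˡ-∣ 6 (subst (Div._∣ 6 * toℕ d) N≡ (aut-6-torsion g a))
  ... | no n₁ | d₃ | d₂ = rest d₃ d₂
    where
    -- Multiples of M matter only modulo 6. The instances are 25 = 1 + 24 (five is a generator), 7 =
    -- 1 + 6 (from 4 + 3) and 8 = 2 + 6.
    fold : ∀ a b q → a ≡ b + q * 6 → Conj (a * M) α α → Conj (b * M) α α
    fold a b q e = conj-mod {d = a * M} {b * M} (trans (cong (λ z → (z * M) % N) e) (trans (cong (_% N) (trans (ℕₚ.*-distribʳ-+ M b (q * 6))
      (cong (b * M +_) (trans (ℕₚ.*-assoc q 6 M) (cong (q *_) (sym N≡)))))) (DM.[m+kn]%n≡m%n (b * M) q N)))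
    times : ∀ c a → Conj (a * M) α α → Conj ((c * a) * M) α α
    times c a p = subst (λ z → Conj z α α) (sym (ℕₚ.*-assoc c a M)) (conj-* c p)
    plus : ∀ a b → Conj (a * M) α α → Conj (b * M) α α → Conj ((a + b) * M) α α
    plus a b p q = subst (λ z → Conj z α α) (sym (ℕₚ.*-distribʳ-+ M a b)) (conj-∘ p q)
    n₅ : ¬ Conj (5 * M) α α
    n₅ a = n₁ (fold 25 1 4 refl (times 5 5 a))
    residue : ∀ {d : Fin N} → Conj (toℕ d) α α → ∃[ j ] (j < 6 × toℕ d ≡ j * M)
    residue {d} a with Div.*-cancelˡ-∣ {M} {toℕ d} 6 (subst (Div._∣ 6 * toℕ d) N≡ (aut-6-torsion g a))
    ... | Div.divides j e = j , ℕₚ.*-cancelʳ-< M j 6 (subst₂ _<_ e N≡ (Fₚ.toℕ<n d)) , e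
    rest : Dec (Conj (3 * M) α α) → Dec (Conj (2 * M) α α) → Conclusion
    rest (yes a₃) _ = let c , o = multiples 2 (3 * M) (trans (lem M) (sym N≡)) only a₃ in c , inj₂ (inj₁ o)
      where
      lem : ∀ M → 2 * (3 * M) ≡ 6 * M
      lem = solve-∀
      only : ∀ {d} → Conj (toℕ d) α α → 3 * M Div.∣ toℕ {N} d
      only {d} a with residue {d} a
      ... | 0 , _ , e = Div.divides 0 e
      ... | 1 , _ , e = ⊥-elim (n₁ (subst (λ z → Conj z α α) e a))
      ... | 2 , _ , e = ⊥-elim (n₁ (fold 7 1 1 refl (plus 4 3 (times 2 2 (subst (λ z → Conj z α α) e a)) a₃)))
      ... | 3 , _ , e = Div.divides 1 (trans e (sym (ℕₚ.*-identityˡ (3 * M))))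
      ... | 4 , _ , e = ⊥-elim (n₁ (fold 7 1 1 refl (plus 4 3 (subst (λ z → Conj z α α) e a) a₃)))
      ... | 5 , _ , e = ⊥-elim (n₅ (subst (λ z → Conj z α α) e a))
      ... | suc (suc (suc (suc (suc (suc _))))) , s≤s (s≤s (s≤s (s≤s (s≤s (s≤s ()))))) , _
    rest (no n₃) (yes a₂) = let c , o = multiples 3 (2 * M) (trans (lem M) (sym N≡)) only a₂ in c , inj₂ (inj₂ (inj₁ o))
      where
      lem : ∀ M → 3 * (2 * M) ≡ 6 * M
      lem = solve-∀
      only : ∀ {d} → Conj (toℕ d) α α → 2 * M Div.∣ toℕ {N} d
      only {d} a with residue {d} a
      ... | 0 , _ , e = Div.divides 0 e
      ... | 1 , _ , e = ⊥-elim (n₁ (subst (λ z → Conj z α α) e a))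
      ... | 2 , _ , e = Div.divides 1 (trans e (sym (ℕₚ.*-identityˡ (2 * M))))
      ... | 3 , _ , e = ⊥-elim (n₃ (subst (λ z → Conj z α α) e a))
      ... | 4 , _ , e = Div.divides 2 (trans e (lem′ M))
        where
        lem′ : ∀ M → 4 * M ≡ 2 * (2 * M)
        lem′ = solve-∀
      ... | 5 , _ , e = ⊥-elim (n₅ (subst (λ z → Conj z α α) e a))
      ... | suc (suc (suc (suc (suc (suc _))))) , s≤s (s≤s (s≤s (s≤s (s≤s (s≤s ()))))) , _
    rest (no n₃) (no n₂) = let c , o = multiples 1 N (ℕₚ.*-identityˡ N) only (conj-mod {d = 0} {N} (sym (DM.n%n≡0 N)) conj-0) in c , inj₁ o
      where
      only : ∀ {d} → Conj (toℕ d) α α → N Div.∣ toℕ {N} d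
      only {d} a with residue {d} a
      ... | 0 , _ , e = Div.divides 0 e
      ... | 1 , _ , e = ⊥-elim (n₁ (subst (λ z → Conj z α α) e a))
      ... | 2 , _ , e = ⊥-elim (n₂ (subst (λ z → Conj z α α) e a))
      ... | 3 , _ , e = ⊥-elim (n₃ (subst (λ z → Conj z α α) e a))
      ... | 4 , _ , e = ⊥-elim (n₂ (fold 8 2 1 refl (times 2 4 (subst (λ z → Conj z α α) e a))))
      ... | 5 , _ , e = ⊥-elim (n₅ (subst (λ z → Conj z α α) e a))
      ... | suc (suc (suc (suc (suc (suc _))))) , s≤s (s≤s (s≤s (s≤s (s≤s (s≤s ()))))) , _

-- Evaluation of the masses

sum-ℤmod : ∀ k r (a : Fin (suc k)) → Sum.sum (FinAb.commutativeMonoid (ℤmod k)) {r} (λ _ → a) ≡ (r * toℕ a) mod suc k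
sum-ℤmod k zero    a = refl
sum-ℤmod k (suc r) a = trans (cong (λ z → shift a (toℕ z)) (sum-ℤmod k r a))
  (trans (cong (shift a) (toℕ-mod (r * toℕ a))) (shift-% a (r * toℕ a)))

sum-mixed : ∀ k {m} κ r η s h₁ t h₂ a b →
  Sum.sum (FinAb.commutativeMonoid (ℤmod k)) (Unlabelled.mixed (ℤmod k) κ {m} r η s h₁ t h₂ a b) ≡ (a * toℕ h₁ + b * toℕ h₂) mod suc k
sum-mixed k κ r η s h₁ t h₂ zero    b = sum-ℤmod k b h₂
sum-mixed k {m} κ r η s h₁ t h₂ (suc a) b = trans (cong (λ z → shift h₁ (toℕ z)) (sum-mixed k {m} κ r η s h₁ t h₂ a b))
  (trans (cong (shift h₁) (toℕ-mod (a * toℕ h₁ + b * toℕ h₂))) (trans (shift-% h₁ _)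
    (cong (_mod suc k) (sym (ℕₚ.+-assoc (toℕ h₁) (a * toℕ h₁) (b * toℕ h₂))))))

module _ (h : ℕ) where
  private
    g k N : ℕ
    g = suc h
    k = Kg g
    N = Len k

  Kg≡ : k ≡ 2 + 6 * h
  Kg≡ = trans (cong (_∸ 4) (lem h)) (ℕₚ.m+n∸m≡n 4 (2 + 6 * h))
    where
    lem : ∀ h → 6 * (1 + h) ≡ 4 + (2 + 6 * h)
    lem = solve-∀

  Len≡ : N ≡ 6 + 12 * h
  Len≡ = trans (cong Len Kg≡) (lem h)
    where
    lem : ∀ h → 1 + (2 + 6 * h) + (1 + (2 + 6 * h)) ≡ 6 + 12 * h
    lem = solve-∀

  -- The evaluation common to n = 1, 2, 3 and 6: `P` enters only through its equivalence with a
  -- symmetry having prescribed numbers of reversed edges and fixed vertices.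
  module Case (n' m : ℕ) (N≡ : N ≡ suc n' * suc m) (r : ℕ) (η : Fin (suc n')) (s : ℕ) (h₁ : Fin (suc n')) (t : ℕ) (h₂ : Fin (suc n'))
              (types : Quotient.Types n' m (k + suc k) N≡ r η s h₁ t h₂) (separate : h₁ ≡ h₂ → s ≡ 0 × t ≡ 0)
              (P : Word k → Set)
              (P⇒ : ∀ w → Gluing (edge w) → P w → Symmetric (suc m) r (toℕ η) s (toℕ h₁) t (toℕ h₂) (suc n') (edge w))
              (⇒P : ∀ w → Symmetric (suc m) r (toℕ η) s (toℕ h₁) t (toℕ h₂) (suc n') (edge w) → P w)
              (L : List (Word k)) (rep : RepSystem g P L) where
    private
      n M : ℕ
      n = suc n'
      M = suc m
      κ = Extension.one n' m (k + suc k) N≡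
      Sym = Symmetric {k + suc k} M r (toℕ η) s (toℕ h₁) t (toℕ h₂) n
      open Unlabelled (ℤmod n') κ {m} using (PairS; Map; map-conditions; map-count; mixed)

      counted : ∃[ A ] (Card (FunS N (Fin N)) Sym A × mass L ≡ frac A N)
      counted = mass-count {Good = λ w → IsMaxWicks g w × P w} {X = Sym} L
        (λ { {w} ((W , G) , p) → P⇒ w (maximal⇒gluing w h Kg≡ W G) p })
        (λ {w} S → gluing⇒maximal w (Symmetric.gluing S) h Kg≡ , ⇒P w S)
        Symmetric-resp Symmetric.gluing (λ c S → conj-symmetric c S)
        (proj₁ rep) (λ { w (W , p) → proj₁ (proj₂ rep) w W p }) (proj₂ (proj₂ rep))

    count-A : ℕ
    count-A = proj₁ counted

    mass≡ : mass L ≡ frac count-A N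
    mass≡ = proj₂ (proj₂ counted)

    private
      cMap : Card PairS (Map r η s h₁ t h₂) count-A
      cMap = Quotient.card-Map n' m (k + suc k) N≡ r η s h₁ t h₂ types (proj₁ (proj₂ counted))

      Σ-hs : Sum.sum (FinAb.commutativeMonoid (ℤmod n')) (mixed r η s h₁ t h₂ s t) ≡ (s * toℕ h₁ + t * toℕ h₂) mod n
      Σ-hs = sum-mixed n' {m} κ r η s h₁ t h₂ s t

      Σ-es : FinAb._∙_ (ℤmod n') κ (Sum.sum (FinAb.commutativeMonoid (ℤmod n')) {r} (λ _ → η)) ≡ (1 + r * toℕ η) mod n
      Σ-es = trans (cong (λ z → shift κ (toℕ z)) (sum-ℤmod n' r η)) (trans (cong (shift κ) (toℕ-mod (r * toℕ η)))
        (trans (shift-% κ (r * toℕ η)) (shift-mod 1 (r * toℕ η))))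

    -- Existence of a single map forces Euler's relation with some genus f and the monodromy
    -- equation in Z/n. Conversely, under these conditions `formula` has a nonzero right-hand side.
    nonempty : count-A ≢ 0 → (∃[ f ] 12 * f + 4 * (s + t) + 3 * r ≡ M + 6) × (s * toℕ h₁ + t * toℕ h₂) % n ≡ (1 + r * toℕ η) % n
    nonempty ne =
      let i = fromℕ< (ℕₚ.n≢0⇒n>0 ne)
          f , Σ≡ = map-conditions r η s h₁ t h₂ separate {Card.enum cMap i} (Card.sound cMap i)
      in f , trans (sym (toℕ-mod (s * toℕ h₁ + t * toℕ h₂))) (trans (cong toℕ (trans (sym Σ-hs) (trans Σ≡ Σ-es))) (toℕ-mod (1 + r * toℕ η)))

    formula : ∀ {f q} → 12 * f + 4 * (s + t) + 3 * r ≡ M + 6 → (s * toℕ h₁ + t * toℕ h₂) % n ≡ (1 + r * toℕ η) % n → 3 * f + (s + t + r) ≡ 2 + q →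
      count-A * (s ! * (t ! * r !)) * (12 ^ f * (f ! * q !)) ≡ M * ((n * n) ^ f * (2 * q) !)
    formula {f} {q} e Σ≡ q≡ = map-count r η s h₁ t h₂ separate {f} {q} q≡ (sym e)
      (trans Σ-hs (trans (mod-cong (s * toℕ h₁ + t * toℕ h₂) (1 + r * toℕ η) Σ≡) (sym Σ-es))) cMap

    positive⇒ : 0ℚ ℚ.< mass L → count-A ≢ 0
    positive⇒ lt e = ℚₚ.<-irrefl refl (subst (0ℚ ℚ.<_) (trans mass≡ (trans (cong (λ z → frac z N) e) (frac-0 N))) lt)

    ⇒positive : ∀ {f q} → 12 * f + 4 * (s + t) + 3 * r ≡ M + 6 → (s * toℕ h₁ + t * toℕ h₂) % n ≡ (1 + r * toℕ η) % n → 3 * f + (s + t + r) ≡ 2 + q →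
      0ℚ ℚ.< mass L
    ⇒positive {f} {q} e Σ≡ q≡ = subst (0ℚ ℚ.<_) (sym mass≡) (frac-pos {count-A} {N} λ A≡0 →
      ≢-nonZero⁻¹ R {{R≢0}} (trans (sym (formula {f} {q} e Σ≡ q≡)) (cong (λ z → z * (s ! * (t ! * r !)) * (12 ^ f * (f ! * q !))) A≡0)))
      where
      R = M * ((n * n) ^ f * (2 * q) !)
      R≢0 : NonZero R
      R≢0 = ℕₚ.m*n≢0 M _ {{_}} {{ℕₚ.m*n≢0 ((n * n) ^ f) ((2 * q) !) {{ℕₚ.m^n≢0 (n * n) f}} {{ℕₚ._!≢0 (2 * q)}}}}

frac-^ : ∀ a b .{{_ : NonZero b}} f → frac a b ^ℚ f ≡ frac (a ^ f) (b ^ f)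
frac-^ a b zero    = refl
frac-^ a b (suc f) = trans (cong (frac a b ℚ.*_) (frac-^ a b f)) (frac-* a b (a ^ f) (b ^ f))
  where
  instance
    b^f≢0 : NonZero (b ^ f)
    b^f≢0 = ℕₚ.m^n≢0 b f

-- Here (2q + 2)! / (q + 1)! = 2 (2q + 1)! / q!, which is the origin of the numerator in 2 / n. The
-- index `suc q` expresses that the argument of the last factorial, 3f plus the number of leaves and
-- half-edges minus 3, is not negative.
mass-formula : ∀ n f Q q {A M} .{{_ : NonZero n}} .{{_ : NonZero M}} .{{_ : NonZero Q}} →
  A * Q * (12 ^ f * (f ! * suc q !)) ≡ M * ((n * n) ^ f * (2 * suc q) !) →
  frac A (n * M) ≡ frac 2 n ℚ.* (frac (n ^ 2) 12 ^ℚ f) ℚ.* frac 1 Q ℚ.* frac ((1 + 2 * q) !) (f ! * q !)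
mass-formula n f Q q {A} {M} e = sym (trans (cong (λ z → frac 2 n ℚ.* z ℚ.* frac 1 Q ℚ.* frac F (f ! * q !)) (frac-^ (n ^ 2) 12 f))
  (trans (cong (λ z → z ℚ.* frac 1 Q ℚ.* frac F (f ! * q !)) (frac-* 2 n ((n ^ 2) ^ f) (12 ^ f)))
    (trans (cong (ℚ._* frac F (f ! * q !)) (frac-* (2 * (n ^ 2) ^ f) (n * 12 ^ f) 1 Q))
      (trans (frac-* (2 * (n ^ 2) ^ f * 1) (n * 12 ^ f * Q) F (f ! * q !)) (frac-cong {d = n * M} (sym cross))))))
  where
  open ≡-Reasoning
  F = (1 + 2 * q) !
  instance
    12^f≢0 : NonZero (12 ^ f)
    12^f≢0 = ℕₚ.m^n≢0 12 f
    n12≢0 : NonZero (n * 12 ^ f)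
    n12≢0 = ℕₚ.m*n≢0 n (12 ^ f)
    n12Q≢0 : NonZero (n * 12 ^ f * Q)
    n12Q≢0 = ℕₚ.m*n≢0 (n * 12 ^ f) Q
    fq≢0 : NonZero (f ! * q !)
    fq≢0 = ℕₚ.m*n≢0 (f !) (q !) {{ℕₚ._!≢0 f}} {{ℕₚ._!≢0 q}}
    all≢0 : NonZero (n * 12 ^ f * Q * (f ! * q !))
    all≢0 = ℕₚ.m*n≢0 (n * 12 ^ f * Q) (f ! * q !)
    nM≢0 : NonZero (n * M)
    nM≢0 = ℕₚ.m*n≢0 n M
  lem₁ : ∀ q A Q T ff qq → (1 + q) * (A * Q * (T * (ff * qq))) ≡ A * Q * (T * (ff * ((1 + q) * qq)))
  lem₁ = solve-∀
  lem₂ : ∀ q M P F → M * (P * ((2 + 2 * q) * F)) ≡ (1 + q) * (M * (P * (2 * F)))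
  lem₂ = solve-∀
  lem₃ : ∀ n A Q T ff qq → A * (n * T * Q * (ff * qq)) ≡ n * (A * Q * (T * (ff * qq)))
  lem₃ = solve-∀
  lem₄ : ∀ n M P F → n * (M * (P * (2 * F))) ≡ 2 * P * 1 * F * (n * M)
  lem₄ = solve-∀
  lem₅ : ∀ q → 2 * (1 + q) ≡ 2 + 2 * q
  lem₅ = solve-∀
  n²≡ : n * n ≡ n ^ 2
  n²≡ = cong (n *_) (sym (ℕₚ.*-identityʳ n))
  core : A * Q * (12 ^ f * (f ! * q !)) ≡ M * ((n ^ 2) ^ f * (2 * F))
  core = ℕₚ.*-cancelˡ-≡ _ _ (suc q) (begin
    suc q * (A * Q * (12 ^ f * (f ! * q !)))     ≡⟨ lem₁ q A Q (12 ^ f) (f !) (q !) ⟩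
    A * Q * (12 ^ f * (f ! * (suc q * q !)))     ≡⟨ e ⟩
    M * ((n * n) ^ f * (2 * suc q) !)            ≡⟨ cong₂ (λ a b → M * (a ^ f * b !)) n²≡ (lem₅ q) ⟩
    M * ((n ^ 2) ^ f * ((2 + 2 * q) * F))        ≡⟨ lem₂ q M ((n ^ 2) ^ f) F ⟩
    suc q * (M * ((n ^ 2) ^ f * (2 * F)))        ∎)
  cross : A * (n * 12 ^ f * Q * (f ! * q !)) ≡ 2 * (n ^ 2) ^ f * 1 * F * (n * M)
  cross = trans (lem₃ n A Q (12 ^ f) (f !) (q !)) (trans (cong (n *_) core) (lem₄ n M ((n ^ 2) ^ f) F))

-- Congruences modulo 3 and 6

mod-from : ∀ n .{{_ : NonZero n}} a b x y → a + x * n ≡ b + y * n → a % n ≡ b % n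
mod-from n a b x y e = trans (sym (DM.[m+kn]%n≡m%n a x n)) (trans (cong (_% n) e) (DM.[m+kn]%n≡m%n b y n))

mod-to : ∀ n .{{_ : NonZero n}} a b → a % n ≡ b % n → a + (b / n) * n ≡ b + (a / n) * n
mod-to n a b e = trans (cong (_+ (b / n) * n) (DM.m≡m%n+[m/n]*n a n)) (trans (cong (λ z → z + (a / n) * n + (b / n) * n) e)
  (trans (lem (b % n) ((a / n) * n) ((b / n) * n)) (cong (_+ (a / n) * n) (sym (DM.m≡m%n+[m/n]*n b n)))))
  where
  lem : ∀ x y z → x + y + z ≡ x + z + y
  lem = solve-∀

-- Modulo 3, Euler's relation reads S + T = g + 1 and the monodromy equation S - T = 1; solving
-- gives S = 2g + 1 and T = 2g. The multiples 3c and 3c' let the same computation serve n = 3 and n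
-- = 6.
signs-from-sum : ∀ g S T c c' → 2 * (S + T) + 3 * c ≡ 2 * g + 2 + 3 * c' → (S + T * 2) % 3 ≡ 1 →
  S % 3 ≡ (2 * g + 1) % 3 × T % 3 ≡ (2 * g) % 3
signs-from-sum g S T c c' E D =
  sym (mod-from 3 (2 * g + 1) S (x + c') (y + c) (ℕₚ.+-cancelʳ-≡ 1 _ _ (begin
    2 * g + 1 + (x + c') * 3 + 1          ≡⟨ lem₁ g x c' ⟩
    2 * g + 2 + 3 * c' + x * 3            ≡⟨ cong (_+ x * 3) E ⟨
    2 * (S + T) + 3 * c + x * 3           ≡⟨ lem₂ S T c x ⟩
    S + 3 * c + (S + T * 2 + x * 3)       ≡⟨ cong (S + 3 * c +_) D′ ⟩
    S + 3 * c + (1 + y * 3)               ≡⟨ lem₃ S c y ⟩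
    S + (y + c) * 3 + 1                   ∎))) ,
  sym (mod-from 3 (2 * g) T (T + 2 * x + c') (2 * y + c) (ℕₚ.+-cancelʳ-≡ 2 _ _ (begin
    2 * g + (T + 2 * x + c') * 3 + 2      ≡⟨ lem₄ g T x c' ⟩
    2 * g + 2 + 3 * c' + 3 * T + 6 * x    ≡⟨ cong (λ z → z + 3 * T + 6 * x) E ⟨
    2 * (S + T) + 3 * c + 3 * T + 6 * x   ≡⟨ lem₅ S T c x ⟩
    T + 3 * c + 2 * (S + T * 2 + x * 3)   ≡⟨ cong (λ z → T + 3 * c + 2 * z) D′ ⟩
    T + 3 * c + 2 * (1 + y * 3)           ≡⟨ lem₆ T c y ⟩
    T + (2 * y + c) * 3 + 2               ∎)))
  where
  open ≡-Reasoning
  x y : ℕ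
  -- The quotient of 1 by 3, as `mod-to` produces it; y is the quotient of S + 2T.
  x = 0
  y = (S + T * 2) / 3
  D′ : S + T * 2 + x * 3 ≡ 1 + y * 3
  D′ = mod-to 3 (S + T * 2) 1 D
  lem₁ : ∀ g x c' → 2 * g + 1 + (x + c') * 3 + 1 ≡ 2 * g + 2 + 3 * c' + x * 3
  lem₁ = solve-∀
  lem₂ : ∀ S T c x → 2 * (S + T) + 3 * c + x * 3 ≡ S + 3 * c + (S + T * 2 + x * 3)
  lem₂ = solve-∀
  lem₃ : ∀ S c y → S + 3 * c + (1 + y * 3) ≡ S + (y + c) * 3 + 1
  lem₃ = solve-∀
  lem₄ : ∀ g T x c' → 2 * g + (T + 2 * x + c') * 3 + 2 ≡ 2 * g + 2 + 3 * c' + 3 * T + 6 * x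
  lem₄ = solve-∀
  lem₅ : ∀ S T c x → 2 * (S + T) + 3 * c + 3 * T + 6 * x ≡ T + 3 * c + 2 * (S + T * 2 + x * 3)
  lem₅ = solve-∀
  lem₆ : ∀ T c y → T + 3 * c + 2 * (1 + y * 3) ≡ T + (2 * y + c) * 3 + 2
  lem₆ = solve-∀

-- Adding the first congruence to twice the second gives S + 2T = 6g + 1 modulo 3.
sum-from-signs : ∀ g S T → S % 3 ≡ (2 * g + 1) % 3 → T % 3 ≡ (2 * g) % 3 → ∃[ x ] ∃[ y ] (S + T * 2 + x * 3 ≡ 1 + y * 3)
sum-from-signs g S T e e' = (2 * g + 1) / 3 + 2 * (2 * g / 3) , 2 * g + S / 3 + 2 * (T / 3) , trans (lem₁ S T ((2 * g + 1) / 3) (2 * g / 3))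
  (trans (cong₂ (λ a b → a + 2 * b) (mod-to 3 S (2 * g + 1) e) (mod-to 3 T (2 * g) e')) (lem₂ g (S / 3) (T / 3)))
  where
  lem₁ : ∀ S T a b → S + T * 2 + (a + 2 * b) * 3 ≡ S + a * 3 + 2 * (T + b * 3)
  lem₁ = solve-∀
  lem₂ : ∀ g a b → 2 * g + 1 + a * 3 + 2 * (2 * g + b * 3) ≡ 1 + (2 * g + a + 2 * b) * 3
  lem₂ = solve-∀

-- Three times the congruence modulo 2 minus twice the one modulo 3, with all terms kept on the side
-- where they are natural numbers.
mod-6 : ∀ Z W a b c d → Z + a * 3 ≡ W + b * 3 → Z + c * 2 ≡ W + d * 2 → Z % 6 ≡ W % 6
mod-6 Z W a b c d e₃ e₂ = mod-from 6 Z W (c + b) (d + a) (ℕₚ.+-cancelˡ-≡ (2 * Z + 2 * W) _ _ (begin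
  2 * Z + 2 * W + (Z + (c + b) * 6)             ≡⟨ lem₁ Z W b c ⟩
  3 * (Z + c * 2) + 2 * (W + b * 3)             ≡⟨ cong₂ (λ x y → 3 * x + 2 * y) e₂ (sym e₃) ⟩
  3 * (W + d * 2) + 2 * (Z + a * 3)             ≡⟨ lem₂ Z W a d ⟩
  2 * Z + 2 * W + (W + (d + a) * 6)             ∎))
  where
  open ≡-Reasoning
  lem₁ : ∀ Z W b c → 2 * Z + 2 * W + (Z + (c + b) * 6) ≡ 3 * (Z + c * 2) + 2 * (W + b * 3)
  lem₁ = solve-∀
  lem₂ : ∀ Z W a d → 3 * (W + d * 2) + 2 * (Z + a * 3) ≡ 2 * Z + 2 * W + (W + (d + a) * 6)
  lem₂ = solve-∀

factorial-indices : ∀ X Y q → Y ≡ 2 * X → X ≡ 3 + q → Y ∸ 5 ≡ 1 + 2 * q × X ∸ 3 ≡ q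
factorial-indices X Y q refl refl = trans (cong (_∸ 5) (lem q)) (ℕₚ.m+n∸m≡n 5 (1 + 2 * q)) , ℕₚ.m+n∸m≡n 3 q
  where
  lem : ∀ q → 2 * (3 + q) ≡ 5 + (1 + 2 * q)
  lem = solve-∀

factorials-nonZero : ∀ a b → NonZero (a ! * b !)
factorials-nonZero a b = ℕₚ.m*n≢0 (a !) (b !) {{ℕₚ._!≢0 a}} {{ℕₚ._!≢0 b}}

-- Masses and automorphism groups in genus h + 1

module MainTheorem (h : ℕ) where
  private
    g k N : ℕ
    g = suc h
    k = Kg g
    N = Len k

  open Gluing using (fpf; no-leaf)

  private
    -- A type of half-edge that does not occur is recorded with displacement 0, and no side is glued
    -- to itself.
    no-halves : ∀ {n} {α : Fin N → Fin N} → Gluing α → Card (EqS (Fin N)) (λ x → α x ≡ shift x 0) (n * 0)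
    no-halves {n} G = subst (Card _ _) (sym (ℕₚ.*-zeroʳ n)) (card-∅ λ {x} e → fpf G x (trans e (shift-0 x)))

    no-leaves : ∀ {n} {α : Fin N → Fin N} → Gluing α → Card (EqS (Fin N)) (λ x → vert α x ≡ shift x 0) (n * 0)
    no-leaves {n} G = subst (Card _ _) (sym (ℕₚ.*-zeroʳ n)) (card-∅ λ {x} e → no-leaf G x (trans e (shift-0 x)))

  -- The case of the trivial voltage group: M = N, the quotient is the surface itself, and f = g.
  all-maximal : ∀ L → RepSystem g (λ _ → ⊤) L → mass L ≡ m1 g
  all-maximal L rep = trans mass≡ (trans (cong (frac count-A) N≡)
    (trans (mass-formula 1 g 1 (3 * h) {count-A} {suc m} (formula {g} {suc (3 * h)} (lem₁ h) refl (lem₂ h)))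
      (cong₂ (λ x y → x ℚ.* y) (ℚₚ.*-identityʳ (frac 2 1 ℚ.* (frac (1 ^ 2) 12 ^ℚ g)))
        (cong₂ (λ a b → frac (a !) (g ! * b !)) (sym (proj₁ indices)) (sym (proj₂ indices))))))
    where
    m : ℕ
    m = 5 + 12 * h
    N≡ : N ≡ 1 * suc m
    N≡ = trans (Len≡ h) (sym (ℕₚ.*-identityˡ _))
    lem₁ : ∀ h → 12 * (1 + h) + 4 * (0 + 0) + 3 * 0 ≡ 6 + 12 * h + 6
    lem₁ = solve-∀
    lem₂ : ∀ h → 3 * (1 + h) + (0 + 0 + 0) ≡ 2 + (1 + 3 * h)
    lem₂ = solve-∀
    lem₃ : ∀ h → 6 * (1 + h) ≡ 2 * (3 * (1 + h))
    lem₃ = solve-∀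
    lem₄ : ∀ h → 3 * (1 + h) ≡ 3 + 3 * h
    lem₄ = solve-∀
    indices : 6 * g ∸ 5 ≡ 1 + 2 * (3 * h) × 3 * g ∸ 3 ≡ 3 * h
    indices = factorial-indices (3 * g) (6 * g) (3 * h) (lem₃ h) (lem₄ h)
    home : ∀ x → shift x (suc m) ≡ x
    home x = trans (cong (shift x) (sym (Len≡ h))) (shift-n x)
    types : Quotient.Types 0 m (k + suc k) N≡ 0 zero 0 zero 0 zero
    types = record { torsion₂ = λ { zero _ ne → ⊥-elim (ne refl) } ; torsion₃ = λ { zero _ ne → ⊥-elim (ne refl) }
                   ; half-ok = λ ne → ⊥-elim (ne refl) ; leaf₁-ok = λ ne → ⊥-elim (ne refl) ; leaf₂-ok = λ ne → ⊥-elim (ne refl) }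
    symmetric : ∀ w → Gluing (edge w) → ⊤ → Symmetric (suc m) 0 0 0 0 0 0 1 (edge w)
    symmetric w G _ = record { gluing = G ; equi = λ x → trans (cong (edge w) (home x)) (sym (home (edge w x)))
                             ; halves = no-halves {1} G ; leaf₁ = no-leaves {1} G ; leaf₂ = no-leaves {1} G }
    open Case h 0 m N≡ 0 zero 0 zero 0 zero types (λ _ → refl , refl) (λ _ → ⊤) symmetric (λ _ _ → tt) L rep

  module Order2 (r : ℕ) (L : List (Word k)) (rep : RepSystem g (InW2 r) L) where
    private
      m : ℕ
      m = 2 + 6 * h
      N≡ : N ≡ 2 * suc m
      N≡ = trans (Len≡ h) (lem h)
        where
        lem : ∀ h → 6 + 12 * h ≡ 2 * (3 + 6 * h)
        lem = solve-∀
      M≡ : suc m ≡ 1 * suc m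
      M≡ = sym (ℕₚ.*-identityˡ _)
      types : Quotient.Types 1 m (k + suc k) N≡ r (suc zero) 0 zero 0 zero
      types = record
        { torsion₂ = λ { zero _ ne → ⊥-elim (ne refl) ; (suc zero) _ _ → refl }
        ; torsion₃ = λ { zero _ ne → ⊥-elim (ne refl) ; (suc zero) () _ }
        ; half-ok = λ _ → refl , λ () ; leaf₁-ok = λ ne → ⊥-elim (ne refl) ; leaf₂-ok = λ ne → ⊥-elim (ne refl) }
      to : ∀ w → Gluing (edge w) → InW2 r w → Symmetric (suc m) r 1 0 0 0 0 2 (edge w)
      to w G p = let a , c = Equivalence.to (InW2⇔ w N≡) p in
        record { gluing = G ; equi = at a ; halves = subst (λ z → Card (EqS (Fin N)) (λ x → edge w x ≡ shift x z) (2 * r)) M≡ c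
               ; leaf₁ = no-leaves {2} G ; leaf₂ = no-leaves {2} G }
      from : ∀ w → Symmetric (suc m) r 1 0 0 0 0 2 (edge w) → InW2 r w
      from w S = Equivalence.from (InW2⇔ w N≡)
        (conj (Symmetric.equi S) , subst (λ z → Card (EqS (Fin N)) (λ x → edge w x ≡ shift x z) (2 * r)) (sym M≡) (Symmetric.halves S))
      open Case h 1 m N≡ r (suc zero) 0 zero 0 zero types (λ _ → refl , refl) (InW2 r) to from L rep

      module _ (f : ℕ) (e : 4 * f + r ≡ 2 * g + 1) where
        euler : 12 * f + 4 * (0 + 0) + 3 * r ≡ suc m + 6
        euler = trans (lem₁ f r) (trans (cong (3 *_) e) (lem₂ h))
          where
          lem₁ : ∀ f r → 12 * f + 4 * (0 + 0) + 3 * r ≡ 3 * (4 * f + r)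
          lem₁ = solve-∀
          lem₂ : ∀ h → 3 * (2 * (1 + h) + 1) ≡ 3 + 6 * h + 6
          lem₂ = solve-∀
        -- Euler's relation already makes r odd, and the monodromy equation 0 = 1 + r in Z/2 says
        -- nothing more. Hence no congruence accompanies the condition on f.
        odd : (0 * 0 + 0 * 0) % 2 ≡ (1 + r * 1) % 2
        odd = mod-from 2 0 (1 + r * 1) (2 + h) (2 * f) (trans (lem₂ h) (trans (cong suc (sym e)) (lem₁ f r)))
          where
          lem₁ : ∀ f r → 1 + (4 * f + r) ≡ 1 + r * 1 + 2 * f * 2
          lem₁ = solve-∀
          lem₂ : ∀ h → 0 + (2 + h) * 2 ≡ 1 + (2 * (1 + h) + 1)
          lem₂ = solve-∀
        -- Genus one is no exception here: f = 0 gives r = 2g + 1, which is at least 3, and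
        -- otherwise 3f is.
        rank : ∃[ q ] 3 * f + r ≡ 3 + q
        rank = go f e
          where
          lem : ∀ f r → 3 * (1 + f) + r ≡ 3 + (3 * f + r)
          lem = solve-∀
          go : ∀ f → 4 * f + r ≡ 2 * g + 1 → ∃[ q ] 3 * f + r ≡ 3 + q
          go zero    e = 2 * h , trans e (lem′ h)
            where
            lem′ : ∀ h → 2 * (1 + h) + 1 ≡ 3 + 2 * h
            lem′ = solve-∀
          go (suc f) e = 3 * f + r , lem f r

    positive : (0ℚ ℚ.< mass L) ⇔ (∃[ f ] (4 * f + r ≡ 2 * g + 1))
    positive = mk⇔
      (λ lt → let f , e = proj₁ (nonempty (positive⇒ lt)) in f , ℕₚ.*-cancelˡ-≡ _ _ 3 (trans (lem₁ f r) (trans e (lem₂ h))))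
      (λ { (f , e) → ⇒positive {f} {suc (proj₁ (rank f e))} (euler f e) (odd f e) (proj₂ (rank f e)) })
      where
      lem₁ : ∀ f r → 3 * (4 * f + r) ≡ 12 * f + 4 * (0 + 0) + 3 * r
      lem₁ = solve-∀
      lem₂ : ∀ h → 3 + 6 * h + 6 ≡ 3 * (2 * (1 + h) + 1)
      lem₂ = solve-∀

    value : ∀ f → 4 * f + r ≡ 2 * g + 1 → mass L ≡ m2 f r
    value f e = trans mass≡ (trans (cong (frac count-A) N≡)
      (trans (mass-formula 2 f (r !) q {count-A} {suc m} {{_}} {{_}} {{ℕₚ._!≢0 r}}
               (trans (cong (λ z → count-A * z * (12 ^ f * (f ! * suc q !))) (sym (lem₂ (r !)))) (formula {f} {suc q} (euler f e) (odd f e) (proj₂ (rank f e)))))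
        (cong (frac 2 2 ℚ.* (frac (2 ^ 2) 12 ^ℚ f) ℚ.* frac 1 (r !) ℚ.*_)
          (cong₂ (λ a b → frac (a !) (f ! * b !)) (sym (proj₁ indices)) (sym (proj₂ indices))))))
      where
      q = proj₁ (rank f e)
      lem₁ : ∀ f r → 6 * f + 2 * r ≡ 2 * (3 * f + r)
      lem₁ = solve-∀
      lem₂ : ∀ x → 1 * (1 * x) ≡ x
      lem₂ = solve-∀
      indices = factorial-indices (3 * f + r) (6 * f + 2 * r) q (lem₁ f r) (proj₂ (rank f e))

  module Order3 (s t : ℕ) (L : List (Word k)) (rep : RepSystem g (InW3 s t) L) where
    private
      m : ℕ
      m = 1 + 4 * h
      N≡ : N ≡ 3 * suc m
      N≡ = trans (Len≡ h) (lem h)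
        where
        lem : ∀ h → 6 + 12 * h ≡ 3 * (2 + 4 * h)
        lem = solve-∀
      M≡ : suc m ≡ 1 * suc m
      M≡ = sym (ℕₚ.*-identityˡ _)
      types : Quotient.Types 2 m (k + suc k) N≡ 0 zero s (suc zero) t (suc (suc zero))
      types = record
        { torsion₂ = λ { zero _ ne → ⊥-elim (ne refl) ; (suc zero) () _ ; (suc (suc zero)) () _ }
        ; torsion₃ = λ { zero _ ne → ⊥-elim (ne refl) ; (suc zero) _ _ → inj₁ refl ; (suc (suc zero)) _ _ → inj₂ refl }
        ; half-ok = λ ne → ⊥-elim (ne refl) ; leaf₁-ok = λ _ → refl , λ () ; leaf₂-ok = λ _ → refl , λ () }
      to : ∀ w → Gluing (edge w) → InW3 s t w → Symmetric (suc m) 0 0 s 1 t 2 3 (edge w)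
      to w G p = let a , c , c' = Equivalence.to (InW3⇔ w G N≡) p in
        record { gluing = G ; equi = at a ; halves = no-halves {3} G
               ; leaf₁ = subst (λ z → Card (EqS (Fin N)) (λ x → vert (edge w) x ≡ shift x z) (3 * s)) M≡ c ; leaf₂ = c' }
      from : ∀ w → Symmetric (suc m) 0 0 s 1 t 2 3 (edge w) → InW3 s t w
      from w S = Equivalence.from (InW3⇔ w (Symmetric.gluing S) N≡)
        (conj (Symmetric.equi S) , subst (λ z → Card (EqS (Fin N)) (λ x → vert (edge w) x ≡ shift x z) (3 * s)) (sym M≡) (Symmetric.leaf₁ S) , Symmetric.leaf₂ S)
      open Case h 2 m N≡ 0 zero s (suc zero) t (suc (suc zero)) types (λ ()) (InW3 s t) to from L rep

      euler : ∀ f → 3 * f + s + t ≡ g + 1 → 12 * f + 4 * (s + t) + 3 * 0 ≡ suc m + 6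
      euler f e = trans (lem₁ f s t) (trans (cong (4 *_) e) (lem₂ h))
        where
        lem₁ : ∀ f s t → 12 * f + 4 * (s + t) + 3 * 0 ≡ 4 * (3 * f + s + t)
        lem₁ = solve-∀
        lem₂ : ∀ h → 4 * (1 + h + 1) ≡ 2 + 4 * h + 6
        lem₂ = solve-∀
      -- The index 3f + s + t is g + 1, which reaches 3 only for g > 1: this is why the torus is
      -- treated apart.
      rank : ∀ f → 3 * f + s + t ≡ g + 1 → 3 * f + (s + t + 0) ≡ 2 + h
      rank f e = trans (lem₁ f s t) (trans e (lem₂ h))
        where
        lem₁ : ∀ f s t → 3 * f + (s + t + 0) ≡ 3 * f + s + t
        lem₁ = solve-∀
        lem₂ : ∀ h → 1 + h + 1 ≡ 2 + h
        lem₂ = solve-∀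
      total : s % 3 ≡ (2 * g + 1) % 3 → t % 3 ≡ (2 * g) % 3 → (s * 1 + t * 2) % 3 ≡ 1
      total es et = let x , y , e = sum-from-signs g s t es et in
        mod-from 3 (s * 1 + t * 2) 1 x y (trans (cong (λ z → z + t * 2 + x * 3) (ℕₚ.*-identityʳ s)) e)

    positive : (0ℚ ℚ.< mass L) ⇔ ((∃[ f ] (3 * f + s + t ≡ g + 1)) × s % 3 ≡ (2 * g + 1) % 3 × t % 3 ≡ (2 * g) % 3)
    positive = mk⇔ only-if (λ { ((f , e) , es , et) → ⇒positive {f} {h} (euler f e) (total es et) (rank f e) })
      where
      lem₁ : ∀ f s t → 4 * (3 * f + s + t) ≡ 12 * f + 4 * (s + t) + 3 * 0
      lem₁ = solve-∀
      lem₂ : ∀ h → 2 + 4 * h + 6 ≡ 4 * (1 + h + 1)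
      lem₂ = solve-∀
      lem₃ : ∀ f s t → 2 * (s + t) + 3 * (2 * f) ≡ 2 * (3 * f + s + t)
      lem₃ = solve-∀
      lem₄ : ∀ g → 2 * (g + 1) ≡ 2 * g + 2 + 3 * 0
      lem₄ = solve-∀
      only-if : 0ℚ ℚ.< mass L → (∃[ f ] (3 * f + s + t ≡ g + 1)) × s % 3 ≡ (2 * g + 1) % 3 × t % 3 ≡ (2 * g) % 3
      only-if lt =
        let (f , e) , d = nonempty (positive⇒ lt)
            e′ = ℕₚ.*-cancelˡ-≡ _ _ 4 (trans (lem₁ f s t) (trans e (lem₂ h)))
        in (f , e′) , signs-from-sum g s t (2 * f) 0 (trans (lem₃ f s t) (trans (cong (2 *_) e′) (lem₄ g)))
             (trans (cong (λ z → (z + t * 2) % 3) (sym (ℕₚ.*-identityʳ s))) d)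

    value : ∀ f → 3 * f + s + t ≡ g + 1 → s % 3 ≡ (2 * g + 1) % 3 → t % 3 ≡ (2 * g) % 3 → ∀ q → h ≡ suc q → mass L ≡ m3 f s t
    value f e es et q h≡ = trans mass≡ (trans (cong (frac count-A) N≡)
      (trans (mass-formula 3 f (s ! * t !) q {count-A} {suc m} {{_}} {{_}} {{factorials-nonZero s t}}
               (trans (cong (λ z → count-A * z * (12 ^ f * (f ! * suc q !))) (sym (lem₂ (s !) (t !))))
                 (formula {f} {suc q} (euler f e) (total es et) (trans (rank f e) (cong (λ z → 2 + z) h≡)))))
        (cong (frac 2 3 ℚ.* (frac (3 ^ 2) 12 ^ℚ f) ℚ.* frac 1 (s ! * t !) ℚ.*_)
          (cong₂ (λ a b → frac (a !) (f ! * b !)) (sym (proj₁ indices)) (sym (proj₂ indices))))))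
      where
      lem₁ : ∀ f s t → 6 * f + 2 * s + 2 * t ≡ 2 * (3 * f + s + t)
      lem₁ = solve-∀
      lem₂ : ∀ x y → x * (y * 1) ≡ x * y
      lem₂ = solve-∀
      indices = factorial-indices (3 * f + s + t) (6 * f + 2 * s + 2 * t) q (lem₁ f s t) (trans e (trans (ℕₚ.+-comm g 1) (cong (λ z → 2 + z) h≡)))

    -- With N = 6 and f = 0 the count is 1: the only such gluing identifies opposite sides of the
    -- hexagon.
    torus : h ≡ 0 → s ≡ 0 → t ≡ 2 → mass L ≡ frac 1 6
    torus refl refl refl = trans mass≡ (cong (λ z → frac z 6) (ℕₚ.*-cancelʳ-≡ count-A 1 2
      (trans (sym (ℕₚ.*-identityʳ (count-A * 2))) (formula {0} {0} refl refl refl))))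

  module Order6 (r s t : ℕ) (L : List (Word k)) (rep : RepSystem g (InW6 r s t) L) where
    private
      m M : ℕ
      m = 2 * h
      M = suc m
      N≡ : N ≡ 6 * M
      N≡ = trans (Len≡ h) (lem h)
        where
        lem : ∀ h → 6 + 12 * h ≡ 6 * (1 + 2 * h)
        lem = solve-∀
      N≡₂ : N ≡ 2 * (3 * M)
      N≡₂ = trans N≡ (lem M)
        where
        lem : ∀ M → 6 * M ≡ 2 * (3 * M)
        lem = solve-∀
      N≡₃ : N ≡ 3 * (2 * M)
      N≡₃ = trans N≡ (lem M)
        where
        lem : ∀ M → 6 * M ≡ 3 * (2 * M)
        lem = solve-∀
      2·2 : 2 * (2 * M) ≡ 4 * M
      2·2 = lem M
        where
        lem : ∀ M → 2 * (2 * M) ≡ 4 * M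
        lem = solve-∀
      2·3 : ∀ r → 2 * (3 * r) ≡ 6 * r
      2·3 = solve-∀
      3·2 : ∀ r → 3 * (2 * r) ≡ 6 * r
      3·2 = solve-∀
      -- In units of M = N / 6, half a turn is 3 and the turns by one and two thirds are 2 and 4.
      -- The rotation permutes the reversed edges in triples and the fixed vertices in pairs, which
      -- explains the arguments 3r, 2s and 2t.
      types : Quotient.Types 5 m (k + suc k) N≡ r (suc (suc (suc zero))) s (suc (suc zero)) t (suc (suc (suc (suc zero))))
      types = record
        { torsion₂ = λ { zero _ ne → ⊥-elim (ne refl) ; (suc zero) () _ ; (suc (suc zero)) () _ ; (suc (suc (suc zero))) _ _ → refl
                       ; (suc (suc (suc (suc zero)))) () _ ; (suc (suc (suc (suc (suc zero))))) () _ }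
        ; torsion₃ = λ { zero _ ne → ⊥-elim (ne refl) ; (suc zero) () _ ; (suc (suc zero)) _ _ → inj₁ refl ; (suc (suc (suc zero))) () _
                       ; (suc (suc (suc (suc zero)))) _ _ → inj₂ refl ; (suc (suc (suc (suc (suc zero))))) () _ }
        ; half-ok = λ _ → refl , λ () ; leaf₁-ok = λ _ → refl , λ () ; leaf₂-ok = λ _ → refl , λ () }

      -- 3 M + 2 (2 M) ≡ M modulo 6 M
      aut-6 : ∀ {w : Word k} → Conj (3 * M) (edge w) (edge w) → Conj (2 * M) (edge w) (edge w) → Conj M (edge w) (edge w)
      aut-6 a b = conj-mod {d = 3 * M + 2 * (2 * M)} {M}
        (trans (cong (_% N) (trans (lem M) (cong (λ z → M + z) (trans (sym N≡) (sym (ℕₚ.*-identityˡ N)))))) (DM.[m+kn]%n≡m%n M 1 N)) (conj-∘ a (conj-* 2 b))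
        where
        lem : ∀ M → 3 * M + 2 * (2 * M) ≡ M + 6 * M
        lem = solve-∀

      to : ∀ w → Gluing (edge w) → InW6 r s t w → Symmetric M r 3 s 2 t 4 6 (edge w)
      to w G (p , p') = let a , c = Equivalence.to (InW2⇔ w N≡₂) p ; b , c₁ , c₂ = Equivalence.to (InW3⇔ w G N≡₃) p' in
        record { gluing = G ; equi = at (aut-6 {w} a b) ; halves = subst (Card _ _) (2·3 r) c ; leaf₁ = subst (Card _ _) (3·2 s) c₁
               ; leaf₂ = subst₂ (λ z l → Card (EqS (Fin N)) (λ x → vert (edge w) x ≡ shift x z) l) 2·2 (3·2 t) c₂ }
      from : ∀ w → Symmetric M r 3 s 2 t 4 6 (edge w) → InW6 r s t w
      from w S = Equivalence.from (InW2⇔ w N≡₂) (conj-* 3 (conj (Symmetric.equi S)) , subst (Card _ _) (sym (2·3 r)) (Symmetric.halves S)) ,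
        Equivalence.from (InW3⇔ w (Symmetric.gluing S) N≡₃) (conj-* 2 (conj (Symmetric.equi S)) , subst (Card _ _) (sym (3·2 s)) (Symmetric.leaf₁ S) ,
          subst₂ (λ z l → Card (EqS (Fin N)) (λ x → vert (edge w) x ≡ shift x z) l) (sym 2·2) (sym (3·2 t)) (Symmetric.leaf₂ S))
      open Case h 5 m N≡ r (suc (suc (suc zero))) s (suc (suc zero)) t (suc (suc (suc (suc zero)))) types (λ ()) (InW6 r s t) to from L rep

      euler : ∀ f → 12 * f + 3 * r + 4 * s + 4 * t ≡ 2 * g + 5 → 12 * f + 4 * (s + t) + 3 * r ≡ M + 6
      euler f e = trans (lem₁ f r s t) (trans e (lem₂ h))
        where
        lem₁ : ∀ f r s t → 12 * f + 4 * (s + t) + 3 * r ≡ 12 * f + 3 * r + 4 * s + 4 * t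
        lem₁ = solve-∀
        lem₂ : ∀ h → 2 * (1 + h) + 5 ≡ 1 + 2 * h + 6
        lem₂ = solve-∀

      -- As 12f + 3r + 4s + 4t = 2h + 7, four times the index 3f + r + s + t is at least 2h + 7:
      -- always more than 4, and more than 8 when g > 1.
      rank : ∀ c f → 12 * f + 3 * r + 4 * s + 4 * t ≡ 2 * g + 5 → 4 * (1 + c) < 7 + 2 * h → ∃[ q ] 3 * f + (s + t + r) ≡ 2 + c + q
      rank c f e lt = _ , sym (ℕₚ.m+[n∸m]≡n (ℕₚ.*-cancelˡ-< 4 (1 + c) (3 * f + (s + t + r)) (ℕₚ.<-≤-trans lt (subst₂ _≤_
          (trans e (lem₂ h)) (lem₁ f r s t) (ℕₚ.m≤m+n (12 * f + 3 * r + 4 * s + 4 * t) r)))))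
        where
        lem₁ : ∀ f r s t → 12 * f + 3 * r + 4 * s + 4 * t + r ≡ 4 * (3 * f + (s + t + r))
        lem₁ = solve-∀
        lem₂ : ∀ h → 2 * (1 + h) + 5 ≡ 7 + 2 * h
        lem₂ = solve-∀

      -- Modulo 3 the monodromy equation follows from the congruences on s and t; modulo 2 it
      -- follows from Euler's relation, which makes r odd.
      total : ∀ f → 12 * f + 3 * r + 4 * s + 4 * t ≡ 2 * g + 5 → (2 * s) % 3 ≡ (2 * g + 1) % 3 → (2 * t) % 3 ≡ (2 * g) % 3 →
        (s * 2 + t * 4) % 6 ≡ (1 + r * 3) % 6
      total f e es et = let x , y , e₃ = sum-from-signs g (2 * s) (2 * t) es et in
        mod-6 (s * 2 + t * 4) (1 + r * 3) (x + r) y (4 + h) (6 * f + 3 * s + 4 * t)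
          (trans (lem₁ s t x r) (trans (cong (_+ r * 3) e₃) (lem₂ y r)))
          (trans (lem₃ s t h) (trans (cong (λ z → s * 2 + t * 4 + 1 + z) (sym e)) (lem₄ f r s t)))
        where
        lem₁ : ∀ s t x r → s * 2 + t * 4 + (x + r) * 3 ≡ 2 * s + 2 * t * 2 + x * 3 + r * 3
        lem₁ = solve-∀
        lem₂ : ∀ y r → 1 + y * 3 + r * 3 ≡ 1 + r * 3 + y * 3
        lem₂ = solve-∀
        lem₃ : ∀ s t h → s * 2 + t * 4 + (4 + h) * 2 ≡ s * 2 + t * 4 + 1 + (2 * (1 + h) + 5)
        lem₃ = solve-∀
        lem₄ : ∀ f r s t → s * 2 + t * 4 + 1 + (12 * f + 3 * r + 4 * s + 4 * t) ≡ 1 + r * 3 + (6 * f + 3 * s + 4 * t) * 2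
        lem₄ = solve-∀

    positive : (0ℚ ℚ.< mass L) ⇔ ((∃[ f ] (12 * f + 3 * r + 4 * s + 4 * t ≡ 2 * g + 5)) ×
                                  (2 * s) % 3 ≡ (2 * g + 1) % 3 × (2 * t) % 3 ≡ (2 * g) % 3)
    positive = mk⇔ only-if (λ { ((f , e) , es , et) → let q , q≡ = rank 0 f e (ℕₚ.m≤m+n 5 (2 + 2 * h))
                                in ⇒positive {f} {q} (euler f e) (total f e es et) q≡ })
      where
      lem₁ : ∀ f r s t → 12 * f + 3 * r + 4 * s + 4 * t ≡ 12 * f + 4 * (s + t) + 3 * r
      lem₁ = solve-∀
      lem₂ : ∀ h → 1 + 2 * h + 6 ≡ 2 * (1 + h) + 5
      lem₂ = solve-∀
      lem₃ : ∀ f r s t → 2 * (2 * s + 2 * t) + 3 * (4 * f + r) ≡ 12 * f + 3 * r + 4 * s + 4 * t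
      lem₃ = solve-∀
      lem₄ : ∀ g → 2 * g + 5 ≡ 2 * g + 2 + 3 * 1
      lem₄ = solve-∀
      lem₅ : ∀ s t x → 2 * s + 2 * t * 2 + 2 * x * 3 ≡ s * 2 + t * 4 + x * 6
      lem₅ = solve-∀
      lem₆ : ∀ r y → 1 + r * 3 + y * 6 ≡ 1 + (r + 2 * y) * 3
      lem₆ = solve-∀
      only-if : 0ℚ ℚ.< mass L → (∃[ f ] (12 * f + 3 * r + 4 * s + 4 * t ≡ 2 * g + 5)) × (2 * s) % 3 ≡ (2 * g + 1) % 3 × (2 * t) % 3 ≡ (2 * g) % 3
      only-if lt =
        let (f , e) , d = nonempty (positive⇒ lt)
            e′ = trans (lem₁ f r s t) (trans e (lem₂ h))
            x = (1 + r * 3) / 6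
            y = (s * 2 + t * 4) / 6
        in (f , e′) , signs-from-sum g (2 * s) (2 * t) (4 * f + r) 1 (trans (lem₃ f r s t) (trans e′ (lem₄ g)))
             (mod-from 3 (2 * s + 2 * t * 2) 1 (2 * x) (r + 2 * y)
               (trans (lem₅ s t x) (trans (mod-to 6 (s * 2 + t * 4) (1 + r * 3) d) (lem₆ r y))))

    value : ∀ f → 12 * f + 3 * r + 4 * s + 4 * t ≡ 2 * g + 5 → (2 * s) % 3 ≡ (2 * g + 1) % 3 → (2 * t) % 3 ≡ (2 * g) % 3 →
      ∀ c → h ≡ suc c → mass L ≡ m6 f r s t
    value f e es et c h≡ = trans mass≡ (trans (cong (frac count-A) N≡)
      (trans (mass-formula 6 f (r ! * s ! * t !) q {count-A} {suc m} {{_}} {{_}} {{ℕₚ.m*n≢0 (r ! * s !) (t !) {{factorials-nonZero r s}} {{ℕₚ._!≢0 t}}}}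
               (trans (cong (λ z → count-A * z * (12 ^ f * (f ! * suc q !))) (lem₂ (r !) (s !) (t !)))
                 (formula {f} {suc q} (euler f e) (total f e es et) q≡)))
        (cong (frac 2 6 ℚ.* (frac (6 ^ 2) 12 ^ℚ f) ℚ.* frac 1 (r ! * s ! * t !) ℚ.*_)
          (cong₂ (λ a b → frac (a !) (f ! * b !)) (sym (proj₁ indices)) (sym (proj₂ indices))))))
      where
      rk = rank 1 f e (subst (λ z → 8 < 7 + 2 * z) (sym h≡) (subst (8 <_) (lem₃ c) (ℕₚ.m≤m+n 9 (2 * c))))
        where
        lem₃ : ∀ c → 9 + 2 * c ≡ 7 + 2 * (1 + c)
        lem₃ = solve-∀
      q = proj₁ rk
      q≡ : 3 * f + (s + t + r) ≡ 3 + q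
      q≡ = proj₂ rk
      lem₁ : ∀ f r s t → 6 * f + 2 * r + 2 * s + 2 * t ≡ 2 * (3 * f + r + s + t)
      lem₁ = solve-∀
      lem₂ : ∀ x y z → x * y * z ≡ y * (z * x)
      lem₂ = solve-∀
      lem₄ : ∀ f r s t → 3 * f + r + s + t ≡ 3 * f + (s + t + r)
      lem₄ = solve-∀
      indices = factorial-indices (3 * f + r + s + t) (6 * f + 2 * r + 2 * s + 2 * t) q (lem₁ f r s t) (trans (lem₄ f r s t) q≡)

    -- Here M = 1: the quotient is the single position of `stick`, a half-edge whose corner is a
    -- leaf. It lifts to the hexagon with opposite sides identified.
    torus : h ≡ 0 → r ≡ 1 → s ≡ 0 → t ≡ 1 → mass L ≡ frac 1 6
    torus refl refl refl refl = trans mass≡ (cong (λ z → frac z 6) (ℕₚ.*-cancelʳ-≡ count-A 1 1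
      (trans (sym (ℕₚ.*-identityʳ (count-A * 1))) (formula {0} {0} refl refl refl))))

  aut-group : (w : Word k) → IsMaxWicks g w →
    (Σ (Fin (Len k)) λ d₀ → ((d : Fin (Len k)) → IsAut w d ⇔ (Σ ℕ λ m → (toℕ d ≡ (m * toℕ d₀) % Len k)))) ×
    (autOrder w ≡ 1 ⊎ autOrder w ≡ 2 ⊎ autOrder w ≡ 3 ⊎ autOrder w ≡ 6)
  aut-group w (W , G) = automorphism-group w (1 + 2 * h) (trans (Len≡ h) (lem h)) (maximal⇒gluing w h (Kg≡ h) W G)
    where
    lem : ∀ h → 6 + 12 * h ≡ 6 * (1 + 2 * h)
    lem = solve-∀

theorem1p1 : (g : ℕ) → 1 ≤ g →
  -- (i) Aut(w) is cyclic of order 1, 2, 3 or 6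
  ((w : Word (Kg g)) → IsMaxWicks g w →
    (Σ (Fin (Len (Kg g))) λ d₀ → ((d : Fin (Len (Kg g))) →
       IsAut w d ⇔ (Σ ℕ λ m → (toℕ d ≡ (m * toℕ d₀) % Len (Kg g))))) ×
    (autOrder w ≡ 1 ⊎ autOrder w ≡ 2 ⊎ autOrder w ≡ 3 ⊎ autOrder w ≡ 6)) ×
  -- (ii) m_1^g
  ((L : List (Word (Kg g))) → RepSystem g (λ _ → ⊤) L → mass L ≡ m1 g) ×
  -- (iii) m_2^g(r)
  ((r : ℕ) (L : List (Word (Kg g))) → RepSystem g (InW2 r) L →
    ((0ℚ ℚ.< mass L) ⇔ (∃[ f ] (4 * f + r ≡ 2 * g + 1))) ×
    ((f : ℕ) → 4 * f + r ≡ 2 * g + 1 → mass L ≡ m2 f r)) ×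
  -- (iv) m_3^g(s,t)
  ((s t : ℕ) (L : List (Word (Kg g))) → RepSystem g (InW3 s t) L →
    ((0ℚ ℚ.< mass L) ⇔
      ((∃[ f ] (3 * f + s + t ≡ g + 1)) ×
       s % 3 ≡ (2 * g + 1) % 3 × t % 3 ≡ (2 * g) % 3)) ×
    ((f : ℕ) → 3 * f + s + t ≡ g + 1 →
       s % 3 ≡ (2 * g + 1) % 3 → t % 3 ≡ (2 * g) % 3 →
       1 < g → mass L ≡ m3 f s t)) ×
  (g ≡ 1 → (L : List (Word (Kg g))) → RepSystem g (InW3 0 2) L →
    mass L ≡ frac 1 6) ×
  -- (v) m_6^g(3r;2s,2t)
  ((r s t : ℕ) (L : List (Word (Kg g))) → RepSystem g (InW6 r s t) L →
    ((0ℚ ℚ.< mass L) ⇔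
      ((∃[ f ] (12 * f + 3 * r + 4 * s + 4 * t ≡ 2 * g + 5)) ×
       (2 * s) % 3 ≡ (2 * g + 1) % 3 × (2 * t) % 3 ≡ (2 * g) % 3)) ×
    ((f : ℕ) → 12 * f + 3 * r + 4 * s + 4 * t ≡ 2 * g + 5 →
       (2 * s) % 3 ≡ (2 * g + 1) % 3 → (2 * t) % 3 ≡ (2 * g) % 3 →
       1 < g → mass L ≡ m6 f r s t)) ×
  (g ≡ 1 → (L : List (Word (Kg g))) → RepSystem g (InW6 1 0 1) L →
    mass L ≡ frac 1 6)
theorem1p1 (suc h) _ =
  aut-group ,
  all-maximal ,
  (λ r L rep → Order2.positive r L rep , Order2.value r L rep) ,
  (λ s t L rep → Order3.positive s t L rep , λ f e es et 1<g → let q , h≡ = above 1<g in Order3.value s t L rep f e es et q h≡) ,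
  (λ g≡1 L rep → Order3.torus 0 2 L rep (ℕₚ.suc-injective g≡1) refl refl) ,
  (λ r s t L rep → Order6.positive r s t L rep , λ f e es et 1<g → let q , h≡ = above 1<g in Order6.value r s t L rep f e es et q h≡) ,
  (λ g≡1 L rep → Order6.torus 1 0 1 L rep (ℕₚ.suc-injective g≡1) refl refl refl)
  where
  open MainTheorem h
  above : ∀ {h} → 1 < suc h → ∃[ q ] h ≡ suc q
  above {suc q} _       = q , refl
  above {zero} (s≤s ())
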